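{- For every integer $r\geq 3$ there exists an $r$-uniform hypergraph $F$ with $\pi_u(F)=\binom{r}{2}^{ -\binom{r}{2}}$.
   Context: An $r$-graph is an $r$-uniform hypergraph. For an $r$-graph $H$ and $S\subseteq V(H)$, $e(S)$ denotes the number of edges of $H$ contained in $S$. $H$ is called $(d,\varepsilon)$-dense if every $S\subseteq V(H)$ with $|S|\geq \varepsilon|V(H)|$ satisfies $e(S)\geq (d-\varepsilon)\binom{|S|}{r}$. A sequence of $r$-graphs $(H_n)_{n\geq1}$ is locally $d$-dense if there is a sequence $\varepsilon_n\to 0$ such that each $H_n$ is $(d,\varepsilon_n)$-dense and $|V(H_n)|\to\infty$. The uniform Turán density $\pi_u(F)$ of an $r$-graph $F$ is the maximum $d$ such that there exists a locally $d$-dense sequence of $r$-graphs none of which contains $F$ as a subgraph. -}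

module Defs where

open import Data.Nat as ℕ using (ℕ; zero; suc; _^_; NonZero)
open import Data.Nat.Properties using (m^n≢0)
open import Data.Nat.Combinatorics using (_C_)
open import Data.Integer using (+_)
open import Data.Rational using (ℚ; _/_; _*_; _-_; _≤_; _<_; 0ℚ)
open import Data.Bool using (Bool; true; false; _∧_; _∨_; if_then_else_)
open import Data.Fin using (Fin; zero; suc)
open import Data.Fin.Properties using () renaming (_≟_ to _≟ᶠ_)
open import Data.Fin.Subset using (Subset; ∣_∣; _⊆_)
open import Data.Vec using (Vec; []; _∷_; tabulate; lookup)
open import Data.List using (List; []; _∷_; map; _++_; length; filterᵇ)
open import Data.Product using (Σ; _×_; ∃; ∃-syntax)
open import Function.Definitions using (Injective)
open import Relation.Binary.PropositionalEquality using (_≡_)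
open import Relation.Nullary using (¬_; does)

ℕ→ℚ : ℕ → ℚ
ℕ→ℚ k = (+ k) / 1

record Hypergraph (r : ℕ) : Set where
  field
    n       : ℕ
    edge    : Subset n → Bool
    uniform : ∀ (s : Subset n) → edge s ≡ true → ∣ s ∣ ≡ r
open Hypergraph public

allSubsets : (n : ℕ) → List (Subset n)
allSubsets zero    = [] ∷ []
allSubsets (suc n) = map (true ∷_) (allSubsets n) ++ map (false ∷_) (allSubsets n)

subsetB : ∀ {n} → Subset n → Subset n → Bool
subsetB []          []          = true
subsetB (true ∷ xs) (false ∷ ys) = false
subsetB (_ ∷ xs)    (_ ∷ ys)    = subsetB xs ys

eCount : ∀ {r} (H : Hypergraph r) → Subset (n H) → ℕ
eCount H S = length (filterᵇ (λ T → edge H T ∧ subsetB T S) (allSubsets (n H)))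

Dense : ∀ {r} → ℚ → ℚ → Hypergraph r → Set
Dense {r} d ε H =
  ∀ (S : Subset (n H)) → ε * ℕ→ℚ (n H) ≤ ℕ→ℚ ∣ S ∣ →
    (d - ε) * ℕ→ℚ (∣ S ∣ C r) ≤ ℕ→ℚ (eCount H S)

LocallyDense : ∀ {r} → ℚ → (ℕ → Hypergraph r) → Set
LocallyDense d Hs =
  Σ (ℕ → ℚ) λ ε →
    (∀ k → Dense d (ε k) (Hs k))
    × (∀ (δ : ℚ) → 0ℚ < δ → ∃[ N ] ∀ k → N ℕ.≤ k → ε k < δ)
    × (∀ (M : ℕ) → ∃[ N ] ∀ k → N ℕ.≤ k → M ℕ.≤ n (Hs k))

anyFin : ∀ {m} → (Fin m → Bool) → Bool
anyFin {zero}  f = false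
anyFin {suc m} f = f zero ∨ anyFin (λ i → f (suc i))

image : ∀ {m k} → (Fin m → Fin k) → Subset m → Subset k
image φ s = tabulate λ j → anyFin (λ i → lookup s i ∧ does (φ i ≟ᶠ j))

_⊑_ : ∀ {r} → Hypergraph r → Hypergraph r → Set
F ⊑ H = Σ (Fin (n F) → Fin (n H)) λ φ →
  Injective _≡_ _≡_ φ × (∀ (s : Subset (n F)) → edge F s ≡ true → edge H (image φ s) ≡ true)

HasFreeLocallyDense : ∀ {r} → Hypergraph r → ℚ → Set
HasFreeLocallyDense {r} F d =
  Σ (ℕ → Hypergraph r) λ Hs → LocallyDense d Hs × (∀ k → ¬ (F ⊑ Hs k))

UniformTuranDensityIs : ∀ {r} → Hypergraph r → ℚ → Set
UniformTuranDensityIs F q =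
  HasFreeLocallyDense F q × (∀ (d : ℚ) → q < d → ¬ HasFreeLocallyDense F d)

-- c^c is never zero (0^0 = 1)
powSelf-nonZero : ∀ c → NonZero (c ^ c)
powSelf-nonZero zero    = _
powSelf-nonZero (suc c) = m^n≢0 (suc c) (suc c)

targetDensity : ℕ → ℚ
targetDensity r = _/_ (+ 1) ((r C 2) ^ (r C 2)) {{powSelf-nonZero (r C 2)}}

{-# OPTIONS --safe #-}
{-
Write c = r(r-1)/2.  The role of a pair of an increasing r-tuple is the pair of its positions, so an r-set assigns one
of c roles to each of its pairs.

F is a union of gadgets: two edges that share just a pair u v, any two gadgets having at most one vertex in common.
It is built so that under every linear order of the vertices some gadget gives u v different roles in its two edges,
while for any two distinct roles p ≠ q some linear order gives u v the role p in the first and q in the second edge of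
every gadget at once.  Order the grid [N]^D, with one coordinate for each ordered pair of distinct roles: by Ramsey
every order of the grid is governed by one coordinate on a suitable family of gadgets and is therefore violated by one
of them, and a greedy choice of gadgets over a blow-up of the grid makes the system linear.

Lower bound: colour the pairs of an ordered vertex set quasirandomly by the c roles, and take as edges those r-sets all
of whose pairs are coloured by their role.  The density is c^(-c) on every large vertex set, and in a copy of F the
role of u v in both edges of a gadget would be its colour, under the vertex order of the host.

Upper bound: cut the vertices of a host of density above c^(-c) into many parts, make them (lower) regular by
density decrement, and pass to parts on which all densities behave homogeneously by Ramsey.  If for some p ≠ q the
gadgets of that type are dense, F embeds by telescoping.  Otherwise, for distinct roles, the sets of pairs that lie in
many edges in that role are almost disjoint, so their densities add up to at most about 1, while every edge has all its
pairs in these sets; by AM-GM the edge density is at most about c^(-c).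
-}
module Submission where

open import Defs
open import Data.Nat as ℕ using (ℕ; zero; suc; _+_; _*_; _∸_; _^_; _!; _≤_; _<_; z≤n; s≤s; NonZero; _≤?_; _<?_; _⊔_)
open import Data.Nat.Properties
open import Data.Nat.DivMod using (m*n/n≡m; m/n*n≤m; /-monoˡ-≤)
open import Data.Nat.Combinatorics using (nCk+nC[k+1]≡[n+1]C[k+1]; nC1≡n) renaming (_C_ to _choose_)
open import Data.Nat.Tactic.RingSolver using (solve-∀)
import Data.Bool.Properties
open import Data.Bool using (Bool; true; false; _∧_; _∨_; not; if_then_else_)
open import Data.Bool.Properties using (∧-assoc; ∧-comm; ∧-zeroʳ; ∧-identityʳ; T-≡)
open import Data.Fin using (Fin; toℕ; fromℕ<; combine; remQuot; funToFin; finToFun) renaming (zero to fzero; suc to fsuc)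
import Data.Fin.Properties as Finₚ
open import Data.Fin.Subset using (Subset; ∣_∣)
open import Data.Vec as Vec using (Vec)
import Data.Vec.Properties as Vecₚ
open import Data.Integer as ℤ using (ℤ; 0ℤ; 1ℤ) renaming (+_ to ⁺_)
import Data.Integer.Properties as ℤₚ
import Data.Integer.Tactic.RingSolver as ℤ-Solver
import Data.List
import Data.List.Properties
open import Data.Rational as ℚ using (ℚ)
import Data.Rational.Properties as ℚₚ
open import Data.Rational.Solver using (module +-*-Solver)
import Data.Rational.Unnormalised as ℚᵘ
import Data.Rational.Unnormalised.Properties as ℚᵘₚ
open import Data.List using (List; []; _∷_; map; _++_; length; filterᵇ; replicate; upTo; applyUpTo; concat; concatMap; allFin; take; drop; tabulate)
open import Data.List.Properties using (map-++; map-∘; map-cong; length-map; length-++; ++-assoc; length-replicate; length-upTo; length-tabulate; take++drop≡id; length-take; length-drop; map-tabulate; length-applyUpTo)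
open import Data.List.Relation.Unary.All as All using (All; []; _∷_)
open import Data.List.Relation.Unary.Any as Any using (Any; here; there)
open import Data.List.Relation.Unary.AllPairs as AllPairs using (AllPairs; []; _∷_)
import Data.List.Relation.Unary.All.Properties as Allₚ
import Data.List.Relation.Unary.Any.Properties as Anyₚ
import Data.List.Relation.Unary.AllPairs.Properties as AllPairsₚ
open import Data.List.Relation.Unary.Unique.Propositional using (Unique)
import Data.List.Relation.Unary.Unique.Propositional.Properties as Uniqueₚ
open import Data.List.Membership.Propositional using (_∈_; find; lose)
import Data.List.Membership.Propositional.Properties as ∈ₚ
open import Data.List.Relation.Binary.Pointwise as Pw using (Pointwise; []; _∷_)
open import Data.List.Relation.Binary.Sublist.Propositional as Sub using (_⊆_; []; _∷_; _∷ʳ_; ⊆-refl; ⊆-trans)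
import Data.List.Relation.Binary.Sublist.Propositional.Properties as Subₚ
open import Data.List.Relation.Binary.Permutation.Propositional using (_↭_; ↭-refl; ↭-reflexive; ↭-sym; ↭-trans; prep)
import Data.List.Relation.Binary.Permutation.Propositional.Properties as ↭ₚ
import Data.Product.Properties
open import Data.Product using (Σ; _×_; _,_; proj₁; proj₂; ∃-syntax)
open import Data.Sum using (_⊎_; inj₁; inj₂)
open import Data.Empty using (⊥; ⊥-elim)
open import Data.Unit using (⊤; tt)
open import Function using (_∘_; id; case_of_; Equivalence)
open import Relation.Nullary using (¬_; Dec; yes; no; does)
open import Relation.Nullary.Decidable using (dec-true; dec-false)
open import Relation.Nullary.Negation using (contradiction)
open import Relation.Binary.Definitions using (Tri; tri<; tri≈; tri>)
open import Relation.Binary.PropositionalEquality using (_≡_; _≢_; refl; sym; trans; cong; cong₂; subst; subst₂; module ≡-Reasoning)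

-- Copies of F have to be counted with regularity for boxes, that is for products of vertex sets;
-- relations on pairs of vertices are not controlled. This is why the gadgets must form a linear
-- system: once all coordinates outside one gadget are frozen, every other gadget is a condition on
-- a single coordinate, and the gadget is counted inside a box. The popular pairs of distinct roles
-- and the coloured pairs of the lower bound also meet in at most one coordinate, so one telescoping
-- lemma serves all three counts.
--
-- Popularity is defined by the box of a first regularisation and is regularised on a smaller box,
-- which costs a factor in volume. Hence the error of the first regularisation is fixed after the
-- shrinkage of the second.
--
-- Densities are fractions with fixed denominators, and all estimates are inequalities of natural
-- numbers. No regular box is searched for: the goal is absurd, so a failing sub-box can be handed
-- to the next round of the decrement. Likewise the random colouring is replaced by a choice, one
-- vertex at a time, that stays below the average of a quadratic cost.

private variable
  A A′ : Set

-- Booleans and finite sums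

infix 6 _==_

_==_ : ℕ → ℕ → Bool
_==_ = ℕ._≡ᵇ_

==-true : ∀ {m n} → (m == n) ≡ true → m ≡ n
==-true {m} {n} h = ≡ᵇ⇒≡ m n (Equivalence.from T-≡ h)

==-refl : ∀ n → (n == n) ≡ true
==-refl n = Equivalence.to T-≡ (≡⇒≡ᵇ n n refl)

==-false : ∀ {m n} → m ≢ n → (m == n) ≡ false
==-false {m} {n} m≢n with m == n in eq
... | true = contradiction (==-true eq) m≢n
... | false = refl

true≢false : ∀ {b} → b ≡ true → b ≡ false → ⊥
true≢false refl ()

≤ᵇ-true : ∀ {a b} → (a ℕ.≤ᵇ b) ≡ true → a ≤ b
≤ᵇ-true {a} {b} h = ≤ᵇ⇒≤ a b (Equivalence.from T-≡ h)

≤ᵇ-false : ∀ {a b} → (a ℕ.≤ᵇ b) ≡ false → b ≤ a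
≤ᵇ-false {a} {b} h = <⇒≤ (≰⇒> λ q → true≢false (Equivalence.to T-≡ (≤⇒≤ᵇ q)) h)

∧-trueˡ : ∀ {a b} → a ∧ b ≡ true → a ≡ true
∧-trueˡ {true} _ = refl

∧-trueʳ : ∀ {a b} → a ∧ b ≡ true → b ≡ true
∧-trueʳ {true} h = h

∧-true : ∀ {a b} → a ≡ true → b ≡ true → a ∧ b ≡ true
∧-true refl refl = refl

𝟙 : Bool → ℕ
𝟙 true = 1
𝟙 false = 0

𝟙≤1 : ∀ b → 𝟙 b ≤ 1
𝟙≤1 true = ≤-refl
𝟙≤1 false = z≤n

𝟙-∧ : ∀ a b → 𝟙 (a ∧ b) ≡ 𝟙 a * 𝟙 b
𝟙-∧ true b = sym (+-identityʳ _)
𝟙-∧ false b = refl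

𝟙-not : ∀ b → 𝟙 b + 𝟙 (not b) ≡ 1
𝟙-not true = refl
𝟙-not false = refl

𝟙-mono : ∀ {a b} → (a ≡ true → b ≡ true) → 𝟙 a ≤ 𝟙 b
𝟙-mono {true} h rewrite h refl = ≤-refl
𝟙-mono {false} h = z≤n

∑ : List A → (A → ℕ) → ℕ
∑ [] f = 0
∑ (x ∷ xs) f = f x + ∑ xs f

∑-cong : ∀ (xs : List A) {f g : A → ℕ} → (∀ x → f x ≡ g x) → ∑ xs f ≡ ∑ xs g
∑-cong [] h = refl
∑-cong (x ∷ xs) h = cong₂ _+_ (h x) (∑-cong xs h)

∑-mono∈ : ∀ (xs : List A) {f g : A → ℕ} → (∀ x → x ∈ xs → f x ≤ g x) → ∑ xs f ≤ ∑ xs g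
∑-mono∈ [] h = z≤n
∑-mono∈ (x ∷ xs) h = +-mono-≤ (h x (here refl)) (∑-mono∈ xs λ y y∈ → h y (there y∈))

∑-mono : ∀ (xs : List A) {f g : A → ℕ} → (∀ x → f x ≤ g x) → ∑ xs f ≤ ∑ xs g
∑-mono xs h = ∑-mono∈ xs λ x _ → h x

∑-cong∈ : ∀ (xs : List A) {f g : A → ℕ} → (∀ x → x ∈ xs → f x ≡ g x) → ∑ xs f ≡ ∑ xs g
∑-cong∈ xs h = ≤-antisym (∑-mono∈ xs λ x m → ≤-reflexive (h x m)) (∑-mono∈ xs λ x m → ≤-reflexive (sym (h x m)))

∑-+ : ∀ (xs : List A) (f g : A → ℕ) → ∑ xs (λ x → f x + g x) ≡ ∑ xs f + ∑ xs g
∑-+ [] f g = refl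
∑-+ (x ∷ xs) f g rewrite ∑-+ xs f g = lem (f x) (g x) (∑ xs f) (∑ xs g)
  where lem : ∀ a b c d → a + b + (c + d) ≡ a + c + (b + d)
        lem = solve-∀

∑-* : ∀ (xs : List A) c (f : A → ℕ) → ∑ xs (λ x → c * f x) ≡ c * ∑ xs f
∑-* [] c f = sym (*-zeroʳ c)
∑-* (x ∷ xs) c f rewrite ∑-* xs c f = sym (*-distribˡ-+ c (f x) (∑ xs f))

∑-*ʳ : ∀ (xs : List A) c (f : A → ℕ) → ∑ xs (λ x → f x * c) ≡ ∑ xs f * c
∑-*ʳ xs c f = trans (∑-cong xs λ x → *-comm (f x) c) (trans (∑-* xs c f) (*-comm c _))

∑-const : ∀ (xs : List A) c → ∑ xs (λ _ → c) ≡ length xs * c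
∑-const [] c = refl
∑-const (x ∷ xs) c = cong (c +_) (∑-const xs c)

∑-0 : ∀ (xs : List A) → ∑ xs (λ _ → 0) ≡ 0
∑-0 xs = trans (∑-const xs 0) (*-zeroʳ (length xs))

∑-++ : ∀ (xs ys : List A) (f : A → ℕ) → ∑ (xs ++ ys) f ≡ ∑ xs f + ∑ ys f
∑-++ [] ys f = refl
∑-++ (x ∷ xs) ys f rewrite ∑-++ xs ys f = sym (+-assoc (f x) _ _)

∑-map : ∀ (g : A → A′) (xs : List A) (f : A′ → ℕ) → ∑ (map g xs) f ≡ ∑ xs (f ∘ g)
∑-map g [] f = refl
∑-map g (x ∷ xs) f = cong (f (g x) +_) (∑-map g xs f)

∑-swap : ∀ (xs : List A) (ys : List A′) (f : A → A′ → ℕ) →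
  ∑ xs (λ x → ∑ ys (f x)) ≡ ∑ ys (λ y → ∑ xs (λ x → f x y))
∑-swap [] ys f = sym (∑-0 ys)
∑-swap (x ∷ xs) ys f rewrite ∑-swap xs ys f = sym (∑-+ ys (f x) (λ y → ∑ xs (λ x → f x y)))

∑-⊆ : ∀ {xs ys : List A} (f : A → ℕ) → xs ⊆ ys → ∑ xs f ≤ ∑ ys f
∑-⊆ f [] = z≤n
∑-⊆ f (y ∷ʳ p) = ≤-trans (∑-⊆ f p) (m≤n+m _ (f y))
∑-⊆ f (refl ∷ p) = +-monoʳ-≤ _ (∑-⊆ f p)

∑-∈ : ∀ {xs : List A} {x} (f : A → ℕ) → x ∈ xs → f x ≤ ∑ xs f
∑-∈ f (here refl) = m≤m+n _ _
∑-∈ f (there p) = ≤-trans (∑-∈ f p) (m≤n+m _ _)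

∑-pos : ∀ (xs : List A) (f : A → ℕ) → 0 < ∑ xs f → ∃[ x ] (x ∈ xs × 0 < f x)
∑-pos (x ∷ xs) f h with f x in eq
... | suc n = x , here refl , subst (0 <_) (sym eq) (s≤s z≤n)
... | zero with ∑-pos xs f h
... | y , y∈ , p = y , there y∈ , p

𝟙-pos : ∀ {b} → 0 < 𝟙 b → b ≡ true
𝟙-pos {true} _ = refl

-- If every `length xs * f x` were less than `m`, summing over `xs` would give less than
-- `length xs * m`. The hypothesis `0 < m` excludes the empty list.
∑-avg-≥ : ∀ (xs : List A) (f : A → ℕ) m → 0 < m → m ≤ ∑ xs f → ∃[ x ] (x ∈ xs × m ≤ length xs * f x)
∑-avg-≥ xs f m m>0 h with Any.any? (λ x → m ≤? length xs * f x) xs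
... | yes p = let x , x∈ , q = find p in x , x∈ , q
... | no ¬p = contradiction h′ (<-irrefl refl)
  where
  small : ∀ ys → (∀ y → y ∈ ys → length xs * f y < m) → length xs * ∑ ys f + length ys ≤ length ys * m
  small [] k = ≤-reflexive (trans (+-identityʳ _) (*-zeroʳ (length xs)))
  small (y ∷ ys) k = begin
    length xs * (f y + ∑ ys f) + suc (length ys) ≡⟨ lem (length xs) (f y) (∑ ys f) (length ys) ⟩
    suc (length xs * f y) + (length xs * ∑ ys f + length ys) ≤⟨ +-mono-≤ (k y (here refl)) (small ys λ z z∈ → k z (there z∈)) ⟩
    m + length ys * m ∎
    where
    open ≤-Reasoning
    lem : ∀ a b c d → a * (b + c) + suc d ≡ suc (a * b) + (a * c + d)
    lem = solve-∀
  nonempty : 0 < length xs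
  nonempty = go xs h
    where go : ∀ ys → m ≤ ∑ ys f → 0 < length ys
          go [] h = contradiction (≤-trans m>0 h) λ ()
          go (_ ∷ _) _ = s≤s z≤n
  h′ : length xs * m < length xs * m
  h′ = begin-strict
    length xs * m ≤⟨ *-monoʳ-≤ (length xs) h ⟩
    length xs * ∑ xs f <⟨ m<m+n _ nonempty ⟩
    length xs * ∑ xs f + length xs ≤⟨ small xs (λ y y∈ → ≰⇒> λ q → ¬p (lose y∈ q)) ⟩
    length xs * m ∎
    where open ≤-Reasoning

∑-avg-≤ : ∀ (xs : List A) (f : A → ℕ) m → 0 < length xs → ∑ xs f ≤ length xs * m → ∃[ x ] (x ∈ xs × f x ≤ m)
∑-avg-≤ xs f m ne h with Any.any? (λ x → f x ≤? m) xs
... | yes p = let x , x∈ , q = find p in x , x∈ , q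
... | no ¬p = contradiction (≤-trans big h) (<⇒≱ (m<n+m _ ne))
  where
  big : length xs + length xs * m ≤ ∑ xs f
  big = ≤-trans (≤-reflexive (trans (sym (*-suc (length xs) m)) (sym (∑-const xs (suc m)))))
          (∑-mono∈ xs λ y y∈ → ≰⇒> λ q → ¬p (lose y∈ q))

∏ : List A → (A → ℕ) → ℕ
∏ [] f = 1
∏ (x ∷ xs) f = f x * ∏ xs f

all : List A → (A → Bool) → Bool
all [] p = true
all (x ∷ xs) p = p x ∧ all xs p

all-∈ : ∀ {xs : List A} {p : A → Bool} → all xs p ≡ true → ∀ {x} → x ∈ xs → p x ≡ true
all-∈ h (here refl) = ∧-trueˡ h
all-∈ {xs = y ∷ _} {p} h (there q) = all-∈ (∧-trueʳ {p y} h) q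

∈-all : ∀ (xs : List A) {p : A → Bool} → (∀ {x} → x ∈ xs → p x ≡ true) → all xs p ≡ true
∈-all [] h = refl
∈-all (x ∷ xs) h = ∧-true (h (here refl)) (∈-all xs (h ∘ there))

any : List A → (A → Bool) → Bool
any [] p = false
any (x ∷ xs) p = p x ∨ any xs p

∈-any : ∀ {xs : List A} {p : A → Bool} {x} → x ∈ xs → p x ≡ true → any xs p ≡ true
∈-any (here refl) e rewrite e = refl
∈-any {xs = y ∷ _} {p} (there q) e with p y
... | true = refl
... | false = ∈-any q e

any-∈ : ∀ (xs : List A) {p : A → Bool} → any xs p ≡ true → ∃[ x ] (x ∈ xs × p x ≡ true)
any-∈ (x ∷ xs) {p} h with p x in eq
... | true = x , here refl , eq
... | false = let y , y∈ , q = any-∈ xs h in y , there y∈ , q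

-- Ramsey's theorem

∑-allFin-suc : ∀ {n} (f : Fin (suc n) → ℕ) → ∑ (allFin (suc n)) f ≡ f fzero + ∑ (allFin n) (f ∘ fsuc)
∑-allFin-suc {n} f = cong (f fzero +_) (trans (cong (λ l → ∑ l f) (sym (map-tabulate id fsuc))) (∑-map fsuc (allFin n) f))

∑-single : ∀ {n} (i : Fin n) (f : Fin n → ℕ) → ∑ (allFin n) (λ j → 𝟙 (does (i Finₚ.≟ j)) * f j) ≡ f i
∑-single {suc n} fzero f = trans (∑-allFin-suc (λ j → 𝟙 (does (fzero Finₚ.≟ j)) * f j)) (trans (cong₂ _+_ (+-identityʳ (f fzero)) (∑-0 (allFin n))) (+-identityʳ (f fzero)))
∑-single {suc n} (fsuc i) f = trans (∑-allFin-suc (λ j → 𝟙 (does (fsuc i Finₚ.≟ j)) * f j)) (∑-single i (f ∘ fsuc))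

private
  colour-class : ∀ {A : Set} {C} m (W : List (A × Fin C)) → 0 < m → C * m ≤ length W → 0 < C →
    ∃[ c ] ∃[ W′ ] (W′ ⊆ W × length W′ ≡ m × All (λ w → proj₂ w ≡ c) W′)
  colour-class {A} {C} m W m>0 h C>0 = c , take m F , ⊆-trans (Subₚ.take-⊆ m F) (Subₚ.filter-⊆ c? W) , len ,
      Allₚ.take⁺ m (Allₚ.all-filter c? W)
    where
    class : Fin C → List (A × Fin C)
    class c = Data.List.filter (λ w → proj₂ w Finₚ.≟ c) W
    total : ∀ W → ∑ (allFin C) (λ c → length (Data.List.filter (λ w → proj₂ w Finₚ.≟ c) W)) ≡ length W
    total [] = ∑-0 (allFin C)
    total (w ∷ W) = trans (∑-cong (allFin C) step) (trans (∑-+ (allFin C) (λ c → 𝟙 (does (proj₂ w Finₚ.≟ c)) * 1) _)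
                      (cong₂ _+_ (∑-single (proj₂ w) (λ _ → 1)) (total W)))
      where
      step : ∀ c → length (Data.List.filter (λ w → proj₂ w Finₚ.≟ c) (w ∷ W)) ≡
                   𝟙 (does (proj₂ w Finₚ.≟ c)) * 1 + length (Data.List.filter (λ w → proj₂ w Finₚ.≟ c) W)
      step c with does (proj₂ w Finₚ.≟ c)
      ... | true = refl
      ... | false = refl
    big : ∃[ c ] (c ∈ allFin C × C * m ≤ length (allFin C) * length (class c))
    big = ∑-avg-≥ (allFin C) (length ∘ class) (C * m) (*-mono-≤ C>0 m>0) (≤-trans h (≤-reflexive (sym (total W))))
    c = proj₁ big
    c? : ∀ (w : A × Fin C) → Dec (proj₂ w ≡ c)
    c? w = proj₂ w Finₚ.≟ c
    F = class c
    m≤F : m ≤ length F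
    m≤F = *-cancelˡ-≤ C {{ℕ.>-nonZero C>0}} (subst (λ l → C * m ≤ l * length F) (length-tabulate {n = C} id) (proj₂ (proj₂ big)))
    len : length (take m F) ≡ m
    len = trans (length-take m F) (m≤n⇒m⊓n≡m m≤F)

Homogeneous : ∀ {A : Set} {C} → ℕ → (List A → Fin C) → List A → Set
Homogeneous {A} k col Y = ∃[ c ] ∀ (Z : List A) → Z ⊆ Y → length Z ≡ k → col Z ≡ c

private
  -- Each entry of `W` carries the common colour of all sets that consist of it and `k` later
  -- entries. Keeping the entries that carry one colour makes such a list homogeneous for sets of
  -- size `suc k`.
  Pre : ∀ {A : Set} {C} → ℕ → (List A → Fin C) → List (A × Fin C) → Set
  Pre k col [] = ⊤
  Pre k col ((y , c) ∷ W) = (∀ Z → Z ⊆ map proj₁ W → length Z ≡ k → col (y ∷ Z) ≡ c) × Pre k col W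

  Pre-⊆ : ∀ {A : Set} {C} k (col : List A → Fin C) {W W′} → W′ ⊆ W → Pre k col W → Pre k col W′
  Pre-⊆ k col [] _ = tt
  Pre-⊆ k col (y ∷ʳ s) (_ , p) = Pre-⊆ k col s p
  Pre-⊆ k col (refl ∷ s) (h , p) = (λ Z t → h Z (⊆-trans t (Subₚ.map⁺ proj₁ s))) , Pre-⊆ k col s p

  Pre-homogeneous : ∀ {A : Set} {C} k (col : List A → Fin C) W {c} → Pre k col W → All (λ w → proj₂ w ≡ c) W →
    ∀ Z → Z ⊆ map proj₁ W → length Z ≡ suc k → col Z ≡ c
  Pre-homogeneous k col [] p a .[] [] ()
  Pre-homogeneous k col (w ∷ W) (_ , p) (_ ∷ a) Z (_ ∷ʳ s) l = Pre-homogeneous k col W p a Z s l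
  Pre-homogeneous k col ((y , c) ∷ W) (h , p) (refl ∷ a) (.y ∷ Z) (refl ∷ s) l = h Z s (suc-injective l)

Ramsey : ℕ → ℕ → ℕ → ℕ → Set₁
Ramsey k C m N = ∀ {A : Set} (col : List A → Fin C) (X : List A) → N ≤ length X →
  ∃[ Y ] (Y ⊆ X × length Y ≡ m × Homogeneous k col Y)

private
  -- The classical induction on the size of the sets: an element is set aside, Ramsey for `k` makes
  -- the colouring of the sets through it constant on a sublist, and the process continues inside
  -- this sublist. After `C * m` elements the pigeonhole principle leaves `m` with one colour.
  build : ∀ k C m → ∃[ N ] Ramsey k C m N
  build zero C m = m , λ col X h → take m X , Subₚ.take-⊆ m X , trans (length-take m X) (m≤n⇒m⊓n≡m h) , col [] , λ { [] _ _ → refl }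
  build (suc k) C m = proj₁ (pre (C * m)) , hom
    where
    pre : ∀ j → ∃[ N ] (∀ {A : Set} (col : List A → Fin C) (X : List A) → N ≤ length X →
      ∃[ W ] (map proj₁ W ⊆ X × length W ≡ j × Pre k col W))
    pre zero = 0 , λ col X _ → [] , Sub.minimum X , refl , tt
    pre (suc j) = suc (proj₁ R) , step
      where
      R = build k C (proj₁ (pre j))
      step : ∀ {A : Set} (col : List A → Fin C) (X : List A) → suc (proj₁ R) ≤ length X →
        ∃[ W ] (map proj₁ W ⊆ X × length W ≡ suc j × Pre k col W)
      step col (x ∷ X) (s≤s h) with proj₂ R (col ∘ (x ∷_)) X h
      ... | Y , Y⊆X , len , c , hom with proj₂ (pre j) col Y (≤-reflexive (sym len))
      ... | W , W⊆Y , lenW , p = (x , c) ∷ W , refl ∷ ⊆-trans W⊆Y Y⊆X , cong suc lenW , (λ Z s → hom Z (⊆-trans s W⊆Y)) , p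
    hom : Ramsey (suc k) C m (proj₁ (pre (C * m)))
    hom col X h with m ≤? 0
    ... | yes z≤n = [] , Sub.minimum X , refl , col [] , λ { [] _ () }
    ... | no m>0 with proj₂ (pre (C * m)) col X h
    ... | W , W⊆X , len , p with colour-class m W (≰⇒> m>0) (≤-reflexive (sym len)) (Fin⇒>0 (col []))
      where Fin⇒>0 : ∀ {n} → Fin n → 0 < n
            Fin⇒>0 {suc n} _ = s≤s z≤n
    ... | c , W′ , s , len′ , a = map proj₁ W′ , ⊆-trans (Subₚ.map⁺ proj₁ s) W⊆X , trans (length-map proj₁ W′) len′ , c ,
          Pre-homogeneous k col W′ (Pre-⊆ k col s p) a

abstract
  ramsey : ∀ k C m → ∃[ N ] Ramsey k C m N
  ramsey = build

-- Sums over the tuples of a box B₀ × B₁ × …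

tuples : List (List A) → List (List A)
tuples [] = [] ∷ []
tuples (B ∷ Bs) = concatMap (λ v → map (v ∷_) (tuples Bs)) B

∑-concatMap : ∀ (g : A → List A′) (xs : List A) (f : A′ → ℕ) → ∑ (concatMap g xs) f ≡ ∑ xs (λ x → ∑ (g x) f)
∑-concatMap g [] f = refl
∑-concatMap g (x ∷ xs) f = trans (∑-++ (g x) _ f) (cong (∑ (g x) f +_) (∑-concatMap g xs f))

∑-tuples : ∀ (B : List A) Bs (f : List A → ℕ) → ∑ (tuples (B ∷ Bs)) f ≡ ∑ B (λ v → ∑ (tuples Bs) (λ x → f (v ∷ x)))
∑-tuples B Bs f = trans (∑-concatMap (λ v → map (v ∷_) (tuples Bs)) B f) (∑-cong B λ v → ∑-map (v ∷_) (tuples Bs) f)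

⟪_⟫ : List (List A) → ℕ
⟪ Bs ⟫ = length (tuples Bs)

length-∑ : ∀ (xs : List A) → length xs ≡ ∑ xs (λ _ → 1)
length-∑ xs = sym (trans (∑-const xs 1) (*-identityʳ _))

vol-∷ : ∀ (B : List A) Bs → ⟪ B ∷ Bs ⟫ ≡ length B * ⟪ Bs ⟫
vol-∷ B Bs = begin
  ⟪ B ∷ Bs ⟫ ≡⟨ length-∑ (tuples (B ∷ Bs)) ⟩
  ∑ (tuples (B ∷ Bs)) (λ _ → 1) ≡⟨ ∑-tuples B Bs _ ⟩
  ∑ B (λ _ → ∑ (tuples Bs) (λ _ → 1)) ≡⟨ ∑-const B _ ⟩
  length B * ∑ (tuples Bs) (λ _ → 1) ≡⟨ cong (length B *_) (sym (length-∑ (tuples Bs))) ⟩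
  length B * ⟪ Bs ⟫ ∎
  where open ≡-Reasoning

vol-^ : ∀ {s} (Bs : List (List A)) → All (λ B → length B ≡ s) Bs → ⟪ Bs ⟫ ≡ s ^ length Bs
vol-^ [] [] = refl
vol-^ (B ∷ Bs) (refl ∷ h) = trans (vol-∷ B Bs) (cong (length B *_) (vol-^ Bs h))

∈-tuples : ∀ (Bs : List (List A)) {x} → x ∈ tuples Bs → Pointwise _∈_ x Bs
∈-tuples [] (here refl) = []
∈-tuples (B ∷ Bs) x∈ with find (∈ₚ.∈-concatMap⁻ (λ v → map (v ∷_) (tuples Bs)) {xs = B} x∈)
... | v , v∈ , q with ∈ₚ.∈-map⁻ (v ∷_) q
... | y , y∈ , refl = v∈ ∷ ∈-tuples Bs y∈

tuples-∈ : ∀ {Bs : List (List A)} {x} → Pointwise _∈_ x Bs → x ∈ tuples Bs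
tuples-∈ [] = here refl
tuples-∈ {Bs = B ∷ Bs} (v∈ ∷ h) = ∈ₚ.∈-concatMap⁺ (λ v → map (v ∷_) (tuples Bs)) (lose v∈ (∈ₚ.∈-map⁺ _ (tuples-∈ h)))

length-∈-tuples : ∀ (Bs : List (List A)) {x} → x ∈ tuples Bs → length x ≡ length Bs
length-∈-tuples Bs x∈ = Pw.Pointwise-length (∈-tuples Bs x∈)

infix 4 _≼_
_≼_ : List (List A) → List (List A) → Set
_≼_ = Pointwise _⊆_

≼-refl : ∀ {Bs : List (List A)} → Bs ≼ Bs
≼-refl = Pw.refl ⊆-refl

≼-trans : ∀ {Bs Cs Ds : List (List A)} → Bs ≼ Cs → Cs ≼ Ds → Bs ≼ Ds
≼-trans = Pw.transitive ⊆-trans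

tuples-⊆ : ∀ {Cs Bs : List (List A)} → Cs ≼ Bs → tuples Cs ⊆ tuples Bs
tuples-⊆ [] = ⊆-refl
tuples-⊆ {Cs = C ∷ Cs} {B ∷ Bs} (p ∷ q) = go p
  where
  go : ∀ {C B} → C ⊆ B → concatMap (λ v → map (v ∷_) (tuples Cs)) C ⊆ concatMap (λ v → map (v ∷_) (tuples Bs)) B
  go [] = []
  go (y ∷ʳ p) = Subₚ.++⁺ (Sub.minimum (map (y ∷_) (tuples Bs))) (go p)
  go (_∷_ {x} refl p) = Subₚ.++⁺ (Subₚ.map⁺ (x ∷_) (tuples-⊆ q)) (go p)

count : (List A → Bool) → List (List A) → ℕ
count f Bs = ∑ (tuples Bs) (𝟙 ∘ f)

count≤vol : ∀ (f : List A → Bool) Bs → count f Bs ≤ ⟪ Bs ⟫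
count≤vol f Bs = ≤-trans (∑-mono (tuples Bs) (𝟙≤1 ∘ f)) (≤-reflexive (sym (length-∑ (tuples Bs))))

filterBox : (ℕ → A → Bool) → List (List A) → List (List A)
filterBox u [] = []
filterBox u (B ∷ Bs) = filterᵇ (u 0) B ∷ filterBox (u ∘ suc) Bs

filterᵇ-⊆ : ∀ (p : A → Bool) xs → filterᵇ p xs ⊆ xs
filterᵇ-⊆ p [] = []
filterᵇ-⊆ p (x ∷ xs) with p x
... | true = refl ∷ filterᵇ-⊆ p xs
... | false = x ∷ʳ filterᵇ-⊆ p xs

filterBox-≼ : ∀ (u : ℕ → A → Bool) Bs → filterBox u Bs ≼ Bs
filterBox-≼ u [] = []
filterBox-≼ u (B ∷ Bs) = filterᵇ-⊆ (u 0) B ∷ filterBox-≼ (u ∘ suc) Bs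

allU : (ℕ → A → Bool) → List A → Bool
allU u [] = true
allU u (v ∷ x) = u 0 v ∧ allU (u ∘ suc) x

∑-filterᵇ : ∀ (p : A → Bool) xs (f : A → ℕ) → ∑ (filterᵇ p xs) f ≡ ∑ xs (λ x → 𝟙 (p x) * f x)
∑-filterᵇ p [] f = refl
∑-filterᵇ p (x ∷ xs) f with p x
... | true = cong₂ _+_ (sym (+-identityʳ (f x))) (∑-filterᵇ p xs f)
... | false = ∑-filterᵇ p xs f

-- Products of unary conditions, one for each coordinate, are exactly the weights that box
-- regularity can handle: summing against such a product is summing over a sub-box.
∑-filterBox : ∀ (u : ℕ → A → Bool) Bs (f : List A → ℕ) →
  ∑ (tuples (filterBox u Bs)) f ≡ ∑ (tuples Bs) (λ x → 𝟙 (allU u x) * f x)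
∑-filterBox u [] f = cong (_+ 0) (sym (+-identityʳ (f [])))
∑-filterBox u (B ∷ Bs) f = begin
  ∑ (tuples (filterBox u (B ∷ Bs))) f ≡⟨ ∑-tuples (filterᵇ (u 0) B) (filterBox (u ∘ suc) Bs) f ⟩
  ∑ (filterᵇ (u 0) B) (λ v → ∑ (tuples (filterBox (u ∘ suc) Bs)) (λ x → f (v ∷ x)))
    ≡⟨ ∑-cong (filterᵇ (u 0) B) (λ v → ∑-filterBox (u ∘ suc) Bs (λ x → f (v ∷ x))) ⟩
  ∑ (filterᵇ (u 0) B) (λ v → ∑ (tuples Bs) (λ x → 𝟙 (allU (u ∘ suc) x) * f (v ∷ x)))
    ≡⟨ ∑-filterᵇ (u 0) B _ ⟩
  ∑ B (λ v → 𝟙 (u 0 v) * ∑ (tuples Bs) (λ x → 𝟙 (allU (u ∘ suc) x) * f (v ∷ x)))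
    ≡⟨ ∑-cong B (λ v → trans (sym (∑-* (tuples Bs) (𝟙 (u 0 v)) _)) (∑-cong (tuples Bs) λ x →
         trans (sym (*-assoc (𝟙 (u 0 v)) _ _)) (cong (_* f (v ∷ x)) (sym (𝟙-∧ (u 0 v) _))))) ⟩
  ∑ B (λ v → ∑ (tuples Bs) (λ x → 𝟙 (allU u (v ∷ x)) * f (v ∷ x))) ≡⟨ sym (∑-tuples B Bs _) ⟩
  ∑ (tuples (B ∷ Bs)) (λ x → 𝟙 (allU u x) * f x) ∎
  where open ≡-Reasoning

merge : (ℕ → Bool) → List A → List A → List A
merge m [] z = []
merge m (v ∷ x) [] = []
merge m (v ∷ x) (w ∷ z) = (if m 0 then v else w) ∷ merge (m ∘ suc) x z

length-merge : ∀ m (x z : List A) → length x ≡ length z → length (merge m x z) ≡ length x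
length-merge m [] z h = refl
length-merge m (v ∷ x) (w ∷ z) h = cong suc (length-merge (m ∘ suc) x z (suc-injective h))

-- a random tuple may be resampled outside the coordinates in m
∑-resample : ∀ m (Bs : List (List A)) (F : List A → ℕ) →
  ∑ (tuples Bs) (λ x → ∑ (tuples Bs) (λ z → F (merge m x z))) ≡ ⟪ Bs ⟫ * ∑ (tuples Bs) F
∑-resample m [] F = cong (_+ 0) (refl {x = F [] + 0})
∑-resample m (B ∷ Bs) F = begin
  ∑ (tuples (B ∷ Bs)) (λ x → ∑ (tuples (B ∷ Bs)) (λ z → F (merge m x z)))
    ≡⟨ trans (∑-tuples B Bs _) (∑-cong B λ v → ∑-cong (tuples Bs) λ x → ∑-tuples B Bs _) ⟩
  ∑ B (λ v → ∑ (tuples Bs) (λ x → ∑ B (λ w → ∑ (tuples Bs) (λ z → F (merge m (v ∷ x) (w ∷ z))))))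
    ≡⟨ ∑-cong B (λ v → ∑-swap (tuples Bs) B _) ⟩
  ∑ B (λ v → ∑ B (λ w → ∑ (tuples Bs) (λ x → ∑ (tuples Bs) (λ z → F ((if m 0 then v else w) ∷ merge (m ∘ suc) x z)))))
    ≡⟨ ∑-cong B (λ v → ∑-cong B λ w → ∑-resample (m ∘ suc) Bs (λ y → F ((if m 0 then v else w) ∷ y))) ⟩
  ∑ B (λ v → ∑ B (λ w → ⟪ Bs ⟫ * G (if m 0 then v else w))) ≡⟨ choose-one (m 0) ⟩
  length B * ∑ B (λ v → ⟪ Bs ⟫ * G v) ≡⟨ cong (length B *_) (∑-* B ⟪ Bs ⟫ G) ⟩
  length B * (⟪ Bs ⟫ * ∑ B G) ≡⟨ sym (*-assoc (length B) _ _) ⟩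
  length B * ⟪ Bs ⟫ * ∑ B G ≡⟨ cong₂ _*_ (sym (vol-∷ B Bs)) (sym (∑-tuples B Bs F)) ⟩
  ⟪ B ∷ Bs ⟫ * ∑ (tuples (B ∷ Bs)) F ∎
  where
  open ≡-Reasoning
  G = λ v → ∑ (tuples Bs) (λ y → F (v ∷ y))
  choose-one : ∀ b → ∑ B (λ v → ∑ B (λ w → ⟪ Bs ⟫ * G (if b then v else w))) ≡ length B * ∑ B (λ v → ⟪ Bs ⟫ * G v)
  choose-one true = trans (∑-cong B λ v → ∑-const B _) (∑-* B (length B) _)
  choose-one false = ∑-const B _

nth : A → List A → ℕ → A
nth d [] i = d
nth d (v ∷ x) zero = v
nth d (v ∷ x) (suc i) = nth d x i

nth-merge : ∀ (d : A) m x z i → length x ≡ length z → nth d (merge m x z) i ≡ (if m i then nth d x i else nth d z i)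
nth-merge d m [] [] i h with m i
... | true = refl
... | false = refl
nth-merge d m (v ∷ x) (w ∷ z) zero h = refl
nth-merge d m (v ∷ x) (w ∷ z) (suc i) h = nth-merge d (m ∘ suc) x z i (suc-injective h)

nth-replicate : ∀ (d v : A) n {i} → i < n → nth d (replicate n v) i ≡ v
nth-replicate d v (suc n) {zero} h = refl
nth-replicate d v (suc n) {suc i} (s≤s h) = nth-replicate d v n h

nth-∈ : ∀ (d : A) x {i} → i < length x → nth d x i ∈ x
nth-∈ d (v ∷ x) {zero} h = here refl
nth-∈ d (v ∷ x) {suc i} (s≤s h) = there (nth-∈ d x h)

allU-true : ∀ {u : ℕ → A → Bool} x → (∀ i v → u i v ≡ true) → allU u x ≡ true
allU-true [] h = refl
allU-true (v ∷ x) h = ∧-true (h 0 v) (allU-true x (λ i → h (suc i)))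

allU-∧ : ∀ (u w : ℕ → A → Bool) x → allU (λ i v → u i v ∧ w i v) x ≡ allU u x ∧ allU w x
allU-∧ u w [] = refl
allU-∧ u w (v ∷ x) rewrite allU-∧ (u ∘ suc) (w ∘ suc) x with u 0 v | w 0 v | allU (u ∘ suc) x
... | true | true | _ = refl
... | true | false | true = refl
... | true | false | false = refl
... | false | _ | _ = refl

allU-at : ∀ (d : A) (g : A → Bool) k x → k < length x → allU (λ i v → if i == k then g v else true) x ≡ g (nth d x k)
allU-at d g zero (v ∷ x) h = trans (cong (g v ∧_) (allU-true x (λ i v → refl))) (∧-identityʳ (g v))
allU-at d g (suc k) (v ∷ x) (s≤s h) = allU-at d g k x h

-- Telescoping over functions whose coordinate sets pairwise meet in at most one coordinate

module Telescoping (d : A) (T : ℕ) where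

  DependsOn : (ℕ → Bool) → (List A → Bool) → Set
  DependsOn J f = ∀ x y → (∀ i → J i ≡ true → nth d x i ≡ nth d y i) → f x ≡ f y

  -- The witness `k` is required to lie in `J`, so that it can be named also when the two sets are
  -- disjoint; any element of `J` serves then.
  Meet : (ℕ → Bool) → (ℕ → Bool) → Set
  Meet J K = ∃[ k ] (k < T × J k ≡ true × (∀ i → J i ≡ true → K i ≡ true → i ≡ k))

  private
    -- With the coordinates outside `J` frozen to `z`, the function `f` on `K` sees only coordinate
    -- `k`. Its dependence on the entry `v` there is read off from the constant tuple
    -- `replicate T v`, merged into `z` at `k` alone.
    separate₁ : ∀ J K f → Meet J K → DependsOn K f → ∀ z →
      ∃[ u ] (length z ≡ T → ∀ x → length x ≡ T → f (merge J x z) ≡ allU u x)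
    separate₁ J K f (k , k<T , Jk , only) dep z = u , λ lz x lx →
      trans (dep _ _ (λ i Ki → trans (lhs x lx lz i Ki) (sym (rhs x lx lz i))))
            (sym (allU-at d (λ v → f (merge (_== k) (replicate T v) z)) k x (subst (k <_) (sym lx) k<T)))
      where
      u : ℕ → A → Bool
      u i v = if i == k then f (merge (_== k) (replicate T v) z) else true
      lhs : ∀ x → length x ≡ T → length z ≡ T → ∀ i → K i ≡ true → nth d (merge J x z) i ≡ (if i == k then nth d x k else nth d z i)
      lhs x lx lz i Ki = trans (nth-merge d J x z i (trans lx (sym lz))) (by (J i) refl)
        where
        by : ∀ b → J i ≡ b → (if b then nth d x i else nth d z i) ≡ (if i == k then nth d x k else nth d z i)
        by true Ji rewrite only i Ji Ki | ==-refl k = refl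
        by false Ji rewrite ==-false {i} {k} (λ { refl → case trans (sym Jk) Ji of λ () }) = refl
      rhs : ∀ x → length x ≡ T → length z ≡ T → ∀ i →
        nth d (merge (_== k) (replicate T (nth d x k)) z) i ≡ (if i == k then nth d x k else nth d z i)
      rhs x lx lz i = trans (nth-merge d (_== k) (replicate T (nth d x k)) z i (trans (length-replicate T) (sym lz))) (by (i == k) refl)
        where
        by : ∀ b → (i == k) ≡ b → (if b then nth d (replicate T (nth d x k)) i else nth d z i) ≡ (if b then nth d x k else nth d z i)
        by true e rewrite ==-true {i} {k} e = nth-replicate d _ T k<T
        by false e = refl

  Factor : Set
  Factor = (ℕ → Bool) × (List A → Bool)

  product : List Factor → List A → Bool
  product ws x = all ws (λ w → proj₂ w x)

  private
    separate : ∀ J ws → All (λ w → Meet J (proj₁ w) × DependsOn (proj₁ w) (proj₂ w)) ws → ∀ z →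
      ∃[ u ] (length z ≡ T → ∀ x → length x ≡ T → product ws (merge J x z) ≡ allU u x)
    separate J [] [] z = (λ _ _ → true) , λ _ x _ → sym (allU-true x λ _ _ → refl)
    separate J ((K , f) ∷ ws) ((m , dep) ∷ h) z with separate₁ J K f m dep z | separate J ws h z
    ... | u , p | u′ , q = (λ i v → u i v ∧ u′ i v) , λ lz x lx →
      trans (cong₂ _∧_ (p lz x lx) (q lz x lx)) (sym (allU-∧ u u′ x))

  module _ (Bs : List (List A)) (len : length Bs ≡ T) (pos : 0 < ⟪ Bs ⟫) (E : ℕ) where

    -- The common form of three comparisons on all sub-boxes: `o` constantly true and `f` a gadget
    -- of positive density (embedding), `f` constantly true and `o` a popular pair (upper bound),
    -- `o` an increasing pair and `f` a correctly coloured one (lower bound).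
    Dominates : (f o : List A → Bool) (a b : ℕ) → Set
    Dominates f o a b = ∀ Cs → Cs ≼ Bs → a * count o Cs ≤ b * count f Cs + E

    private
      -- Resampling fixes the coordinates outside `J` to `z`. By `separate` the factors in `ws` then
      -- cut a sub-box out of `Bs`, and what is left is the number of tuples of this box that
      -- satisfy `g`.
      decompose : ∀ J g ws (h : All (λ w → Meet J (proj₁ w) × DependsOn (proj₁ w) (proj₂ w)) ws) → DependsOn J g →
        ⟪ Bs ⟫ * ∑ (tuples Bs) (λ x → 𝟙 (g x ∧ product ws x)) ≡
        ∑ (tuples Bs) (λ z → count g (filterBox (proj₁ (separate J ws h z)) Bs))
      decompose J g ws h dep = begin
        ⟪ Bs ⟫ * ∑ X F ≡⟨ sym (∑-resample J Bs F) ⟩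
        ∑ X (λ x → ∑ X (λ z → F (merge J x z))) ≡⟨ ∑-swap X X _ ⟩
        ∑ X (λ z → ∑ X (λ x → F (merge J x z))) ≡⟨ ∑-cong∈ X (λ z z∈ → trans (∑-cong∈ X (λ x x∈ → step z x (length∈ z∈) (length∈ x∈)))
              (sym (∑-filterBox (proj₁ (separate J ws h z)) Bs (𝟙 ∘ g)))) ⟩
        ∑ X (λ z → count g (filterBox (proj₁ (separate J ws h z)) Bs)) ∎
        where
        open ≡-Reasoning
        X = tuples Bs
        F = λ x → 𝟙 (g x ∧ product ws x)
        length∈ : ∀ {x} → x ∈ X → length x ≡ T
        length∈ x∈ = trans (length-∈-tuples Bs x∈) len
        step : ∀ z x → length z ≡ T → length x ≡ T → F (merge J x z) ≡ 𝟙 (allU (proj₁ (separate J ws h z)) x) * 𝟙 (g x)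
        step z x lz lx = trans (cong 𝟙 (cong₂ _∧_ (dep _ _ (λ i Ji → trans (nth-merge d J x z i (trans lx (sym lz))) (cong (λ b → if b then _ else _) Ji)))
              (proj₂ (separate J ws h z) lz x lx))) (trans (𝟙-∧ (g x) _) (*-comm (𝟙 (g x)) _))

      step : ∀ J f o a b ws → All (λ w → Meet J (proj₁ w) × DependsOn (proj₁ w) (proj₂ w)) ws → DependsOn J f → DependsOn J o →
        Dominates f o a b →
        a * ∑ (tuples Bs) (λ x → 𝟙 (o x ∧ product ws x)) ≤ b * ∑ (tuples Bs) (λ x → 𝟙 (f x ∧ product ws x)) + E
      step J f o a b ws h df do′ dom = *-cancelˡ-≤ ⟪ Bs ⟫ {{ℕ.>-nonZero pos}} (begin
        ⟪ Bs ⟫ * (a * So) ≡⟨ lem ⟪ Bs ⟫ a So ⟩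
        a * (⟪ Bs ⟫ * So) ≡⟨ cong (a *_) (decompose J o ws h do′) ⟩
        a * ∑ X (λ z → count o (C z)) ≡⟨ sym (∑-* X a _) ⟩
        ∑ X (λ z → a * count o (C z)) ≤⟨ ∑-mono X (λ z → dom (C z) (filterBox-≼ _ Bs)) ⟩
        ∑ X (λ z → b * count f (C z) + E) ≡⟨ trans (∑-+ X (λ z → b * count f (C z)) (λ _ → E)) (cong₂ _+_ (∑-* X b (λ z → count f (C z))) (∑-const X E)) ⟩
        b * ∑ X (λ z → count f (C z)) + ⟪ Bs ⟫ * E ≡⟨ cong (λ t → b * t + ⟪ Bs ⟫ * E) (sym (decompose J f ws h df)) ⟩
        b * (⟪ Bs ⟫ * Sf) + ⟪ Bs ⟫ * E ≡⟨ lem′ ⟪ Bs ⟫ b Sf E ⟩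
        ⟪ Bs ⟫ * (b * Sf + E) ∎)
        where
        open ≤-Reasoning
        X = tuples Bs
        C = λ z → filterBox (proj₁ (separate J ws h z)) Bs
        So = ∑ X (λ x → 𝟙 (o x ∧ product ws x))
        Sf = ∑ X (λ x → 𝟙 (f x ∧ product ws x))
        lem : ∀ n a s → n * (a * s) ≡ a * (n * s)
        lem = solve-∀
        lem′ : ∀ n b s e → b * (n * s) + n * e ≡ n * (b * s + e)
        lem′ = solve-∀

    record Item : Set where
      field
        coords : ℕ → Bool
        f o : List A → Bool
        a b : ℕ
        f-dep : DependsOn coords f
        o-dep : DependsOn coords o
        dom : Dominates f o a b

    open Item

    Meet² : (ℕ → Bool) → (ℕ → Bool) → Set
    Meet² J K = Meet J K × Meet K J

    -- This is `K * L ^ (K - 1) * E`: exchanging one of `K` items costs `E`, weighted by the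
    -- coefficients of the others, each at most `L`. The closed form is multiplied by `L` to avoid
    -- the predecessor.
    loss : ℕ → ℕ → ℕ
    loss L zero = 0
    loss L (suc K) = L * loss L K + L ^ K * E

    loss-closed : ∀ L K → L * loss L K ≡ K * (L ^ K * E)
    loss-closed L zero = *-zeroʳ L
    loss-closed L (suc K) = trans (*-distribˡ-+ L (L * loss L K) _)
      (trans (cong (λ t → L * t + L * (L ^ K * E)) (loss-closed L K)) (lem L K (L ^ K) E))
      where lem : ∀ L K P E → L * (K * (P * E)) + L * (P * E) ≡ (1 + K) * (L * P * E)
            lem = solve-∀

    private
      -- `ws` holds the factors that have already been exchanged. While `o` of the first item is
      -- replaced by `f`, the factors `o` of the later items and those in `ws` are treated alike:
      -- each meets the coordinates of the first item at most once and becomes part of a sub-box.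
      telescope′ : ∀ L (its : List Item) (ws : List Factor) →
        All (λ it → a it ≤ L × b it ≤ L) its →
        AllPairs (λ it jt → Meet² (coords it) (coords jt)) its →
        All (λ it → All (λ w → Meet (coords it) (proj₁ w) × DependsOn (proj₁ w) (proj₂ w)) ws) its →
        ∏ its a * ∑ (tuples Bs) (λ x → 𝟙 (all its (λ it → o it x) ∧ product ws x)) ≤
        ∏ its b * ∑ (tuples Bs) (λ x → 𝟙 (all its (λ it → f it x) ∧ product ws x)) + loss L (length its)
      telescope′ L [] ws [] [] [] = m≤m+n _ 0
      telescope′ L (it ∷ its) ws ((a≤ , b≤) ∷ ab) (m ∷ ms) (w ∷ hs) = begin
        a it * ∏ its a * ∑ X (λ x → 𝟙 ((o it x ∧ O x) ∧ W x))
          ≡⟨ cong (a it * ∏ its a *_) (∑-cong X λ x → cong 𝟙 (trans (∧-assoc (o it x) (O x) (W x)) (cong (o it x ∧_) (sym (product-++ x its))))) ⟩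
        a it * ∏ its a * ∑ X (λ x → 𝟙 (o it x ∧ product (map of its ++ ws) x)) ≡⟨ lem₁ (a it) (∏ its a) _ ⟩
        ∏ its a * (a it * ∑ X (λ x → 𝟙 (o it x ∧ product (map of its ++ ws) x)))
          ≤⟨ *-monoʳ-≤ (∏ its a) (step (coords it) (f it) (o it) (a it) (b it) (map of its ++ ws)
               (Allₚ.++⁺ (Allₚ.map⁺ (All.map (λ {jt} p → proj₁ p , o-dep jt) m)) w) (f-dep it) (o-dep it) (dom it)) ⟩
        ∏ its a * (b it * ∑ X (λ x → 𝟙 (f it x ∧ product (map of its ++ ws) x)) + E)
          ≡⟨ cong (λ t → ∏ its a * (b it * t + E)) (∑-cong X λ x → cong 𝟙 (trans (cong (f it x ∧_) (product-++ x its))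
               (trans (sym (∧-assoc (f it x) (O x) (W x))) (trans (cong (_∧ W x) (∧-comm (f it x) (O x))) (∧-assoc (O x) (f it x) (W x)))))) ⟩
        ∏ its a * (b it * S + E) ≡⟨ lem₂ (∏ its a) (b it) S E ⟩
        b it * (∏ its a * S) + ∏ its a * E
          ≤⟨ +-mono-≤ (*-monoʳ-≤ (b it) (telescope′ L its ((coords it , f it) ∷ ws) ab ms (extend its m hs)))
               (*-monoˡ-≤ E (∏-≤ its ab)) ⟩
        b it * (∏ its b * S′ + loss L (length its)) + L ^ length its * E ≡⟨ lem₃ (b it) (∏ its b) S′ _ _ ⟩
        b it * ∏ its b * S′ + (b it * loss L (length its) + L ^ length its * E)
          ≤⟨ +-monoʳ-≤ (b it * ∏ its b * S′) (+-monoˡ-≤ (L ^ length its * E) (*-monoˡ-≤ (loss L (length its)) b≤)) ⟩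
        b it * ∏ its b * S′ + loss L (suc (length its))
          ≡⟨ cong (λ t → b it * ∏ its b * t + loss L (suc (length its))) (∑-cong X λ x → cong 𝟙
               (trans (sym (∧-assoc (Fs x) (f it x) (W x))) (cong (_∧ W x) (∧-comm (Fs x) (f it x))))) ⟩
        b it * ∏ its b * ∑ X (λ x → 𝟙 ((f it x ∧ Fs x) ∧ W x)) + loss L (suc (length its)) ∎
        where
        open ≤-Reasoning
        X = tuples Bs
        O = λ x → all its (λ it → o it x)
        Fs = λ x → all its (λ it → f it x)
        W = product ws
        of : Item → Factor
        of jt = coords jt , o jt
        S = ∑ X (λ x → 𝟙 (O x ∧ product ((coords it , f it) ∷ ws) x))
        S′ = ∑ X (λ x → 𝟙 (Fs x ∧ product ((coords it , f it) ∷ ws) x))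
        product-++ : ∀ x js → product (map of js ++ ws) x ≡ all js (λ jt → o jt x) ∧ W x
        product-++ x [] = refl
        product-++ x (jt ∷ js) = trans (cong (o jt x ∧_) (product-++ x js)) (sym (∧-assoc (o jt x) (all js (λ kt → o kt x)) (W x)))
        ∏-≤ : ∀ js → All (λ jt → a jt ≤ L × b jt ≤ L) js → ∏ js a ≤ L ^ length js
        ∏-≤ [] [] = ≤-refl
        ∏-≤ (j ∷ js) ((p , _) ∷ q) = *-mono-≤ p (∏-≤ js q)
        extend : ∀ js → All (λ jt → Meet² (coords it) (coords jt)) js →
          All (λ jt → All (λ w → Meet (coords jt) (proj₁ w) × DependsOn (proj₁ w) (proj₂ w)) ws) js →
          All (λ jt → All (λ w → Meet (coords jt) (proj₁ w) × DependsOn (proj₁ w) (proj₂ w)) ((coords it , f it) ∷ ws)) js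
        extend [] [] [] = []
        extend (j ∷ js) ((_ , p) ∷ q) (r ∷ s) = ((p , f-dep it) ∷ r) ∷ extend js q s
        lem₁ : ∀ a b c → a * b * c ≡ b * (a * c)
        lem₁ = solve-∀
        lem₂ : ∀ p b s e → p * (b * s + e) ≡ b * (p * s) + p * e
        lem₂ = solve-∀
        lem₃ : ∀ b p s l m → b * (p * s + l) + m ≡ b * p * s + (b * l + m)
        lem₃ = solve-∀

    telescope : ∀ L (its : List Item) →
      All (λ it → a it ≤ L × b it ≤ L) its →
      AllPairs (λ it jt → Meet² (coords it) (coords jt)) its →
      ∏ its a * count (λ x → all its (λ it → o it x)) Bs ≤
      ∏ its b * count (λ x → all its (λ it → f it x)) Bs + loss L (length its)
    telescope L its ab ms = subst₂ (λ s t → ∏ its a * s ≤ ∏ its b * t + loss L (length its))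
      (∑-cong (tuples Bs) λ x → cong 𝟙 (∧-identityʳ _)) (∑-cong (tuples Bs) λ x → cong 𝟙 (∧-identityʳ _))
      (telescope′ L its [] ab ms (All.universal (λ _ → []) its))

-- Regularity by density decrement

⊆-length : ∀ {xs ys : List A} → xs ⊆ ys → length xs ≤ length ys
⊆-length [] = z≤n
⊆-length (y ∷ʳ p) = m≤n⇒m≤1+n (⊆-length p)
⊆-length (refl ∷ p) = s≤s (⊆-length p)

^-* : ∀ n a b → (a * b) ^ n ≡ a ^ n * b ^ n
^-* zero a b = refl
^-* (suc n) a b = trans (cong (a * b *_) (^-* n a b)) (lem a b (a ^ n) (b ^ n))
  where lem : ∀ a b c d → a * b * (c * d) ≡ a * c * (b * d)
        lem = solve-∀

private
  remove : ∀ {xs : List A} {x} → x ∈ xs →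
    ∃[ ys ] (ys ⊆ xs × length xs ≡ suc (length ys) × ∀ (w : A → ℕ) → ∑ xs w ≡ w x + ∑ ys w)
  remove {xs = x ∷ xs} (here refl) = xs , x ∷ʳ ⊆-refl , refl , λ w → refl
  remove {xs = y ∷ xs} {x} (there p) with remove p
  ... | ys , s , l , e = y ∷ ys , refl ∷ s , cong suc l , λ w → trans (cong (w y +_) (e w)) (lem (w y) (w x) (∑ ys w))
    where lem : ∀ a b c → a + (b + c) ≡ b + (a + c)
          lem = solve-∀

  -- Removing an entry of at least average weight does not raise the average.
  remove-heavy : ∀ (w : A → ℕ) n (xs : List A) → length xs ≡ suc n →
    ∃[ ys ] (ys ⊆ xs × length ys ≡ n × suc n * ∑ ys w ≤ n * ∑ xs w)
  remove-heavy w n xs@(x ∷ xs′) len = let y , y∈ , h = heavy in body y y∈ h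
    where
    heavy : ∃[ y ] (y ∈ xs × ∑ xs w ≤ suc n * w y)
    heavy with ∑ xs w in eq
    ... | zero = x , here refl , z≤n
    ... | suc m with ∑-avg-≥ xs w (suc m) (s≤s z≤n) (≤-reflexive (sym eq))
    ... | y , y∈ , h = y , y∈ , subst (λ l → suc m ≤ l * w y) len h
    body : ∀ y → y ∈ xs → ∑ xs w ≤ suc n * w y → _
    body y y∈ h with remove y∈
    ... | ys , s , l , e = ys , s , suc-injective (trans (sym l) len) , +-cancelˡ-≤ (∑ xs w) _ _ (begin
      ∑ xs w + suc n * ∑ ys w ≤⟨ +-monoˡ-≤ _ h ⟩
      suc n * w y + suc n * ∑ ys w ≡⟨ sym (*-distribˡ-+ (suc n) (w y) _) ⟩
      suc n * (w y + ∑ ys w) ≡⟨ cong (suc n *_) (sym (e w)) ⟩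
      suc n * ∑ xs w ∎)
      where open ≤-Reasoning

thin-list : ∀ (w : A → ℕ) m (xs : List A) → m ≤ length xs →
  ∃[ ys ] (ys ⊆ xs × length ys ≡ m × length xs * ∑ ys w ≤ m * ∑ xs w)
thin-list w m xs h = go (length xs ∸ m) xs (sym (m∸n+n≡m h))
  where
  go : ∀ d xs → length xs ≡ d + m → ∃[ ys ] (ys ⊆ xs × length ys ≡ m × length xs * ∑ ys w ≤ m * ∑ xs w)
  go zero xs l = xs , ⊆-refl , l , ≤-reflexive (cong (_* ∑ xs w) l)
  go (suc d) xs l with remove-heavy w (d + m) xs l
  ... | ys , s , l′ , h with go d ys l′
  ... | zs , s′ , l″ , h′ = zs , ⊆-trans s′ s , l″ , subst (λ n → n * ∑ zs w ≤ m * ∑ xs w) (sym l) (fin (d + m) refl)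
    where
    fin : ∀ n → d + m ≡ n → suc (d + m) * ∑ zs w ≤ m * ∑ xs w
    fin zero e rewrite m+n≡0⇒n≡0 d {m} e | m+n≡0⇒m≡0 d e = ≤-reflexive (empty zs l″)
      where empty : ∀ zs → length zs ≡ 0 → 1 * ∑ zs w ≡ 0
            empty [] _ = refl
    fin (suc n) e rewrite e = *-cancelˡ-≤ (suc n) (begin
      suc n * (suc (suc n) * ∑ zs w) ≡⟨ lem (suc n) (suc (suc n)) (∑ zs w) ⟩
      suc (suc n) * (suc n * ∑ zs w) ≤⟨ *-monoʳ-≤ (suc (suc n)) (subst (λ t → t * ∑ zs w ≤ m * ∑ ys w) (trans l′ refl) h′) ⟩
      suc (suc n) * (m * ∑ ys w) ≡⟨ lem (suc (suc n)) m (∑ ys w) ⟩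
      m * (suc (suc n) * ∑ ys w) ≤⟨ *-monoʳ-≤ m h ⟩
      m * (suc n * ∑ xs w) ≡⟨ lem m (suc n) (∑ xs w) ⟩
      suc n * (m * ∑ xs w) ∎)
      where open ≤-Reasoning
            lem : ∀ a b c → a * (b * c) ≡ b * (a * c)
            lem = solve-∀

-- The first side is thinned for the weights summed over the full remaining sides, the remaining
-- sides for the weights summed over the thinned first side; neither step raises the average of `F`.
-- The point is to restore equal sides without raising the density.
thin-box : ∀ (F : List A → ℕ) m (Bs : List (List A)) → All (λ B → m ≤ length B) Bs →
  ∃[ Cs ] (Cs ≼ Bs × All (λ C → length C ≡ m) Cs × ⟪ Bs ⟫ * ∑ (tuples Cs) F ≤ ⟪ Cs ⟫ * ∑ (tuples Bs) F)
thin-box F m [] [] = [] , [] , [] , ≤-refl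
thin-box F m (B ∷ Bs) (h ∷ hs) with thin-list (λ v → ∑ (tuples Bs) (λ x → F (v ∷ x))) m B h
... | C , s , l , p with thin-box (λ x → ∑ C (λ v → F (v ∷ x))) m Bs hs
... | Cs , ss , ls , q = C ∷ Cs , s ∷ ss , l ∷ ls , (begin
  ⟪ B ∷ Bs ⟫ * ∑ (tuples (C ∷ Cs)) F ≡⟨ cong₂ _*_ (vol-∷ B Bs) (trans (∑-tuples C Cs F) (∑-swap C (tuples Cs) (λ v x → F (v ∷ x)))) ⟩
  length B * ⟪ Bs ⟫ * ∑ (tuples Cs) (λ x → ∑ C (λ v → F (v ∷ x))) ≡⟨ *-assoc (length B) _ _ ⟩
  length B * (⟪ Bs ⟫ * ∑ (tuples Cs) (λ x → ∑ C (λ v → F (v ∷ x)))) ≤⟨ *-monoʳ-≤ (length B) q ⟩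
  length B * (⟪ Cs ⟫ * ∑ (tuples Bs) (λ x → ∑ C (λ v → F (v ∷ x)))) ≡⟨ cong (λ t → length B * (⟪ Cs ⟫ * t)) (∑-swap (tuples Bs) C (λ x v → F (v ∷ x))) ⟩
  length B * (⟪ Cs ⟫ * ∑ C (λ v → ∑ (tuples Bs) (λ x → F (v ∷ x)))) ≡⟨ lem (length B) ⟪ Cs ⟫ _ ⟩
  ⟪ Cs ⟫ * (length B * ∑ C (λ v → ∑ (tuples Bs) (λ x → F (v ∷ x)))) ≤⟨ *-monoʳ-≤ ⟪ Cs ⟫ p ⟩
  ⟪ Cs ⟫ * (m * ∑ B (λ v → ∑ (tuples Bs) (λ x → F (v ∷ x)))) ≡⟨ lem′ ⟪ Cs ⟫ m _ ⟩
  m * ⟪ Cs ⟫ * ∑ B (λ v → ∑ (tuples Bs) (λ x → F (v ∷ x))) ≡⟨ cong₂ _*_ (trans (cong (_* ⟪ Cs ⟫) (sym l)) (sym (vol-∷ C Cs))) (sym (∑-tuples B Bs F)) ⟩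
  ⟪ C ∷ Cs ⟫ * ∑ (tuples (B ∷ Bs)) F ∎)
  where
  open ≤-Reasoning
  lem : ∀ a b c → a * (b * c) ≡ b * (a * c)
  lem = solve-∀
  lem′ : ∀ a b c → a * (b * c) ≡ b * a * c
  lem′ = solve-∀

vol-≼ : ∀ {Cs Bs : List (List A)} → Cs ≼ Bs → ⟪ Cs ⟫ ≤ ⟪ Bs ⟫
vol-≼ s = ⊆-length (tuples-⊆ s)

count-≼ : ∀ (f : List A → Bool) {Cs Bs} → Cs ≼ Bs → count f Cs ≤ count f Bs
count-≼ f s = ∑-⊆ (𝟙 ∘ f) (tuples-⊆ s)

private
  -- In the other sides a sub-box has at most the full extent. If more than one part in `L` of the
  -- volume survives, at least that proportion survives in every single side.
  sides-large : ∀ L {Cs Bs : List (List A)} → Cs ≼ Bs → ⟪ Bs ⟫ < L * ⟪ Cs ⟫ → Pointwise (λ C B → length B ≤ L * length C) Cs Bs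
  sides-large L [] h = []
  sides-large L {C ∷ Cs} {B ∷ Bs} (s ∷ ss) h = <⇒≤ side ∷ sides-large L ss rest
    where
    open ≤-Reasoning
    lem : ∀ a b c → a * (b * c) ≡ b * (a * c)
    lem = solve-∀
    h′ : length B * ⟪ Bs ⟫ < L * (length C * ⟪ Cs ⟫)
    h′ = subst₂ (λ s t → s < L * t) (vol-∷ B Bs) (vol-∷ C Cs) h
    side : length B < L * length C
    side = *-cancelʳ-< (⟪ Bs ⟫) _ _ (begin-strict
      length B * ⟪ Bs ⟫ <⟨ h′ ⟩
      L * (length C * ⟪ Cs ⟫) ≡⟨ sym (*-assoc L _ _) ⟩
      L * length C * ⟪ Cs ⟫ ≤⟨ *-monoʳ-≤ (L * length C) (vol-≼ ss) ⟩
      L * length C * ⟪ Bs ⟫ ∎)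
    rest : ⟪ Bs ⟫ < L * ⟪ Cs ⟫
    rest = *-cancelˡ-< (length B) _ _ (begin-strict
      length B * ⟪ Bs ⟫ <⟨ h′ ⟩
      L * (length C * ⟪ Cs ⟫) ≡⟨ lem L (length C) _ ⟩
      length C * (L * ⟪ Cs ⟫) ≤⟨ *-monoˡ-≤ (L * ⟪ Cs ⟫) (⊆-length s) ⟩
      length B * (L * ⟪ Cs ⟫) ∎)

  all-side : ∀ {L m n} {Cs Bs : List (List A)} → Pointwise (λ C B → length B ≤ L * length C) Cs Bs →
    All (λ B → length B ≡ n) Bs → n ≡ L * m → 0 < L → All (λ C → m ≤ length C) Cs
  all-side [] [] e p = []
  all-side {L = L} (h ∷ hs) (q ∷ qs) e p = *-cancelˡ-≤ L {{ℕ.>-nonZero p}} (subst (_≤ _) (trans q e) h) ∷ all-side hs qs e p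

  -- a sub-box of lower density is thinned to side σ L^k, and the density numerator drops by one
  decrement : ∀ (f : List A → Bool) L σ k (Bs : List (List A)) → All (λ B → length B ≡ σ * L ^ k) Bs → k ≤ L → 0 < L →
    L * count f Bs ≤ k * ⟪ Bs ⟫ →
    (∀ Bs′ j k′ → Bs′ ≼ Bs → All (λ B → length B ≡ σ * L ^ j) Bs′ → k′ ≤ L → L * count f Bs′ ≤ k′ * ⟪ Bs′ ⟫ →
      (∀ Cs → Cs ≼ Bs′ → k′ * ⟪ Cs ⟫ ≤ L * count f Cs + 2 * ⟪ Bs′ ⟫) → ⊥) → ⊥
  decrement f L σ zero Bs len k≤L L>0 up κ = κ Bs 0 0 ≼-refl len z≤n up (λ Cs s → z≤n)
  decrement f L σ (suc k) Bs len k≤L L>0 up κ = κ Bs (suc k) (suc k) ≼-refl len k≤L up low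
    where
    low : ∀ Cs → Cs ≼ Bs → suc k * ⟪ Cs ⟫ ≤ L * count f Cs + 2 * ⟪ Bs ⟫
    -- The bound is decidable at the one given `Cs`. If it fails, `Cs` keeps more than one part in
    -- `L` of the volume and has density at most `k / L`, so a thinned copy of it can start the next
    -- round.
    low Cs s with suc k * ⟪ Cs ⟫ ≤? L * count f Cs + 2 * ⟪ Bs ⟫
    ... | yes p = p
    ... | no ¬p = ⊥-elim (decrement f L σ k Ds lenD (≤-trans (n≤1+n k) k≤L) L>0 upD
                    (λ Bs′ j k′ t → κ Bs′ j k′ (≼-trans t (≼-trans s′ s))))
      where
      open ≤-Reasoning
      big : L * count f Cs + 2 * ⟪ Bs ⟫ < suc k * ⟪ Cs ⟫
      big = ≰⇒> ¬p
      vol : ⟪ Bs ⟫ < L * ⟪ Cs ⟫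
      vol = begin-strict
        ⟪ Bs ⟫ ≤⟨ m≤m+n _ _ ⟩
        2 * ⟪ Bs ⟫ ≤⟨ m≤n+m _ (L * count f Cs) ⟩
        L * count f Cs + 2 * ⟪ Bs ⟫ <⟨ big ⟩
        suc k * ⟪ Cs ⟫ ≤⟨ *-monoˡ-≤ ⟪ Cs ⟫ k≤L ⟩
        L * ⟪ Cs ⟫ ∎
      lem : ∀ a b c → a * (b * c) ≡ b * (a * c)
      lem = solve-∀
      thinned = thin-box (𝟙 ∘ f) (σ * L ^ k) Cs (all-side (sides-large L s vol) len (lem σ L (L ^ k)) L>0)
      Ds = proj₁ thinned
      s′ = proj₁ (proj₂ thinned)
      lenD = proj₁ (proj₂ (proj₂ thinned))
      -- The slack `2 * ⟪ Bs ⟫` exceeds the single `⟪ Cs ⟫` by which the numerator drops from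
      -- `suc k` to `k`.
      light : L * count f Cs ≤ k * ⟪ Cs ⟫
      light = +-cancelʳ-≤ (2 * ⟪ Bs ⟫) _ _ (begin
        L * count f Cs + 2 * ⟪ Bs ⟫ ≤⟨ <⇒≤ big ⟩
        ⟪ Cs ⟫ + k * ⟪ Cs ⟫ ≡⟨ +-comm ⟪ Cs ⟫ _ ⟩
        k * ⟪ Cs ⟫ + ⟪ Cs ⟫ ≤⟨ +-monoʳ-≤ (k * ⟪ Cs ⟫) (≤-trans (vol-≼ s) (m≤m+n _ _)) ⟩
        k * ⟪ Cs ⟫ + 2 * ⟪ Bs ⟫ ∎)
      C>0 : 0 < ⟪ Cs ⟫
      C>0 = pos ⟪ Cs ⟫ vol
        where pos : ∀ n → ⟪ Bs ⟫ < L * n → 0 < n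
              pos zero h = contradiction (subst (⟪ Bs ⟫ <_) (*-zeroʳ L) h) λ ()
              pos (suc n) _ = s≤s z≤n
      upD : L * count f Ds ≤ k * ⟪ Ds ⟫
      upD = *-cancelˡ-≤ ⟪ Cs ⟫ {{ℕ.>-nonZero C>0}} (begin
        ⟪ Cs ⟫ * (L * count f Ds) ≡⟨ lem ⟪ Cs ⟫ L _ ⟩
        L * (⟪ Cs ⟫ * count f Ds) ≤⟨ *-monoʳ-≤ L (proj₂ (proj₂ (proj₂ thinned))) ⟩
        L * (⟪ Ds ⟫ * count f Cs) ≡⟨ lem L ⟪ Ds ⟫ _ ⟩
        ⟪ Ds ⟫ * (L * count f Cs) ≤⟨ *-monoʳ-≤ ⟪ Ds ⟫ light ⟩
        ⟪ Ds ⟫ * (k * ⟪ Cs ⟫) ≡⟨ lem′ ⟪ Ds ⟫ k ⟪ Cs ⟫ ⟩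
        ⟪ Cs ⟫ * (k * ⟪ Ds ⟫) ∎)
        where lem′ : ∀ a b c → a * (b * c) ≡ c * (b * a)
              lem′ = solve-∀

  split-⊆ : ∀ {C B : List A} → C ⊆ B → ∃[ D ] (D ⊆ B × ∀ (g : A → ℕ) → ∑ B g ≡ ∑ C g + ∑ D g)
  split-⊆ [] = [] , [] , λ g → refl
  split-⊆ (_∷ʳ_ {C} y p) with split-⊆ p
  ... | D , s , e = y ∷ D , refl ∷ s , λ g → trans (cong (g y +_) (e g)) (lem (g y) (∑ C g) (∑ D g))
    where lem : ∀ a b c → a + (b + c) ≡ b + (a + c)
          lem = solve-∀
  split-⊆ (_∷_ {y} {C} refl p) with split-⊆ p
  ... | D , s , e = D , y ∷ʳ s , λ g → trans (cong (g y +_) (e g)) (sym (+-assoc (g y) (∑ C g) (∑ D g)))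

  ∑-split-side : ∀ (pre : List (List A)) {C D B} Bs → (∀ (g : A → ℕ) → ∑ B g ≡ ∑ C g + ∑ D g) → ∀ F →
    ∑ (tuples (pre ++ B ∷ Bs)) F ≡ ∑ (tuples (pre ++ C ∷ Bs)) F + ∑ (tuples (pre ++ D ∷ Bs)) F
  ∑-split-side [] {C} {D} {B} Bs e F = trans (∑-tuples B Bs F) (trans (e _) (sym (cong₂ _+_ (∑-tuples C Bs F) (∑-tuples D Bs F))))
  ∑-split-side (P ∷ pre) {C} {D} {B} Bs e F = trans (∑-tuples P (pre ++ B ∷ Bs) F)
    (trans (∑-cong P λ v → ∑-split-side pre Bs e (λ x → F (v ∷ x)))
    (trans (∑-+ P _ _) (sym (cong₂ _+_ (∑-tuples P (pre ++ C ∷ Bs) F) (∑-tuples P (pre ++ D ∷ Bs) F)))))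

  -- swapping the sides of Bs for those of Cs one at a time, the lower bound on each discarded box gives the upper bound
  upper : ∀ (f : List A → Bool) L k S (Full : List (List A)) →
    (∀ Cs → Cs ≼ Full → k * ⟪ Cs ⟫ ≤ L * count f Cs + 2 * S) →
    ∀ pre Bs e → pre ++ Bs ≼ Full → L * count f (pre ++ Bs) ≤ k * ⟪ pre ++ Bs ⟫ + e →
    ∀ Cs → Cs ≼ Bs → L * count f (pre ++ Cs) ≤ k * ⟪ pre ++ Cs ⟫ + (e + length Bs * (2 * S))
  upper f L k S Full low pre [] e s h [] [] = subst (λ t → L * count f (pre ++ []) ≤ k * ⟪ pre ++ [] ⟫ + t) (sym (+-identityʳ e)) h
  upper f L k S Full low pre (B ∷ Bs) e s h (C ∷ Cs) (t ∷ ts) with split-⊆ t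
  ... | D , D⊆B , eq = subst₂ (λ X n → L * count f X ≤ k * ⟪ X ⟫ + n) (++-assoc pre (C ∷ []) Cs) (lem₃ e (2 * S) (length Bs * (2 * S)))
      (upper f L k S Full low (pre ++ C ∷ []) Bs (e + 2 * S)
        (subst (_≼ Full) (sym (++-assoc pre (C ∷ []) Bs)) (≼-trans (Pw.++⁺ ≼-refl (t ∷ ≼-refl)) s))
        (subst (λ X → L * count f X ≤ k * ⟪ X ⟫ + (e + 2 * S)) (sym (++-assoc pre (C ∷ []) Bs)) step) Cs ts)
    where
    open ≤-Reasoning
    X = pre ++ C ∷ Bs
    Y = pre ++ D ∷ Bs
    lem₃ : ∀ a b c → a + b + c ≡ a + (b + c)
    lem₃ = solve-∀
    vol : ⟪ pre ++ B ∷ Bs ⟫ ≡ ⟪ X ⟫ + ⟪ Y ⟫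
    vol = trans (length-∑ (tuples (pre ++ B ∷ Bs))) (trans (∑-split-side pre Bs eq (λ _ → 1))
            (sym (cong₂ _+_ (length-∑ (tuples X)) (length-∑ (tuples Y)))))
    step : L * count f X ≤ k * ⟪ X ⟫ + (e + 2 * S)
    step = +-cancelʳ-≤ (k * ⟪ Y ⟫) _ _ (begin
      L * count f X + k * ⟪ Y ⟫ ≤⟨ +-monoʳ-≤ (L * count f X) (low Y (≼-trans (Pw.++⁺ ≼-refl (D⊆B ∷ ≼-refl)) s)) ⟩
      L * count f X + (L * count f Y + 2 * S) ≡⟨ lem₁ L (count f X) (count f Y) (2 * S) ⟩
      L * (count f X + count f Y) + 2 * S ≡⟨ cong (λ t → L * t + 2 * S) (sym (∑-split-side pre Bs eq (𝟙 ∘ f))) ⟩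
      L * count f (pre ++ B ∷ Bs) + 2 * S ≤⟨ +-monoˡ-≤ (2 * S) h ⟩
      k * ⟪ pre ++ B ∷ Bs ⟫ + e + 2 * S ≡⟨ cong (λ t → k * t + e + 2 * S) vol ⟩
      k * (⟪ X ⟫ + ⟪ Y ⟫) + e + 2 * S ≡⟨ lem₂ k ⟪ X ⟫ ⟪ Y ⟫ e (2 * S) ⟩
      k * ⟪ X ⟫ + (e + 2 * S) + k * ⟪ Y ⟫ ∎)
      where
      lem₁ : ∀ L x y s → L * x + (L * y + s) ≡ L * (x + y) + s
      lem₁ = solve-∀
      lem₂ : ∀ k x y e s → k * (x + y) + e + s ≡ k * x + (e + s) + k * y
      lem₂ = solve-∀

div-floor : ∀ k g → 0 < g → ∃[ q ] (q * g ≤ k × k ≤ q * g + g)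
div-floor zero g h = 0 , z≤n , z≤n
div-floor (suc k) g h with div-floor k g h
... | q , p , p′ with suc k ≤? q * g + g
... | yes r = q , ≤-trans p (n≤1+n k) , r
... | no r = suc q , ≤-trans (≤-reflexive (+-comm g (q * g))) (<⇒≤ (≰⇒> r)) ,
             ≤-trans (+-mono-≤ h p′) (≤-reflexive (trans (cong (g +_) (+-comm (q * g) g)) (lem g q)))
  where lem : ∀ g q → g + (g + q * g) ≡ g + q * g + g
        lem = solve-∀

-- Density `k / ℓ` on every sub-box, up to an error of `2 / ℓ` of the volume of the whole box.
-- Sub-boxes of small relative volume are therefore unconstrained; this weak form is what the
-- decrement yields and what telescoping uses.
Regular : ℕ → (List A → Bool) → List (List A) → Set
Regular ℓ f Bs = ∃[ k ] (k ≤ ℓ × (∀ Cs → Cs ≼ Bs → k * ⟪ Cs ⟫ ≤ ℓ * count f Cs + 2 * ⟪ Bs ⟫)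
                               × (∀ Cs → Cs ≼ Bs → ℓ * count f Cs ≤ k * ⟪ Cs ⟫ + 2 * ⟪ Bs ⟫))

module Regularity (ℓ T : ℕ) (ℓ>0 : 0 < ℓ) where

  private
    fineness : ℕ → ℕ
    fineness R = (2 + T * 2) * R ^ T

    scale : ℕ → ℕ
    scale R = ℓ * fineness R

  -- Later functions shrink the box by at most R, so an earlier function must be regular at a scale finer by (2 + 2 T) R^T.
  shrinkage : ℕ → ℕ
  shrinkage zero = 1
  shrinkage (suc j) = shrinkage j * scale (shrinkage j) ^ scale (shrinkage j)

  private
    shrinkage>0 : ∀ j → 0 < shrinkage j
    fineness>0 : ∀ j → 0 < fineness (shrinkage j)
    scale>0 : ∀ j → 0 < scale (shrinkage j)

    shrinkage>0 zero = s≤s z≤n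
    shrinkage>0 (suc j) = *-mono-≤ (shrinkage>0 j) (m^n>0 (scale (shrinkage j)) {{ℕ.>-nonZero (scale>0 j)}} (scale (shrinkage j)))
    fineness>0 j = *-mono-≤ {1} {2 + T * 2} (s≤s z≤n) (m^n>0 (shrinkage j) {{ℕ.>-nonZero (shrinkage>0 j)}} T)
    scale>0 j = *-mono-≤ ℓ>0 (fineness>0 j)

  shrinkage-positive : ∀ j → 0 < shrinkage j
  shrinkage-positive = shrinkage>0

  -- The head is made regular at the fine scale `L` before the recursion treats the tail. The
  -- recursion shrinks each side by at most `R`, so the error for the head, measured against the
  -- smaller box, is still of order `1 / ℓ`. Sides are kept as multiples of `σ`, so that the later
  -- shrinkages divide them exactly.
  regularise : ∀ (fs : List (List A → Bool)) σ (Bs : List (List A)) → length Bs ≡ T →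
    All (λ B → length B ≡ σ * shrinkage (length fs)) Bs →
    (∀ Bs′ w → Bs′ ≼ Bs → 0 < w → All (λ B → length B ≡ σ * w) Bs′ → All (λ f → Regular ℓ f Bs′) fs → ⊥) → ⊥
  regularise [] σ Bs T≡ len κ = κ Bs 1 ≼-refl (s≤s z≤n) len []
  regularise {A} (f ∷ fs) σ Bs T≡ len κ =
    decrement f L (σ * R) L Bs (All.map (λ e → trans e (sym (*-assoc σ R (L ^ L)))) len) ≤-refl (scale>0 j)
      (*-monoʳ-≤ L (count≤vol f Bs)) first
    where
    j = length fs
    R = shrinkage j
    g = fineness R
    L = scale R
    first : ∀ Bs₁ i k₁ → Bs₁ ≼ Bs → All (λ B → length B ≡ σ * R * L ^ i) Bs₁ → k₁ ≤ L → L * count f Bs₁ ≤ k₁ * ⟪ Bs₁ ⟫ →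
      (∀ Cs → Cs ≼ Bs₁ → k₁ * ⟪ Cs ⟫ ≤ L * count f Cs + 2 * ⟪ Bs₁ ⟫) → ⊥
    first Bs₁ i k₁ s₁ len₁ k₁≤L up₁ low₁ =
      regularise fs (σ * w) Bs₁ T₁ (All.map (λ e → trans e (lem σ R w)) len₁) second
      where
      open ≤-Reasoning
      w = L ^ i
      w>0 : 0 < w
      w>0 = m^n>0 L {{ℕ.>-nonZero (scale>0 j)}} i
      lem : ∀ a b c → a * b * c ≡ a * c * b
      lem = solve-∀
      T₁ : length Bs₁ ≡ T
      T₁ = trans (Pw.Pointwise-length s₁) T≡
      second : ∀ Bs₂ w₂ → Bs₂ ≼ Bs₁ → 0 < w₂ → All (λ B → length B ≡ σ * w * w₂) Bs₂ → All (λ f → Regular ℓ f Bs₂) fs → ⊥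
      second Bs₂ w₂ s₂ w₂>0 len₂ regs = κ Bs₂ (w * w₂) (≼-trans s₂ s₁) (*-mono-≤ w>0 w₂>0)
          (All.map (λ e → trans e (*-assoc σ w w₂)) len₂) ((k , k≤ℓ , low , up) ∷ regs)
        where
        T₂ : length Bs₂ ≡ T
        T₂ = trans (Pw.Pointwise-length s₂) T₁
        vol : (2 + T * 2) * ⟪ Bs₁ ⟫ ≤ g * ⟪ Bs₂ ⟫
        vol = begin
          (2 + T * 2) * ⟪ Bs₁ ⟫ ≡⟨ cong ((2 + T * 2) *_) (trans (vol-^ Bs₁ len₁) (cong ((σ * R * w) ^_) T₁)) ⟩
          (2 + T * 2) * (σ * R * w) ^ T ≤⟨ *-monoʳ-≤ (2 + T * 2) (^-monoˡ-≤ T sides) ⟩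
          (2 + T * 2) * (R * (σ * w * w₂)) ^ T ≡⟨ cong ((2 + T * 2) *_) (^-* T R (σ * w * w₂)) ⟩
          (2 + T * 2) * (R ^ T * (σ * w * w₂) ^ T) ≡⟨ sym (*-assoc (2 + T * 2) (R ^ T) ((σ * w * w₂) ^ T)) ⟩
          g * (σ * w * w₂) ^ T ≡⟨ cong (g *_) (sym (trans (vol-^ Bs₂ len₂) (cong ((σ * w * w₂) ^_) T₂))) ⟩
          g * ⟪ Bs₂ ⟫ ∎
          where
          sides : σ * R * w ≤ R * (σ * w * w₂)
          sides = begin
            σ * R * w ≡⟨ lem′ σ R w ⟩
            R * (σ * w * 1) ≤⟨ *-monoʳ-≤ R (*-monoʳ-≤ (σ * w) w₂>0) ⟩
            R * (σ * w * w₂) ∎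
            where lem′ : ∀ a b c → a * b * c ≡ b * (a * c * 1)
                  lem′ = solve-∀
        -- `L` is `ℓ * g`, so `k₁ / L` is rounded down to `k / ℓ`. The rounding error is at most
        -- `1 / ℓ`, which is why `up` spends one copy of `⟪ Bs₂ ⟫` on it and the other on the error
        -- inherited from `Bs₁`.
        floored = div-floor k₁ g (fineness>0 j)
        k = proj₁ floored
        kg≤ = proj₁ (proj₂ floored)
        ≤kg = proj₂ (proj₂ floored)
        instance _ = ℕ.>-nonZero (fineness>0 j)
        k≤ℓ : k ≤ ℓ
        k≤ℓ = *-cancelʳ-≤ k ℓ g (≤-trans kg≤ k₁≤L)
        lem₁ : ∀ a b c → a * (b * c) ≡ b * a * c
        lem₁ = solve-∀
        low : ∀ Cs → Cs ≼ Bs₂ → k * ⟪ Cs ⟫ ≤ ℓ * count f Cs + 2 * ⟪ Bs₂ ⟫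
        low Cs s = *-cancelˡ-≤ g (begin
          g * (k * ⟪ Cs ⟫) ≡⟨ lem₁ g k ⟪ Cs ⟫ ⟩
          k * g * ⟪ Cs ⟫ ≤⟨ *-monoˡ-≤ ⟪ Cs ⟫ kg≤ ⟩
          k₁ * ⟪ Cs ⟫ ≤⟨ low₁ Cs (≼-trans s s₂) ⟩
          L * count f Cs + 2 * ⟪ Bs₁ ⟫ ≤⟨ +-monoʳ-≤ (L * count f Cs) (≤-trans (*-monoˡ-≤ ⟪ Bs₁ ⟫ (m≤m+n 2 (T * 2))) vol) ⟩
          L * count f Cs + g * ⟪ Bs₂ ⟫ ≤⟨ +-monoʳ-≤ (L * count f Cs) (*-monoʳ-≤ g (m≤m+n ⟪ Bs₂ ⟫ _)) ⟩
          L * count f Cs + g * (2 * ⟪ Bs₂ ⟫) ≡⟨ lem₂ ℓ g (count f Cs) (2 * ⟪ Bs₂ ⟫) ⟩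
          g * (ℓ * count f Cs + 2 * ⟪ Bs₂ ⟫) ∎)
          where lem₂ : ∀ l g c b → l * g * c + g * b ≡ g * (l * c + b)
                lem₂ = solve-∀
        up : ∀ Cs → Cs ≼ Bs₂ → ℓ * count f Cs ≤ k * ⟪ Cs ⟫ + 2 * ⟪ Bs₂ ⟫
        up Cs s = *-cancelˡ-≤ g (begin
          g * (ℓ * count f Cs) ≡⟨ lem₁ g ℓ (count f Cs) ⟩
          L * count f Cs ≤⟨ upper f L k₁ ⟪ Bs₁ ⟫ Bs₁ low₁ [] Bs₁ 0 ≼-refl (≤-trans up₁ (m≤m+n _ 0)) Cs (≼-trans s s₂) ⟩
          k₁ * ⟪ Cs ⟫ + length Bs₁ * (2 * ⟪ Bs₁ ⟫) ≡⟨ cong (λ t → k₁ * ⟪ Cs ⟫ + t * (2 * ⟪ Bs₁ ⟫)) T₁ ⟩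
          k₁ * ⟪ Cs ⟫ + T * (2 * ⟪ Bs₁ ⟫) ≡⟨ cong (k₁ * ⟪ Cs ⟫ +_) (sym (*-assoc T 2 ⟪ Bs₁ ⟫)) ⟩
          k₁ * ⟪ Cs ⟫ + T * 2 * ⟪ Bs₁ ⟫ ≤⟨ +-mono-≤ (*-monoˡ-≤ ⟪ Cs ⟫ ≤kg) (≤-trans (*-monoˡ-≤ ⟪ Bs₁ ⟫ (m≤n+m (T * 2) 2)) vol) ⟩
          (k * g + g) * ⟪ Cs ⟫ + g * ⟪ Bs₂ ⟫ ≡⟨ lem₃ k g ⟪ Cs ⟫ ⟪ Bs₂ ⟫ ⟩
          g * (k * ⟪ Cs ⟫ + (⟪ Cs ⟫ + ⟪ Bs₂ ⟫)) ≤⟨ *-monoʳ-≤ g (+-monoʳ-≤ (k * ⟪ Cs ⟫) (+-monoˡ-≤ ⟪ Bs₂ ⟫ (vol-≼ s))) ⟩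
          g * (k * ⟪ Cs ⟫ + (⟪ Bs₂ ⟫ + ⟪ Bs₂ ⟫)) ≡⟨ cong (λ t → g * (k * ⟪ Cs ⟫ + (⟪ Bs₂ ⟫ + t))) (sym (+-identityʳ ⟪ Bs₂ ⟫)) ⟩
          g * (k * ⟪ Cs ⟫ + 2 * ⟪ Bs₂ ⟫) ∎)
          where lem₃ : ∀ k g c b → (k * g + g) * c + g * b ≡ g * (k * c + (c + b))
                lem₃ = solve-∀

-- Combinations, subsets and edge counts

combos : ℕ → List A → List (List A)
combos zero xs = [] ∷ []
combos (suc k) [] = []
combos (suc k) (x ∷ xs) = map (x ∷_) (combos k xs) ++ combos (suc k) xs

∑-combos-∷ : ∀ k x (xs : List A) (g : List A → ℕ) →
  ∑ (combos (suc k) (x ∷ xs)) g ≡ ∑ (combos k xs) (g ∘ (x ∷_)) + ∑ (combos (suc k) xs) g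
∑-combos-∷ k x xs g = trans (∑-++ (map (x ∷_) (combos k xs)) _ g) (cong (_+ ∑ (combos (suc k) xs) g) (∑-map (x ∷_) (combos k xs) g))

∑-combos-map : ∀ {A A′ : Set} (f : A → A′) k xs (g : List A′ → ℕ) → ∑ (combos k (map f xs)) g ≡ ∑ (combos k xs) (g ∘ map f)
∑-combos-map f zero xs g = refl
∑-combos-map f (suc k) [] g = refl
∑-combos-map f (suc k) (x ∷ xs) g = trans (∑-combos-∷ k (f x) (map f xs) g)
  (trans (cong₂ _+_ (∑-combos-map f k xs _) (∑-combos-map f (suc k) xs g)) (sym (∑-combos-∷ k x xs (g ∘ map f))))

∈-combos : ∀ k (xs : List A) {Z} → Z ∈ combos k xs → Z ⊆ xs × length Z ≡ k
∈-combos zero xs (here refl) = Sub.minimum xs , refl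
∈-combos (suc k) (x ∷ xs) Z∈ with ∈ₚ.∈-++⁻ (map (x ∷_) (combos k xs)) Z∈
... | inj₂ q = let s , l = ∈-combos (suc k) xs q in x ∷ʳ s , l
... | inj₁ q with ∈ₚ.∈-map⁻ (x ∷_) q
... | Y , Y∈ , refl = let s , l = ∈-combos k xs Y∈ in refl ∷ s , cong suc l

length-combos : ∀ k (xs : List A) → length (combos k xs) ≡ length xs choose k
length-combos zero xs = refl
length-combos (suc k) [] = refl
length-combos (suc k) (x ∷ xs) = trans (length-++ (map (x ∷_) (combos k xs)))
  (trans (cong₂ _+_ (trans (length-map _ (combos k xs)) (length-combos k xs)) (length-combos (suc k) xs))
         (nCk+nC[k+1]≡[n+1]C[k+1] (length xs) k))

combos-mono : ∀ k {xs ys : List A} (g : List A → ℕ) → xs ⊆ ys → ∑ (combos k xs) g ≤ ∑ (combos k ys) g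
combos-mono zero g s = ≤-refl
combos-mono (suc k) g [] = ≤-refl
combos-mono (suc k) g (_∷ʳ_ {_} {ys} y s) = ≤-trans (combos-mono (suc k) g s)
  (≤-trans (m≤n+m _ _) (≤-reflexive (sym (∑-combos-∷ k y ys g))))
combos-mono (suc k) g (_∷_ {x} {xs} {_} {ys} refl s) = subst₂ _≤_ (sym (∑-combos-∷ k x xs g)) (sym (∑-combos-∷ k x ys g))
  (+-mono-≤ (combos-mono k (g ∘ (x ∷_)) s) (combos-mono (suc k) g s))

crossing : ℕ → List (List A) → (List A → ℕ) → ℕ
crossing zero Bs g = g []
crossing (suc k) [] g = 0
crossing (suc k) (B ∷ Bs) g = ∑ B (λ v → crossing k Bs (g ∘ (v ∷_))) + crossing (suc k) Bs g

crossing-≤-combos : ∀ k (Bs : List (List A)) g → crossing k Bs g ≤ ∑ (combos k (concat Bs)) g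
crossing-≤-combos zero Bs g = m≤m+n _ 0
crossing-≤-combos (suc k) [] g = ≤-refl
crossing-≤-combos (suc k) (B ∷ Bs) g = ≤-trans
  (+-mono-≤ (∑-mono B λ v → crossing-≤-combos k Bs (g ∘ (v ∷_))) (crossing-≤-combos (suc k) Bs g)) (prepend B)
  where
  L = concat Bs
  prepend : ∀ B → ∑ B (λ v → ∑ (combos k L) (g ∘ (v ∷_))) + ∑ (combos (suc k) L) g ≤ ∑ (combos (suc k) (B ++ L)) g
  prepend [] = ≤-refl
  prepend (v ∷ B) = begin
    ∑ (combos k L) (g ∘ (v ∷_)) + ∑ B (λ v → ∑ (combos k L) (g ∘ (v ∷_))) + ∑ (combos (suc k) L) g ≡⟨ +-assoc (∑ (combos k L) (g ∘ (v ∷_))) _ _ ⟩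
    ∑ (combos k L) (g ∘ (v ∷_)) + (∑ B (λ v → ∑ (combos k L) (g ∘ (v ∷_))) + ∑ (combos (suc k) L) g)
      ≤⟨ +-mono-≤ (combos-mono k (g ∘ (v ∷_)) (Subₚ.++⁺ (Sub.minimum B) ⊆-refl)) (prepend B) ⟩
    ∑ (combos k (B ++ L)) (g ∘ (v ∷_)) + ∑ (combos (suc k) (B ++ L)) g ≡⟨ sym (∑-combos-∷ k v (B ++ L) g) ⟩
    ∑ (combos (suc k) (v ∷ B ++ L)) g ∎
    where open ≤-Reasoning

-- Each way of taking one vertex from each of `k` sides is contained in the same proportion
-- `1 / s ^ k` of the tuples of the box.
crossing-average : ∀ s k (Bs : List (List A)) g → All (λ B → length B ≡ s) Bs →
  ∑ (tuples Bs) (λ x → ∑ (combos k x) g) * s ^ k ≡ s ^ length Bs * crossing k Bs g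
crossing-average s zero Bs g h = begin
  ∑ (tuples Bs) (λ x → g [] + 0) * 1 ≡⟨ *-identityʳ _ ⟩
  ∑ (tuples Bs) (λ x → g [] + 0) ≡⟨ ∑-const (tuples Bs) _ ⟩
  ⟪ Bs ⟫ * (g [] + 0) ≡⟨ cong₂ _*_ (vol-^ Bs h) (+-identityʳ (g [])) ⟩
  s ^ length Bs * g [] ∎
  where open ≡-Reasoning
crossing-average s (suc k) [] g [] = refl
crossing-average s (suc k) (B ∷ Bs) g (refl ∷ h) = begin
  ∑ (tuples (B ∷ Bs)) (λ x → ∑ (combos (suc k) x) g) * (s * s ^ k)
    ≡⟨ cong (_* (s * s ^ k)) (trans (∑-tuples B Bs _) (∑-cong B λ v → trans (∑-cong (tuples Bs) λ x → ∑-combos-∷ k v x g) (∑-+ (tuples Bs) (λ x → ∑ (combos k x) (g ∘ (v ∷_))) (λ x → ∑ (combos (suc k) x) g)))) ⟩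
  ∑ B (λ v → ∑ (tuples Bs) (λ x → ∑ (combos k x) (g ∘ (v ∷_))) + Y) * (s * s ^ k)
    ≡⟨ cong (_* (s * s ^ k)) (trans (∑-+ B (λ v → ∑ (tuples Bs) (λ x → ∑ (combos k x) (g ∘ (v ∷_)))) (λ _ → Y)) (cong (X +_) (∑-const B Y))) ⟩
  (∑ B (λ v → ∑ (tuples Bs) (λ x → ∑ (combos k x) (g ∘ (v ∷_)))) + s * Y) * (s * s ^ k) ≡⟨ lem₁ X s Y (s ^ k) ⟩
  s * (∑ B (λ v → ∑ (tuples Bs) (λ x → ∑ (combos k x) (g ∘ (v ∷_)))) * s ^ k) + s * (Y * (s * s ^ k))
    ≡⟨ cong₂ (λ a b → s * a + s * b) (trans (sym (∑-*ʳ B (s ^ k) _)) (trans (∑-cong B λ v → crossing-average s k Bs (g ∘ (v ∷_)) h) (∑-* B (s ^ length Bs) _)))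
          (crossing-average s (suc k) Bs g h) ⟩
  s * (s ^ length Bs * ∑ B (λ v → crossing k Bs (g ∘ (v ∷_)))) + s * (s ^ length Bs * crossing (suc k) Bs g) ≡⟨ lem₂ s (s ^ length Bs) (∑ B (λ v → crossing k Bs (g ∘ (v ∷_)))) (crossing (suc k) Bs g) ⟩
  s * s ^ length Bs * (∑ B (λ v → crossing k Bs (g ∘ (v ∷_))) + crossing (suc k) Bs g) ∎
  where
  open ≡-Reasoning
  X = ∑ B (λ v → ∑ (tuples Bs) (λ x → ∑ (combos k x) (g ∘ (v ∷_))))
  Y = ∑ (tuples Bs) (λ x → ∑ (combos (suc k) x) g)
  lem₁ : ∀ x s y p → (x + s * y) * (s * p) ≡ s * (x * p) + s * (y * (s * p))
  lem₁ = solve-∀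
  lem₂ : ∀ s p a b → s * (p * a) + s * (p * b) ≡ s * p * (a + b)
  lem₂ = solve-∀

Increasing : List ℕ → Set
Increasing = AllPairs _<_

private
  unshift-all : ∀ {is : List ℕ} → All (0 <_) is → Increasing is → ∃[ js ] (is ≡ map suc js × Increasing js)
  unshift-all [] [] = [] , refl , []
  unshift-all {suc i ∷ is} (_ ∷ p) (q ∷ h) with unshift-all p h
  ... | js , refl , h′ = i ∷ js , refl , All.map ≤-pred (Allₚ.map⁻ q) ∷ h′

-- The recursion principle for increasing index lists: either 0 is skipped or it comes first, and
-- the remaining indices are shifted down to address the tail.
unshift : ∀ {is} → Increasing is → (∃[ js ] (is ≡ map suc js × Increasing js)) ⊎ (∃[ js ] (is ≡ 0 ∷ map suc js × Increasing js))
unshift [] = inj₁ ([] , refl , [])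
unshift {zero ∷ is} (q ∷ h) with unshift-all q h
... | js , refl , h′ = inj₂ (js , refl , h′)
unshift {suc i ∷ is} (q ∷ h) with unshift-all (s≤s z≤n ∷ All.map (≤-trans (s≤s z≤n)) q) (q ∷ h)
... | js , e , h′ = inj₁ (js , e , h′)

-- The projection of a uniform tuple to distinct coordinates is uniform: a side that is not
-- projected to contributes a bare factor `s`. The powers of `s` stand on both sides to avoid a
-- quotient.
∑-marginal : ∀ (d : A) s (Bs : List (List A)) → All (λ B → length B ≡ s) Bs → ∀ is → Increasing is → All (_< length Bs) is → ∀ g →
  ∑ (tuples Bs) (λ x → g (map (nth d x) is)) * s ^ length is ≡ s ^ length Bs * ∑ (tuples (map (nth [] Bs) is)) g
∑-marginal d s [] [] [] _ _ g = *-comm (g [] + 0) 1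
∑-marginal d s [] [] (i ∷ is) _ (() ∷ _) g
∑-marginal d s (B ∷ Bs) (refl ∷ h) is inc bd g with unshift inc
... | inj₁ (js , refl , inc′) = begin
  ∑ (tuples (B ∷ Bs)) (λ x → g (map (nth d x) (map suc js))) * s ^ length (map suc js)
    ≡⟨ cong₂ _*_ (trans (∑-tuples B Bs _) (trans (∑-cong B λ v → ∑-cong (tuples Bs) λ x → cong g (sym (map-∘ js))) (∑-const B _))) (cong (s ^_) (length-map suc js)) ⟩
  s * ∑ (tuples Bs) (λ x → g (map (nth d x) js)) * s ^ length js ≡⟨ *-assoc s _ _ ⟩
  s * (∑ (tuples Bs) (λ x → g (map (nth d x) js)) * s ^ length js)
    ≡⟨ cong (s *_) (∑-marginal d s Bs h js inc′ (All.map ≤-pred (Allₚ.map⁻ bd)) g) ⟩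
  s * (s ^ length Bs * ∑ (tuples (map (nth [] Bs) js)) g) ≡⟨ sym (*-assoc s _ _) ⟩
  s * s ^ length Bs * ∑ (tuples (map (nth [] Bs) js)) g ≡⟨ cong (λ l → s * s ^ length Bs * ∑ (tuples l) g) (map-∘ js) ⟩
  s * s ^ length Bs * ∑ (tuples (map (nth [] (B ∷ Bs)) (map suc js))) g ∎
  where open ≡-Reasoning
... | inj₂ (js , refl , inc′) = begin
  ∑ (tuples (B ∷ Bs)) (λ x → g (map (nth d x) (0 ∷ map suc js))) * (s * s ^ length (map suc js))
    ≡⟨ cong₂ _*_ (trans (∑-tuples B Bs _) (∑-cong B λ v → ∑-cong (tuples Bs) λ x → cong (g ∘ (v ∷_)) (sym (map-∘ js)))) (cong (λ l → s * s ^ l) (length-map suc js)) ⟩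
  ∑ B (λ v → ∑ (tuples Bs) (λ x → g (v ∷ map (nth d x) js))) * (s * s ^ length js) ≡⟨ lem (∑ B (λ v → ∑ (tuples Bs) (λ x → g (v ∷ map (nth d x) js)))) s (s ^ length js) ⟩
  s * (∑ B (λ v → ∑ (tuples Bs) (λ x → g (v ∷ map (nth d x) js))) * s ^ length js)
    ≡⟨ cong (s *_) (trans (sym (∑-*ʳ B (s ^ length js) _)) (trans (∑-cong B λ v → ∑-marginal d s Bs h js inc′ (All.map ≤-pred (Allₚ.map⁻ (All.tail bd))) (g ∘ (v ∷_))) (∑-* B (s ^ length Bs) _))) ⟩
  s * (s ^ length Bs * ∑ B (λ v → ∑ (tuples (map (nth [] Bs) js)) (g ∘ (v ∷_)))) ≡⟨ sym (*-assoc s _ _) ⟩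
  s * s ^ length Bs * ∑ B (λ v → ∑ (tuples (map (nth [] Bs) js)) (g ∘ (v ∷_))) ≡⟨ cong (s * s ^ length Bs *_) (sym (∑-tuples B (map (nth [] Bs) js) g)) ⟩
  s * s ^ length Bs * ∑ (tuples (B ∷ map (nth [] Bs) js)) g ≡⟨ cong (λ l → s * s ^ length Bs * ∑ (tuples (B ∷ l)) g) (map-∘ js) ⟩
  s * s ^ length Bs * ∑ (tuples (map (nth [] (B ∷ Bs)) (0 ∷ map suc js))) g ∎
  where
  open ≡-Reasoning
  lem : ∀ x s p → x * (s * p) ≡ s * (x * p)
  lem = solve-∀

bool-iff : ∀ {a b} → (a ≡ true → b ≡ true) → (b ≡ true → a ≡ true) → a ≡ b
bool-iff {true} {b} f g = sym (f refl)
bool-iff {false} {true} f g = g refl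
bool-iff {false} {false} f g = refl

module _ {n : ℕ} where

  infix 6 _≡ᶠ_
  _≡ᶠ_ : Fin n → Fin n → Bool
  i ≡ᶠ j = does (i Finₚ.≟ j)

  ≡ᶠ-true : ∀ {i j} → (i ≡ᶠ j) ≡ true → i ≡ j
  ≡ᶠ-true {i} {j} h with i Finₚ.≟ j
  ... | yes p = p

  ≡ᶠ-refl : ∀ i → (i ≡ᶠ i) ≡ true
  ≡ᶠ-refl i = dec-true (i Finₚ.≟ i) refl

  fromList : List (Fin n) → Subset n
  fromList l = Vec.tabulate λ j → any l (_≡ᶠ j)

  fromList-cong : ∀ {l l′} → (∀ {v} → v ∈ l → v ∈ l′) → (∀ {v} → v ∈ l′ → v ∈ l) → fromList l ≡ fromList l′
  fromList-cong {l} {l′} f g = Vecₚ.tabulate-cong λ j → bool-iff (go l l′ f j) (go l′ l g j)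
    where
    go : ∀ l l′ → (∀ {v} → v ∈ l → v ∈ l′) → ∀ j → any l (_≡ᶠ j) ≡ true → any l′ (_≡ᶠ j) ≡ true
    go l l′ f j h = let v , v∈ , e = any-∈ l h in ∈-any (f v∈) e

  fromList-↭ : ∀ {l l′} → l ↭ l′ → fromList l ≡ fromList l′
  fromList-↭ p = fromList-cong (↭ₚ.∈-resp-↭ p) (↭ₚ.∈-resp-↭ (↭-sym p))

elems : ∀ {n} → Subset n → List (Fin n)
elems Vec.[] = []
elems (true Vec.∷ s) = fzero ∷ map fsuc (elems s)
elems (false Vec.∷ s) = map fsuc (elems s)

length-elems : ∀ {n} (s : Subset n) → length (elems s) ≡ ∣ s ∣
length-elems Vec.[] = refl
length-elems (true Vec.∷ s) = cong suc (trans (length-map fsuc (elems s)) (length-elems s))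
length-elems (false Vec.∷ s) = trans (length-map fsuc (elems s)) (length-elems s)

allFin-suc : ∀ n → allFin (suc n) ≡ fzero ∷ map fsuc (allFin n)
allFin-suc n = cong (fzero ∷_) (sym (map-tabulate id fsuc))

elems-⊆ : ∀ {n} (s : Subset n) → elems s ⊆ allFin n
elems-⊆ Vec.[] = []
elems-⊆ {suc n} (true Vec.∷ s) rewrite allFin-suc n = refl ∷ Subₚ.map⁺ fsuc (elems-⊆ s)
elems-⊆ {suc n} (false Vec.∷ s) rewrite allFin-suc n = fzero ∷ʳ Subₚ.map⁺ fsuc (elems-⊆ s)

any-map : ∀ {A A′ : Set} (f : A → A′) l (p : A′ → Bool) → any (map f l) p ≡ any l (p ∘ f)
any-map f [] p = refl
any-map f (x ∷ l) p = cong (p (f x) ∨_) (any-map f l p)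

any-false : ∀ (l : List A) → any l (λ _ → false) ≡ false
any-false [] = refl
any-false (x ∷ l) = any-false l

fromList-map-suc : ∀ {n} (l : List (Fin n)) → fromList (map fsuc l) ≡ false Vec.∷ fromList l
fromList-map-suc l = cong₂ Vec._∷_ (trans (any-map fsuc l _) (any-false l)) (Vecₚ.tabulate-cong λ j → any-map fsuc l _)

fromList-zero-suc : ∀ {n} (l : List (Fin n)) → fromList (fzero ∷ map fsuc l) ≡ true Vec.∷ fromList l
fromList-zero-suc l = cong (true Vec.∷_) (Vecₚ.tabulate-cong λ j → any-map fsuc l _)

unmap-⊆ : ∀ {A A′ : Set} (f : A → A′) {l xs} → l ⊆ map f xs → ∃[ l′ ] (l′ ⊆ xs × l ≡ map f l′)
unmap-⊆ f {xs = []} [] = [] , [] , refl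
unmap-⊆ f {xs = x ∷ xs} (_ ∷ʳ s) = let l′ , s′ , e = unmap-⊆ f s in l′ , x ∷ʳ s′ , e
unmap-⊆ f {xs = x ∷ xs} (refl ∷ s) = let l′ , s′ , e = unmap-⊆ f s in x ∷ l′ , refl ∷ s′ , cong (f x ∷_) e

elems-fromList : ∀ {n} {l : List (Fin n)} → l ⊆ allFin n → elems (fromList l) ≡ l
elems-fromList {zero} [] = refl
elems-fromList {suc n} {l} s with subst (l ⊆_) (allFin-suc n) s
... | _ ∷ʳ t with unmap-⊆ fsuc t
... | l′ , t′ , refl = trans (cong elems (fromList-map-suc l′)) (cong (map fsuc) (elems-fromList t′))
elems-fromList {suc n} {l} s | refl ∷ t with unmap-⊆ fsuc t
... | l′ , t′ , refl = trans (cong elems (fromList-zero-suc l′)) (cong (λ l → fzero ∷ map fsuc l) (elems-fromList t′))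

∑-elems : ∀ {n} (s : Subset n) (f : Fin n → ℕ) → ∑ (elems s) f ≡ ∑ (allFin n) (λ j → 𝟙 (Vec.lookup s j) * f j)
∑-elems Vec.[] f = refl
∑-elems {suc n} (b Vec.∷ s) f = trans (head b) (sym (∑-allFin-suc (λ j → 𝟙 (Vec.lookup (b Vec.∷ s) j) * f j)))
  where
  tail : ∑ (map fsuc (elems s)) f ≡ ∑ (allFin n) (λ j → 𝟙 (Vec.lookup s j) * f (fsuc j))
  tail = trans (∑-map fsuc (elems s) f) (∑-elems s (f ∘ fsuc))
  head : ∀ b → ∑ (elems (b Vec.∷ s)) f ≡ 𝟙 b * f fzero + ∑ (allFin n) (λ j → 𝟙 (Vec.lookup s j) * f (fsuc j))
  head true = cong₂ _+_ (sym (+-identityʳ (f fzero))) tail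
  head false = tail

𝟙-any-unique : ∀ {n} (l : List (Fin n)) → Unique l → ∀ j → 𝟙 (any l (_≡ᶠ j)) ≡ ∑ l (λ v → 𝟙 (v ≡ᶠ j))
𝟙-any-unique [] _ j = refl
𝟙-any-unique (v ∷ l) (v∉ ∷ u) j with v ≡ᶠ j in eq
... | false = 𝟙-any-unique l u j
... | true = cong suc (sym (trans (∑-cong∈ l (λ w w∈ → cong 𝟙 (neq w w∈))) (∑-0 l)))
  where neq : ∀ w → w ∈ l → (w ≡ᶠ j) ≡ false
        neq w w∈ = dec-false (w Finₚ.≟ j) λ { refl → All.lookup v∉ w∈ (≡ᶠ-true eq) }

∑-elems-fromList : ∀ {n} (l : List (Fin n)) → Unique l → ∀ f → ∑ (elems (fromList l)) f ≡ ∑ l f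
∑-elems-fromList {n} l u f = begin
  ∑ (elems (fromList l)) f ≡⟨ ∑-elems (fromList l) f ⟩
  ∑ (allFin n) (λ j → 𝟙 (Vec.lookup (fromList l) j) * f j)
    ≡⟨ ∑-cong (allFin n) (λ j → cong (_* f j) (trans (cong 𝟙 (Vecₚ.lookup∘tabulate (λ j → any l (_≡ᶠ j)) j)) (𝟙-any-unique l u j))) ⟩
  ∑ (allFin n) (λ j → ∑ l (λ v → 𝟙 (v ≡ᶠ j)) * f j) ≡⟨ ∑-cong (allFin n) (λ j → sym (∑-*ʳ l (f j) _)) ⟩
  ∑ (allFin n) (λ j → ∑ l (λ v → 𝟙 (v ≡ᶠ j) * f j)) ≡⟨ ∑-swap (allFin n) l _ ⟩
  ∑ l (λ v → ∑ (allFin n) (λ j → 𝟙 (v ≡ᶠ j) * f j)) ≡⟨ ∑-cong l (λ v → ∑-single v f) ⟩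
  ∑ l f ∎
  where open ≡-Reasoning

size-fromList : ∀ {n} (l : List (Fin n)) → Unique l → ∣ fromList l ∣ ≡ length l
size-fromList l u = begin
  ∣ fromList l ∣ ≡⟨ sym (length-elems (fromList l)) ⟩
  length (elems (fromList l)) ≡⟨ length-∑ (elems (fromList l)) ⟩
  ∑ (elems (fromList l)) (λ _ → 1) ≡⟨ ∑-elems-fromList l u _ ⟩
  ∑ l (λ _ → 1) ≡⟨ sym (length-∑ l) ⟩
  length l ∎
  where open ≡-Reasoning

anyFin-∃ : ∀ {m} (f : Fin m → Bool) → anyFin f ≡ true → ∃[ i ] f i ≡ true
anyFin-∃ {suc m} f h with f fzero in eq
... | true = fzero , eq
... | false = let i , e = anyFin-∃ (f ∘ fsuc) h in fsuc i , e

∃-anyFin : ∀ {m} (f : Fin m → Bool) i → f i ≡ true → anyFin f ≡ true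
∃-anyFin f fzero h rewrite h = refl
∃-anyFin f (fsuc i) h with f fzero
... | true = refl
... | false = ∃-anyFin (f ∘ fsuc) i h

image-fromList : ∀ {m n} (φ : Fin m → Fin n) l → image φ (fromList l) ≡ fromList (map φ l)
image-fromList φ l = Vecₚ.tabulate-cong λ j → bool-iff (to j) (from j)
  where
  to : ∀ j → anyFin (λ i → Vec.lookup (fromList l) i ∧ (φ i ≡ᶠ j)) ≡ true → any (map φ l) (_≡ᶠ j) ≡ true
  to j h with anyFin-∃ _ h
  ... | i , e with any-∈ l (trans (sym (Vecₚ.lookup∘tabulate (λ j → any l (_≡ᶠ j)) i)) (∧-trueˡ e))
  ... | v , v∈ , e′ = ∈-any (∈ₚ.∈-map⁺ φ v∈) (subst (λ w → (φ w ≡ᶠ j) ≡ true) (sym (≡ᶠ-true e′)) (∧-trueʳ {Vec.lookup (fromList l) i} e))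
  from : ∀ j → any (map φ l) (_≡ᶠ j) ≡ true → anyFin (λ i → Vec.lookup (fromList l) i ∧ (φ i ≡ᶠ j)) ≡ true
  from j h with any-∈ (map φ l) h
  ... | w , w∈ , e with ∈ₚ.∈-map⁻ φ w∈
  ... | v , v∈ , refl = ∃-anyFin _ v (∧-true (trans (Vecₚ.lookup∘tabulate (λ j → any l (_≡ᶠ j)) v) (∈-any v∈ (≡ᶠ-refl v))) e)

length-filterᵇ : ∀ (p : A → Bool) xs → length (filterᵇ p xs) ≡ ∑ xs (𝟙 ∘ p)
length-filterᵇ p [] = refl
length-filterᵇ p (x ∷ xs) with p x
... | true = cong suc (length-filterᵇ p xs)
... | false = length-filterᵇ p xs

-- Splitting the subsets by whether they contain the first vertex matches the recursion of `combos`.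
-- The hypothesis on sizes removes the subsets of other sizes over which `allSubsets` also ranges.
∑-subsets : ∀ {n} k (P : Subset n → Bool) → (∀ s → P s ≡ true → ∣ s ∣ ≡ k) → ∀ S →
  ∑ (allSubsets n) (λ X → 𝟙 (P X ∧ subsetB X S)) ≡ ∑ (combos k (elems S)) (𝟙 ∘ P ∘ fromList)
∑-subsets {zero} zero P size Vec.[] = cong (λ b → 𝟙 b + 0) (∧-identityʳ (P Vec.[]))
∑-subsets {zero} (suc k) P size Vec.[] with P Vec.[] in eq
... | false = refl
... | true = contradiction (size Vec.[] eq) λ ()
∑-subsets {suc n} k P size (b Vec.∷ S) = trans (∑-++ (map (true Vec.∷_) (allSubsets n)) _ _)
  (trans (cong₂ _+_ (∑-map (true Vec.∷_) (allSubsets n) _) (trans (∑-map (false Vec.∷_) (allSubsets n) _) without)) (by b k size))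
  where
  without : ∑ (allSubsets n) (λ X → 𝟙 (P (false Vec.∷ X) ∧ subsetB X S)) ≡ ∑ (combos k (map fsuc (elems S))) (𝟙 ∘ P ∘ fromList)
  without = trans (∑-subsets k (P ∘ (false Vec.∷_)) (λ s → size (false Vec.∷ s)) S)
    (sym (trans (∑-combos-map fsuc k (elems S) _) (∑-cong (combos k (elems S)) λ l → cong (𝟙 ∘ P) (fromList-map-suc l))))
  by : ∀ b k → (∀ s → P s ≡ true → ∣ s ∣ ≡ k) →
    ∑ (allSubsets n) (λ X → 𝟙 (P (true Vec.∷ X) ∧ subsetB (true Vec.∷ X) (b Vec.∷ S))) + ∑ (combos k (map fsuc (elems S))) (𝟙 ∘ P ∘ fromList)
    ≡ ∑ (combos k (elems (b Vec.∷ S))) (𝟙 ∘ P ∘ fromList)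
  by false k size = cong (_+ ∑ (combos k (map fsuc (elems S))) (𝟙 ∘ P ∘ fromList))
    (trans (∑-cong (allSubsets n) λ X → cong 𝟙 (∧-zeroʳ (P (true Vec.∷ X)))) (∑-0 (allSubsets n)))
  by true zero size = cong (_+ ∑ (combos zero (map fsuc (elems S))) (𝟙 ∘ P ∘ fromList))
    (trans (∑-cong (allSubsets n) never) (∑-0 (allSubsets n)))
    where never : ∀ X → 𝟙 (P (true Vec.∷ X) ∧ subsetB X S) ≡ 0
          never X with P (true Vec.∷ X) in eq
          ... | false = refl
          ... | true = contradiction (size (true Vec.∷ X) eq) λ ()
  by true (suc k) size = trans (cong (_+ ∑ (combos (suc k) (map fsuc (elems S))) (𝟙 ∘ P ∘ fromList))
      (trans (∑-subsets k (P ∘ (true Vec.∷_)) (λ s e → suc-injective (size (true Vec.∷ s) e)) S)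
        (sym (trans (∑-combos-map fsuc k (elems S) _) (∑-cong (combos k (elems S)) λ l → cong (𝟙 ∘ P) (fromList-zero-suc l))))))
    (sym (∑-combos-∷ k fzero (map fsuc (elems S)) (𝟙 ∘ P ∘ fromList)))

eCount-combos : ∀ {r} (H : Hypergraph r) S → eCount H S ≡ ∑ (combos r (elems S)) (𝟙 ∘ edge H ∘ fromList)
eCount-combos {r} H S = trans (length-filterᵇ _ (allSubsets (n H))) (∑-subsets r (edge H) (uniform H) S)

-- Roles and gadget systems

Role : Set
Role = ℕ × ℕ

first-role : ℕ → Role
first-role y = 0 , y

later-role : Role → Role
later-role (x , y) = suc x , y

abstract
  -- (x , y) is the role of the pair at the positions x < x + 1 + y of an increasing r-tuple
  roles : ℕ → List Role
  roles zero = []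
  roles (suc r) = map first-role (upTo r) ++ map later-role (roles r)

  length-roles : ∀ r → length (roles r) ≡ r choose 2
  length-roles zero = refl
  length-roles (suc r) = begin
    length (roles (suc r)) ≡⟨ length-++ (map first-role (upTo r)) {map later-role (roles r)} ⟩
    length (map first-role (upTo r)) + length (map later-role (roles r))
      ≡⟨ cong₂ _+_ (trans (length-map first-role (upTo r)) (length-upTo r)) (trans (length-map later-role (roles r)) (length-roles r)) ⟩
    r + r choose 2 ≡⟨ cong (_+ r choose 2) (sym (nC1≡n r)) ⟩
    r choose 1 + r choose 2 ≡⟨ nCk+nC[k+1]≡[n+1]C[k+1] r 1 ⟩
    suc r choose 2 ∎
    where open ≡-Reasoning

  ∈-roles : ∀ {r x y} → (x , y) ∈ roles r → x + suc y < r
  ∈-roles {suc r} p∈ with ∈ₚ.∈-++⁻ (map first-role (upTo r)) p∈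
  ... | inj₁ q with ∈ₚ.∈-map⁻ first-role q
  ... | y , y∈ , refl = s≤s (∈ₚ.∈-upTo⁻ y∈)
  ∈-roles {suc r} p∈ | inj₂ q with ∈ₚ.∈-map⁻ later-role q
  ... | (x , y) , xy∈ , refl = s≤s (∈-roles xy∈)

  roles-∈ : ∀ {r} x y → x + suc y < r → (x , y) ∈ roles r
  roles-∈ {suc r} zero y (s≤s h) = ∈ₚ.∈-++⁺ˡ (∈ₚ.∈-map⁺ first-role (∈ₚ.∈-upTo⁺ h))
  roles-∈ {suc r} (suc x) y (s≤s h) = ∈ₚ.∈-++⁺ʳ (map first-role (upTo r)) (∈ₚ.∈-map⁺ later-role (roles-∈ x y h))

  roles-unique : ∀ r → Unique (roles r)
  roles-unique zero = []
  roles-unique (suc r) = Uniqueₚ.++⁺ (Uniqueₚ.map⁺ (λ { refl → refl }) (Uniqueₚ.upTo⁺ r))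
    (Uniqueₚ.map⁺ (λ { refl → refl }) (roles-unique r)) disjoint
    where
    disjoint : ∀ {p} → ¬ (p ∈ map first-role (upTo r) × p ∈ map later-role (roles r))
    disjoint (a , b) with ∈ₚ.∈-map⁻ first-role a | ∈ₚ.∈-map⁻ later-role b
    ... | _ , _ , refl | _ , _ , ()

infix 6 _≡ʳ_
_≡ʳ_ : Role → Role → Bool
(x , y) ≡ʳ (x′ , y′) = (x == x′) ∧ (y == y′)

≡ʳ-true : ∀ {p q} → (p ≡ʳ q) ≡ true → p ≡ q
≡ʳ-true {x , y} {x′ , y′} h = cong₂ _,_ (==-true (∧-trueˡ h)) (==-true (∧-trueʳ {x == x′} h))

≡ʳ-refl : ∀ p → (p ≡ʳ p) ≡ true
≡ʳ-refl (x , y) = ∧-true (==-refl x) (==-refl y)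

-- a gadget consists of two edges u v rest and u v rest′ that share only the pair u v
record Gadget (A : Set) : Set where
  constructor gadget
  field
    u v : A
    rest rest′ : List A

open Gadget public

mapᵍ : (A → A′) → Gadget A → Gadget A′
mapᵍ f (gadget u v E E′) = gadget (f u) (f v) (map f E) (map f E′)

vertices : Gadget A → List A
vertices (gadget u v E E′) = u ∷ v ∷ E ++ E′

-- the increasing order in which u v plays the role p in the edge u v E
arrange : Role → A → A → List A → List A
arrange (x , y) u v E = take x E ++ u ∷ (take y (drop x E) ++ v ∷ drop y (drop x E))

interleave : List A → List A → A → List A → List A → A → List A → List A → List A
interleave X X′ u Y Y′ v Z Z′ = X ++ X′ ++ u ∷ (Y ++ Y′ ++ v ∷ (Z ++ Z′))

-- The gadget type `(p , q)` as one linear order: in each of the three gaps around `u` and `v` the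
-- vertices of the first edge precede those of the second. With this convention an increasing list
-- of `2 + (k + k)` indices together with `(p , q)` determines a gadget.
arrange² : Role → Role → Gadget A → List A
arrange² (x , y) (x′ , y′) (gadget u v E E′) =
  interleave (take x E) (take x′ E′) u (take y (drop x E)) (take y′ (drop x′ E′)) v (drop y (drop x E)) (drop y′ (drop x′ E′))

-- Inverse to the interleaving, on bare index lists: it recovers the two edges from the sorted list
-- of all positions, so that Ramsey can colour such lists. The last block of the first edge has the
-- remaining `k ∸ (x + y)` entries.
split : Role → Role → ℕ → List A → List A × List A
split (x , y) (x′ , y′) k J = (X ++ U ++ Y ++ V ++ Z) , (X′ ++ U ++ Y′ ++ V ++ Z′)
  where
  X = take x J
  J₁ = drop x J
  X′ = take x′ J₁
  J₂ = drop x′ J₁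
  U = take 1 J₂
  J₃ = drop 1 J₂
  Y = take y J₃
  J₄ = drop y J₃
  Y′ = take y′ J₄
  J₅ = drop y′ J₄
  V = take 1 J₅
  J₆ = drop 1 J₅
  Z = take (k ∸ (x + y)) J₆
  Z′ = drop (k ∸ (x + y)) J₆

take-++-exact : ∀ {n} (xs : List A) {ys} → length xs ≡ n → take n (xs ++ ys) ≡ xs
take-++-exact [] refl = refl
take-++-exact (x ∷ xs) refl = cong (x ∷_) (take-++-exact xs refl)

drop-++-exact : ∀ {n} (xs : List A) {ys} → length xs ≡ n → drop n (xs ++ ys) ≡ ys
drop-++-exact [] refl = refl
drop-++-exact (x ∷ xs) refl = drop-++-exact xs refl

split-interleave : ∀ {x y x′ y′ k} (X X′ : List A) u Y Y′ v Z Z′ →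
  length X ≡ x → length X′ ≡ x′ → length Y ≡ y → length Y′ ≡ y′ → length Z ≡ k ∸ (x + y) →
  split (x , y) (x′ , y′) k (interleave X X′ u Y Y′ v Z Z′) ≡ (X ++ u ∷ (Y ++ v ∷ Z) , X′ ++ u ∷ (Y′ ++ v ∷ Z′))
split-interleave {x = x} {y} {x′} {y′} {k} X X′ u Y Y′ v Z Z′ lX lX′ lY lY′ lZ
  rewrite take-++-exact X {X′ ++ u ∷ (Y ++ Y′ ++ v ∷ (Z ++ Z′))} lX | drop-++-exact X {X′ ++ u ∷ (Y ++ Y′ ++ v ∷ (Z ++ Z′))} lX
        | take-++-exact X′ {u ∷ (Y ++ Y′ ++ v ∷ (Z ++ Z′))} lX′ | drop-++-exact X′ {u ∷ (Y ++ Y′ ++ v ∷ (Z ++ Z′))} lX′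
        | take-++-exact Y {Y′ ++ v ∷ (Z ++ Z′)} lY | drop-++-exact Y {Y′ ++ v ∷ (Z ++ Z′)} lY
        | take-++-exact Y′ {v ∷ (Z ++ Z′)} lY′ | drop-++-exact Y′ {v ∷ (Z ++ Z′)} lY′
        | take-++-exact Z {Z′} lZ | drop-++-exact Z {Z′} lZ = refl

module _ {k x y : ℕ} (h : x + y ≤ k) (E : List A) (len : length E ≡ k) where
  length-before : length (take x E) ≡ x
  length-before = trans (length-take x E) (m≤n⇒m⊓n≡m (≤-trans (m≤m+n x y) (subst (x + y ≤_) (sym len) h)))
  length-between : length (take y (drop x E)) ≡ y
  length-between = trans (length-take y (drop x E)) (m≤n⇒m⊓n≡m (subst (y ≤_) (sym (trans (length-drop x E) (cong (_∸ x) len))) (m+n≤o⇒n≤o∸m x h)))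
    where m+n≤o⇒n≤o∸m : ∀ x {y k} → x + y ≤ k → y ≤ k ∸ x
          m+n≤o⇒n≤o∸m x {y} {k} h = m+n≤o⇒m≤o∸n y (subst (_≤ k) (+-comm x y) h)
  length-after : length (drop y (drop x E)) ≡ k ∸ (x + y)
  length-after = trans (length-drop y (drop x E)) (trans (cong (_∸ y) (trans (length-drop x E) (cong (_∸ x) len))) (∸-+-assoc k x y))

role-bound : ∀ {k x y} → (x , y) ∈ roles (2 + k) → x + y ≤ k
role-bound {k} {x} {y} p∈ = ≤-pred (≤-trans (≤-reflexive (sym (+-suc x y))) (≤-pred (∈-roles p∈)))

split-arrange² : ∀ {k p q} → p ∈ roles (2 + k) → q ∈ roles (2 + k) → (g : Gadget A) → length (rest g) ≡ k → length (rest′ g) ≡ k →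
  split p q k (arrange² p q g) ≡ (arrange p (u g) (v g) (rest g) , arrange q (u g) (v g) (rest′ g))
split-arrange² {k = k} {p = x , y} {x′ , y′} p∈ q∈ (gadget u v E E′) l l′ =
  split-interleave {x = x} {y} {x′} {y′} {k} (take x E) (take x′ E′) u (take y (drop x E)) (take y′ (drop x′ E′)) v (drop y (drop x E)) (drop y′ (drop x′ E′))
    (length-before {k = k} {x} {y} (role-bound p∈) E l) (length-before {k = k} {x′} {y′} (role-bound q∈) E′ l′)
    (length-between {k = k} {x} {y} (role-bound p∈) E l) (length-between {k = k} {x′} {y′} (role-bound q∈) E′ l′) (length-after {k = k} {x} {y} (role-bound p∈) E l)

map-take : ∀ {A A′ : Set} (f : A → A′) n xs → map f (take n xs) ≡ take n (map f xs)
map-take f zero xs = refl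
map-take f (suc n) [] = refl
map-take f (suc n) (x ∷ xs) = cong (f x ∷_) (map-take f n xs)

map-drop : ∀ {A A′ : Set} (f : A → A′) n xs → map f (drop n xs) ≡ drop n (map f xs)
map-drop f zero xs = refl
map-drop f (suc n) [] = refl
map-drop f (suc n) (x ∷ xs) = map-drop f n xs

map-arrange : ∀ {A A′ : Set} (f : A → A′) p u v E → map f (arrange p u v E) ≡ arrange p (f u) (f v) (map f E)
map-arrange f (x , y) u v E
  rewrite map-++ f (take x E) (u ∷ (take y (drop x E) ++ v ∷ drop y (drop x E))) | map-++ f (take y (drop x E)) (v ∷ drop y (drop x E))
        | map-take f x E | map-take f y (drop x E) | map-drop f y (drop x E) | map-drop f x E = refl

map-interleave : ∀ {A A′ : Set} (f : A → A′) X X′ u Y Y′ v Z Z′ →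
  map f (interleave X X′ u Y Y′ v Z Z′) ≡ interleave (map f X) (map f X′) (f u) (map f Y) (map f Y′) (f v) (map f Z) (map f Z′)
map-interleave f X X′ u Y Y′ v Z Z′
  rewrite map-++ f X (X′ ++ u ∷ (Y ++ Y′ ++ v ∷ (Z ++ Z′))) | map-++ f X′ (u ∷ (Y ++ Y′ ++ v ∷ (Z ++ Z′)))
        | map-++ f Y (Y′ ++ v ∷ (Z ++ Z′)) | map-++ f Y′ (v ∷ (Z ++ Z′)) | map-++ f Z Z′ = refl

map-arrange² : ∀ {A A′ : Set} (f : A → A′) p q g → map f (arrange² p q g) ≡ arrange² p q (mapᵍ f g)
map-arrange² f (x , y) (x′ , y′) (gadget u v E E′) = trans (map-interleave f (take x E) (take x′ E′) u (take y (drop x E)) (take y′ (drop x′ E′)) v (drop y (drop x E)) (drop y′ (drop x′ E′))) fin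
  where
  fin : interleave (map f (take x E)) (map f (take x′ E′)) (f u) (map f (take y (drop x E))) (map f (take y′ (drop x′ E′))) (f v)
          (map f (drop y (drop x E))) (map f (drop y′ (drop x′ E′)))
      ≡ arrange² (x , y) (x′ , y′) (mapᵍ f (gadget u v E E′))
  fin rewrite map-take f x E | map-take f x′ E′ | map-take f y (drop x E) | map-take f y′ (drop x′ E′)
            | map-drop f y (drop x E) | map-drop f y′ (drop x′ E′) | map-drop f x E | map-drop f x′ E′ = refl

arrange-↭ : ∀ p (u v : A) E → arrange p u v E ↭ u ∷ v ∷ E
arrange-↭ (x , y) u v E = ↭-trans (↭ₚ.shift u (take x E) _) (prep u (↭-trans (↭ₚ.++⁺ˡ (take x E) (↭ₚ.shift v (take y (drop x E)) _))
  (↭-trans (↭ₚ.shift v (take x E) _) (prep v (↭-reflexive (trans (cong (take x E ++_) (take++drop≡id y (drop x E))) (take++drop≡id x E)))))))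

interleave-↭ : ∀ (X X′ : List A) u Y Y′ v Z Z′ → interleave X X′ u Y Y′ v Z Z′ ↭ (X ++ u ∷ (Y ++ v ∷ Z)) ++ (X′ ++ Y′ ++ Z′)
interleave-↭ X X′ u Y Y′ v Z Z′ = ↭-trans (↭ₚ.++⁺ˡ X (↭-trans (↭ₚ.shift u X′ _) (prep u (↭-trans (↭ₚ.++⁺ˡ X′ rest-Y) out))))
    (↭-reflexive (sym (++-assoc X (u ∷ (Y ++ v ∷ Z)) _)))
  where
  move : ∀ (P Q R : List A) → P ++ Q ++ R ↭ Q ++ P ++ R
  move P Q R = ↭-trans (↭-reflexive (sym (++-assoc P Q R))) (↭-trans (↭ₚ.++⁺ʳ R (↭ₚ.++-comm P Q)) (↭-reflexive (++-assoc Q P R)))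
  rest-Y : Y ++ Y′ ++ v ∷ (Z ++ Z′) ↭ (Y ++ v ∷ Z) ++ Y′ ++ Z′
  rest-Y = ↭-trans (↭ₚ.++⁺ˡ Y (move Y′ (v ∷ Z) Z′)) (↭-reflexive (sym (++-assoc Y (v ∷ Z) _)))
  out : X′ ++ (Y ++ v ∷ Z) ++ Y′ ++ Z′ ↭ (Y ++ v ∷ Z) ++ X′ ++ Y′ ++ Z′
  out = move X′ (Y ++ v ∷ Z) (Y′ ++ Z′)

arrange²-↭ : ∀ p q (g : Gadget A) → arrange² p q g ↭ vertices g
arrange²-↭ (x , y) (x′ , y′) (gadget u v E E′) = ↭-trans (interleave-↭ (take x E) (take x′ E′) u (take y (drop x E)) (take y′ (drop x′ E′)) v (drop y (drop x E)) (drop y′ (drop x′ E′)))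
  (↭-trans (↭ₚ.++⁺ʳ _ (arrange-↭ (x , y) u v E)) (↭-reflexive (cong (λ l → u ∷ v ∷ E ++ l)
    (trans (cong (take x′ E′ ++_) (take++drop≡id y′ (drop x′ E′))) (take++drop≡id x′ E′)))))

-- the role that the pair u v plays in the edge u v E when the vertices are ordered by ψ
roleUnder : (A → ℕ) → A → A → List A → Role
roleUnder ψ u v E = ∑ E (λ e → 𝟙 (ψ e ℕ.<ᵇ ψ u) * 𝟙 (ψ e ℕ.<ᵇ ψ v)) ,
                    ∑ E (λ e → 𝟙 (ψ e ℕ.<ᵇ ψ u) * 𝟙 (not (ψ e ℕ.<ᵇ ψ v)) + 𝟙 (not (ψ e ℕ.<ᵇ ψ u)) * 𝟙 (ψ e ℕ.<ᵇ ψ v))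

Consistent : (A → ℕ) → Gadget A → Set
Consistent ψ g = roleUnder ψ (u g) (v g) (rest g) ≡ roleUnder ψ (u g) (v g) (rest′ g)

SharesOne : Gadget A → Gadget A → Set
SharesOne g h = ∀ {a b} → a ∈ vertices g → a ∈ vertices h → b ∈ vertices g → b ∈ vertices h → a ≡ b

-- The lower bound uses `unavoidable`. The embedding uses the rest: `rank p q` tells which part of
-- the host receives a vertex when gadgets of type `(p , q)` are dense, and `linear` is what
-- telescoping demands.
record GadgetSystem (k : ℕ) : Set where
  field
    size bound : ℕ
    gadgets : List (Gadget (Fin size))
    length-rest : ∀ {g} → g ∈ gadgets → length (rest g) ≡ k × length (rest′ g) ≡ k
    linear : AllPairs SharesOne gadgets
    rank : Role → Role → Fin size → ℕ
    rank<bound : ∀ p q v → rank p q v < bound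
    rank-injective : ∀ p q {v w} → rank p q v ≡ rank p q w → v ≡ w
    rank-increasing : ∀ {p q g} → p ∈ roles (2 + k) → q ∈ roles (2 + k) → p ≢ q → g ∈ gadgets → Increasing (map (rank p q) (arrange² p q g))
    unavoidable : ∀ (ψ : Fin size → ℕ) → (∀ {v w} → ψ v ≡ ψ w → v ≡ w) → ∃[ g ] (g ∈ gadgets × ¬ Consistent ψ g)

increasing-unique : ∀ {is} → Increasing is → Unique is
increasing-unique = AllPairs.map <⇒≢

unique-map : ∀ {A A′ : Set} (f : A → A′) {xs} → Unique (map f xs) → Unique xs
unique-map f {[]} [] = []
unique-map f {x ∷ xs} (h ∷ hs) = All.map (λ ne e → ne (cong f e)) (Allₚ.map⁻ h) ∷ unique-map f hs

unique-++ˡ : ∀ (xs : List A) {ys} → Unique (xs ++ ys) → Unique xs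
unique-++ˡ [] _ = []
unique-++ˡ (x ∷ xs) (h ∷ hs) = Allₚ.++⁻ˡ xs h ∷ unique-++ˡ xs hs

unique-++ʳ : ∀ (xs : List A) {ys} → Unique (xs ++ ys) → Unique ys
unique-++ʳ [] h = h
unique-++ʳ (x ∷ xs) (_ ∷ hs) = unique-++ʳ xs hs

unique-↭ : ∀ {xs ys : List A} → xs ↭ ys → Unique xs → Unique ys
unique-↭ _↭_.refl h = h
unique-↭ (prep x p) (a ∷ h) = ↭ₚ.All-resp-↭ p a ∷ unique-↭ p h
unique-↭ (_↭_.swap x y p) ((ne ∷ a) ∷ b ∷ h) = ((λ e → ne (sym e)) ∷ ↭ₚ.All-resp-↭ p b) ∷ ↭ₚ.All-resp-↭ p a ∷ unique-↭ p h
unique-↭ (_↭_.trans p q) h = unique-↭ q (unique-↭ p h)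

module _ {k′ : ℕ} (𝒢 : GadgetSystem (suc k′)) where
  open GadgetSystem 𝒢
  private
    k = suc k′
    first second : Role
    first = 0 , 0
    second = 0 , 1

  -- Distinctness follows from any order in which the gadget is strictly increasing. Such an order
  -- comes from two distinct roles, which exist because the uniformity is at least 3.
  vertices-unique : ∀ {g} → g ∈ gadgets → Unique (vertices g)
  vertices-unique {g} g∈ = unique-↭ (arrange²-↭ first second g) (unique-map (rank first second) (increasing-unique
    (rank-increasing {first} {second} (roles-∈ {2 + k} 0 0 (s≤s (s≤s z≤n))) (roles-∈ {2 + k} 0 1 (s≤s (s≤s (s≤s z≤n)))) (λ ()) g∈)))

  edge₁-unique : ∀ {g} → g ∈ gadgets → Unique (u g ∷ v g ∷ rest g)
  edge₁-unique {g} g∈ = unique-++ˡ (u g ∷ v g ∷ rest g) (vertices-unique g∈)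

  edge₂-unique : ∀ {g} → g ∈ gadgets → Unique (u g ∷ v g ∷ rest′ g)
  edge₂-unique {g} g∈ with vertices-unique g∈
  ... | (a ∷ b) ∷ c ∷ d = (a ∷ Allₚ.++⁻ʳ (rest g) b) ∷ Allₚ.++⁻ʳ (rest g) c ∷ unique-++ʳ (rest g) d

  isEdge : Subset size → Gadget (Fin size) → Bool
  isEdge s g = does (Vecₚ.≡-dec Data.Bool.Properties._≟_ s (fromList (u g ∷ v g ∷ rest g)))
             ∨ does (Vecₚ.≡-dec Data.Bool.Properties._≟_ s (fromList (u g ∷ v g ∷ rest′ g)))

  isEdge-true : ∀ {s g} → isEdge s g ≡ true → s ≡ fromList (u g ∷ v g ∷ rest g) ⊎ s ≡ fromList (u g ∷ v g ∷ rest′ g)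
  isEdge-true {s} {g} h with Vecₚ.≡-dec Data.Bool.Properties._≟_ s (fromList (u g ∷ v g ∷ rest g))
                           | Vecₚ.≡-dec Data.Bool.Properties._≟_ s (fromList (u g ∷ v g ∷ rest′ g))
  ... | yes e | _ = inj₁ e
  ... | no _ | yes e = inj₂ e

  isEdge-rest : ∀ g → isEdge (fromList (u g ∷ v g ∷ rest g)) g ≡ true
  isEdge-rest g rewrite dec-true (Vecₚ.≡-dec Data.Bool.Properties._≟_ (fromList (u g ∷ v g ∷ rest g)) (fromList (u g ∷ v g ∷ rest g))) refl = refl

  isEdge-rest′ : ∀ g → isEdge (fromList (u g ∷ v g ∷ rest′ g)) g ≡ true
  isEdge-rest′ g rewrite dec-true (Vecₚ.≡-dec Data.Bool.Properties._≟_ (fromList (u g ∷ v g ∷ rest′ g)) (fromList (u g ∷ v g ∷ rest′ g))) refl =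
    Data.Bool.Properties.∨-zeroʳ _

  systemGraph : Hypergraph (2 + k)
  systemGraph = record { n = size ; edge = λ s → any gadgets (isEdge s) ; uniform = uni }
    where
    uni : ∀ s → any gadgets (isEdge s) ≡ true → ∣ s ∣ ≡ 2 + k
    uni s h with any-∈ gadgets h
    ... | g , g∈ , e with isEdge-true {s} {g} e
    ... | inj₁ refl = trans (size-fromList _ (edge₁-unique g∈)) (cong (2 +_) (proj₁ (length-rest g∈)))
    ... | inj₂ refl = trans (size-fromList _ (edge₂-unique g∈)) (cong (2 +_) (proj₂ (length-rest g∈)))

-- The grid Fin N ^ D has no ordering that is consistent with all gadgets

AllPairs-⊆ : ∀ {A : Set} {R : A → A → Set} {xs ys} → xs ⊆ ys → AllPairs R ys → AllPairs R xs
AllPairs-⊆ [] [] = []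
AllPairs-⊆ (y ∷ʳ s) (_ ∷ h) = AllPairs-⊆ s h
AllPairs-⊆ (refl ∷ s) (a ∷ h) = Subₚ.All-resp-⊆ s a ∷ AllPairs-⊆ s h

nth-⊆ : ∀ (d : A) (Y : List A) {is} → Increasing is → All (_< length Y) is → map (nth d Y) is ⊆ Y
nth-⊆ d [] [] [] = []
nth-⊆ d (y ∷ Y) inc bd with unshift inc
... | inj₁ (js , refl , inc′) = y ∷ʳ subst (_⊆ Y) (map-∘ js) (nth-⊆ d Y inc′ (All.map ≤-pred (Allₚ.map⁻ bd)))
... | inj₂ (js , refl , inc′) = refl ∷ subst (_⊆ Y) (map-∘ js) (nth-⊆ d Y inc′ (All.map ≤-pred (Allₚ.map⁻ (All.tail bd))))

<ᵇ-true : ∀ {m n} → m < n → (m ℕ.<ᵇ n) ≡ true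
<ᵇ-true h = Equivalence.to T-≡ (<⇒<ᵇ h)

<ᵇ-true⁻¹ : ∀ {m n} → (m ℕ.<ᵇ n) ≡ true → m < n
<ᵇ-true⁻¹ {m} {n} h = <ᵇ⇒< m n (Equivalence.from T-≡ h)

<ᵇ-false : ∀ {m n} → n ≤ m → (m ℕ.<ᵇ n) ≡ false
<ᵇ-false {m} {n} h with m ℕ.<ᵇ n in eq
... | false = refl
... | true = contradiction h (<⇒≱ (<ᵇ-true⁻¹ eq))

AllPairs-++⁻ : ∀ {A : Set} {R : A → A → Set} xs {ys} → AllPairs R (xs ++ ys) → All (λ x → All (R x) ys) xs × AllPairs R ys
AllPairs-++⁻ [] h = [] , h
AllPairs-++⁻ (x ∷ xs) (a ∷ h) = let b , c = AllPairs-++⁻ xs h in Allₚ.++⁻ʳ xs a ∷ b , c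

∑-All : ∀ {xs : List A} {f : A → ℕ} {c} → All (λ x → f x ≡ c) xs → ∑ xs f ≡ length xs * c
∑-All [] = refl
∑-All (refl ∷ h) = cong (_ +_) (∑-All h)

∑-three : ∀ n m (E : List A) (f : A → ℕ) → ∑ E f ≡ ∑ (take n E) f + (∑ (take m (drop n E)) f + ∑ (drop m (drop n E)) f)
∑-three n m E f = begin
  ∑ E f ≡⟨ cong (λ l → ∑ l f) (sym (take++drop≡id n E)) ⟩
  ∑ (take n E ++ drop n E) f ≡⟨ ∑-++ (take n E) (drop n E) f ⟩
  ∑ (take n E) f + ∑ (drop n E) f ≡⟨ cong (λ l → ∑ (take n E) f + ∑ l f) (sym (take++drop≡id m (drop n E))) ⟩
  ∑ (take n E) f + ∑ (take m (drop n E) ++ drop m (drop n E)) f ≡⟨ cong (∑ (take n E) f +_) (∑-++ (take m (drop n E)) (drop m (drop n E)) f) ⟩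
  _ ∎
  where open ≡-Reasoning

module _ {A : Set} (ψ : A → ℕ) {k x y : ℕ} (bd : x + y ≤ k) (u v : A) (E : List A) (len : length E ≡ k) where

  private
    X = take x E
    Y = take y (drop x E)
    Z = drop y (drop x E)
    _<u _<v : A → Bool
    e <u = ψ e ℕ.<ᵇ ψ u
    e <v = ψ e ℕ.<ᵇ ψ v
    evaluate : ∀ {a b c a′ b′ c′} →
      All (λ e → (e <u) ≡ a × (e <v) ≡ a′) X → All (λ e → (e <u) ≡ b × (e <v) ≡ b′) Y → All (λ e → (e <u) ≡ c × (e <v) ≡ c′) Z →
      roleUnder ψ u v E ≡ (x * (𝟙 a * 𝟙 a′) + (y * (𝟙 b * 𝟙 b′) + (k ∸ (x + y)) * (𝟙 c * 𝟙 c′)) ,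
        x * (𝟙 a * 𝟙 (not a′) + 𝟙 (not a) * 𝟙 a′) + (y * (𝟙 b * 𝟙 (not b′) + 𝟙 (not b) * 𝟙 b′) + (k ∸ (x + y)) * (𝟙 c * 𝟙 (not c′) + 𝟙 (not c) * 𝟙 c′)))
    evaluate hX hY hZ = cong₂ _,_ (parts (λ s t → 𝟙 s * 𝟙 t) hX hY hZ) (parts (λ s t → 𝟙 s * 𝟙 (not t) + 𝟙 (not s) * 𝟙 t) hX hY hZ)
      where
      parts : ∀ (F : Bool → Bool → ℕ) {a b c a′ b′ c′} →
        All (λ e → (e <u) ≡ a × (e <v) ≡ a′) X → All (λ e → (e <u) ≡ b × (e <v) ≡ b′) Y → All (λ e → (e <u) ≡ c × (e <v) ≡ c′) Z →
        ∑ E (λ e → F (e <u) (e <v)) ≡ x * F a a′ + (y * F b b′ + (k ∸ (x + y)) * F c c′)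
      parts F hX hY hZ = trans (∑-three x y E _) (cong₂ _+_ (part X hX (length-before {k = k} {x} {y} bd E len))
          (cong₂ _+_ (part Y hY (length-between {k = k} {x} {y} bd E len)) (part Z hZ (length-after {k = k} {x} {y} bd E len))))
        where
        part : ∀ W {a a′ n} → All (λ e → (e <u) ≡ a × (e <v) ≡ a′) W → length W ≡ n → ∑ W (λ e → F (e <u) (e <v)) ≡ n * F a a′
        part W h refl = ∑-All (All.map (λ { (refl , refl) → refl }) h)

  roleUnder-increasing : AllPairs (λ a b → ψ a < ψ b) (arrange (x , y) u v E) → roleUnder ψ u v E ≡ (x , y)
  roleUnder-increasing h with AllPairs-++⁻ X h
  ... | X< , (u< ∷ h′) with AllPairs-++⁻ Y h′ | Allₚ.++⁻ˡ Y u< | Allₚ.++⁻ʳ Y u<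
  ... | Y< , (v<Z ∷ _) | u<Y | u<v ∷ u<Z = trans
    (evaluate (All.map (λ { (a ∷ b) → <ᵇ-true a , <ᵇ-true (head (Allₚ.++⁻ʳ Y b)) }) X<)
              (All.zipWith (λ (a , b) → <ᵇ-false (<⇒≤ a) , <ᵇ-true (head b)) (u<Y , Y<))
              (All.zipWith (λ (a , b) → <ᵇ-false (<⇒≤ a) , <ᵇ-false (<⇒≤ b)) (u<Z , v<Z)))
    (cong₂ _,_ (lem₁ x y (k ∸ (x + y))) (lem₂ x y (k ∸ (x + y))))
    where
    head : ∀ {P : A → Set} {w ws} → All P (w ∷ ws) → P w
    head (p ∷ _) = p
    lem₁ : ∀ x y z → x * 1 + (y * 0 + z * 0) ≡ x
    lem₁ = solve-∀
    lem₂ : ∀ x y z → x * 0 + (y * 1 + z * 0) ≡ y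
    lem₂ = solve-∀

  roleUnder-decreasing : AllPairs (λ a b → ψ b < ψ a) (arrange (x , y) u v E) → roleUnder ψ u v E ≡ (k ∸ (x + y) , y)
  roleUnder-decreasing h with AllPairs-++⁻ X h
  ... | X> , (u> ∷ h′) with AllPairs-++⁻ Y h′ | Allₚ.++⁻ˡ Y u> | Allₚ.++⁻ʳ Y u>
  ... | Y> , (v>Z ∷ _) | u>Y | u>v ∷ u>Z = trans
    (evaluate (All.map (λ { (a ∷ b) → <ᵇ-false (<⇒≤ a) , <ᵇ-false (<⇒≤ (head (Allₚ.++⁻ʳ Y b))) }) X>)
              (All.zipWith (λ (a , b) → <ᵇ-true a , <ᵇ-false (<⇒≤ (head b))) (u>Y , Y>))
              (All.zipWith (λ (a , b) → <ᵇ-true a , <ᵇ-true b) (u>Z , v>Z)))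
    (cong₂ _,_ (lem₁ x y (k ∸ (x + y))) (lem₂ x y (k ∸ (x + y))))
    where
    head : ∀ {P : A → Set} {w ws} → All P (w ∷ ws) → P w
    head (p ∷ _) = p
    lem₁ : ∀ x y z → x * 0 + (y * 0 + z * 1) ≡ z
    lem₁ = solve-∀
    lem₂ : ∀ x y z → x * 0 + (y * 1 + z * 0) ≡ y
    lem₂ = solve-∀

arrange-⊆₁ : ∀ p q (g : Gadget A) → arrange p (u g) (v g) (rest g) ⊆ arrange² p q g
arrange-⊆₁ (x , y) (x′ , y′) (gadget u v E E′) = Subₚ.++⁺ ⊆-refl (Subₚ.++⁺ (Sub.minimum (take x′ E′)) (refl ∷
  Subₚ.++⁺ ⊆-refl (Subₚ.++⁺ (Sub.minimum (take y′ (drop x′ E′))) (refl ∷ Subₚ.++⁺ʳ (drop y′ (drop x′ E′)) ⊆-refl))))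

arrange-⊆₂ : ∀ p q (g : Gadget A) → arrange q (u g) (v g) (rest′ g) ⊆ arrange² p q g
arrange-⊆₂ (x , y) (x′ , y′) (gadget u v E E′) = Subₚ.++⁺ (Sub.minimum (take x E)) (Subₚ.++⁺ ⊆-refl (refl ∷
  Subₚ.++⁺ (Sub.minimum (take y (drop x E))) (Subₚ.++⁺ ⊆-refl (refl ∷ Subₚ.++⁺ (Sub.minimum (drop y (drop x E))) ⊆-refl))))

-- The Ramsey argument tells that `ψ` is monotone along a coordinate, but not in which direction.
-- Reversal sends the role `(x , y)` to `(k ∸ (x + y) , y)`; this map is injective on roles, so
-- distinct roles stay distinct.
inconsistent : ∀ {A : Set} (ψ : A → ℕ) {k p q} → p ∈ roles (2 + k) → q ∈ roles (2 + k) → p ≢ q → (g : Gadget A) →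
  length (rest g) ≡ k → length (rest′ g) ≡ k →
  AllPairs (λ a b → ψ a < ψ b) (arrange² p q g) ⊎ AllPairs (λ a b → ψ b < ψ a) (arrange² p q g) → ¬ Consistent ψ g
inconsistent ψ {k} {p@(x , y)} {q@(x′ , y′)} p∈ q∈ p≢q g l l′ (inj₁ h) c = p≢q (trans
  (sym (roleUnder-increasing ψ (role-bound p∈) (u g) (v g) (rest g) l (AllPairs-⊆ (arrange-⊆₁ p q g) h)))
  (trans c (roleUnder-increasing ψ (role-bound q∈) (u g) (v g) (rest′ g) l′ (AllPairs-⊆ (arrange-⊆₂ p q g) h))))
inconsistent ψ {k} {p@(x , y)} {q@(x′ , y′)} p∈ q∈ p≢q g l l′ (inj₂ h) c = p≢q (same (trans
  (sym (roleUnder-decreasing ψ (role-bound p∈) (u g) (v g) (rest g) l (AllPairs-⊆ (arrange-⊆₁ p q g) h)))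
  (trans c (roleUnder-decreasing ψ (role-bound q∈) (u g) (v g) (rest′ g) l′ (AllPairs-⊆ (arrange-⊆₂ p q g) h)))))
  where
  same : (k ∸ (x + y) , y) ≡ (k ∸ (x′ + y′) , y′) → p ≡ q
  same e with cong proj₂ e
  ... | refl = cong (_, y) (+-cancelʳ-≡ y x x′ (∸-cancelˡ-≡ (role-bound p∈) (role-bound q∈) (cong proj₁ e)))

indexOf : List ℕ → ℕ → ℕ
indexOf [] t = 0
indexOf (s ∷ l) t = if s == t then 0 else suc (indexOf l t)

indexOf-< : ∀ {l t} → t ∈ l → indexOf l t < length l
indexOf-< {s ∷ l} {t} t∈ with s == t in eq
... | true = s≤s z≤n
... | false with t∈
... | here refl = contradiction (trans (sym eq) (==-refl t)) λ ()
... | there q = s≤s (indexOf-< q)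

indexOf-increasing : ∀ {l} → Unique l → AllPairs (λ s t → indexOf l s < indexOf l t) l
indexOf-increasing [] = []
indexOf-increasing {s ∷ l} (s∉ ∷ uniq) = All.map first s∉ ∷ later s∉ (indexOf-increasing uniq)
  where
  first : ∀ {t} → s ≢ t → indexOf (s ∷ l) s < indexOf (s ∷ l) t
  first {t} ne rewrite ==-refl s | ==-false ne = s≤s z≤n
  later : ∀ {ts} → All (s ≢_) ts → AllPairs (λ a b → indexOf l a < indexOf l b) ts → AllPairs (λ a b → indexOf (s ∷ l) a < indexOf (s ∷ l) b) ts
  later [] [] = []
  later {t ∷ ts} (n ∷ ns) (h ∷ hs) = go ns h ∷ later ns hs
    where go : ∀ {ts} → All (s ≢_) ts → All (λ b → indexOf l t < indexOf l b) ts → All (λ b → indexOf (s ∷ l) t < indexOf (s ∷ l) b) ts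
          go [] [] = []
          go (m ∷ ms) (i ∷ is) = lt m i ∷ go ms is
            where lt : ∀ {b} → s ≢ b → indexOf l t < indexOf l b → indexOf (s ∷ l) t < indexOf (s ∷ l) b
                  lt m i rewrite ==-false n | ==-false m = s≤s i

module Grid (k D′ : ℕ) (pattern′ : Fin (suc D′) → Role × Role)
            (valid : ∀ i → proj₁ (pattern′ i) ∈ roles (2 + k) × proj₂ (pattern′ i) ∈ roles (2 + k) × proj₁ (pattern′ i) ≢ proj₂ (pattern′ i)) where

  private
    D = suc D′
    -- every coordinate of a gadget point takes an odd offset below w - 1, leaving room below, above and in between
    w = 2 + 2 * (2 + (k + k))

    labels : Gadget ℕ
    labels = gadget 0 1 (applyUpTo (2 +_) k) (applyUpTo (2 + k +_) k)

    order : Fin D → List ℕ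
    order i = arrange² (proj₁ (pattern′ i)) (proj₂ (pattern′ i)) labels

    labels-unique : Unique (vertices labels)
    labels-unique = (nonzero 1 (s≤s z≤n) ∷ Allₚ.++⁺ (Allₚ.applyUpTo⁺₂ (2 +_) k λ i ()) (Allₚ.applyUpTo⁺₂ (2 + k +_) k λ i ()))
      ∷ Allₚ.++⁺ (Allₚ.applyUpTo⁺₂ (2 +_) k λ i ()) (Allₚ.applyUpTo⁺₂ (2 + k +_) k λ i ())
      ∷ Uniqueₚ.++⁺ (Uniqueₚ.applyUpTo⁺₁ (2 +_) k λ i<j _ → <⇒≢ (+-monoʳ-< 2 i<j)) (Uniqueₚ.applyUpTo⁺₁ (2 + k +_) k λ i<j _ → <⇒≢ (+-monoʳ-< (2 + k) i<j)) disjoint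
      where
      nonzero : ∀ n → 0 < n → 0 ≢ n
      nonzero (suc n) _ ()
      disjoint : ∀ {t} → ¬ (t ∈ applyUpTo (2 +_) k × t ∈ applyUpTo (2 + k +_) k)
      disjoint (a , b) with ∈ₚ.∈-applyUpTo⁻ (2 +_) a | ∈ₚ.∈-applyUpTo⁻ (2 + k +_) b
      ... | i , i<k , refl | j , j<k , e = <⇒≱ i<k (≤-trans (m≤m+n k j) (≤-reflexive (sym (+-cancelˡ-≡ 2 _ _ e))))

    order-unique : ∀ i → Unique (order i)
    order-unique i = unique-↭ (↭-sym (arrange²-↭ (proj₁ (pattern′ i)) (proj₂ (pattern′ i)) labels)) labels-unique

    position : Fin D → ℕ → ℕ
    position i t = indexOf (order i) t

    position-< : ∀ i {t} → t ∈ vertices labels → position i t < 2 + (k + k)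
    position-< i t∈ = ≤-trans (indexOf-< (↭ₚ.∈-resp-↭ (↭-sym σ) t∈)) (≤-reflexive (trans (↭ₚ.↭-length σ)
        (cong (2 +_) (trans (length-++ (applyUpTo (2 +_) k)) (cong₂ _+_ (length-applyUpTo (2 +_) k) (length-applyUpTo (2 + k +_) k))))))
      where
      σ = arrange²-↭ (proj₁ (pattern′ i)) (proj₂ (pattern′ i)) labels

    -- The indices of two points that differ in all `n` coordinates. Window `i`, of width `w`,
    -- carries their `i`-th entries, the smaller one first, so the list is increasing and a set of
    -- `D * 2` indices encodes such a pair of points.
    pairs : ℕ → (ℕ → ℕ) → (ℕ → ℕ) → ℕ → List ℕ
    pairs zero lo hi o = []
    pairs (suc n) lo hi o = o + lo 0 ∷ o + hi 0 ∷ pairs n (lo ∘ suc) (hi ∘ suc) (o + w)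

    length-pairs : ∀ n lo hi o → length (pairs n lo hi o) ≡ n * 2
    length-pairs zero lo hi o = refl
    length-pairs (suc n) lo hi o = cong (2 +_) (length-pairs n _ _ _)

    pairs-bounds : ∀ n lo hi o → (∀ i → lo i < hi i) → (∀ i → hi i < w) → All (λ m → o ≤ m × m < o + n * w) (pairs n lo hi o)
    pairs-bounds zero lo hi o l h = []
    pairs-bounds (suc n) lo hi o l h = (m≤m+n o _ , +-monoʳ-< o (≤-trans (<-trans (l 0) (h 0)) (m≤m+n w _)))
      ∷ (m≤m+n o _ , +-monoʳ-< o (≤-trans (h 0) (m≤m+n w _)))
      ∷ All.map (λ (a , b) → ≤-trans (m≤m+n o w) a , <-≤-trans b (≤-reflexive (+-assoc o w (n * w)))) (pairs-bounds n _ _ (o + w) (l ∘ suc) (h ∘ suc))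

    pairs-increasing : ∀ n lo hi o → (∀ i → lo i < hi i) → (∀ i → hi i < w) → Increasing (pairs n lo hi o)
    pairs-increasing zero lo hi o l h = []
    pairs-increasing (suc n) lo hi o l h = (+-monoʳ-< o (l 0) ∷ All.map (λ (a , _) → <-≤-trans (+-monoʳ-< o (<-trans (l 0) (h 0))) a) bds)
      ∷ All.map (λ (a , _) → <-≤-trans (+-monoʳ-< o (h 0)) a) bds ∷ pairs-increasing n _ _ (o + w) (l ∘ suc) (h ∘ suc)
      where bds = pairs-bounds n (lo ∘ suc) (hi ∘ suc) (o + w) (l ∘ suc) (h ∘ suc)

    side : Bool → List ℕ → ℕ → ℕ
    side b (l ∷ h ∷ L) zero = if b then h else l
    side b (l ∷ h ∷ L) (suc i) = side b L i
    side b _ i = 0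

    side-pairs : ∀ (ι : ℕ → ℕ) b n lo hi o i → i < n → side b (map ι (pairs n lo hi o)) i ≡ ι (o + i * w + (if b then hi i else lo i))
    side-pairs ι true (suc n) lo hi o zero h = cong (λ t → ι (t + hi 0)) (sym (+-identityʳ o))
    side-pairs ι false (suc n) lo hi o zero h = cong (λ t → ι (t + lo 0)) (sym (+-identityʳ o))
    side-pairs ι b (suc n) lo hi o (suc i) (s≤s h) = trans (side-pairs ι b n (lo ∘ suc) (hi ∘ suc) (o + w) i h)
      (cong (λ t → ι (t + (if b then hi (suc i) else lo (suc i)))) (+-assoc o w (i * w)))

    room : ∀ p a → p < a → suc (suc (2 * p)) < 2 + 2 * a
    room p a h = ≤-trans (s≤s (≤-trans (≤-reflexive (lem p)) (*-monoʳ-≤ 2 h))) (n≤1+n (suc (2 * a)))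
      where lem : ∀ p → suc (suc (2 * p)) ≡ 2 * suc p
            lem = solve-∀

    m = D * w

    -- A set of `D * 2` indices determines two points once it is known which of them takes the
    -- larger entry in each coordinate. Only the `suc D` threshold choices are recorded, one bit for
    -- each. The homogeneous set must fill `D` windows of width `w`.
    R = ramsey (D * 2) (2 ^ suc D) m
    N′ = proj₁ R

  N : ℕ
  N = suc N′

  coordinate : Fin D → Fin (N ^ D) → ℕ
  coordinate i x = toℕ (finToFun {N} {D} x i)

  private
    clamp : ℕ → Fin N
    clamp n with n <? N
    ... | yes h = fromℕ< h
    ... | no _ = fzero

    toℕ-clamp : ∀ {n} → n < N → toℕ (clamp n) ≡ n
    toℕ-clamp {n} h with n <? N
    ... | yes h′ = Finₚ.toℕ-fromℕ< h′
    ... | no ¬h = contradiction h ¬h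

    funToFin-cong : ∀ {n m} {f g : Fin n → Fin m} → (∀ i → f i ≡ g i) → funToFin f ≡ funToFin g
    funToFin-cong {zero} h = refl
    funToFin-cong {suc n} h = cong₂ combine (h fzero) (funToFin-cong (h ∘ fsuc))

    abstract
      point : (ℕ → ℕ) → Fin (N ^ D)
      point X = funToFin {D} {N} (λ i → clamp (X (toℕ i)))

      point-cong : ∀ {X Y} → (∀ i → i < D → X i ≡ Y i) → point X ≡ point Y
      point-cong h = funToFin-cong λ i → cong clamp (h (toℕ i) (Finₚ.toℕ<n i))

      coordinate-point : ∀ X i → X (toℕ i) < N → coordinate i (point X) ≡ X (toℕ i)
      coordinate-point X i h = trans (cong toℕ (Finₚ.finToFun-funToFin {D} {N} (λ i → clamp (X (toℕ i))) i)) (toℕ-clamp h)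

    -- the first point takes the larger entry in the coordinates below j, the second one the smaller entry
    source target : ℕ → List ℕ → Fin (N ^ D)
    source j L = point (λ i → side (i ℕ.<ᵇ j) L i)
    target j L = point (λ i → side (not (i ℕ.<ᵇ j)) L i)

    toBit : Bool → Fin 2
    toBit true = fsuc fzero
    toBit false = fzero

  module _ (ψ : Fin (N ^ D) → ℕ) (ψ-injective : ∀ {x y} → ψ x ≡ ψ y → x ≡ y) where

    private
      bits : List ℕ → Fin (suc D) → Fin 2
      bits L j = toBit (ψ (source (toℕ j) L) ℕ.<ᵇ ψ (target (toℕ j) L))

      colour : List ℕ → Fin (2 ^ suc D)
      colour L = funToFin {suc D} {2} (bits L)

      hom = proj₂ R colour (upTo N) (≤-trans (n≤1+n N′) (≤-reflexive (sym (length-upTo N))))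
      Yl = proj₁ hom
      Yl⊆ = proj₁ (proj₂ hom)
      Yl-len = proj₁ (proj₂ (proj₂ hom))
      c₀ = proj₁ (proj₂ (proj₂ (proj₂ hom)))
      c₀-hom = proj₂ (proj₂ (proj₂ (proj₂ hom)))

      ι : ℕ → ℕ
      ι = nth 0 Yl

      Yl-increasing : Increasing Yl
      Yl-increasing = AllPairs-⊆ Yl⊆ (AllPairsₚ.applyUpTo⁺₁ id N λ i<j _ → i<j)

      ι-mono : ∀ {i j} → i < j → j < m → ι i < ι j
      ι-mono {i} {j} i<j j<m with AllPairs-⊆ (nth-⊆ 0 Yl {i ∷ j ∷ []} ((i<j ∷ []) ∷ [] ∷ [])
          (subst (i <_) (sym Yl-len) (<-trans i<j j<m) ∷ subst (j <_) (sym Yl-len) j<m ∷ [])) Yl-increasing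
      ... | (h ∷ []) ∷ _ = h

      ι<N : ∀ {i} → i < m → ι i < N
      ι<N h = ∈ₚ.∈-upTo⁻ (Sub.lookup Yl⊆ (nth-∈ 0 Yl (subst (_ <_) (sym Yl-len) h)))

      offset<m : ∀ {i x} → i < D → x < w → i * w + x < m
      offset<m {i} {x} i<D x<w = ≤-trans (≤-trans (+-monoʳ-< (i * w) x<w) (≤-reflexive (+-comm (i * w) w))) (*-monoˡ-≤ w i<D)

      P : (ℕ → ℕ) → Fin (N ^ D)
      P X = point (λ i → ι (i * w + X i))

      coordinate-P : ∀ X → (∀ i → X i < w) → ∀ i → coordinate i (P X) ≡ ι (toℕ i * w + X (toℕ i))
      coordinate-P X h i = coordinate-point (λ i → ι (i * w + X i)) i (ι<N (offset<m (Finₚ.toℕ<n i) (h (toℕ i))))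

      bit₀ : Fin (suc D) → Fin 2
      bit₀ = finToFun {2} {suc D} c₀

      bitAt : ∀ {j} → Dec (j < suc D) → Bool
      bitAt (no _) = false
      bitAt (yes h) = does (bit₀ (fromℕ< h) Finₚ.≟ fsuc fzero)

      bit : ℕ → Bool
      bit j = bitAt (j <? suc D)

      bits-homogeneous : ∀ L j → colour L ≡ c₀ → bits L j ≡ bit₀ j
      bits-homogeneous L j e = trans (sym (Finₚ.finToFun-funToFin {suc D} {2} (bits L) j)) (cong (λ c → finToFun {2} {suc D} c j) e)

      untoBit : ∀ (a : Bool) b → toBit a ≡ b → a ≡ does (b Finₚ.≟ fsuc fzero)
      untoBit true .(fsuc fzero) refl = refl
      untoBit false .fzero refl = refl

      -- By homogeneity the comparison depends only on the sign pattern of the two points, here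
      -- larger below `j` and smaller from `j` on, and not on the entries themselves.
      bit-spec : ∀ j → j ≤ D → ∀ X Y → (∀ i → X i < w) → (∀ i → Y i < w) →
        (∀ i → i < j → Y i < X i) → (∀ i → j ≤ i → X i < Y i) → (ψ (P X) ℕ.<ᵇ ψ (P Y)) ≡ bit j
      bit-spec j j≤D X Y X<w Y<w below above = decided (j <? suc D)
        where
        lo hi : ℕ → ℕ
        lo i = if i ℕ.<ᵇ j then Y i else X i
        hi i = if i ℕ.<ᵇ j then X i else Y i
        lo<hi : ∀ i → lo i < hi i
        lo<hi i with i ℕ.<ᵇ j in eq
        ... | true = below i (<ᵇ-true⁻¹ eq)
        ... | false = above i (≮⇒≥ λ q → contradiction (trans (sym eq) (<ᵇ-true q)) λ ())
        hi<w : ∀ i → hi i < w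
        hi<w i with i ℕ.<ᵇ j
        ... | true = X<w i
        ... | false = Y<w i
        L = map ι (pairs D lo hi 0)
        col : colour L ≡ c₀
        col = c₀-hom L (nth-⊆ 0 Yl (pairs-increasing D lo hi 0 lo<hi hi<w)
                (All.map (λ (_ , b) → subst (_ <_) (sym Yl-len) b) (pairs-bounds D lo hi 0 lo<hi hi<w)))
                (trans (length-map ι (pairs D lo hi 0)) (length-pairs D lo hi 0))
        src : P X ≡ source j L
        src = point-cong λ i i<D → trans (cong ι (cong (i * w +_) (pick i))) (sym (side-pairs ι (i ℕ.<ᵇ j) D lo hi 0 i i<D))
          where pick : ∀ i → X i ≡ (if i ℕ.<ᵇ j then hi i else lo i)
                pick i with i ℕ.<ᵇ j
                ... | true = refl
                ... | false = refl
        tgt : P Y ≡ target j L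
        tgt = point-cong λ i i<D → trans (cong ι (cong (i * w +_) (pick i))) (sym (side-pairs ι (not (i ℕ.<ᵇ j)) D lo hi 0 i i<D))
          where pick : ∀ i → Y i ≡ (if not (i ℕ.<ᵇ j) then hi i else lo i)
                pick i with i ℕ.<ᵇ j
                ... | true = refl
                ... | false = refl
        decided : ∀ d → (ψ (P X) ℕ.<ᵇ ψ (P Y)) ≡ bitAt {j} d
        decided (no ¬h) = contradiction (s≤s j≤D) ¬h
        decided (yes h) = untoBit (ψ (P X) ℕ.<ᵇ ψ (P Y)) (bit₀ (fromℕ< h)) (trans
          (trans (cong₂ (λ a b → toBit (ψ a ℕ.<ᵇ ψ b)) src tgt)
            (cong (λ j → toBit (ψ (source j L) ℕ.<ᵇ ψ (target j L))) (sym (Finₚ.toℕ-fromℕ< h))))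
          (bits-homogeneous L (fromℕ< h) col))

      all-0 all-1 : ℕ → ℕ
      all-0 _ = 0
      all-1 _ = 1

      -- Exchanging the two points turns the threshold 0 into the threshold `D`, and an injective
      -- `ψ` answers the two comparisons differently. Somewhere between 0 and `D` the bit must
      -- therefore change; that coordinate governs the order.
      bit-ends : bit 0 ≢ bit D
      bit-ends e = separated (ψ-injective (≤-antisym
          (≮⇒≥ λ q → <-asym q (<ᵇ-true⁻¹ (trans (sym agree) (<ᵇ-true q))))
          (≮⇒≥ λ q → <-asym q (<ᵇ-true⁻¹ (trans agree (<ᵇ-true q))))))
        where
        0<w : ∀ (i : ℕ) → 0 < w
        0<w _ = s≤s z≤n
        1<w : ∀ (i : ℕ) → 1 < w
        1<w _ = s≤s (s≤s z≤n)
        e₀ : (ψ (P all-0) ℕ.<ᵇ ψ (P all-1)) ≡ bit 0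
        e₀ = bit-spec 0 z≤n all-0 all-1 0<w 1<w (λ i ()) (λ i _ → s≤s z≤n)
        e₁ : (ψ (P all-1) ℕ.<ᵇ ψ (P all-0)) ≡ bit D
        -- `bit-spec` compares the entries at all indices from `j` on, hence also beyond the grid.
        -- The second point gets the value 2 there, which `point` does not see.
        e₁ = trans (cong₂ (λ a b → ψ a ℕ.<ᵇ ψ b) refl (point-cong {λ i → ι (i * w + all-0 i)} {λ i → ι (i * w + (if i ℕ.<ᵇ D then 0 else 2))}
               (λ i i<D → cong (λ b → ι (i * w + (if b then 0 else 2))) (sym (<ᵇ-true i<D)))))
             (bit-spec D ≤-refl all-1 (λ i → if i ℕ.<ᵇ D then 0 else 2) 1<w (λ i → bnd (i ℕ.<ᵇ D))
               (λ i i<D → subst (λ b → (if b then 0 else 2) < 1) (sym (<ᵇ-true i<D)) (s≤s z≤n))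
               (λ i D≤i → subst (λ b → 1 < (if b then 0 else 2)) (sym (<ᵇ-false D≤i)) ≤-refl))
          where bnd : ∀ b → (if b then 0 else 2) < w
                bnd true = s≤s z≤n
                bnd false = s≤s (s≤s (s≤s z≤n))
        agree : (ψ (P all-0) ℕ.<ᵇ ψ (P all-1)) ≡ (ψ (P all-1) ℕ.<ᵇ ψ (P all-0))
        agree = trans e₀ (trans e (sym e₁))
        separated : P all-1 ≢ P all-0
        separated q = <-irrefl (trans (sym (coordinate-P all-0 0<w fzero)) (trans (cong (coordinate fzero) (sym q)) (coordinate-P all-1 1<w fzero)))
          (ι-mono {0} {1} (s≤s z≤n) (offset<m {0} {1} (s≤s z≤n) (1<w 0)))

      change : ∀ n → bit 0 ≢ bit n → ∃[ j ] (j < n × bit j ≢ bit (suc j))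
      change zero h = contradiction refl h
      change (suc n) h with Data.Bool.Properties._≟_ (bit n) (bit (suc n))
      ... | no ne = n , ≤-refl , ne
      ... | yes e = let j , j<n , ne = change n (λ q → h (trans q e)) in j , m≤n⇒m≤1+n j<n , ne

      -- abstracting over the bits keeps the Ramsey colouring from being unfolded
      module Dictator (bit : ℕ → Bool)
        (bit-spec : ∀ j → j ≤ D → ∀ X Y → (∀ i → X i < w) → (∀ i → Y i < w) →
          (∀ i → i < j → Y i < X i) → (∀ i → j ≤ i → X i < Y i) → (ψ (P X) ℕ.<ᵇ ψ (P Y)) ≡ bit j)
        (j₀ : ℕ) (j₀<D : j₀ < D) (change-j₀ : bit j₀ ≢ bit (suc j₀)) where

        offsetAt : ℕ → ∀ {i} → Dec (i < D) → ℕ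
        offsetAt t (yes h) = suc (2 * position (fromℕ< h) t)
        -- A value beyond the grid that obeys the same bounds as a true offset.
        offsetAt t (no _) = 1

        offsets : ℕ → ℕ → ℕ
        offsets t i = offsetAt t (i <? D)

        offsets-eq : ∀ t i → offsets t (toℕ i) ≡ suc (2 * position i t)
        offsets-eq t i = decided (toℕ i <? D)
          where
          decided : ∀ d → offsetAt t {toℕ i} d ≡ suc (2 * position i t)
          decided (yes h) = cong (λ i → suc (2 * position i t)) (Finₚ.fromℕ<-toℕ i h)
          decided (no ¬h) = contradiction (Finₚ.toℕ<n i) ¬h

        offsets-bounds : ∀ {t} → t ∈ vertices labels → ∀ i → 0 < offsets t i × suc (offsets t i) < w
        offsets-bounds {t} t∈ i = decided (i <? D)
          where
          decided : ∀ d → 0 < offsetAt t {i} d × suc (offsetAt t {i} d) < w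
          decided (yes h) = s≤s z≤n , room (position (fromℕ< h) t) (2 + (k + k)) (position-< (fromℕ< h) t∈)
          decided (no _) = s≤s z≤n , room 0 (2 + (k + k)) (s≤s z≤n)

        -- The point y lies between x and z in coordinate j₀ and on one side of both elsewhere; it witnesses that j₀ decides the order.
        dictator : ∀ X Z → (∀ i → 0 < X i × suc (X i) < w) → (∀ i → 0 < Z i × suc (Z i) < w) → X j₀ + 1 < Z j₀ →
          (bit j₀ ≡ true → ψ (P X) < ψ (P Z)) × (bit j₀ ≡ false → ψ (P Z) < ψ (P X))
        dictator X Z X-bds Z-bds lt = forward , backward
          where
          Y : ℕ → ℕ
          Y i = if i ℕ.<ᵇ j₀ then 0 else (if i == j₀ then X j₀ + 1 else w ∸ 1)
          Y-before : ∀ {i} → i < j₀ → Y i ≡ 0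
          Y-before h rewrite <ᵇ-true h = refl
          Y-at : Y j₀ ≡ X j₀ + 1
          Y-at rewrite <ᵇ-false (≤-refl {j₀}) | ==-refl j₀ = refl
          Y-after : ∀ {i} → j₀ < i → Y i ≡ w ∸ 1
          Y-after {i} h rewrite <ᵇ-false (<⇒≤ h) | ==-false {i} {j₀} (λ e → <-irrefl (sym e) h) = refl
          Y<w : ∀ i → Y i < w
          Y<w i = by (<-cmp i j₀)
            where
            by : Tri (i < j₀) (i ≡ j₀) (j₀ < i) → Y i < w
            by (tri< a _ _) = subst (_< w) (sym (Y-before a)) (s≤s z≤n)
            by (tri≈ _ e _) = subst (λ i → Y i < w) (sym e) (subst (_< w) (sym Y-at) (<-trans lt (<-trans (n<1+n _) (proj₂ (Z-bds j₀)))))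
            by (tri> _ _ c) = subst (_< w) (sym (Y-after c)) ≤-refl
          e₁ : (ψ (P X) ℕ.<ᵇ ψ (P Y)) ≡ bit j₀
          e₁ = bit-spec j₀ (<⇒≤ j₀<D) X Y (λ i → <-trans (n<1+n _) (proj₂ (X-bds i))) Y<w
            (λ i h → subst (_< X i) (sym (Y-before h)) (proj₁ (X-bds i))) above
            where
            above : ∀ i → j₀ ≤ i → X i < Y i
            above i h with m≤n⇒m<n∨m≡n h
            ... | inj₁ lt′ = subst (X i <_) (sym (Y-after lt′)) (≤-pred (proj₂ (X-bds i)))
            ... | inj₂ refl = subst (X i <_) (sym Y-at) (≤-reflexive (+-comm 1 (X i)))
          e₂ : (ψ (P Z) ℕ.<ᵇ ψ (P Y)) ≡ bit (suc j₀)
          e₂ = bit-spec (suc j₀) j₀<D Z Y (λ i → <-trans (n<1+n _) (proj₂ (Z-bds i))) Y<w below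
            (λ i h → subst (Z i <_) (sym (Y-after h)) (≤-pred (proj₂ (Z-bds i))))
            where
            below : ∀ i → i < suc j₀ → Y i < Z i
            below i (s≤s h) with m≤n⇒m<n∨m≡n h
            ... | inj₁ lt′ = subst (_< Z i) (sym (Y-before lt′)) (proj₁ (Z-bds i))
            ... | inj₂ refl = subst (_< Z i) (sym Y-at) lt
          forward : bit j₀ ≡ true → ψ (P X) < ψ (P Z)
          forward q = <-≤-trans (<ᵇ-true⁻¹ {ψ (P X)} {ψ (P Y)} (trans e₁ q)) (≮⇒≥ λ r → change-j₀ (trans q (trans (sym (<ᵇ-true r)) e₂)))
          backward : bit j₀ ≡ false → ψ (P Z) < ψ (P X)
          backward q = <-≤-trans (<ᵇ-true⁻¹ {ψ (P Z)} {ψ (P Y)} (trans e₂ (flip (bit j₀) (bit (suc j₀)) q change-j₀))) (≮⇒≥ λ r → contradiction (trans (sym q) (trans (sym e₁) (<ᵇ-true r))) λ ())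
            where flip : ∀ a b → a ≡ false → a ≢ b → b ≡ true
                  flip false true _ _ = refl
                  flip false false _ ne = contradiction refl ne

        fpt : ℕ → Fin (N ^ D)
        fpt t = P (offsets t)

        j : Fin D
        j = fromℕ< j₀<D

        gap : ∀ {s t} → position j s < position j t → offsets s j₀ + 1 < offsets t j₀
        gap {s} {t} h = subst₂ (λ a b → a + 1 < b) (sym (at s)) (sym (at t)) (odd (position j s) (position j t) h)
          where
          at : ∀ t → offsets t j₀ ≡ suc (2 * position j t)
          at t = trans (cong (offsets t) (sym (Finₚ.toℕ-fromℕ< j₀<D))) (offsets-eq t j)
          odd : ∀ p q → p < q → suc (2 * p) + 1 < suc (2 * q)
          odd p q h = s≤s (≤-trans (≤-reflexive (lem p)) (*-monoʳ-≤ 2 h))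
            where lem : ∀ p → suc (2 * p) + 1 ≡ 2 * suc p
                  lem = solve-∀

        g₀ : Gadget (Fin (N ^ D))
        g₀ = mapᵍ fpt labels

        AllPairs-∈ : ∀ {A : Set} {R S : A → A → Set} {xs} → (∀ {a b} → a ∈ xs → b ∈ xs → R a b → S a b) → AllPairs R xs → AllPairs S xs
        AllPairs-∈ {A} {R} {S} f [] = []
        AllPairs-∈ {A} {R} {S} {x ∷ xs} f (h ∷ hs) = All.tabulate (λ y∈ → f (here refl) (there y∈) (All.lookup h y∈))
          ∷ AllPairs-∈ (λ a∈ b∈ → f (there a∈) (there b∈)) hs

        ∈-labels : ∀ i {t} → t ∈ order i → t ∈ vertices labels
        ∈-labels i = ↭ₚ.∈-resp-↭ (arrange²-↭ (proj₁ (pattern′ i)) (proj₂ (pattern′ i)) labels)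

        lengths : length (rest g₀) ≡ k × length (rest′ g₀) ≡ k
        lengths = trans (length-map fpt (applyUpTo (2 +_) k)) (length-applyUpTo (2 +_) k) , trans (length-map fpt (applyUpTo (2 + k +_) k)) (length-applyUpTo (2 + k +_) k)

        increasing : ∀ i → Increasing (map (coordinate i) (arrange² (proj₁ (pattern′ i)) (proj₂ (pattern′ i)) g₀))
        increasing i = subst (λ l → Increasing (map (coordinate i) l)) (map-arrange² fpt (proj₁ (pattern′ i)) (proj₂ (pattern′ i)) labels)
          (AllPairsₚ.map⁺ (AllPairsₚ.map⁺ (AllPairs-∈ (λ s∈ t∈ h → step (∈-labels i s∈) (∈-labels i t∈) h) (indexOf-increasing (order-unique i)))))
          where
          bd : ∀ {t} → t ∈ vertices labels → ∀ i → offsets t i < w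
          bd t∈ i = <-trans (n<1+n _) (proj₂ (offsets-bounds t∈ i))
          step : ∀ {s t} → s ∈ vertices labels → t ∈ vertices labels → position i s < position i t → coordinate i (fpt s) < coordinate i (fpt t)
          step {s} {t} s∈ t∈ h = subst₂ _<_ (sym (coordinate-P (offsets s) (bd s∈) i)) (sym (coordinate-P (offsets t) (bd t∈) i))
            (ι-mono (+-monoʳ-< (toℕ i * w) (subst₂ _<_ (sym (offsets-eq s i)) (sym (offsets-eq t i)) (s≤s (*-monoʳ-< 2 h))))
                    (offset<m (Finₚ.toℕ<n i) (bd t∈ (toℕ i))))

        monotone : AllPairs (λ a b → ψ a < ψ b) (arrange² (proj₁ (pattern′ j)) (proj₂ (pattern′ j)) g₀) ⊎
                   AllPairs (λ a b → ψ b < ψ a) (arrange² (proj₁ (pattern′ j)) (proj₂ (pattern′ j)) g₀)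
        monotone = by (bit j₀) refl
          where
          by : ∀ b → bit j₀ ≡ b → AllPairs (λ a b → ψ a < ψ b) (arrange² (proj₁ (pattern′ j)) (proj₂ (pattern′ j)) g₀) ⊎
                 AllPairs (λ a b → ψ b < ψ a) (arrange² (proj₁ (pattern′ j)) (proj₂ (pattern′ j)) g₀)
          by true eq = inj₁ (subst (AllPairs (λ a b → ψ a < ψ b)) (map-arrange² fpt (proj₁ (pattern′ j)) (proj₂ (pattern′ j)) labels)
                       (AllPairsₚ.map⁺ (AllPairs-∈ (λ s∈ t∈ h → proj₁ (dictator _ _ (offsets-bounds (∈-labels j s∈)) (offsets-bounds (∈-labels j t∈)) (gap h)) eq) (indexOf-increasing (order-unique j)))))
          by false eq = inj₂ (subst (AllPairs (λ a b → ψ b < ψ a)) (map-arrange² fpt (proj₁ (pattern′ j)) (proj₂ (pattern′ j)) labels)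
                       (AllPairsₚ.map⁺ (AllPairs-∈ (λ s∈ t∈ h → proj₂ (dictator _ _ (offsets-bounds (∈-labels j s∈)) (offsets-bounds (∈-labels j t∈)) (gap h)) eq) (indexOf-increasing (order-unique j)))))

        found : ∃[ g ] ((length (rest g) ≡ k × length (rest′ g) ≡ k) ×
          (∀ i → Increasing (map (coordinate i) (arrange² (proj₁ (pattern′ i)) (proj₂ (pattern′ i)) g))) × ¬ Consistent ψ g)
        found = g₀ , lengths , increasing ,
          inconsistent ψ (proj₁ (valid j)) (proj₁ (proj₂ (valid j))) (proj₂ (proj₂ (valid j))) g₀ (proj₁ lengths) (proj₂ lengths) monotone

    grid-gadget : ∃[ g ] ((length (rest g) ≡ k × length (rest′ g) ≡ k) ×
      (∀ i → Increasing (map (coordinate i) (arrange² (proj₁ (pattern′ i)) (proj₂ (pattern′ i)) g))) × ¬ Consistent ψ g)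
    grid-gadget = let j , j<D , ne = change D bit-ends in Dictator.found bit bit-spec j j<D ne

-- A sparse gadget system, chosen greedily

private
  survivors : ∀ {X Y : Set} (hit : X → Y → Bool) c (ys : List Y) → ∑ ys (𝟙 ∘ hit c) + length (filterᵇ (not ∘ hit c) ys) ≡ length ys
  survivors hit c [] = refl
  survivors hit c (y ∷ ys) with hit c y
  ... | true = cong suc (survivors hit c ys)
  ... | false = trans (+-suc _ _) (cong suc (survivors hit c ys))

  ∈-filterᵇ : ∀ (p : A → Bool) {x xs} → x ∈ xs → p x ≡ true → x ∈ filterᵇ p xs
  ∈-filterᵇ p {xs = y ∷ xs} (here refl) h rewrite h = here refl
  ∈-filterᵇ p {xs = y ∷ xs} (there x∈) h with p y
  ... | true = there (∈-filterᵇ p x∈ h)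
  ... | false = ∈-filterᵇ p x∈ h

  filterᵇ-∈ : ∀ (p : A → Bool) {x} xs → x ∈ filterᵇ p xs → x ∈ xs
  filterᵇ-∈ p xs x∈ = Sub.lookup (filterᵇ-⊆ p xs) x∈

-- Each test is hit by at least h of the G h candidates, and each candidate forbids at most b others.
module Greedy {X Y : Set} (candidates : List X) (hit : X → Y → Bool) (forbids : X → X → Bool) (G h b M : ℕ)
  (G>0 : 0 < G) (size : length candidates ≡ G * h) (h>0 : 0 < h)
  (few : ∀ c → c ∈ candidates → ∑ candidates (𝟙 ∘ forbids c) ≤ b) (budget : 2 * (M * b) ≤ h) where

  Compatible : List X → X → Set
  Compatible cs c = All (λ c′ → forbids c′ c ≡ false) cs

  private
    allowed : List X → X → Bool
    allowed cs c = all cs (λ c′ → not (forbids c′ c))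

    disallowed : ∀ cs → All (_∈ candidates) cs → ∑ candidates (𝟙 ∘ not ∘ allowed cs) ≤ length cs * b
    disallowed [] [] = ≤-reflexive (∑-0 candidates)
    disallowed (c ∷ cs) (c∈ ∷ cs∈) = begin
      ∑ candidates (𝟙 ∘ not ∘ allowed (c ∷ cs)) ≤⟨ ∑-mono candidates (λ x → de-morgan (forbids c x) (allowed cs x)) ⟩
      ∑ candidates (λ x → 𝟙 (forbids c x) + 𝟙 (not (allowed cs x))) ≡⟨ ∑-+ candidates _ _ ⟩
      ∑ candidates (𝟙 ∘ forbids c) + ∑ candidates (𝟙 ∘ not ∘ allowed cs) ≤⟨ +-mono-≤ (few c c∈) (disallowed cs cs∈) ⟩
      b + length cs * b ∎
      where
      open ≤-Reasoning
      de-morgan : ∀ p q → 𝟙 (not (not p ∧ q)) ≤ 𝟙 p + 𝟙 (not q)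
      de-morgan true q = s≤s z≤n
      de-morgan false q = ≤-refl

    allowed-compatible : ∀ cs c → allowed cs c ≡ true → Compatible cs c
    allowed-compatible [] c _ = []
    allowed-compatible (c′ ∷ cs) c e with forbids c′ c in eq
    ... | false = eq ∷ allowed-compatible cs c e

    -- The chosen candidates forbid at most `M * b` others, which is at most half of `h`. Every
    -- uncovered test is thus hit by at least `h / 2` allowed candidates out of `G * h`, and on
    -- average a candidate hits one part in `2 * G` of the tests while being allowed.
    best : ∀ cs ys → All (_∈ candidates) cs → length cs ≤ M → 0 < length ys → (∀ y → y ∈ ys → h ≤ ∑ candidates (λ c → 𝟙 (hit c y))) →
      ∃[ c ] (c ∈ candidates × Compatible cs c × length ys ≤ 2 * G * ∑ ys (𝟙 ∘ hit c))
    best cs ys cs∈ len ne hits = c , c∈ , allowed-compatible cs c ok , enough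
      where
      open ≤-Reasoning
      score : X → ℕ
      score c = 𝟙 (allowed cs c) * ∑ ys (𝟙 ∘ hit c)
      each : ∀ y → y ∈ ys → h ≤ ∑ candidates (λ c → 𝟙 (allowed cs c) * 𝟙 (hit c y)) + M * b
      each y y∈ = begin
        h ≤⟨ hits y y∈ ⟩
        ∑ candidates (λ c → 𝟙 (hit c y)) ≤⟨ ∑-mono candidates (λ c → either (allowed cs c) (hit c y)) ⟩
        ∑ candidates (λ c → 𝟙 (allowed cs c) * 𝟙 (hit c y) + 𝟙 (not (allowed cs c))) ≡⟨ ∑-+ candidates _ _ ⟩
        ∑ candidates (λ c → 𝟙 (allowed cs c) * 𝟙 (hit c y)) + ∑ candidates (𝟙 ∘ not ∘ allowed cs)
          ≤⟨ +-monoʳ-≤ (∑ candidates (λ c → 𝟙 (allowed cs c) * 𝟙 (hit c y))) (≤-trans (disallowed cs cs∈) (*-monoˡ-≤ b len)) ⟩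
        ∑ candidates (λ c → 𝟙 (allowed cs c) * 𝟙 (hit c y)) + M * b ∎
        where
        either : ∀ p q → 𝟙 q ≤ 𝟙 p * 𝟙 q + 𝟙 (not p)
        either true q = ≤-reflexive (sym (trans (+-identityʳ _) (+-identityʳ (𝟙 q))))
        either false q = 𝟙≤1 q
      total : length ys * h ≤ ∑ candidates score + length ys * (M * b)
      total = begin
        length ys * h ≡⟨ sym (∑-const ys h) ⟩
        ∑ ys (λ _ → h) ≤⟨ ∑-mono∈ ys each ⟩
        ∑ ys (λ y → ∑ candidates (λ c → 𝟙 (allowed cs c) * 𝟙 (hit c y)) + M * b) ≡⟨ trans (∑-+ ys _ _) (cong₂ _+_ (∑-swap ys candidates _) (∑-const ys (M * b))) ⟩
        ∑ candidates (λ c → ∑ ys (λ y → 𝟙 (allowed cs c) * 𝟙 (hit c y))) + length ys * (M * b)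
          ≡⟨ cong (_+ length ys * (M * b)) (∑-cong candidates (λ c → ∑-* ys (𝟙 (allowed cs c)) _)) ⟩
        ∑ candidates score + length ys * (M * b) ∎
      half : length ys * h ≤ 2 * ∑ candidates score
      half = +-cancelʳ-≤ (length ys * h) _ _ (begin
        length ys * h + length ys * h ≤⟨ +-mono-≤ total total ⟩
        (∑ candidates score + length ys * (M * b)) + (∑ candidates score + length ys * (M * b)) ≡⟨ lem (∑ candidates score) (length ys) (M * b) ⟩
        2 * ∑ candidates score + length ys * (2 * (M * b)) ≤⟨ +-monoʳ-≤ (2 * ∑ candidates score) (*-monoʳ-≤ (length ys) budget) ⟩
        2 * ∑ candidates score + length ys * h ∎)
        where lem : ∀ a b c → (a + b * c) + (a + b * c) ≡ 2 * a + b * (2 * c)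
              lem = solve-∀
      heavy : ∃[ c ] (c ∈ candidates × length ys * h ≤ length candidates * (2 * score c))
      heavy = ∑-avg-≥ candidates (λ c → 2 * score c) (length ys * h) (*-mono-≤ ne h>0) (≤-trans half (≤-reflexive (sym (∑-* candidates 2 score))))
      c = proj₁ heavy
      c∈ = proj₁ (proj₂ heavy)
      good : length ys ≤ 2 * G * score c
      good = *-cancelʳ-≤ _ _ h {{ℕ.>-nonZero h>0}} (≤-trans (proj₂ (proj₂ heavy)) (≤-reflexive (trans (cong (_* (2 * score c)) size) (lem G h (score c)))))
        where lem : ∀ G h s → G * h * (2 * s) ≡ 2 * G * s * h
              lem = solve-∀
      by : ∀ a → allowed cs c ≡ a → allowed cs c ≡ true × length ys ≤ 2 * G * ∑ ys (𝟙 ∘ hit c)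
      by true e = e , subst (λ s → length ys ≤ 2 * G * s) (trans (cong (λ a → 𝟙 a * ∑ ys (𝟙 ∘ hit c)) e) (+-identityʳ _)) good
      by false e = contradiction (≤-trans ne (subst (λ s → length ys ≤ 2 * G * s) (cong (λ a → 𝟙 a * ∑ ys (𝟙 ∘ hit c)) e) good)) λ q → contradiction (≤-trans q (≤-reflexive (*-zeroʳ (2 * G)))) λ ()
      ok = proj₁ (by (allowed cs c) refl)
      enough = proj₂ (by (allowed cs c) refl)

    Cover : List X → List Y → Set
    Cover cs ys = ∃[ ds ] (All (_∈ candidates) ds × AllPairs (λ c c′ → forbids c′ c ≡ false) ds × All (λ d → d ∈ cs ⊎ ∃[ y ] (y ∈ ys × hit d y ≡ true)) ds ×
               (∀ {c} → c ∈ cs → c ∈ ds) × (∀ y → y ∈ ys → ∃[ d ] (d ∈ ds × hit d y ≡ true)))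

    -- Each round leaves at most the fraction `(2 * G - 1) / (2 * G)` of the tests. The last
    -- hypothesis is the invariant of this decay; at `n = 0` it says that fewer than one test is
    -- left.
    rounds : ∀ n cs ys → All (_∈ candidates) cs → AllPairs (λ c c′ → forbids c′ c ≡ false) cs → length cs + n ≤ M →
      (∀ y → y ∈ ys → h ≤ ∑ candidates (λ c → 𝟙 (hit c y))) → length ys * (2 * G ∸ 1) ^ n < (2 * G) ^ n →
      Cover cs ys
    rounds n cs [] cs∈ ap len hits small = cs , cs∈ , ap , All.tabulate inj₁ , id , λ y ()
    rounds zero cs (y ∷ ys) cs∈ ap len hits (s≤s ())
    rounds (suc n) cs ys@(y₀ ∷ _) cs∈ ap len hits small = add (best cs ys cs∈ (≤-trans (m≤m+n _ _) len) (s≤s z≤n) hits)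
     where
     add : ∃[ c ] (c ∈ candidates × Compatible cs c × length ys ≤ 2 * G * ∑ ys (𝟙 ∘ hit c)) → Cover cs ys
     add (c , c∈ , compat , enough) = extend (rounds n (c ∷ cs) (filterᵇ (not ∘ hit c) ys) (c∈ ∷ cs∈) (compat ∷ ap)
            (≤-trans (≤-reflexive (sym (+-suc (length cs) n))) len) (λ y y∈ → hits y (filterᵇ-∈ (not ∘ hit c) ys y∈)) shrink)
      where
      open ≤-Reasoning
      rem = length (filterᵇ (not ∘ hit c) ys)
      g = 2 * G
      1≤g : 1 ≤ g
      1≤g = ≤-trans G>0 (m≤m+n G _)
      one : g * rem ≤ (g ∸ 1) * length ys
      one = +-cancelʳ-≤ (length ys) _ _ (begin
        g * rem + length ys ≤⟨ +-monoʳ-≤ (g * rem) enough ⟩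
        g * rem + g * ∑ ys (𝟙 ∘ hit c) ≡⟨ trans (sym (*-distribˡ-+ g rem _)) (cong (g *_) (trans (+-comm rem _) (survivors hit c ys))) ⟩
        g * length ys ≡⟨ cong (_* length ys) (sym (m∸n+n≡m 1≤g)) ⟩
        (g ∸ 1 + 1) * length ys ≡⟨ lem (g ∸ 1) (length ys) ⟩
        (g ∸ 1) * length ys + length ys ∎)
        where lem : ∀ a b → (a + 1) * b ≡ a * b + b
              lem = solve-∀
      shrink : rem * (g ∸ 1) ^ n < g ^ n
      shrink = *-cancelˡ-< g _ _ (begin-strict
        g * (rem * (g ∸ 1) ^ n) ≡⟨ sym (*-assoc g rem _) ⟩
        g * rem * (g ∸ 1) ^ n ≤⟨ *-monoˡ-≤ ((g ∸ 1) ^ n) one ⟩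
        (g ∸ 1) * length ys * (g ∸ 1) ^ n ≡⟨ lem (g ∸ 1) (length ys) ((g ∸ 1) ^ n) ⟩
        length ys * (g ∸ 1) ^ suc n <⟨ small ⟩
        g ^ suc n ∎)
        where lem : ∀ a b c → a * b * c ≡ b * (a * c)
              lem = solve-∀
      c-hits : 0 < ∑ ys (𝟙 ∘ hit c)
      c-hits = pos (∑ ys (𝟙 ∘ hit c)) enough
        where pos : ∀ s → length ys ≤ 2 * G * s → 0 < s
              pos zero e = contradiction (≤-trans e (≤-reflexive (*-zeroʳ (2 * G)))) λ ()
              pos (suc s) e = s≤s z≤n
      reason : ∀ {d} → d ∈ c ∷ cs ⊎ ∃[ y ] (y ∈ filterᵇ (not ∘ hit c) ys × hit d y ≡ true) → d ∈ cs ⊎ ∃[ y ] (y ∈ ys × hit d y ≡ true)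
      reason (inj₁ (here refl)) = let y , y∈ , q = ∑-pos ys (𝟙 ∘ hit c) c-hits in inj₂ (y , y∈ , 𝟙-pos q)
      reason (inj₁ (there q)) = inj₁ q
      reason (inj₂ (y , y∈ , q)) = inj₂ (y , filterᵇ-∈ (not ∘ hit c) ys y∈ , q)
      extend : Cover (c ∷ cs) (filterᵇ (not ∘ hit c) ys) → Cover cs ys
      extend (ds , ds∈ , ap′ , why , keep , cover) = ds , ds∈ , ap′ , All.map reason why , (λ q → keep (there q)) , λ y y∈ → covered y y∈ (hit c y) refl
        where
        covered : ∀ y → y ∈ ys → ∀ b → hit c y ≡ b → ∃[ d ] (d ∈ ds × hit d y ≡ true)
        covered y y∈ true eq = c , keep (here refl) , eq
        covered y y∈ false eq = cover y (∈-filterᵇ (not ∘ hit c) y∈ (cong not eq))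

  greedy : ∀ ys → (∀ y → y ∈ ys → h ≤ ∑ candidates (λ c → 𝟙 (hit c y))) → length ys * (2 * G ∸ 1) ^ M < (2 * G) ^ M →
    ∃[ ds ] (AllPairs (λ c c′ → forbids c′ c ≡ false) ds × All (λ d → ∃[ y ] (y ∈ ys × hit d y ≡ true)) ds ×
             (∀ y → y ∈ ys → ∃[ d ] (d ∈ ds × hit d y ≡ true)))
  greedy ys hits small with rounds M [] ys [] [] ≤-refl hits small
  ... | ds , _ , ap , why , _ , cover = ds , ap , All.map (λ { (inj₂ q) → q }) why , cover

∑-strict : ∀ {xs : List A} {f g : A → ℕ} {x} → x ∈ xs → (∀ y → f y ≤ g y) → f x < g x → ∑ xs f < ∑ xs g
∑-strict {xs = _ ∷ xs} (here refl) h lt = +-mono-<-≤ lt (∑-mono xs h)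
∑-strict {xs = y ∷ xs} (there x∈) h lt = +-mono-≤-< (h y) (∑-strict x∈ h lt)

bernoulli : ∀ n e → n ^ suc e + suc e * n ^ e ≤ suc n ^ suc e
bernoulli n zero = ≤-reflexive (lem n)
  where lem : ∀ n → n * 1 + 1 * 1 ≡ (1 + n) * 1
        lem = solve-∀
bernoulli n (suc e) = begin
  n * n ^ suc e + suc (suc e) * n ^ suc e ≡⟨ lem n (n ^ e) e ⟩
  (1 + n) * (n * n ^ e) + suc e * (n * n ^ e) ≤⟨ m≤m+n _ (suc e * n ^ e) ⟩
  (1 + n) * (n * n ^ e) + suc e * (n * n ^ e) + suc e * n ^ e ≡⟨ lem′ n (n ^ e) (suc e) ⟩
  suc n * (n ^ suc e + suc e * n ^ e) ≤⟨ *-monoʳ-≤ (suc n) (bernoulli n e) ⟩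
  suc n * suc n ^ suc e ∎
  where
  open ≤-Reasoning
  lem : ∀ n p e → n * (n * p) + (2 + e) * (n * p) ≡ (1 + n) * (n * p) + (1 + e) * (n * p)
  lem = solve-∀
  lem′ : ∀ n p e → (1 + n) * (n * p) + e * (n * p) + e * p ≡ (1 + n) * (n * p + e * p)
  lem′ = solve-∀

-- The integer form of `(1 - 1 / g) ^ g ≤ 1 / 2` with `g = suc n`: a block of `2 * G` greedy rounds
-- halves the number of uncovered tests.
halving : ∀ n → 2 * n ^ suc n ≤ suc n ^ suc n
halving n = begin
  2 * n ^ suc n ≡⟨ cong (n ^ suc n +_) (+-identityʳ _) ⟩
  n ^ suc n + n * n ^ n ≤⟨ +-monoʳ-≤ (n ^ suc n) (*-monoˡ-≤ (n ^ n) (n≤1+n n)) ⟩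
  n ^ suc n + suc n * n ^ n ≤⟨ bernoulli n n ⟩
  suc n ^ suc n ∎
  where open ≤-Reasoning

n<2^n : ∀ n → n < 2 ^ n
n<2^n zero = s≤s z≤n
n<2^n (suc n) = +-mono-≤ {1} {2 ^ n} (m^n>0 2 n) (≤-trans (n<2^n n) (m≤m+n _ 0))

-- The number of greedy rounds grows like the logarithm of the number of orders, which brings in a
-- factor linear in `j` when each grid point has `2 ^ j` copies. The blow-up has to outgrow this
-- factor.
linear-exponential : ∀ a b → ∃[ j ] (a + b * j ≤ 2 ^ j)
linear-exponential a b = m + m , (begin
  a + b * (m + m) ≡⟨ lem a b m ⟩
  a + 2 * b * m ≤⟨ +-mono-≤ (m≤m+n a (2 * b)) (*-monoˡ-≤ m (m≤n+m (2 * b) a)) ⟩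
  m + m * m ≤⟨ *-monoˡ-≤ m (≤-refl {suc m}) ⟩
  suc m * m ≤⟨ *-monoʳ-≤ (suc m) (n≤1+n m) ⟩
  suc m * suc m ≤⟨ *-mono-≤ (n<2^n m) (n<2^n m) ⟩
  2 ^ m * 2 ^ m ≡⟨ sym (^-distribˡ-+-* 2 m m) ⟩
  2 ^ (m + m) ∎)
  where
  open ≤-Reasoning
  m = a + 2 * b
  lem : ∀ a b m → a + b * (m + m) ≡ a + 2 * b * m
  lem = solve-∀

roleUnder-map : ∀ {A A′ : Set} (f : A → A′) (ψ : A′ → ℕ) u v E → roleUnder ψ (f u) (f v) (map f E) ≡ roleUnder (ψ ∘ f) u v E
roleUnder-map f ψ u v E = cong₂ _,_ (∑-map f E _) (∑-map f E _)

roleUnder-cong : ∀ {A : Set} {ψ ψ′ : A → ℕ} → (∀ a b → (ψ a ℕ.<ᵇ ψ b) ≡ (ψ′ a ℕ.<ᵇ ψ′ b)) → ∀ u v E → roleUnder ψ u v E ≡ roleUnder ψ′ u v E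
roleUnder-cong h u v E = cong₂ _,_ (∑-cong E λ e → cong₂ (λ a b → 𝟙 a * 𝟙 b) (h e u) (h e v))
  (∑-cong E λ e → cong₂ (λ a b → 𝟙 a * 𝟙 (not b) + 𝟙 (not a) * 𝟙 b) (h e u) (h e v))

vertices-mapᵍ : ∀ {A A′ : Set} (f : A → A′) g → vertices (mapᵍ f g) ≡ map f (vertices g)
vertices-mapᵍ f (gadget u v E E′) = cong (λ l → f u ∷ f v ∷ l) (sym (map-++ f E E′))

nth-map-allFin : ∀ {n} (f : Fin n → ℕ) (v : Fin n) → nth 0 (map f (allFin n)) (toℕ v) ≡ f v
nth-map-allFin {suc n} f fzero = refl
nth-map-allFin {suc n} f (fsuc v) = trans (cong (λ l → nth 0 (map f l) (toℕ v)) (sym (map-tabulate id fsuc)))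
  (trans (cong (λ l → nth 0 l (toℕ v)) (sym (map-∘ (allFin n)))) (nth-map-allFin (f ∘ fsuc) v))

replicate-∈ₜ : ∀ {A : Set} {L : List A} {n} (x : List A) → length x ≡ n → All (_∈ L) x → Pointwise _∈_ x (replicate n L)
replicate-∈ₜ [] refl [] = []
replicate-∈ₜ (v ∷ x) refl (a ∷ h) = a ∷ replicate-∈ₜ x refl h

length-replicate-box : ∀ {A : Set} (L : List A) n → All (λ B → length B ≡ length L) (replicate n L)
length-replicate-box L zero = []
length-replicate-box L (suc n) = refl ∷ length-replicate-box L n

nth-replicate-box : ∀ {A : Set} (L : List A) n {i} → i < n → nth [] (replicate n L) i ≡ L
nth-replicate-box L n h = nth-replicate [] L n h

-- Consistency depends only on comparisons. Replacing an order by its ranks, which are below `n`,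
-- leaves finitely many orders to be treated as tests by the greedy choice.
module Compression {n : ℕ} (ψ : Fin n → ℕ) (ψ-injective : ∀ {v w} → ψ v ≡ ψ w → v ≡ w) where

  compressed : Fin n → ℕ
  compressed v = ∑ (allFin n) (λ y → 𝟙 (ψ y ℕ.<ᵇ ψ v))

  compressed-mono : ∀ {v w} → ψ v < ψ w → compressed v < compressed w
  compressed-mono {v} {w} h = ∑-strict (∈ₚ.∈-allFin v) (λ y → 𝟙-mono λ e → <ᵇ-true (<-trans (<ᵇ-true⁻¹ {ψ y} e) h))
    (subst₂ (λ a b → 𝟙 a < 𝟙 b) (sym (<ᵇ-false (≤-refl {ψ v}))) (sym (<ᵇ-true h)) (s≤s z≤n))

  compressed< : ∀ v → compressed v < n
  compressed< v = ≤-trans (∑-strict (∈ₚ.∈-allFin v) (λ y → 𝟙≤1 (ψ y ℕ.<ᵇ ψ v)) (subst (λ a → 𝟙 a < 1) (sym (<ᵇ-false (≤-refl {ψ v}))) (s≤s z≤n)))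
    (≤-reflexive (trans (sym (length-∑ (allFin n))) (length-tabulate {n = n} id)))

  -- the second summand breaks ties, so that arbitrary lists give injective orders
  compression-agrees : ∀ v w → (ψ v ℕ.<ᵇ ψ w) ≡ (compressed v * n + toℕ v ℕ.<ᵇ compressed w * n + toℕ w)
  compression-agrees v w = bool-iff (λ e → <ᵇ-true (strict (<ᵇ-true⁻¹ {ψ v} e))) (λ e → <ᵇ-true (back (<ᵇ-true⁻¹ {compressed v * n + toℕ v} e)))
    where
    strict : ∀ {v w} → ψ v < ψ w → compressed v * n + toℕ v < compressed w * n + toℕ w
    strict {v} {w} h = ≤-trans (≤-trans (+-monoʳ-< (compressed v * n) (Finₚ.toℕ<n v)) (≤-reflexive (+-comm (compressed v * n) n)))
      (≤-trans (*-monoˡ-≤ n (compressed-mono h)) (m≤m+n _ _))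
    back : compressed v * n + toℕ v < compressed w * n + toℕ w → ψ v < ψ w
    back h with <-cmp (ψ v) (ψ w)
    ... | tri< a _ _ = a
    ... | tri≈ _ e _ = contradiction h (<-irrefl (cong (λ v → compressed v * n + toℕ v) (ψ-injective e)))
    ... | tri> _ _ c = contradiction h (<-asym (strict c))

isIncreasing : List ℕ → Bool
isIncreasing [] = true
isIncreasing (i ∷ is) = all is (i ℕ.<ᵇ_) ∧ isIncreasing is

isIncreasing-sound : ∀ is → isIncreasing is ≡ true → Increasing is
isIncreasing-sound [] _ = []
isIncreasing-sound (i ∷ is) h = All.tabulate (λ {j} j∈ → <ᵇ-true⁻¹ (all-∈ (∧-trueˡ h) j∈)) ∷ isIncreasing-sound is (∧-trueʳ {all is (i ℕ.<ᵇ_)} h)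

isIncreasing-complete : ∀ {is} → Increasing is → isIncreasing is ≡ true
isIncreasing-complete [] = refl
isIncreasing-complete {i ∷ is} (a ∷ h) = ∧-true (∈-all is λ j∈ → <ᵇ-true (All.lookup a j∈)) (isIncreasing-complete h)

not-true : ∀ {b} → not b ≡ true → b ≡ false
not-true {false} _ = refl

-- Each of the `p` grid points is blown up to `t` copies. A spread selects one copy of every grid
-- point, and so a copy of the whole grid; a candidate is a shape of gadget placed in a spread, and
-- the tests are the orders of all `p * t` vertices.
module Construction (k D : ℕ) (pattern′ : Fin D → Role × Role) (N p : ℕ) (coordinateᶠ : Fin D → Fin p → Fin N) (i₀ : Fin D)
  (grid-gadget : ∀ (ψ : Fin p → ℕ) → (∀ {x y} → ψ x ≡ ψ y → x ≡ y) → ∃[ g ] ((length (rest g) ≡ k × length (rest′ g) ≡ k) ×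
      (∀ i → Increasing (map (λ x → toℕ (coordinateᶠ i x)) (arrange² (proj₁ (pattern′ i)) (proj₂ (pattern′ i)) g))) × ¬ Consistent ψ g)) where

  private
    coordinate : Fin D → Fin p → ℕ
    coordinate i x = toℕ (coordinateᶠ i x)

  private
    rests : List (List (Fin p))
    rests = tuples (replicate k (allFin p))

    shapes₂ : Fin p → Fin p → List (Fin p) → List (Gadget (Fin p))
    shapes₂ u v E = map (gadget u v E) rests

    shapes₁ : Fin p → Fin p → List (Gadget (Fin p))
    shapes₁ u v = concatMap (shapes₂ u v) rests

    shapes₀ : Fin p → List (Gadget (Fin p))
    shapes₀ u = concatMap (shapes₁ u) (allFin p)

  abstract
    shapes : List (Gadget (Fin p))
    shapes = concatMap shapes₀ (allFin p)

    ∈-shapes : ∀ {g} → length (rest g) ≡ k → length (rest′ g) ≡ k → g ∈ shapes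
    ∈-shapes {gadget u v E E′} l l′ = ∈ₚ.∈-concatMap⁺ shapes₀ (lose (∈ₚ.∈-allFin u) (∈ₚ.∈-concatMap⁺ (shapes₁ u) (lose (∈ₚ.∈-allFin v)
      (∈ₚ.∈-concatMap⁺ (shapes₂ u v) (lose (tuples-∈ (replicate-∈ₜ E l (All.universal ∈ₚ.∈-allFin E)))
        (∈ₚ.∈-map⁺ (gadget u v E) (tuples-∈ (replicate-∈ₜ E′ l′ (All.universal ∈ₚ.∈-allFin E′)))))))))

    shapes-∈ : ∀ {g} → g ∈ shapes → length (vertices g) ≡ 2 + (k + k)
    shapes-∈ {g} g∈ with find (∈ₚ.∈-concatMap⁻ shapes₀ {xs = allFin p} g∈)
    ... | u , _ , g∈₁ with find (∈ₚ.∈-concatMap⁻ (shapes₁ u) {xs = allFin p} g∈₁)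
    ... | v , _ , g∈₂ with find (∈ₚ.∈-concatMap⁻ (shapes₂ u v) {xs = rests} g∈₂)
    ... | E , E∈ , g∈₃ with ∈ₚ.∈-map⁻ (gadget u v E) g∈₃
    ... | E′ , E′∈ , refl = cong (2 +_) (trans (length-++ E) (cong₂ _+_ (len E∈) (len E′∈)))
      where len : ∀ {E : List (Fin p)} → E ∈ rests → length E ≡ k
            len E∈ = trans (length-∈-tuples (replicate k (allFin p)) E∈) (length-replicate k)

  private
    G = length shapes
    a = 2 + (k + k)

    G>0 : 0 < G
    G>0 with grid-gadget toℕ Finₚ.toℕ-injective
    ... | g , (l , l′) , _ = ∈ₚ.∈-length (∈-shapes {g} l l′)

    -- With `b`, `e` and `M` inserted, `2 * (M * b) ≤ h` reduces to
    -- `K * ((p + j) * p * t + 1) ≤ t * t`; `j` is chosen so that `t = 2 ^ j` satisfies this.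
    K = 4 * (G * G) * (a * a)

    chosen-j = linear-exponential (K * (p * p + 1)) (K * p)
    j = proj₁ chosen-j

  abstract
    t′ : ℕ
    t′ = 2 ^ j ∸ 1

    t≡ : suc t′ ≡ 2 ^ j
    t≡ = m+[n∸m]≡n (m^n>0 2 j)

  private
    t = suc t′
    n′ = p * t

    h = t ^ p
    -- A conflict fixes the copies of two of the `a` points of a gadget, which leaves at most
    -- `t ^ (p ∸ 2)` spreads, each with any of the `G` shapes. There are at most
    -- `2 ^ ((p + j) * n′)` tests, so `e` halvings, of `2 * G` rounds each, cover all of them.
    b = G * (a * a) * t ^ (p ∸ 2)
    e = (p + j) * n′ + 1
    M = 2 * G * e

  place : List (Fin t) → Fin p → Fin n′
  place s x = combine x (nth fzero s (toℕ x))

  place-injective : ∀ s {x y} → place s x ≡ place s y → x ≡ y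
  place-injective s {x} {y} = Finₚ.combine-injectiveˡ x _ y _

  private
    Candidate = Gadget (Fin p) × List (Fin t)

    spreads : List (List (Fin t))
    spreads = tuples (replicate p (allFin t))

    length-spreads : length spreads ≡ h
    length-spreads = trans (vol-^ (replicate p (allFin t)) (length-replicate-box (allFin t) p))
      (cong₂ _^_ (length-tabulate {n = t} id) (length-replicate p))

    candidates : List Candidate
    candidates = concatMap (λ g → map (g ,_) spreads) shapes

    ∑-candidates : ∀ f → ∑ candidates f ≡ ∑ shapes (λ g → ∑ spreads (λ s → f (g , s)))
    ∑-candidates f = trans (∑-concatMap _ shapes f) (∑-cong shapes λ g → ∑-map (g ,_) spreads f)

    length-candidates : length candidates ≡ G * h
    length-candidates = trans (length-∑ candidates) (trans (∑-candidates _) (trans (∑-cong shapes λ g → trans (sym (length-∑ spreads)) length-spreads) (∑-const shapes h)))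

    isValid : Gadget (Fin p) → Bool
    isValid g = (length (rest g) == k) ∧ ((length (rest′ g) == k) ∧
      all (allFin D) (λ i → isIncreasing (map (coordinate i) (arrange² (proj₁ (pattern′ i)) (proj₂ (pattern′ i)) g))))

    order : List ℕ → Fin n′ → ℕ
    order ψ v = nth 0 ψ (toℕ v) * n′ + toℕ v

    order-injective : ∀ ψ {v w} → order ψ v ≡ order ψ w → v ≡ w
    order-injective ψ {v} {w} q = Finₚ.toℕ-injective (remainders (nth 0 ψ (toℕ v)) (nth 0 ψ (toℕ w)) (Finₚ.toℕ<n v) (Finₚ.toℕ<n w) q)
      where
      remainders : ∀ c d {r s n} → r < n → s < n → c * n + r ≡ d * n + s → r ≡ s
      remainders zero zero _ _ q = q
      remainders zero (suc d) {r} {s} {n} r< _ q = contradiction r< (≤⇒≯ (≤-trans (≤-trans (m≤m+n n (d * n)) (m≤m+n _ s)) (≤-reflexive (sym q))))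
      remainders (suc c) zero {r} {s} {n} _ s< q = contradiction s< (≤⇒≯ (≤-trans (≤-trans (m≤m+n n (c * n)) (m≤m+n _ r)) (≤-reflexive q)))
      remainders (suc c) (suc d) {r} {s} {n} r< s< q = remainders c d r< s< (+-cancelˡ-≡ n _ _ (trans (sym (+-assoc n (c * n) r)) (trans q (+-assoc n (d * n) s))))

    isConsistent : (Fin n′ → ℕ) → Gadget (Fin n′) → Bool
    isConsistent ψ g = roleUnder ψ (u g) (v g) (rest g) ≡ʳ roleUnder ψ (u g) (v g) (rest′ g)

    consistent-cong : ∀ {ψ ψ′} → (∀ v w → (ψ v ℕ.<ᵇ ψ w) ≡ (ψ′ v ℕ.<ᵇ ψ′ w)) → ∀ g → Consistent ψ g → isConsistent ψ′ g ≡ true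
    consistent-cong {ψ} {ψ′} agrees (gadget u v E E′) q = trans (cong (roleUnder ψ′ u v E ≡ʳ_)
      (trans (sym (roleUnder-cong {ψ = ψ} {ψ′} agrees u v E′)) (trans (sym q) (roleUnder-cong {ψ = ψ} {ψ′} agrees u v E)))) (≡ʳ-refl (roleUnder ψ′ u v E))

    hit : Candidate → List ℕ → Bool
    hit (g , s) ψ = isValid g ∧ not (isConsistent (order ψ) (mapᵍ (place s) g))

    clash : List (Fin t) → List (Fin t) → Fin p → Fin p → Bool
    clash s s′ x y = not (x ≡ᶠ y) ∧ ((nth fzero s (toℕ x) ≡ᶠ nth fzero s′ (toℕ x)) ∧ (nth fzero s (toℕ y) ≡ᶠ nth fzero s′ (toℕ y)))

    -- Placed vertices coincide only as copies of the same grid point. Two gadgets with two common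
    -- vertices therefore come from spreads that agree at two grid points of the first gadget; the
    -- shape `g′` does not enter.
    forbids : Candidate → Candidate → Bool
    forbids (g , s) (g′ , s′) = any (vertices g) (λ x → any (vertices g) (λ y → clash s s′ x y))

    𝟙-any : ∀ {A : Set} (l : List A) q → 𝟙 (any l q) ≤ ∑ l (𝟙 ∘ q)
    𝟙-any [] q = z≤n
    𝟙-any (x ∷ l) q with q x
    ... | true = s≤s z≤n
    ... | false = 𝟙-any l q

    fixed-two : ∀ x y c d → toℕ x < toℕ y → ∑ spreads (λ s → 𝟙 ((c ≡ᶠ nth fzero s (toℕ x)) ∧ (d ≡ᶠ nth fzero s (toℕ y)))) * t ^ 2 ≡ h
    fixed-two x y c d lt = begin
      ∑ spreads (λ s → 𝟙 ((c ≡ᶠ nth fzero s (toℕ x)) ∧ (d ≡ᶠ nth fzero s (toℕ y)))) * t ^ 2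
        ≡⟨ ∑-marginal fzero t (replicate p (allFin t)) sides (toℕ x ∷ toℕ y ∷ []) ((lt ∷ []) ∷ [] ∷ []) (bd x ∷ bd y ∷ []) test ⟩
      t ^ length (replicate p (allFin t)) * ∑ (tuples (nth [] (replicate p (allFin t)) (toℕ x) ∷ nth [] (replicate p (allFin t)) (toℕ y) ∷ [])) test
        ≡⟨ cong₂ (λ q l → t ^ q * ∑ (tuples l) test) (length-replicate p)
             (cong₂ (λ A B → A ∷ B ∷ []) (nth-replicate-box (allFin t) p (Finₚ.toℕ<n x)) (nth-replicate-box (allFin t) p (Finₚ.toℕ<n y))) ⟩
      h * ∑ (tuples (allFin t ∷ allFin t ∷ [])) test ≡⟨ cong (h *_) one ⟩
      h * 1 ≡⟨ *-identityʳ h ⟩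
      h ∎
      where
      open ≡-Reasoning
      sides : All (λ B → length B ≡ t) (replicate p (allFin t))
      sides = All.map (λ q → trans q (length-tabulate {n = t} id)) (length-replicate-box (allFin t) p)
      bd : ∀ x → toℕ x < length (replicate p (allFin t))
      bd x = subst (toℕ x <_) (sym (length-replicate p)) (Finₚ.toℕ<n x)
      test : List (Fin t) → ℕ
      test l = 𝟙 ((c ≡ᶠ nth fzero l 0) ∧ (d ≡ᶠ nth fzero l 1))
      one : ∑ (tuples (allFin t ∷ allFin t ∷ [])) test ≡ 1
      one = trans (∑-tuples (allFin t) (allFin t ∷ []) test) (trans (∑-cong (allFin t) λ v → trans (∑-tuples (allFin t) [] (λ x → test (v ∷ x)))
          (trans (∑-cong (allFin t) λ w → trans (+-identityʳ _) (𝟙-∧ (c ≡ᶠ v) (d ≡ᶠ w)))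
            (trans (∑-* (allFin t) (𝟙 (c ≡ᶠ v)) _) (cong (𝟙 (c ≡ᶠ v) *_) (trans (∑-cong (allFin t) λ w → sym (*-identityʳ _)) (∑-single d (λ _ → 1)))))))
          (∑-single c (λ _ → 1)))

    clash-count : ∀ s x y → ∑ spreads (λ s′ → 𝟙 (clash s s′ x y)) ≤ t ^ (p ∸ 2)
    clash-count s x y with <-cmp (toℕ x) (toℕ y)
    ... | tri≈ _ q _ = ≤-trans (≤-reflexive (trans (∑-cong spreads λ s′ → cong (λ b → 𝟙 (not b ∧ ((nth fzero s (toℕ x) ≡ᶠ nth fzero s′ (toℕ x)) ∧ (nth fzero s (toℕ y) ≡ᶠ nth fzero s′ (toℕ y))))) (dec-true (x Finₚ.≟ y) (Finₚ.toℕ-injective q))) (∑-0 spreads))) z≤n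
    ... | tri< lt _ _ = bounded (≤-reflexive (fixed-two x y (nth fzero s (toℕ x)) (nth fzero s (toℕ y)) lt)) (∑-mono spreads λ s′ → 𝟙-mono (∧-trueʳ {not (x ≡ᶠ y)})) lt
      where
      bounded : ∀ {A B} → A * t ^ 2 ≤ h → B ≤ A → toℕ x < toℕ y → B ≤ t ^ (p ∸ 2)
      bounded {A} A≤ B≤A lt = ≤-trans B≤A (*-cancelʳ-≤ A _ (t ^ 2) {{ℕ.>-nonZero (m^n>0 t 2)}} (≤-trans A≤ (≤-reflexive
        (trans (cong (t ^_) (sym (m∸n+n≡m (≤-trans (s≤s (≤-trans (s≤s z≤n) lt)) (Finₚ.toℕ<n y))))) (^-distribˡ-+-* t (p ∸ 2) 2)))))
    ... | tri> _ _ gt = bounded (≤-reflexive (fixed-two y x (nth fzero s (toℕ y)) (nth fzero s (toℕ x)) gt)) (∑-mono spreads λ s′ → 𝟙-mono (swapped s′)) gt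
      where
      bounded : ∀ {A B} → A * t ^ 2 ≤ h → B ≤ A → toℕ y < toℕ x → B ≤ t ^ (p ∸ 2)
      bounded {A} A≤ B≤A lt = ≤-trans B≤A (*-cancelʳ-≤ A _ (t ^ 2) {{ℕ.>-nonZero (m^n>0 t 2)}} (≤-trans A≤ (≤-reflexive
        (trans (cong (t ^_) (sym (m∸n+n≡m (≤-trans (s≤s (≤-trans (s≤s z≤n) lt)) (Finₚ.toℕ<n x))))) (^-distribˡ-+-* t (p ∸ 2) 2)))))
      swapped : ∀ s′ → clash s s′ x y ≡ true → (nth fzero s (toℕ y) ≡ᶠ nth fzero s′ (toℕ y)) ∧ (nth fzero s (toℕ x) ≡ᶠ nth fzero s′ (toℕ x)) ≡ true
      swapped s′ q = let r = ∧-trueʳ {not (x ≡ᶠ y)} q in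
        ∧-true (∧-trueʳ {nth fzero s (toℕ x) ≡ᶠ nth fzero s′ (toℕ x)} r) (∧-trueˡ r)

    few : ∀ c → c ∈ candidates → ∑ candidates (𝟙 ∘ forbids c) ≤ b
    few (g , s) c∈ = begin
      ∑ candidates (𝟙 ∘ forbids (g , s)) ≡⟨ ∑-candidates _ ⟩
      ∑ shapes (λ g′ → ∑ spreads (λ s′ → 𝟙 (forbids (g , s) (g′ , s′)))) ≡⟨ ∑-const shapes _ ⟩
      G * ∑ spreads (λ s′ → 𝟙 (any V (λ x → any V (λ y → clash s s′ x y))))
        ≤⟨ *-monoʳ-≤ G (∑-mono spreads λ s′ → ≤-trans (𝟙-any V (λ x → any V (clash s s′ x))) (∑-mono V λ x → 𝟙-any V (clash s s′ x))) ⟩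
      G * ∑ spreads (λ s′ → ∑ V (λ x → ∑ V (λ y → 𝟙 (clash s s′ x y))))
        ≡⟨ cong (G *_) (trans (∑-swap spreads V _) (∑-cong V λ x → ∑-swap spreads V _)) ⟩
      G * ∑ V (λ x → ∑ V (λ y → ∑ spreads (λ s′ → 𝟙 (clash s s′ x y))))
        ≤⟨ *-monoʳ-≤ G (∑-mono V λ x → ∑-mono V λ y → clash-count s x y) ⟩
      G * ∑ V (λ x → ∑ V (λ y → t ^ (p ∸ 2))) ≡⟨ cong (G *_) (trans (∑-cong V λ x → ∑-const V (t ^ (p ∸ 2))) (∑-const V (length V * t ^ (p ∸ 2)))) ⟩
      G * (length V * (length V * t ^ (p ∸ 2))) ≡⟨ cong (λ l → G * (l * (l * t ^ (p ∸ 2)))) V-length ⟩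
      G * (a * (a * t ^ (p ∸ 2))) ≡⟨ lem G a (t ^ (p ∸ 2)) ⟩
      b ∎
      where
      open ≤-Reasoning
      V = vertices g
      V-length : length V ≡ a
      V-length with find (∈ₚ.∈-concatMap⁻ (λ g → map (g ,_) spreads) c∈)
      ... | g′ , g′∈ , q with ∈ₚ.∈-map⁻ (g′ ,_) q
      ... | _ , _ , refl = shapes-∈ g′∈
      lem : ∀ G a x → G * (a * (a * x)) ≡ G * (a * a) * x
      lem = solve-∀

    -- An order of all vertices restricts to an order of the grid along each spread, and there
    -- `grid-gadget` supplies an inconsistent valid shape: one hit for each of the `h` spreads.
    hits : ∀ ψ → h ≤ ∑ candidates (λ c → 𝟙 (hit c ψ))
    hits ψ = begin
      h ≡⟨ trans (sym length-spreads) (length-∑ spreads) ⟩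
      ∑ spreads (λ _ → 1) ≤⟨ ∑-mono spreads one-hit ⟩
      ∑ spreads (λ s → ∑ shapes (λ g → 𝟙 (hit (g , s) ψ))) ≡⟨ trans (∑-swap spreads shapes _) (sym (∑-candidates _)) ⟩
      ∑ candidates (λ c → 𝟙 (hit c ψ)) ∎
      where
      open ≤-Reasoning
      one-hit : ∀ s → 1 ≤ ∑ shapes (λ g → 𝟙 (hit (g , s) ψ))
      one-hit s with grid-gadget (order ψ ∘ place s) (λ q → place-injective s (order-injective ψ q))
      ... | g , (l , l′) , inc , bad = ≤-trans (≤-reflexive (cong 𝟙 (sym good))) (∑-∈ (λ g → 𝟙 (hit (g , s) ψ)) (∈-shapes {g} l l′))
        where
        good : hit (g , s) ψ ≡ true
        good = ∧-true (∧-true (subst (λ m → (m == k) ≡ true) (sym l) (==-refl k)) (∧-true (subst (λ m → (m == k) ≡ true) (sym l′) (==-refl k))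
            (∈-all (allFin D) λ {i} _ → isIncreasing-complete (inc i)))) (cong not (flip (isConsistent (order ψ) (mapᵍ (place s) g)) refl))
          where
          flip : ∀ c → isConsistent (order ψ) (mapᵍ (place s) g) ≡ c → isConsistent (order ψ) (mapᵍ (place s) g) ≡ false
          flip false q = q
          flip true q = contradiction (trans (sym (roleUnder-map (place s) (order ψ) (u g) (v g) (rest g)))
            (trans (≡ʳ-true q) (roleUnder-map (place s) (order ψ) (u g) (v g) (rest′ g)))) bad

    budget : 2 * (M * b) ≤ h
    budget = trivial-or (2 ≤? p)
      where
      open ≤-Reasoning
      n-bound : 2 * (M * (G * (a * a))) ≤ t * t
      n-bound = begin
        2 * (M * (G * (a * a))) ≡⟨ lem₁ G a (p + j) p t ⟩
        K * ((p + j) * p * t + 1) ≤⟨ *-monoʳ-≤ K (+-monoʳ-≤ ((p + j) * p * t) {1} {t} (s≤s z≤n)) ⟩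
        K * ((p + j) * p * t + t) ≡⟨ lem₂ K p j t ⟩
        (K * (p * p + 1) + K * p * j) * t ≤⟨ *-monoˡ-≤ t (≤-trans (proj₂ chosen-j) (≤-reflexive (sym t≡))) ⟩
        t * t ∎
        where
        lem₁ : ∀ G a l p t → 2 * (2 * G * (l * (p * t) + 1) * (G * (a * a))) ≡ 4 * (G * G) * (a * a) * (l * p * t + 1)
        lem₁ = solve-∀
        lem₂ : ∀ K p j t → K * ((p + j) * p * t + t) ≡ (K * (p * p + 1) + K * p * j) * t
        lem₂ = solve-∀
      2≤p : 2 ≤ p
      2≤p with grid-gadget toℕ Finₚ.toℕ-injective
      ... | gadget x y E E′ , (l , l′) , inc , _ = two x y distinct
        where
        distinct : x ≢ y
        distinct q with unique-↭ (arrange²-↭ (proj₁ (pattern′ i₀)) (proj₂ (pattern′ i₀)) (gadget x y E E′))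
                          (unique-map (coordinate i₀) (increasing-unique (inc i₀)))
        ... | (ne ∷ _) ∷ _ = ne q
        two : ∀ {p} (x y : Fin p) → x ≢ y → 2 ≤ p
        two {suc zero} fzero fzero ne = contradiction refl ne
        two {suc (suc p)} x y ne = s≤s (s≤s z≤n)
      trivial-or : Dec (2 ≤ p) → 2 * (M * b) ≤ h
      trivial-or (no ¬q) = contradiction 2≤p ¬q
      trivial-or (yes q) = begin
        2 * (M * (G * (a * a) * t ^ (p ∸ 2))) ≡⟨ lem M (G * (a * a)) (t ^ (p ∸ 2)) ⟩
        t ^ (p ∸ 2) * (2 * (M * (G * (a * a)))) ≤⟨ *-monoʳ-≤ (t ^ (p ∸ 2)) n-bound ⟩
        t ^ (p ∸ 2) * (t * t) ≡⟨ cong (λ z → t ^ (p ∸ 2) * (t * z)) (sym (*-identityʳ t)) ⟩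
        t ^ (p ∸ 2) * t ^ 2 ≡⟨ trans (sym (^-distribˡ-+-* t (p ∸ 2) 2)) (cong (t ^_) (m∸n+n≡m q)) ⟩
        h ∎
        where lem : ∀ M g x → 2 * (M * (g * x)) ≡ x * (2 * (M * g))
              lem = solve-∀

    tests : List (List ℕ)
    tests = tuples (replicate n′ (upTo n′))

    length-tests : length tests ≡ n′ ^ n′
    length-tests = trans (vol-^ (replicate n′ (upTo n′)) (length-replicate-box (upTo n′) n′)) (cong₂ _^_ (length-upTo n′) (length-replicate n′))

    small : length tests * (2 * G ∸ 1) ^ M < (2 * G) ^ M
    small = begin-strict
      length tests * g′ ^ M ≡⟨ cong₂ _*_ length-tests (sym (^-*-assoc g′ (2 * G) e)) ⟩
      n′ ^ n′ * (g′ ^ (2 * G)) ^ e ≤⟨ *-monoˡ-≤ ((g′ ^ (2 * G)) ^ e) tests-bound ⟩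
      2 ^ ((p + j) * n′) * (g′ ^ (2 * G)) ^ e <⟨ *-monoˡ-< ((g′ ^ (2 * G)) ^ e) {{pow-nonZero}} (^-monoʳ-< 2 (s≤s (s≤s z≤n)) (≤-reflexive (+-comm 1 ((p + j) * n′)))) ⟩
      2 ^ e * (g′ ^ (2 * G)) ^ e ≡⟨ sym (^-* e 2 (g′ ^ (2 * G))) ⟩
      (2 * g′ ^ (2 * G)) ^ e ≤⟨ ^-monoˡ-≤ e (subst (λ z → 2 * g′ ^ z ≤ z ^ z) (m+[n∸m]≡n 1≤g) (halving g′)) ⟩
      ((2 * G) ^ (2 * G)) ^ e ≡⟨ ^-*-assoc (2 * G) (2 * G) e ⟩
      (2 * G) ^ M ∎
      where
      open ≤-Reasoning
      g′ = 2 * G ∸ 1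
      1≤g : 1 ≤ 2 * G
      1≤g = ≤-trans G>0 (m≤m+n G _)
      2≤g : 2 ≤ 2 * G
      2≤g = *-monoʳ-≤ 2 G>0
      g′>0 : 0 < g′
      g′>0 = ≤-pred (subst (2 ≤_) (sym (m+[n∸m]≡n 1≤g)) 2≤g)
      pow-nonZero : NonZero ((g′ ^ (2 * G)) ^ e)
      pow-nonZero = ℕ.>-nonZero (m^n>0 (g′ ^ (2 * G)) {{ℕ.>-nonZero (m^n>0 g′ {{ℕ.>-nonZero g′>0}} (2 * G))}} e)
      n′≤ : n′ ≤ 2 ^ (p + j)
      n′≤ = ≤-trans (*-mono-≤ (<⇒≤ (n<2^n p)) (≤-reflexive t≡)) (≤-reflexive (sym (^-distribˡ-+-* 2 p j)))
      tests-bound : n′ ^ n′ ≤ 2 ^ ((p + j) * n′)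
      tests-bound = ≤-trans (^-monoˡ-≤ n′ n′≤) (≤-reflexive (^-*-assoc 2 (p + j) n′))

    h>0 : 0 < h
    h>0 = m^n>0 t p

  private abstract
    selected : ∃[ ds ] (AllPairs (λ c c′ → forbids c′ c ≡ false) ds × All (λ d → ∃[ y ] (y ∈ tests × hit d y ≡ true)) ds ×
      (∀ y → y ∈ tests → ∃[ d ] (d ∈ ds × hit d y ≡ true)))
    selected = Greedy.greedy candidates hit forbids G h b M G>0 length-candidates h>0 few budget tests (λ ψ _ → hits ψ) small
  private
    ds = proj₁ selected

    placed : Candidate → Gadget (Fin n′)
    placed (g , s) = mapᵍ (place s) g

    shares-one : ∀ c d → forbids d c ≡ false → SharesOne (placed c) (placed d)
    shares-one (g , s) (g′ , s′) free {a₁} {b₁} a∈ a∈′ b∈ b∈′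
      with ∈ₚ.∈-map⁻ (place s) (subst (a₁ ∈_) (vertices-mapᵍ (place s) g) a∈) | ∈ₚ.∈-map⁻ (place s′) (subst (a₁ ∈_) (vertices-mapᵍ (place s′) g′) a∈′)
         | ∈ₚ.∈-map⁻ (place s) (subst (b₁ ∈_) (vertices-mapᵍ (place s) g) b∈) | ∈ₚ.∈-map⁻ (place s′) (subst (b₁ ∈_) (vertices-mapᵍ (place s′) g′) b∈′)
    ... | x , x∈ , qx | x′ , x′∈ , qx′ | y , y∈ , qy | y′ , y′∈ , qy′ = decide (x′ Finₚ.≟ y′)
      where
      same : ∀ x x′ → place s x ≡ place s′ x′ → x ≡ x′ × nth fzero s (toℕ x) ≡ nth fzero s′ (toℕ x′)
      same x x′ q = Finₚ.combine-injectiveˡ x _ x′ _ q , Finₚ.combine-injectiveʳ x _ x′ _ q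
      agree : ∀ x x′ → place s x ≡ place s′ x′ → (nth fzero s′ (toℕ x′) ≡ᶠ nth fzero s (toℕ x′)) ≡ true
      agree x x′ q with same x x′ q
      ... | refl , r = trans (cong (nth fzero s′ (toℕ x) ≡ᶠ_) r) (≡ᶠ-refl (nth fzero s′ (toℕ x)))
      decide : Dec (x′ ≡ y′) → a₁ ≡ b₁
      decide (yes q) = trans qx′ (trans (cong (place s′) q) (sym qy′))
      decide (no ne) = ⊥-elim (true≢false (∈-any {xs = vertices g′} {p = λ x → any (vertices g′) (clash s′ s x)} x′∈ (∈-any {xs = vertices g′} {p = clash s′ s x′} y′∈
        (∧-true (cong not (dec-false (x′ Finₚ.≟ y′) ne)) (∧-true (agree x x′ (trans (sym qx) qx′)) (agree y y′ (trans (sym qy) qy′)))))) free)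

  private
    valid-parts : ∀ {g} → isValid g ≡ true → (length (rest g) ≡ k × length (rest′ g) ≡ k) ×
      (∀ i → Increasing (map (coordinate i) (arrange² (proj₁ (pattern′ i)) (proj₂ (pattern′ i)) g)))
    valid-parts {g} q = let q₁ = ∧-trueʳ {length (rest g) == k} q in
      (==-true {length (rest g)} (∧-trueˡ q) , ==-true {length (rest′ g)} (∧-trueˡ q₁)) ,
      λ i → isIncreasing-sound _ (all-∈ {xs = allFin D} (∧-trueʳ {length (rest′ g) == k} q₁) (∈ₚ.∈-allFin i))

    chosen-valid : ∀ {d} → d ∈ ds → isValid (proj₁ d) ≡ true
    chosen-valid d∈ = ∧-trueˡ (proj₂ (proj₂ (All.lookup (proj₁ (proj₂ (proj₂ selected))) d∈)))

    -- Lexicographic: the coordinate of the underlying grid point comes first, and the vertex itself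
    -- breaks ties. The rank is thereby injective and still increases along every chosen gadget.
    rankFin : Fin D → Fin n′ → Fin (N * n′)
    rankFin i v = combine (coordinateᶠ i (proj₁ (remQuot {p} t v))) v

  patternRank : Fin D → Fin n′ → ℕ
  patternRank i v = toℕ (rankFin i v)

  private
    rank-place : ∀ i s x y → coordinate i x < coordinate i y → patternRank i (place s x) < patternRank i (place s y)
    rank-place i s x y lt = Finₚ.combine-monoˡ-< (place s x) (place s y)
      (subst₂ (λ a b → coordinate i a < coordinate i b) (sym (quotient x)) (sym (quotient y)) lt)
      where quotient : ∀ x → proj₁ (remQuot {p} t (place s x)) ≡ x
            quotient x = cong proj₁ (Finₚ.remQuot-combine x (nth fzero s (toℕ x)))

    pattern-increasing : ∀ i {g} → g ∈ map placed ds → Increasing (map (patternRank i) (arrange² (proj₁ (pattern′ i)) (proj₂ (pattern′ i)) g))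
    pattern-increasing i g∈ with ∈ₚ.∈-map⁻ placed g∈
    ... | (g , s) , d∈ , refl = subst (λ l → Increasing (map (patternRank i) l)) (map-arrange² (place s) (proj₁ (pattern′ i)) (proj₂ (pattern′ i)) g)
      (AllPairsₚ.map⁺ (AllPairsₚ.map⁺ (AllPairs.map (λ {x} {y} → rank-place i s x y) (AllPairsₚ.map⁻ (proj₂ (valid-parts {g} (chosen-valid d∈)) i)))))

  module _ (index : Role → Role → Fin D) (index-spec : ∀ {p q} → p ∈ roles (2 + k) → q ∈ roles (2 + k) → p ≢ q → pattern′ (index p q) ≡ (p , q)) where

    system : GadgetSystem k
    system = record
      { size = n′
      ; bound = N * n′
      ; gadgets = map placed ds
      ; length-rest = lengths
      ; linear = AllPairsₚ.map⁺ (AllPairs.map (λ {c} {d} → shares-one c d) (proj₁ (proj₂ selected)))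
      ; rank = λ p q → patternRank (index p q)
      ; rank<bound = λ p q v → Finₚ.toℕ<n (rankFin (index p q) v)
      ; rank-injective = λ p q {v} {w} e → Finₚ.combine-injectiveʳ (coordinateᶠ (index p q) (proj₁ (remQuot t v))) v (coordinateᶠ (index p q) (proj₁ (remQuot t w))) w (Finₚ.toℕ-injective {i = rankFin (index p q) v} {rankFin (index p q) w} e)
      ; rank-increasing = λ {p} {q} {g} p∈ q∈ p≢q g∈ → subst (λ z → Increasing (map (patternRank (index p q)) (arrange² (proj₁ z) (proj₂ z) g))) (index-spec p∈ q∈ p≢q) (pattern-increasing (index p q) g∈)
      ; unavoidable = unavoided
      }
      where
      lengths : ∀ {g} → g ∈ map placed ds → length (rest g) ≡ k × length (rest′ g) ≡ k
      lengths g∈ with ∈ₚ.∈-map⁻ placed g∈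
      ... | (g , s) , d∈ , refl = let (l , l′) , _ = valid-parts {g} (chosen-valid d∈) in trans (length-map (place s) (rest g)) l , trans (length-map (place s) (rest′ g)) l′
      unavoided : ∀ (ψ : Fin n′ → ℕ) → (∀ {v w} → ψ v ≡ ψ w → v ≡ w) → ∃[ g ] (g ∈ map placed ds × ¬ Consistent ψ g)
      unavoided ψ inj = placed d , ∈ₚ.∈-map⁺ placed d∈ , bad
        where
        open Compression ψ inj
        test : List ℕ
        test = map compressed (allFin n′)
        test∈ : test ∈ tests
        test∈ = tuples-∈ (replicate-∈ₜ test (trans (length-map compressed (allFin n′)) (length-tabulate {n = n′} id))
          (Allₚ.map⁺ (All.universal (λ v → ∈ₚ.∈-upTo⁺ (compressed< v)) (allFin n′))))
        found = proj₂ (proj₂ (proj₂ selected)) test test∈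
        d = proj₁ found
        d∈ = proj₁ (proj₂ found)
        agrees : ∀ v w → (ψ v ℕ.<ᵇ ψ w) ≡ (order test v ℕ.<ᵇ order test w)
        agrees v w = trans (compression-agrees v w) (cong₂ (λ a b → a * n′ + toℕ v ℕ.<ᵇ b * n′ + toℕ w) (sym (nth-map-allFin compressed v)) (sym (nth-map-allFin compressed w)))
        bad : ¬ Consistent ψ (placed d)
        bad q = true≢false (consistent-cong {ψ} {order test} agrees (placed d) q) (not-true (∧-trueʳ {isValid (proj₁ d)} (proj₂ (proj₂ found))))

-- Pairs of distinct roles and the gadget system indexed by them

Pattern : Set
Pattern = Role × Role

patternsFrom : List Role → Role → List Pattern
patternsFrom rs p = map (p ,_) (filterᵇ (λ q → not (p ≡ʳ q)) rs)

-- the leading entry only makes the list visibly non-empty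
patterns : ℕ → List Pattern
patterns r = ((0 , 0) , (0 , 1)) ∷ concatMap (patternsFrom (roles r)) (roles r)

filterᵇ-true : ∀ (p : A → Bool) {x} xs → x ∈ filterᵇ p xs → p x ≡ true
filterᵇ-true p (y ∷ xs) x∈ with p y in eq
... | false = filterᵇ-true p xs x∈
filterᵇ-true p (y ∷ xs) (here refl) | true = eq
filterᵇ-true p (y ∷ xs) (there x∈) | true = filterᵇ-true p xs x∈

∈-filterᵇ⁺ : ∀ (p : A → Bool) {x xs} → x ∈ xs → p x ≡ true → x ∈ filterᵇ p xs
∈-filterᵇ⁺ p {xs = y ∷ xs} (here refl) h rewrite h = here refl
∈-filterᵇ⁺ p {xs = y ∷ xs} (there x∈) h with p y
... | true = there (∈-filterᵇ⁺ p x∈ h)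
... | false = ∈-filterᵇ⁺ p x∈ h

ValidPattern : ℕ → Pattern → Set
ValidPattern r (p , q) = p ∈ roles r × q ∈ roles r × p ≢ q

patterns-valid : ∀ {k} → 1 ≤ k → ∀ {π} → π ∈ patterns (2 + k) → ValidPattern (2 + k) π
patterns-valid {suc k} _ (here refl) = roles-∈ {3 + k} 0 0 (s≤s (s≤s z≤n)) , roles-∈ {3 + k} 0 1 (s≤s (s≤s (s≤s z≤n))) , λ ()
patterns-valid {suc k} _ {π} (there π∈) with find (∈ₚ.∈-concatMap⁻ (patternsFrom (roles (3 + k))) {xs = roles (3 + k)} π∈)
... | p , p∈ , q∈′ with ∈ₚ.∈-map⁻ (p ,_) q∈′
... | q , q∈ , refl = p∈ , Sub.lookup (filterᵇ-⊆ (λ q → not (p ≡ʳ q)) (roles (3 + k))) q∈ ,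
  λ { refl → true≢false (≡ʳ-refl p) (not-true (filterᵇ-true (λ q → not (p ≡ʳ q)) (roles (3 + k)) q∈)) }

∈-patterns : ∀ {r p q} → ValidPattern r (p , q) → (p , q) ∈ patterns r
∈-patterns {r} {p} {q} (p∈ , q∈ , p≢q) = there (∈ₚ.∈-concatMap⁺ (patternsFrom (roles r)) (lose p∈ (∈ₚ.∈-map⁺ (p ,_)
  (∈-filterᵇ⁺ (λ q → not (p ≡ʳ q)) q∈ (differ (p ≡ʳ q) refl)))))
  where differ : ∀ b → (p ≡ʳ q) ≡ b → not (p ≡ʳ q) ≡ true
        differ true e = contradiction (≡ʳ-true e) p≢q
        differ false e = cong not e

private
  lookupPattern : ∀ r → Fin (length (patterns r)) → Pattern
  lookupPattern r = Data.List.lookup (patterns r)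

  role≟ : (p q : Role) → Dec (p ≡ q)
  role≟ = Data.Product.Properties.≡-dec _≟_ _≟_

  indexPattern : ∀ r → Role → Role → Fin (length (patterns r))
  indexPattern r p q with Any.any? (λ π → Data.Product.Properties.≡-dec role≟ role≟ (p , q) π) (patterns r)
  ... | yes π∈ = Any.index π∈
  ... | no _ = fzero

  indexPattern-spec : ∀ r {p q} → (p , q) ∈ patterns r → lookupPattern r (indexPattern r p q) ≡ (p , q)
  indexPattern-spec r {p} {q} π∈ with Any.any? (λ π → Data.Product.Properties.≡-dec role≟ role≟ (p , q) π) (patterns r)
  ... | yes π∈′ = sym (Anyₚ.lookup-index π∈′)
  ... | no ¬π∈ = contradiction π∈ ¬π∈

  module _ (k : ℕ) (1≤k : 1 ≤ k) where
    D′ : ℕ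
    D′ = length (concatMap (patternsFrom (roles (2 + k))) (roles (2 + k)))

    all-valid : ∀ (i : Fin (suc D′)) → ValidPattern (2 + k) (lookupPattern (2 + k) i)
    all-valid i = patterns-valid 1≤k (∈ₚ.∈-lookup {xs = patterns (2 + k)} i)

    buildSystem : GadgetSystem k
    buildSystem = Construction.system k (suc D′) (lookupPattern (2 + k)) (Grid.N k D′ (lookupPattern (2 + k)) all-valid)
      (Grid.N k D′ (lookupPattern (2 + k)) all-valid ^ suc D′) (λ i x → finToFun x i) fzero (Grid.grid-gadget k D′ (lookupPattern (2 + k)) all-valid)
      (indexPattern (2 + k)) (λ p∈ q∈ p≢q → indexPattern-spec (2 + k) (∈-patterns {2 + k} (p∈ , q∈ , p≢q)))

abstract
  gadgetSystem : ∀ k → 1 ≤ k → GadgetSystem k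
  gadgetSystem = buildSystem

-- Embedding a gadget system into a box in which one kind of gadget is dense everywhere

nth-injective : ∀ {A : Set} (d : A) {x} → Unique x → ∀ {i j} → i < length x → j < length x → nth d x i ≡ nth d x j → i ≡ j
nth-injective d (h ∷ hs) {zero} {zero} _ _ e = refl
nth-injective d {x = v ∷ x} (h ∷ hs) {zero} {suc j} _ (s≤s q) e = contradiction e (All.lookup h (nth-∈ d x q))
nth-injective d {x = v ∷ x} (h ∷ hs) {suc i} {zero} (s≤s q) _ e = contradiction (sym e) (All.lookup h (nth-∈ d x q))
nth-injective d (h ∷ hs) {suc i} {suc j} (s≤s p) (s≤s q) e = cong suc (nth-injective d hs p q e)

Unique-⊆ : ∀ {A : Set} {xs ys : List A} → xs ⊆ ys → Unique ys → Unique xs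
Unique-⊆ = AllPairs-⊆

transversal-⊆ : ∀ {A : Set} {Bs : List (List A)} {x} → Pointwise _∈_ x Bs → x ⊆ concat Bs
transversal-⊆ [] = []
transversal-⊆ (v∈ ∷ h) = Subₚ.++⁺ (Sub.from∈ v∈) (transversal-⊆ h)

concat-≼ : ∀ {A : Set} {Cs Bs : List (List A)} → Cs ≼ Bs → concat Cs ⊆ concat Bs
concat-≼ [] = []
concat-≼ (s ∷ ss) = Subₚ.++⁺ s (concat-≼ ss)

mask : List ℕ → ℕ → Bool
mask J i = any J (_== i)

mask-∈ : ∀ {J i} → mask J i ≡ true → i ∈ J
mask-∈ {J} {i} h with any-∈ J h
... | j , j∈ , e = subst (_∈ J) (==-true e) j∈

∈-mask : ∀ {J i} → i ∈ J → mask J i ≡ true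
∈-mask {J} {i} i∈ = ∈-any i∈ (==-refl i)

module Links {k : ℕ} (H : Hypergraph (2 + k)) (v₀ : Fin (n H)) (T : ℕ) where

  open Telescoping {Fin (n H)} v₀ T

  joined : List ℕ → List (Fin (n H)) → Bool
  joined I x = edge H (fromList (map (nth v₀ x) I))

  joined-depends : ∀ {I J} → (∀ {i} → i ∈ I → J i ≡ true) → DependsOn J (joined I)
  joined-depends {I} sub x y agree = cong (λ l → edge H (fromList l)) (go I sub)
    where go : ∀ I → (∀ {i} → i ∈ I → _ ≡ true) → map (nth v₀ x) I ≡ map (nth v₀ y) I
          go [] _ = refl
          go (i ∷ I) sub = cong₂ _∷_ (agree i (sub (here refl))) (go I (sub ∘ there))

  linked : Pattern → List ℕ → List (Fin (n H)) → Bool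
  linked (p , q) J x = joined (proj₁ (split p q k J)) x ∧ joined (proj₂ (split p q k J)) x

-- A vertex `v` of F goes to the side of `Bs` whose index stands at place `rank p q v` of `Y`. Every
-- gadget then occupies a sublist of `Y` in the order prescribed by the one pattern `(p , q)`, so
-- density of this single gadget type on all sublists is enough.
module Embedding {k′ : ℕ} (𝒢 : GadgetSystem (suc k′)) (H : Hypergraph (3 + k′)) (v₀ : Fin (n H))
  (Bs : List (List (Fin (n H)))) (distinct : Unique (concat Bs)) (pos : 0 < ⟪ Bs ⟫)
  (p q : Role) (valid : ValidPattern (3 + k′) (p , q)) (Y : List ℕ) (Y-increasing : Increasing Y) (Y< : All (_< length Bs) Y)
  (room : GadgetSystem.bound 𝒢 ≤ length Y) (ℓ κ : ℕ) where

  open GadgetSystem 𝒢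
  private
    k = suc k′
    T = length Bs
    V = Fin (n H)
  open Links H v₀ T
  open Telescoping {V} v₀ T

  -- The gadgets on the sides in `J` have density numerator at least `ℓ / κ`. Only the lower half of
  -- regularity enters.
  Dense-at : List ℕ → Set
  Dense-at J = ∃[ m ] (m ≤ ℓ × ℓ ≤ κ * m × (∀ Cs → Cs ≼ Bs → m * ⟪ Cs ⟫ ≤ ℓ * count (linked (p , q) J) Cs + 2 * ⟪ Bs ⟫))

  module _ (rich : ∀ J → J ⊆ Y → length J ≡ 2 + (k + k) → Dense-at J) (ℓ-large : 2 * length gadgets * κ ^ length gadgets < ℓ) where

    private
      slot : Fin size → ℕ
      slot v = nth 0 Y (rank p q v)

      slot-injective : ∀ {v w} → slot v ≡ slot w → v ≡ w
      slot-injective e = rank-injective p q (nth-injective 0 (increasing-unique Y-increasing)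
        (≤-trans (rank<bound p q _) room) (≤-trans (rank<bound p q _) room) e)

      slots : Gadget (Fin size) → List ℕ
      slots g = map slot (arrange² p q g)

      slots-∈ : ∀ {g i} → i ∈ slots g → ∃[ v ] (v ∈ vertices g × i ≡ slot v)
      slots-∈ {g} i∈ = let v , v∈ , e = ∈ₚ.∈-map⁻ slot i∈ in v , ↭ₚ.∈-resp-↭ (arrange²-↭ p q g) v∈ , e

      edge₁ edge₂ : Gadget (Fin size) → List ℕ
      edge₁ g = map slot (arrange p (u g) (v g) (rest g))
      edge₂ g = map slot (arrange q (u g) (v g) (rest′ g))

      split-slots : ∀ {g} → g ∈ gadgets → split p q k (slots g) ≡ (edge₁ g , edge₂ g)
      split-slots {g} g∈ = let l , l′ = length-rest g∈ in trans (cong (split p q k) (map-arrange² slot p q g))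
        (trans (split-arrange² (proj₁ valid) (proj₁ (proj₂ valid)) (mapᵍ slot g) (trans (length-map slot (rest g)) l) (trans (length-map slot (rest′ g)) l′))
          (sym (cong₂ _,_ (map-arrange slot p (u g) (v g) (rest g)) (map-arrange slot q (u g) (v g) (rest′ g)))))

      linked-slots : ∀ {g} → g ∈ gadgets → ∀ x → linked (p , q) (slots g) x ≡ joined (edge₁ g) x ∧ joined (edge₂ g) x
      linked-slots g∈ x = cong (λ s → joined (proj₁ s) x ∧ joined (proj₂ s) x) (split-slots g∈)

      slots-⊆ : ∀ {g} → g ∈ gadgets → slots g ⊆ Y
      slots-⊆ {g} g∈ = subst (_⊆ Y) (sym (map-∘ (arrange² p q g))) (nth-⊆ 0 Y (rank-increasing (proj₁ valid) (proj₁ (proj₂ valid)) (proj₂ (proj₂ valid)) g∈)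
        (Allₚ.map⁺ (All.universal (λ v → ≤-trans (rank<bound p q v) room) (arrange² p q g))))

      slots-length : ∀ {g} → g ∈ gadgets → length (slots g) ≡ 2 + (k + k)
      slots-length {g} g∈ = trans (length-map slot (arrange² p q g)) (trans (↭ₚ.↭-length (arrange²-↭ p q g))
        (cong (2 +_) (trans (length-++ (rest g)) (cong₂ _+_ (proj₁ (length-rest g∈)) (proj₂ (length-rest g∈))))))

      dense : ∀ {g} → g ∈ gadgets → Dense-at (slots g)
      dense {g} g∈ = rich (slots g) (slots-⊆ g∈) (slots-length g∈)

      E = 2 * ⟪ Bs ⟫

      It : Set
      It = Item Bs refl pos E
      open Item

      item : ∀ {g} → g ∈ gadgets → It
      item {g} g∈ = record
        { coords = mask (slots g)
        ; f = linked (p , q) (slots g)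
        ; o = λ _ → true
        ; a = proj₁ (dense g∈)
        ; b = ℓ
        ; f-dep = λ x y agree → trans (linked-slots g∈ x) (trans (cong₂ _∧_
            (joined-depends {edge₁ g} {mask (slots g)} (λ i∈ → ∈-mask (Sub.lookup (Subₚ.map⁺ slot (arrange-⊆₁ p q g)) i∈)) x y agree)
            (joined-depends {edge₂ g} {mask (slots g)} (λ i∈ → ∈-mask (Sub.lookup (Subₚ.map⁺ slot (arrange-⊆₂ p q g)) i∈)) x y agree))
            (sym (linked-slots g∈ y)))
        ; o-dep = λ _ _ _ → refl
        ; dom = λ Cs s → subst (λ c → proj₁ (dense g∈) * c ≤ ℓ * count (linked (p , q) (slots g)) Cs + E) (length-∑ (tuples Cs)) (proj₂ (proj₂ (proj₂ (dense g∈))) Cs s)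
        }

      meet : ∀ {g g′} → g ∈ gadgets → SharesOne g g′ → Meet (mask (slots g)) (mask (slots g′))
      meet {g} {g′} g∈ share = decide (Any.any? (λ i → Any.any? (i ≟_) (slots g′)) (slots g))
        where
        slots<T : ∀ {i} → i ∈ slots g → i < T
        slots<T i∈ = All.lookup Y< (Sub.lookup (slots-⊆ g∈) i∈)
        decide : Dec (Any (λ i → Any (i ≡_) (slots g′)) (slots g)) → Meet (mask (slots g)) (mask (slots g′))
        decide (yes common) with find common
        ... | i , i∈ , i∈′ = i , slots<T i∈ , ∈-mask i∈ , λ j Jj Kj → same (slots-∈ {g} i∈) (slots-∈ {g′} i∈′) (slots-∈ {g} (mask-∈ Jj)) (slots-∈ {g′} (mask-∈ Kj))
          where
          same : ∀ {i j} → ∃[ v ] (v ∈ vertices g × i ≡ slot v) → ∃[ v ] (v ∈ vertices g′ × i ≡ slot v) →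
            ∃[ v ] (v ∈ vertices g × j ≡ slot v) → ∃[ v ] (v ∈ vertices g′ × j ≡ slot v) → j ≡ i
          same (v₁ , m₁ , refl) (v₂ , m₂ , e₂) (v₃ , m₃ , refl) (v₄ , m₄ , e₄) =
            cong slot (share m₃ (subst (_∈ vertices g′) (sym (slot-injective e₄)) m₄) m₁ (subst (_∈ vertices g′) (sym (slot-injective e₂)) m₂))
        -- Disjoint gadgets: any slot of `g` serves as the witness that `Meet` asks for.
        decide (no none) with slots g in eq | slots-length g∈
        ... | [] | ()
        ... | i ∷ is | _ = i , slots<T (subst (i ∈_) (sym eq) (here refl)) , ∈-mask {i ∷ is} (here refl) ,
          λ j Jj Kj → contradiction (lose (mask-∈ Jj) (mask-∈ Kj)) none

      items : ∀ {gs} → All (_∈ gadgets) gs → List It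
      items [] = []
      items (g∈ ∷ h) = item g∈ ∷ items h

      items-bounds : ∀ {gs} (h : All (_∈ gadgets) gs) → All (λ it → a it ≤ ℓ × b it ≤ ℓ) (items h)
      items-bounds [] = []
      items-bounds (g∈ ∷ h) = (proj₁ (proj₂ (dense g∈)) , ≤-refl) ∷ items-bounds h

      items-meet : ∀ {gs} (h : All (_∈ gadgets) gs) → AllPairs SharesOne gs → AllPairs (λ it jt → Meet² Bs refl pos E (coords it) (coords jt)) (items h)
      items-meet [] [] = []
      items-meet {g ∷ gs} (g∈ ∷ h) (s ∷ ss) = go h s ∷ items-meet h ss
        where
        go : ∀ {gs} (h : All (_∈ gadgets) gs) → All (SharesOne g) gs → All (λ jt → Meet² Bs refl pos E (coords (item g∈)) (coords jt)) (items h)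
        go [] [] = []
        go {g′ ∷ _} (g′∈ ∷ h) (s ∷ ss) = (meet g∈ s , meet g′∈ (λ {c} {d} x y z w → s y x w z)) ∷ go h ss

      items-length : ∀ {gs} (h : All (_∈ gadgets) gs) → length (items h) ≡ length gs
      items-length [] = refl
      items-length (_ ∷ h) = cong suc (items-length h)

      items-o : ∀ {gs} (h : All (_∈ gadgets) gs) x → all (items h) (λ it → o it x) ≡ true
      items-o [] x = refl
      items-o (_ ∷ h) x = items-o h x

      items-f : ∀ {gs} (h : All (_∈ gadgets) gs) x → all (items h) (λ it → f it x) ≡ true → ∀ {g} → g ∈ gs → linked (p , q) (slots g) x ≡ true
      items-f (_ ∷ h) x e (here refl) = ∧-trueˡ e
      items-f {g ∷ _} (_ ∷ h) x e (there g∈) = items-f h x (∧-trueʳ {linked (p , q) (slots g) x} e) g∈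

      items-b : ∀ {gs} (h : All (_∈ gadgets) gs) → ∏ (items h) b ≡ ℓ ^ length gs
      items-b [] = refl
      items-b (_ ∷ h) = cong (ℓ *_) (items-b h)

      items-a : ∀ {gs} (h : All (_∈ gadgets) gs) → ℓ ^ length gs ≤ κ ^ length gs * ∏ (items h) a
      items-a [] = ≤-refl
      items-a {_ ∷ gs} (g∈ ∷ h) = ≤-trans (*-mono-≤ (proj₁ (proj₂ (proj₂ (dense g∈)))) (items-a h)) (≤-reflexive (lem κ (proj₁ (dense g∈)) (κ ^ length gs) (∏ (items h) a)))
        where lem : ∀ a b c d → a * b * (c * d) ≡ a * c * (b * d)
              lem = solve-∀

      members : All (_∈ gadgets) gadgets
      members = All.tabulate id

      its = items members
      all-linked = λ x → all its (λ it → f it x)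
      K = length gadgets

      positive : 0 < count all-linked Bs
      positive with count all-linked Bs in eq
      ... | suc m = s≤s z≤n
      -- Without a copy, telescoping leaves `∏ its a * ⟪ Bs ⟫` below the loss. Each factor `a` is at
      -- least `ℓ / κ`, so this amounts to `ℓ ≤ 2 * K * κ ^ K`.
      ... | zero = contradiction ℓ-large (≤⇒≯ (*-cancelʳ-≤ ℓ _ (ℓ ^ K * ⟪ Bs ⟫) {{ℕ.>-nonZero (*-mono-≤ (m^n>0 ℓ {{ℕ.>-nonZero ℓ>0}} K) pos)}} (begin
        ℓ * (ℓ ^ K * ⟪ Bs ⟫) ≤⟨ *-monoʳ-≤ ℓ (*-monoˡ-≤ ⟪ Bs ⟫ (items-a members)) ⟩
        ℓ * (κ ^ K * ∏ its a * ⟪ Bs ⟫) ≡⟨ lem₁ ℓ (κ ^ K) (∏ its a) ⟪ Bs ⟫ ⟩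
        κ ^ K * (ℓ * (∏ its a * ⟪ Bs ⟫)) ≤⟨ *-monoʳ-≤ (κ ^ K) (*-monoʳ-≤ ℓ below) ⟩
        κ ^ K * (ℓ * loss Bs refl pos E ℓ (length its)) ≡⟨ cong (κ ^ K *_) (trans (loss-closed Bs refl pos E ℓ (length its)) (cong (λ m → m * (ℓ ^ m * E)) (items-length members))) ⟩
        κ ^ K * (K * (ℓ ^ K * (2 * ⟪ Bs ⟫))) ≡⟨ lem₂ (κ ^ K) K (ℓ ^ K) ⟪ Bs ⟫ ⟩
        2 * K * κ ^ K * (ℓ ^ K * ⟪ Bs ⟫) ∎)))
        where
        open ≤-Reasoning
        ℓ>0 : 0 < ℓ
        ℓ>0 = ≤-trans (s≤s z≤n) ℓ-large
        lem₁ : ∀ l k a b → l * (k * a * b) ≡ k * (l * (a * b))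
        lem₁ = solve-∀
        lem₂ : ∀ k K l b → k * (K * (l * (2 * b))) ≡ 2 * K * k * (l * b)
        lem₂ = solve-∀
        below : ∏ its a * ⟪ Bs ⟫ ≤ loss Bs refl pos E ℓ (length its)
        below = subst₂ (λ s t → ∏ its a * s ≤ t + loss Bs refl pos E ℓ (length its))
          (trans (∑-cong (tuples Bs) (λ x → cong 𝟙 (items-o members x))) (sym (length-∑ (tuples Bs))))
          (trans (cong (∏ its b *_) eq) (*-zeroʳ (∏ its b)))
          (telescope Bs refl pos E ℓ its (items-bounds members) (items-meet members linear))

      witness = ∑-pos (tuples Bs) (𝟙 ∘ all-linked) positive
      x = proj₁ witness
      x∈ = proj₁ (proj₂ witness)

      x-linked : ∀ {g} → g ∈ gadgets → joined (edge₁ g) x ∧ joined (edge₂ g) x ≡ true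
      x-linked g∈ = trans (sym (linked-slots g∈ x)) (items-f members x (𝟙-pos (proj₂ (proj₂ witness))) g∈)

      φ : Fin size → V
      φ v = nth v₀ x (slot v)

      φ-injective : ∀ {v w} → φ v ≡ φ w → v ≡ w
      φ-injective {v} {w} e = slot-injective (nth-injective v₀ (Unique-⊆ (transversal-⊆ (∈-tuples Bs x∈)) distinct) (bd v) (bd w) e)
        where bd : ∀ v → slot v < length x
              bd v = subst (slot v <_) (sym (length-∈-tuples Bs x∈)) (All.lookup Y< (nth-∈ 0 Y (≤-trans (rank<bound p q v) room)))

      φ-image : ∀ p′ a b E → joined (map slot (arrange p′ a b E)) x ≡ edge H (image φ (fromList (a ∷ b ∷ E)))
      φ-image p′ a b E = cong (edge H) (trans (cong fromList (sym (map-∘ (arrange p′ a b E))))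
        (trans (fromList-↭ (↭ₚ.map⁺ φ (arrange-↭ p′ a b E))) (sym (image-fromList φ (a ∷ b ∷ E)))))

    embedding : systemGraph 𝒢 ⊑ H
    embedding = φ , φ-injective , preserves
      where
      preserves : ∀ s → edge (systemGraph 𝒢) s ≡ true → edge H (image φ s) ≡ true
      preserves s e with any-∈ gadgets e
      ... | g , g∈ , e′ with isEdge-true 𝒢 {s} {g} e′
      ... | inj₁ refl = trans (sym (φ-image p (u g) (v g) (rest g))) (∧-trueˡ (x-linked g∈))
      ... | inj₂ refl = trans (sym (φ-image q (u g) (v g) (rest′ g))) (∧-trueʳ {joined (edge₁ g) x} (x-linked g∈))

-- Arithmetic of the upper bound

absorption : ∀ n k → suc k * (suc n choose suc k) ≡ suc n * (n choose k)
absorption zero zero = refl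
absorption zero (suc k) = *-zeroʳ k
absorption (suc n) zero = trans (cong (_+ 0) (nC1≡n (suc (suc n)))) (trans (+-identityʳ _) (sym (*-identityʳ (suc (suc n)))))
absorption (suc n) (suc k) = begin
  suc (suc k) * (suc (suc n) choose suc (suc k)) ≡⟨ cong (suc (suc k) *_) (sym (nCk+nC[k+1]≡[n+1]C[k+1] (suc n) (suc k))) ⟩
  suc (suc k) * (c + suc n choose suc (suc k)) ≡⟨ *-distribˡ-+ (suc (suc k)) c _ ⟩
  suc (suc k) * c + suc (suc k) * (suc n choose suc (suc k)) ≡⟨ cong (suc (suc k) * c +_) (absorption n (suc k)) ⟩
  c + suc k * c + suc n * (n choose suc k) ≡⟨ cong (λ z → c + z + suc n * (n choose suc k)) (absorption n k) ⟩
  c + suc n * (n choose k) + suc n * (n choose suc k) ≡⟨ lem c (suc n) (n choose k) (n choose suc k) ⟩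
  c + suc n * (n choose k + n choose suc k) ≡⟨ cong (λ z → c + suc n * z) (nCk+nC[k+1]≡[n+1]C[k+1] n k) ⟩
  suc (suc n) * c ∎
  where
  open ≡-Reasoning
  c = suc n choose suc k
  lem : ∀ c n a b → c + n * a + n * b ≡ c + n * (a + b)
  lem = solve-∀

private
  absorb! : ∀ n k → (suc n choose suc k) * (suc k !) ≡ suc n * ((n choose k) * (k !))
  absorb! n k = trans (lem (suc n choose suc k) (suc k) (k !)) (trans (cong (_* (k !)) (absorption n k)) (*-assoc (suc n) (n choose k) (k !)))
    where lem : ∀ a b c → a * (b * c) ≡ b * a * c
          lem = solve-∀

choose-upper : ∀ n k → (n choose k) * (k !) ≤ n ^ k
choose-upper n zero = ≤-refl
choose-upper zero (suc k) = z≤n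
choose-upper (suc n) (suc k) = begin
  (suc n choose suc k) * (suc k !) ≡⟨ absorb! n k ⟩
  suc n * ((n choose k) * (k !)) ≤⟨ *-monoʳ-≤ (suc n) (≤-trans (choose-upper n k) (^-monoˡ-≤ k (n≤1+n n))) ⟩
  suc n * suc n ^ k ∎
  where open ≤-Reasoning

choose-lower : ∀ d k → d ^ k ≤ ((d + k) choose k) * (k !)
choose-lower d zero = ≤-refl
choose-lower d (suc k) = begin
  d * d ^ k ≤⟨ *-mono-≤ (≤-trans (m≤m+n d k) (n≤1+n (d + k))) (choose-lower d k) ⟩
  suc (d + k) * (((d + k) choose k) * (k !)) ≡⟨ sym (absorb! (d + k) k) ⟩
  (suc (d + k) choose suc k) * (suc k !) ≡⟨ cong (λ m → (m choose suc k) * (suc k !)) (sym (+-suc d k)) ⟩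
  ((d + suc k) choose suc k) * (suc k !) ∎
  where open ≤-Reasoning

-- Divided by `d * d ^ m`, this is `(1 + x / d) ^ m ≤ 1 + (1 + 2 * x) ^ m /
-- d`: a relative error of order `1 / d` whose constant does not involve `d`.
pow-bound : ∀ d x m → 0 < d → d * (d + x) ^ m ≤ (d + (1 + 2 * x) ^ m) * d ^ m
pow-bound d x zero d>0 = ≤-trans (≤-reflexive (*-identityʳ d)) (≤-trans (m≤m+n d 1) (≤-reflexive (sym (*-identityʳ (d + 1)))))
pow-bound d x (suc m) d>0 = begin
  d * ((d + x) * (d + x) ^ m) ≡⟨ lem₁ d (d + x) ((d + x) ^ m) ⟩
  (d + x) * (d * (d + x) ^ m) ≤⟨ *-monoʳ-≤ (d + x) (pow-bound d x m d>0) ⟩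
  (d + x) * ((d + K) * d ^ m) ≡⟨ lem₂ d x K (d ^ m) ⟩
  (d * d + d * K + x * (d + K)) * d ^ m ≤⟨ *-monoˡ-≤ (d ^ m) (+-monoʳ-≤ (d * d + d * K) (*-monoʳ-≤ x (+-mono-≤ (m≤m*n′ d K K>0) (m≤n*m′ d K d>0)))) ⟩
  (d * d + d * K + x * (d * K + d * K)) * d ^ m ≡⟨ lem₃ d x K (d ^ m) ⟩
  (d + (1 + 2 * x) * K) * (d * d ^ m) ∎
  where
  open ≤-Reasoning
  K = (1 + 2 * x) ^ m
  K>0 : 0 < K
  K>0 = m^n>0 (1 + 2 * x) m
  m≤m*n′ : ∀ a b → 0 < b → a ≤ a * b
  m≤m*n′ a b h = ≤-trans (≤-reflexive (sym (*-identityʳ a))) (*-monoʳ-≤ a h)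
  m≤n*m′ : ∀ a b → 0 < a → b ≤ a * b
  m≤n*m′ a b h = ≤-trans (≤-reflexive (sym (*-identityˡ b))) (*-monoˡ-≤ b h)
  lem₁ : ∀ a b c → a * (b * c) ≡ b * (a * c)
  lem₁ = solve-∀
  lem₂ : ∀ d x K p → (d + x) * ((d + K) * p) ≡ (d * d + d * K + x * (d + K)) * p
  lem₂ = solve-∀
  lem₃ : ∀ d x K p → (d * d + d * K + x * (d * K + d * K)) * p ≡ (d + (1 + 2 * x) * K) * (d * p)
  lem₃ = solve-∀

two-squares : ∀ u w → 2 * (u * w) ≤ u * u + w * w
two-squares u w with ≤-total u w
... | inj₁ h with m≤n⇒∃[o]m+o≡n h
... | d , refl = ≤-trans (m≤m+n (2 * (u * (u + d))) (d * d)) (≤-reflexive (lem u d))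
  where lem : ∀ u d → 2 * (u * (u + d)) + d * d ≡ u * u + (u + d) * (u + d)
        lem = solve-∀
two-squares u w | inj₂ h with m≤n⇒∃[o]m+o≡n h
... | d , refl = ≤-trans (m≤m+n (2 * ((w + d) * w)) (d * d)) (≤-reflexive (lem w d))
  where lem : ∀ w d → 2 * ((w + d) * w) + d * d ≡ (w + d) * (w + d) + w * w
        lem = solve-∀

private
  -- The inequality of the means for `u` once and `w` taken `c` times. The induction on `c` needs
  -- only `2 * u * w ≤ u * u + w * w`; the mixed term is added on both sides because there is no
  -- subtraction.
  weighted : ∀ c u w → suc c * (u * w ^ c) ≤ u ^ suc c + c * w ^ suc c
  weighted zero u w = ≤-reflexive (lem u w)
    where lem : ∀ u w → 1 * (u * 1) ≡ u * 1 + 0 * (w * 1)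
          lem = solve-∀
  weighted (suc c) u w = +-cancelʳ-≤ (c * (u * (w * w ^ c))) _ _ (begin
    suc (suc c) * (u * (w * p)) + c * (u * (w * p)) ≡⟨ lem₁ c u w p ⟩
    suc c * p * (2 * (u * w)) ≤⟨ *-monoʳ-≤ (suc c * p) (two-squares u w) ⟩
    suc c * p * (u * u + w * w) ≡⟨ lem₂ c u w p ⟩
    u * (suc c * (u * p)) + suc c * (w * (w * p)) ≤⟨ +-monoˡ-≤ (suc c * (w * (w * p))) (*-monoʳ-≤ u (weighted c u w)) ⟩
    u * (u ^ suc c + c * (w * p)) + suc c * (w * (w * p)) ≡⟨ lem₃ c u w p (u ^ suc c) ⟩
    u * u ^ suc c + suc c * (w * (w * p)) + c * (u * (w * p)) ∎)
    where
    open ≤-Reasoning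
    p = w ^ c
    lem₁ : ∀ c u w p → (2 + c) * (u * (w * p)) + c * (u * (w * p)) ≡ (1 + c) * p * (2 * (u * w))
    lem₁ = solve-∀
    lem₂ : ∀ c u w p → (1 + c) * p * (u * u + w * w) ≡ u * ((1 + c) * (u * p)) + (1 + c) * (w * (w * p))
    lem₂ = solve-∀
    lem₃ : ∀ c u w p q → u * (q + c * (w * p)) + (1 + c) * (w * (w * p)) ≡ u * q + (1 + c) * (w * (w * p)) + c * (u * (w * p))
    lem₃ = solve-∀

  -- the weighted inequality at u = c (x + S) and w = (c + 1) S
  am-gm-step : ∀ c x S → 0 < c → suc c ^ suc c * (x * S ^ c) ≤ c ^ c * (x + S) ^ suc c
  am-gm-step c x S c>0 = *-cancelˡ-≤ c {{ℕ.>-nonZero c>0}} (+-cancelʳ-≤ (c * w ^ suc c) _ _ (begin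
    c * (suc c ^ suc c * (x * S ^ c)) + c * (suc c * S * w ^ c) ≡⟨ cong (λ z → c * (suc c ^ suc c * (x * S ^ c)) + c * (suc c * S * z)) (^-* c (suc c) S) ⟩
    c * (suc c * suc c ^ c * (x * S ^ c)) + c * (suc c * S * (suc c ^ c * S ^ c)) ≡⟨ lem₁ c (suc c ^ c) x S (S ^ c) ⟩
    suc c * (c * (x + S) * (suc c ^ c * S ^ c)) ≡⟨ cong (λ z → suc c * (c * (x + S) * z)) (sym (^-* c (suc c) S)) ⟩
    suc c * (u′ * w ^ c) ≤⟨ weighted c u′ w ⟩
    u′ ^ suc c + c * w ^ suc c ≡⟨ cong (_+ c * w ^ suc c) (trans (^-* (suc c) c (x + S)) (*-assoc c (c ^ c) _)) ⟩
    c * (c ^ c * (x + S) ^ suc c) + c * w ^ suc c ∎))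
    where
    open ≤-Reasoning
    u′ = c * (x + S)
    w = suc c * S
    lem₁ : ∀ c q x S s → c * ((1 + c) * q * (x * s)) + c * ((1 + c) * S * (q * s)) ≡ (1 + c) * (c * (x + S) * (q * s))
    lem₁ = solve-∀

am-gm : ∀ {A : Set} (xs : List A) (f : A → ℕ) → length xs ^ length xs * ∏ xs f ≤ ∑ xs f ^ length xs
am-gm [] f = ≤-refl
am-gm (x ∷ []) f = ≤-reflexive (lem (f x))
  where lem : ∀ a → 1 * (a * 1) ≡ (a + 0) * 1
        lem = solve-∀
am-gm (x ∷ xs@(y ∷ ys)) f = *-cancelˡ-≤ (c ^ c) {{m^n≢0 c c}} (begin
  c ^ c * (suc c ^ suc c * (f x * P)) ≡⟨ lem (c ^ c) (suc c ^ suc c) (f x) P ⟩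
  suc c ^ suc c * (f x * (c ^ c * P)) ≤⟨ *-monoʳ-≤ (suc c ^ suc c) (*-monoʳ-≤ (f x) (am-gm xs f)) ⟩
  suc c ^ suc c * (f x * S ^ c) ≤⟨ am-gm-step c (f x) S (s≤s z≤n) ⟩
  c ^ c * (f x + S) ^ suc c ∎)
  where
  open ≤-Reasoning
  c = length xs
  P = ∏ xs f
  S = ∑ xs f
  lem : ∀ a b c d → a * (b * (c * d)) ≡ b * (c * (a * d))
  lem = solve-∀

chunks : ∀ {A : Set} → ℕ → ℕ → List A → List (List A)
chunks zero m xs = []
chunks (suc t) m xs = take m xs ∷ chunks t m (drop m xs)

length-chunks : ∀ {A : Set} t m (xs : List A) → length (chunks t m xs) ≡ t
length-chunks zero m xs = refl
length-chunks (suc t) m xs = cong suc (length-chunks t m (drop m xs))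

chunks-sides : ∀ {A : Set} t m (xs : List A) → t * m ≤ length xs → All (λ B → length B ≡ m) (chunks t m xs)
chunks-sides zero m xs h = []
chunks-sides (suc t) m xs h = trans (length-take m xs) (m≤n⇒m⊓n≡m (≤-trans (m≤m+n m (t * m)) h)) ∷
  chunks-sides t m (drop m xs) (≤-trans (m+n≤o⇒m≤o∸n (t * m) (≤-trans (≤-reflexive (+-comm (t * m) m)) h)) (≤-reflexive (sym (length-drop m xs))))

concat-chunks : ∀ {A : Set} t m (xs : List A) → concat (chunks t m xs) ⊆ xs
concat-chunks zero m xs = Sub.minimum xs
concat-chunks (suc t) m xs = subst (take m xs ++ concat (chunks t m (drop m xs)) ⊆_) (take++drop≡id m xs) (Subₚ.++⁺ ⊆-refl (concat-chunks t m (drop m xs)))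

combos-∈ : ∀ {A : Set} {k} {Z xs : List A} → Z ⊆ xs → length Z ≡ k → Z ∈ combos k xs
combos-∈ {k = zero} {[]} s l = here refl
combos-∈ {k = suc k} (_∷ʳ_ {xs = Z} {ys = xs} y s) l = ∈ₚ.∈-++⁺ʳ (map (y ∷_) (combos k xs)) (combos-∈ s l)
combos-∈ {k = suc k} (_∷_ {x} refl s) l = ∈ₚ.∈-++⁺ˡ (∈ₚ.∈-map⁺ (x ∷_) (combos-∈ s (suc-injective l)))

funToFin-injective : ∀ {m n} {f g : Fin m → Fin n} → funToFin f ≡ funToFin g → ∀ i → f i ≡ g i
funToFin-injective {m} {n} {f} {g} e i = trans (sym (Finₚ.finToFun-funToFin f i)) (trans (cong (λ c → finToFun c i) e) (Finₚ.finToFun-funToFin g i))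

-- Averages over a box, and popular pairs

module BoxCounts {k : ℕ} (H : Hypergraph (2 + k)) (v₀ : Fin (n H)) (Bs : List (List (Fin (n H)))) (s : ℕ)
  (sides : All (λ B → length B ≡ s) Bs) (s>0 : 0 < s) where

  private
    r = 2 + k
    V = Fin (n H)
    T = length Bs
    X = tuples Bs

  open Links H v₀ T
  open Telescoping {V} v₀ T

  vol>0 : 0 < ⟪ Bs ⟫
  vol>0 = ≤-trans (m^n>0 s {{ℕ.>-nonZero s>0}} T) (≤-reflexive (sym (vol-^ Bs sides)))

  -- Transversal sets are only some of the sets in a union of sides, so a lower bound on edges does
  -- not pass to them. An upper bound on non-edges does.
  nonedge : List V → ℕ
  nonedge l = 𝟙 (not (edge H (fromList l)))

  selection : List ℕ → List (List V)
  selection Y = map (nth [] Bs) Y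

  selection-sides : ∀ {Y} → All (_< T) Y → All (λ B → length B ≡ s) (selection Y)
  selection-sides [] = []
  selection-sides (h ∷ hs) = All.lookup sides (nth-∈ [] Bs h) ∷ selection-sides hs

  -- Double counting over the tuples of the box: every `r`-set of indices from `Y` is an edge or a
  -- non-edge in each tuple, and by `crossing-average` the non-edges seen by a random tuple measure
  -- the transversal non-edges.
  average : ∀ Y → Increasing Y → All (_< T) Y →
    ⟪ Bs ⟫ * crossing r (selection Y) nonedge + s ^ r * ∑ (combos r Y) (λ Z → count (joined Z) Bs) ≡ s ^ r * (⟪ Bs ⟫ * (length Y choose r))
  average Y inc Y< = trans (cong (_+ s ^ r * ∑ (combos r Y) (λ Z → count (joined Z) Bs)) (sym cross))
      (trans (lem S (s ^ r) _) (cong (s ^ r *_) complement))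
    where
    lem : ∀ a b c → a * b + b * c ≡ b * (a + c)
    lem = solve-∀
    m = length Y
    S = ∑ X (λ x → ∑ (combos r (map (nth v₀ x) Y)) nonedge)
    cross : S * s ^ r ≡ ⟪ Bs ⟫ * crossing r (selection Y) nonedge
    cross = *-cancelʳ-≡ _ _ (s ^ m) {{m^n≢0 s m {{ℕ.>-nonZero s>0}}}} (begin
      S * s ^ r * s ^ m ≡⟨ lem₁ S (s ^ r) (s ^ m) ⟩
      S * s ^ m * s ^ r ≡⟨ cong (_* s ^ r) (∑-marginal v₀ s Bs sides Y inc Y< (λ l → ∑ (combos r l) nonedge)) ⟩
      s ^ T * ∑ (tuples (selection Y)) (λ l → ∑ (combos r l) nonedge) * s ^ r ≡⟨ *-assoc (s ^ T) _ (s ^ r) ⟩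
      s ^ T * (∑ (tuples (selection Y)) (λ l → ∑ (combos r l) nonedge) * s ^ r) ≡⟨ cong (s ^ T *_) (crossing-average s r (selection Y) nonedge (selection-sides Y<)) ⟩
      s ^ T * (s ^ length (selection Y) * crossing r (selection Y) nonedge) ≡⟨ cong₂ (λ a b → a * (s ^ b * crossing r (selection Y) nonedge)) (sym (vol-^ Bs sides)) (length-map (nth [] Bs) Y) ⟩
      ⟪ Bs ⟫ * (s ^ m * crossing r (selection Y) nonedge) ≡⟨ lem₂ ⟪ Bs ⟫ (s ^ m) (crossing r (selection Y) nonedge) ⟩
      ⟪ Bs ⟫ * crossing r (selection Y) nonedge * s ^ m ∎)
      where
      open ≡-Reasoning
      lem₁ : ∀ a b c → a * b * c ≡ a * c * b
      lem₁ = solve-∀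
      lem₂ : ∀ a b c → a * (b * c) ≡ a * c * b
      lem₂ = solve-∀
    complement : S + ∑ (combos r Y) (λ Z → count (joined Z) Bs) ≡ ⟪ Bs ⟫ * (m choose r)
    complement = begin
      S + ∑ (combos r Y) (λ Z → count (joined Z) Bs)
        ≡⟨ cong (_+ ∑ (combos r Y) (λ Z → count (joined Z) Bs)) (trans (∑-cong X λ x → ∑-combos-map (nth v₀ x) r Y nonedge) (∑-swap X (combos r Y) (λ x Z → nonedge (map (nth v₀ x) Z)))) ⟩
      ∑ (combos r Y) (λ Z → ∑ X (λ x → 𝟙 (not (joined Z x)))) + ∑ (combos r Y) (λ Z → ∑ X (λ x → 𝟙 (joined Z x)))
        ≡⟨ sym (∑-+ (combos r Y) _ _) ⟩
      ∑ (combos r Y) (λ Z → ∑ X (λ x → 𝟙 (not (joined Z x))) + ∑ X (λ x → 𝟙 (joined Z x)))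
        ≡⟨ ∑-cong (combos r Y) (λ Z → trans (sym (∑-+ X _ _)) (trans (∑-cong X λ x → trans (+-comm (𝟙 (not (joined Z x))) _) (𝟙-not (joined Z x))) (sym (length-∑ X)))) ⟩
      ∑ (combos r Y) (λ Z → ⟪ Bs ⟫) ≡⟨ ∑-const (combos r Y) ⟪ Bs ⟫ ⟩
      length (combos r Y) * ⟪ Bs ⟫ ≡⟨ trans (cong (_* ⟪ Bs ⟫) (length-combos r Y)) (*-comm (m choose r) ⟪ Bs ⟫) ⟩
      ⟪ Bs ⟫ * (m choose r) ∎
      where open ≡-Reasoning

  length-concat : ∀ {Cs : List (List V)} → All (λ B → length B ≡ s) Cs → length (concat Cs) ≡ length Cs * s
  length-concat [] = refl
  length-concat {C ∷ Cs} (h ∷ hs) = trans (length-++ C) (cong₂ _+_ h (length-concat hs))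

  -- if every r-tuple of selected sides were sparse, the union of these sides would violate the local density
  sparse-contradiction : ∀ A Q → 0 < A → A + Q ≤ A * Q → concat Bs ⊆ allFin (n H) → ∀ Y → Increasing Y → All (_< T) Y →
    (∀ S → ∣ S ∣ ≡ length Y * s → (A + Q) * (∣ S ∣ choose r) ≤ A * Q * eCount H S) →
    (∀ Z → Z ∈ combos r Y → 4 * A * Q * count (joined Z) Bs ≤ (4 * A + 3 * Q) * ⟪ Bs ⟫) →
    4 * A * ((length Y * s) choose r) < (4 * A + 1) * (s ^ r * (length Y choose r)) → ⊥
  sparse-contradiction A Q A>0 A+Q≤ Bs⊆ Y inc Y< dense sparse close with m≤n⇒∃[o]m+o≡n A+Q≤
  -- `W / (A * Q)` is one minus the guaranteed density `1 / Q + 1 / A`, so it bounds the density of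
  -- non-edges. Sparseness, with the threshold `1 / Q + 3 / (4 * A)`, would require transversal
  -- non-edges of density at least `(4 * W + Q) / (4 * A * Q)`; the factor `1 + 1 / (4 * A)` between
  -- all sets and the transversal ones is too small for that.
  ... | W , A+Q+W≡ = <-irrefl refl (begin-strict
      W * D₁ <⟨ *-monoˡ-< D₁ {{ℕ.>-nonZero D₁>0}} W< ⟩
      A * Q * D₁ ≤⟨ +-cancelˡ-≤ (4 * A * W * D₁) _ _ combined ⟩
      W * D₁ ∎)
    where
    open ≤-Reasoning
    m = length Y
    L = concat (selection Y)
    S = fromList L
    D₁ = s ^ r * (m choose r)
    Cn = (m * s) choose r
    L⊆ : L ⊆ allFin (n H)
    L⊆ = ⊆-trans (concat-⊆ (nth-⊆ [] Bs inc Y<)) Bs⊆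
      where
      concat-⊆ : ∀ {Cs Ds : List (List V)} → Cs ⊆ Ds → concat Cs ⊆ concat Ds
      concat-⊆ [] = []
      concat-⊆ (D ∷ʳ p) = Subₚ.++⁺ (Sub.minimum D) (concat-⊆ p)
      concat-⊆ (refl ∷ p) = Subₚ.++⁺ ⊆-refl (concat-⊆ p)
    S-size : ∣ S ∣ ≡ m * s
    S-size = trans (size-fromList L (Unique-⊆ L⊆ (Uniqueₚ.allFin⁺ (n H)))) (trans (length-concat (selection-sides Y<)) (cong (_* s) (length-map (nth [] Bs) Y)))
    e = ∑ (combos r L) (𝟙 ∘ edge H ∘ fromList)
    ē = ∑ (combos r L) nonedge
    e≡ : eCount H S ≡ e
    e≡ = trans (eCount-combos H S) (cong (λ l → ∑ (combos r l) (𝟙 ∘ edge H ∘ fromList)) (elems-fromList L⊆))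
    e+ē : e + ē ≡ Cn
    e+ē = trans (sym (∑-+ (combos r L) _ _)) (trans (∑-cong (combos r L) λ l → 𝟙-not (edge H (fromList l))) (trans (sym (length-∑ (combos r L)))
      (trans (length-combos r L) (cong (_choose r) (trans (sym (size-fromList L (Unique-⊆ L⊆ (Uniqueₚ.allFin⁺ (n H))))) S-size)))))
    few-nonedges : A * Q * ē + (A + Q) * Cn ≤ A * Q * Cn
    few-nonedges = begin
      A * Q * ē + (A + Q) * Cn ≤⟨ +-monoʳ-≤ (A * Q * ē) (subst₂ (λ a b → (A + Q) * (a choose r) ≤ A * Q * b) S-size e≡ (dense S S-size)) ⟩
      A * Q * ē + A * Q * e ≡⟨ trans (sym (*-distribˡ-+ (A * Q) ē e)) (cong (A * Q *_) (trans (+-comm ē e) e+ē)) ⟩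
      A * Q * Cn ∎
    cr = crossing r (selection Y) nonedge
    many-nonedges : 4 * A * Q * D₁ ≤ 4 * A * Q * cr + (4 * A + 3 * Q) * D₁
    many-nonedges = *-cancelˡ-≤ ⟪ Bs ⟫ {{ℕ.>-nonZero vol>0}} (begin
      ⟪ Bs ⟫ * (4 * A * Q * D₁) ≡⟨ lem₁ ⟪ Bs ⟫ (4 * A * Q) (s ^ r) (m choose r) ⟩
      4 * A * Q * (s ^ r * (⟪ Bs ⟫ * (m choose r))) ≡⟨ cong (4 * A * Q *_) (sym (average Y inc Y<)) ⟩
      4 * A * Q * (⟪ Bs ⟫ * cr + s ^ r * ∑ (combos r Y) (λ Z → count (joined Z) Bs)) ≡⟨ lem₂ (4 * A * Q) ⟪ Bs ⟫ cr (s ^ r) _ ⟩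
      ⟪ Bs ⟫ * (4 * A * Q * cr) + s ^ r * (4 * A * Q * ∑ (combos r Y) (λ Z → count (joined Z) Bs))
        ≤⟨ +-monoʳ-≤ (⟪ Bs ⟫ * (4 * A * Q * cr)) (*-monoʳ-≤ (s ^ r) total-sparse) ⟩
      ⟪ Bs ⟫ * (4 * A * Q * cr) + s ^ r * ((m choose r) * ((4 * A + 3 * Q) * ⟪ Bs ⟫)) ≡⟨ lem₃ ⟪ Bs ⟫ (4 * A * Q * cr) (s ^ r) (m choose r) (4 * A + 3 * Q) ⟩
      ⟪ Bs ⟫ * (4 * A * Q * cr + (4 * A + 3 * Q) * D₁) ∎)
      where
      total-sparse : 4 * A * Q * ∑ (combos r Y) (λ Z → count (joined Z) Bs) ≤ (m choose r) * ((4 * A + 3 * Q) * ⟪ Bs ⟫)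
      total-sparse = ≤-trans (≤-reflexive (sym (∑-* (combos r Y) (4 * A * Q) _))) (≤-trans (∑-mono∈ (combos r Y) sparse)
        (≤-reflexive (trans (∑-const (combos r Y) ((4 * A + 3 * Q) * ⟪ Bs ⟫)) (cong (_* ((4 * A + 3 * Q) * ⟪ Bs ⟫)) (length-combos r Y)))))
      lem₁ : ∀ v a p c → v * (a * (p * c)) ≡ a * (p * (v * c))
      lem₁ = solve-∀
      lem₂ : ∀ a v c p z → a * (v * c + p * z) ≡ v * (a * c) + p * (a * z)
      lem₂ = solve-∀
      lem₃ : ∀ v a p c b → v * a + p * (c * (b * v)) ≡ v * (a + b * (p * c))
      lem₃ = solve-∀
    both : 4 * W * D₁ + Q * D₁ ≤ 4 * W * Cn
    both = +-cancelʳ-≤ ((4 * A + 3 * Q) * D₁ + 4 * (A + Q) * Cn) _ _ (begin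
      4 * W * D₁ + Q * D₁ + ((4 * A + 3 * Q) * D₁ + 4 * (A + Q) * Cn) ≡⟨ lem₁ A Q W D₁ Cn ⟩
      4 * (A + Q + W) * D₁ + 4 * ((A + Q) * Cn) ≡⟨ cong (λ z → 4 * z * D₁ + 4 * ((A + Q) * Cn)) A+Q+W≡ ⟩
      4 * (A * Q) * D₁ + 4 * ((A + Q) * Cn) ≡⟨ cong (λ z → z * D₁ + 4 * ((A + Q) * Cn)) (sym (*-assoc 4 A Q)) ⟩
      4 * A * Q * D₁ + 4 * ((A + Q) * Cn) ≤⟨ +-monoˡ-≤ (4 * ((A + Q) * Cn)) (≤-trans many-nonedges (+-monoˡ-≤ ((4 * A + 3 * Q) * D₁) (*-monoʳ-≤ (4 * A * Q) (crossing-≤-combos r (selection Y) nonedge)))) ⟩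
      4 * A * Q * ē + (4 * A + 3 * Q) * D₁ + 4 * ((A + Q) * Cn) ≡⟨ lem₂ A Q ē D₁ ((A + Q) * Cn) ⟩
      4 * (A * Q * ē + (A + Q) * Cn) + (4 * A + 3 * Q) * D₁ ≤⟨ +-monoˡ-≤ ((4 * A + 3 * Q) * D₁) (*-monoʳ-≤ 4 few-nonedges) ⟩
      4 * (A * Q * Cn) + (4 * A + 3 * Q) * D₁ ≡⟨ cong (λ z → 4 * (z * Cn) + (4 * A + 3 * Q) * D₁) (sym A+Q+W≡) ⟩
      4 * ((A + Q + W) * Cn) + (4 * A + 3 * Q) * D₁ ≡⟨ lem₃ A Q W Cn D₁ ⟩
      4 * W * Cn + ((4 * A + 3 * Q) * D₁ + 4 * (A + Q) * Cn) ∎)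
      where
      lem₁ : ∀ A Q W D C → 4 * W * D + Q * D + ((4 * A + 3 * Q) * D + 4 * (A + Q) * C) ≡ 4 * (A + Q + W) * D + 4 * ((A + Q) * C)
      lem₁ = solve-∀
      lem₂ : ∀ A Q e D c → 4 * A * Q * e + (4 * A + 3 * Q) * D + 4 * c ≡ 4 * (A * Q * e + c) + (4 * A + 3 * Q) * D
      lem₂ = solve-∀
      lem₃ : ∀ A Q W C D → 4 * ((A + Q + W) * C) + (4 * A + 3 * Q) * D ≡ 4 * W * C + ((4 * A + 3 * Q) * D + 4 * (A + Q) * C)
      lem₃ = solve-∀
    combined : 4 * A * W * D₁ + A * Q * D₁ ≤ 4 * A * W * D₁ + W * D₁
    combined = begin
      4 * A * W * D₁ + A * Q * D₁ ≡⟨ lem₁ A W Q D₁ ⟩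
      A * (4 * W * D₁ + Q * D₁) ≤⟨ *-monoʳ-≤ A both ⟩
      A * (4 * W * Cn) ≡⟨ lem₂ A W Cn ⟩
      W * (4 * A * Cn) ≤⟨ *-monoʳ-≤ W (<⇒≤ close) ⟩
      W * ((4 * A + 1) * D₁) ≡⟨ lem₃ A W D₁ ⟩
      4 * A * W * D₁ + W * D₁ ∎
      where
      lem₁ : ∀ A W Q D → 4 * A * W * D + A * Q * D ≡ A * (4 * W * D + Q * D)
      lem₁ = solve-∀
      lem₂ : ∀ A W C → A * (4 * W * C) ≡ W * (4 * A * C)
      lem₂ = solve-∀
      lem₃ : ∀ A W D → W * ((4 * A + 1) * D) ≡ 4 * A * W * D + W * D
      lem₃ = solve-∀
    W< : W < A * Q
    W< = ≤-trans (+-monoˡ-≤ W (≤-trans A>0 (m≤m+n A Q))) (≤-reflexive A+Q+W≡)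
    D₁>0 : 0 < D₁
    D₁>0 = pos D₁ {4 * A + 1} close
      where pos : ∀ d {c x} → x < c * d → 0 < d
            pos zero {c} h = contradiction (≤-trans h (≤-reflexive (*-zeroʳ c))) λ ()
            pos (suc d) h = s≤s z≤n

  pairMask : ℕ → ℕ → ℕ → Bool
  pairMask i j = mask (i ∷ j ∷ [])

  mixed : (ℕ → Bool) → List V → List V → ℕ → V
  mixed m x z i = if m i then nth v₀ x i else nth v₀ z i

  joinedMix : (ℕ → Bool) → List ℕ → List V → List V → Bool
  joinedMix m I x z = edge H (fromList (map (mixed m x z) I))

  joined-merge : ∀ m I x z → length x ≡ length z → joined I (merge m x z) ≡ joinedMix m I x z
  joined-merge m I x z l = cong (λ l → edge H (fromList l)) (map-cong (λ i → nth-merge v₀ m x z i l) I)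

  -- The number of extensions of the pair `(x i , x j)` to an edge on `I`, weighted by the free
  -- coordinates. The whole tuple `x` is passed, though the value depends on these two entries
  -- alone, so that degrees are functions on the box.
  degree : List ℕ → ℕ → ℕ → List V → ℕ
  degree I i j x = ∑ X (λ z → 𝟙 (joinedMix (pairMask i j) I x z))

  popular : ℕ → List ℕ → ℕ → ℕ → List V → Bool
  popular N I i j x = ⟪ Bs ⟫ ℕ.≤ᵇ N * degree I i j x

  popular-depends : ∀ N I i j → DependsOn (pairMask i j) (popular N I i j)
  popular-depends N I i j x y agree = cong (λ d → ⟪ Bs ⟫ ℕ.≤ᵇ N * d) (∑-cong X λ z → cong (λ l → 𝟙 (edge H (fromList l))) (map-cong (eq z) I))
    where
    eq : ∀ z l → mixed (pairMask i j) x z l ≡ mixed (pairMask i j) y z l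
    eq z l = by (pairMask i j l) refl
      where by : ∀ b → pairMask i j l ≡ b → (if b then nth v₀ x l else nth v₀ z l) ≡ (if b then nth v₀ y l else nth v₀ z l)
            by true e = agree l e
            by false e = refl

  private
    same-length : ∀ {x z} → x ∈ X → z ∈ X → length x ≡ length z
    same-length x∈ z∈ = trans (length-∈-tuples Bs x∈) (sym (length-∈-tuples Bs z∈))

  -- Resampling everything but the coordinates `i` and `j` turns the count into the average degree
  -- over unpopular pairs, and each such degree is at most `⟪ Bs ⟫ / N`.
  unpopular-few : ∀ N I i j → N * count (λ x → joined I x ∧ not (popular N I i j x)) Bs ≤ ⟪ Bs ⟫
  unpopular-few N I i j = *-cancelˡ-≤ ⟪ Bs ⟫ {{ℕ.>-nonZero vol>0}} (begin
    ⟪ Bs ⟫ * (N * count F Bs) ≡⟨ lem ⟪ Bs ⟫ N (count F Bs) ⟩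
    N * (⟪ Bs ⟫ * count F Bs) ≡⟨ cong (N *_) (sym (∑-resample (pairMask i j) Bs (𝟙 ∘ F))) ⟩
    N * ∑ X (λ x → ∑ X (λ z → 𝟙 (F (merge (pairMask i j) x z)))) ≡⟨ cong (N *_) (∑-cong∈ X λ x x∈ → trans (∑-cong∈ X λ z z∈ → step x z (same-length x∈ z∈)) (∑-* X (𝟙 (not (popular N I i j x))) _)) ⟩
    N * ∑ X (λ x → 𝟙 (not (popular N I i j x)) * degree I i j x) ≡⟨ sym (∑-* X N _) ⟩
    ∑ X (λ x → N * (𝟙 (not (popular N I i j x)) * degree I i j x)) ≤⟨ ∑-mono X (λ x → bound x (popular N I i j x) refl) ⟩
    ∑ X (λ x → ⟪ Bs ⟫) ≡⟨ ∑-const X ⟪ Bs ⟫ ⟩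
    ⟪ Bs ⟫ * ⟪ Bs ⟫ ∎)
    where
    open ≤-Reasoning
    F = λ x → joined I x ∧ not (popular N I i j x)
    lem : ∀ a b c → a * (b * c) ≡ b * (a * c)
    lem = solve-∀
    step : ∀ x z → length x ≡ length z → 𝟙 (F (merge (pairMask i j) x z)) ≡ 𝟙 (not (popular N I i j x)) * 𝟙 (joinedMix (pairMask i j) I x z)
    step x z l = trans (𝟙-∧ (joined I (merge (pairMask i j) x z)) _) (trans (*-comm (𝟙 (joined I (merge (pairMask i j) x z))) _)
      (cong₂ (λ a b → 𝟙 (not a) * 𝟙 b) (popular-depends N I i j (merge (pairMask i j) x z) x (λ l′ e → trans (nth-merge v₀ (pairMask i j) x z l′ l) (cong (λ b → if b then nth v₀ x l′ else nth v₀ z l′) e)))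
        (joined-merge (pairMask i j) I x z l)))
    bound : ∀ x b → popular N I i j x ≡ b → N * (𝟙 (not b) * degree I i j x) ≤ ⟪ Bs ⟫
    bound x true e = ≤-trans (≤-reflexive (*-zeroʳ N)) z≤n
    bound x false e = ≤-trans (≤-reflexive (cong (N *_) (*-identityˡ (degree I i j x)))) (≤ᵇ-false e)

  -- two popular edges through the same pair extend to many gadgets, since their other vertices are independent
  popular-overlap : ∀ N I I′ i j → (∀ {l} → l ∈ I → l ∈ I′ → pairMask i j l ≡ true) →
    count (λ x → popular N I i j x ∧ popular N I′ i j x) Bs ≤ N * N * count (λ x → joined I x ∧ joined I′ x) Bs
  popular-overlap N I I′ i j share = *-cancelˡ-≤ (⟪ Bs ⟫ * ⟪ Bs ⟫) {{ℕ.>-nonZero (*-mono-≤ vol>0 vol>0)}} (begin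
    ⟪ Bs ⟫ * ⟪ Bs ⟫ * ∑ X (λ x → 𝟙 (P x ∧ P′ x)) ≡⟨ sym (∑-* X (⟪ Bs ⟫ * ⟪ Bs ⟫) _) ⟩
    ∑ X (λ x → ⟪ Bs ⟫ * ⟪ Bs ⟫ * 𝟙 (P x ∧ P′ x)) ≤⟨ ∑-mono X (λ x → bound x (P x) (P′ x) refl refl) ⟩
    ∑ X (λ x → N * N * (degree I i j x * degree I′ i j x)) ≡⟨ ∑-* X (N * N) _ ⟩
    N * N * ∑ X (λ x → degree I i j x * degree I′ i j x) ≡⟨ cong (N * N *_) resampled ⟩
    N * N * (⟪ Bs ⟫ * (⟪ Bs ⟫ * count G Bs)) ≡⟨ lem (N * N) ⟪ Bs ⟫ (count G Bs) ⟩
    ⟪ Bs ⟫ * ⟪ Bs ⟫ * (N * N * count G Bs) ∎)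
    where
    P = popular N I i j
    P′ = popular N I′ i j
    G = λ x → joined I x ∧ joined I′ x
    m = pairMask i j
    -- The coordinates of `I′` off the common pair are resampled a second time, from `z′`. Since `I`
    -- and `I′` share nothing outside the pair, the edge on `I` does not notice.
    m′ : ℕ → Bool
    m′ l = mask I′ l ∧ not (m l)
    lem : ∀ a b c → a * (b * (b * c)) ≡ b * b * (a * c)
    lem = solve-∀
    bound : ∀ x b b′ → P x ≡ b → P′ x ≡ b′ → ⟪ Bs ⟫ * ⟪ Bs ⟫ * 𝟙 (b ∧ b′) ≤ N * N * (degree I i j x * degree I′ i j x)
    bound x true true e e′ = begin
      ⟪ Bs ⟫ * ⟪ Bs ⟫ * 1 ≡⟨ *-identityʳ _ ⟩
      ⟪ Bs ⟫ * ⟪ Bs ⟫ ≤⟨ *-mono-≤ (≤ᵇ-true {⟪ Bs ⟫} {N * degree I i j x} e) (≤ᵇ-true {⟪ Bs ⟫} {N * degree I′ i j x} e′) ⟩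
      N * degree I i j x * (N * degree I′ i j x) ≡⟨ lem₁ N (degree I i j x) (degree I′ i j x) ⟩
      N * N * (degree I i j x * degree I′ i j x) ∎
      where
      open ≤-Reasoning
      lem₁ : ∀ N a b → N * a * (N * b) ≡ N * N * (a * b)
      lem₁ = solve-∀
    bound x true false e e′ = ≤-trans (≤-reflexive (*-zeroʳ (⟪ Bs ⟫ * ⟪ Bs ⟫))) z≤n
    bound x false b′ e e′ = ≤-trans (≤-reflexive (*-zeroʳ (⟪ Bs ⟫ * ⟪ Bs ⟫))) z≤n
    point : ∀ x z z′ → length x ≡ length z → length x ≡ length z′ → 𝟙 (joinedMix m I x z) * 𝟙 (joinedMix m I′ x z′) ≡ 𝟙 (G (merge m′ z′ (merge m x z)))
    point x z z′ l l′ = trans (sym (𝟙-∧ (joinedMix m I x z) _)) (cong 𝟙 (sym (cong₂ _∧_ left right)))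
      where
      y = merge m′ z′ (merge m x z)
      y-nth : ∀ i → nth v₀ y i ≡ (if m′ i then nth v₀ z′ i else mixed m x z i)
      y-nth i = trans (nth-merge v₀ m′ z′ (merge m x z) i (trans (sym l′) (sym (length-merge m x z l))))
        (cong (λ t → if m′ i then nth v₀ z′ i else t) (nth-merge v₀ m x z i l))
      maps : ∀ (f g : ℕ → V) K → (∀ {i} → i ∈ K → f i ≡ g i) → map f K ≡ map g K
      maps f g [] h = refl
      maps f g (i ∷ K) h = cong₂ _∷_ (h (here refl)) (maps f g K (h ∘ there))
      left : joined I y ≡ joinedMix m I x z
      left = cong (λ l → edge H (fromList l)) (maps _ _ I λ {i} i∈ → trans (y-nth i) (cong (λ b → if b then nth v₀ z′ i else mixed m x z i) (m′-false i∈ (mask I′ i) refl)))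
        where m′-false : ∀ {i} → i ∈ I → ∀ b → mask I′ i ≡ b → b ∧ not (m i) ≡ false
              m′-false i∈ false e = refl
              m′-false i∈ true e = cong not (share i∈ (mask-∈ e))
      right : joined I′ y ≡ joinedMix m I′ x z′
      right = cong (λ l → edge H (fromList l)) (maps _ _ I′ λ {i} i∈ → trans (y-nth i)
        (trans (cong (λ b → if b ∧ not (m i) then nth v₀ z′ i else mixed m x z i) (∈-mask i∈)) (pick i (m i))))
        where pick : ∀ i b → (if not b then nth v₀ z′ i else (if b then nth v₀ x i else nth v₀ z i)) ≡ (if b then nth v₀ x i else nth v₀ z′ i)
              pick i true = refl
              pick i false = refl
    resampled : ∑ X (λ x → degree I i j x * degree I′ i j x) ≡ ⟪ Bs ⟫ * (⟪ Bs ⟫ * count G Bs)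
    resampled = begin
      ∑ X (λ x → degree I i j x * degree I′ i j x)
        ≡⟨ ∑-cong∈ X (λ x x∈ → trans (sym (∑-* X (degree I i j x) _)) (∑-cong∈ X λ z′ z′∈ → trans (sym (∑-*ʳ X (𝟙 (joinedMix m I′ x z′)) _))
             (∑-cong∈ X λ z z∈ → point x z z′ (same-length x∈ z∈) (same-length x∈ z′∈)))) ⟩
      ∑ X (λ x → ∑ X (λ z′ → ∑ X (λ z → 𝟙 (G (merge m′ z′ (merge m x z)))))) ≡⟨ ∑-swap X X _ ⟩
      ∑ X (λ z′ → ∑ X (λ x → ∑ X (λ z → 𝟙 (G (merge m′ z′ (merge m x z)))))) ≡⟨ ∑-cong X (λ z′ → ∑-resample m Bs (λ y → 𝟙 (G (merge m′ z′ y)))) ⟩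
      ∑ X (λ z′ → ⟪ Bs ⟫ * ∑ X (λ y → 𝟙 (G (merge m′ z′ y)))) ≡⟨ ∑-* X ⟪ Bs ⟫ _ ⟩
      ⟪ Bs ⟫ * ∑ X (λ z′ → ∑ X (λ y → 𝟙 (G (merge m′ z′ y)))) ≡⟨ cong (⟪ Bs ⟫ *_) (∑-resample m′ Bs (𝟙 ∘ G)) ⟩
      ⟪ Bs ⟫ * (⟪ Bs ⟫ * count G Bs) ∎
      where open ≡-Reasoning
    open ≤-Reasoning

-- When all gadgets are rare, the popular pairs of distinct roles are nearly disjoint

nth-mono : ∀ {I} → Increasing I → ∀ {a b} → a < b → b < length I → nth 0 I a < nth 0 I b
nth-mono {i ∷ I} (h ∷ _) {zero} {suc b} _ (s≤s q) = All.lookup h (nth-∈ 0 I q)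
nth-mono {i ∷ I} (_ ∷ h) {suc a} {suc b} (s≤s p) (s≤s q) = nth-mono h p q

nth-++-length : ∀ {A : Set} (d : A) xs {v ys} → nth d (xs ++ v ∷ ys) (length xs) ≡ v
nth-++-length d [] = refl
nth-++-length d (x ∷ xs) = nth-++-length d xs

nth-++-skip : ∀ {A : Set} (d : A) xs {ys} m → nth d (xs ++ ys) (length xs + m) ≡ nth d ys m
nth-++-skip d [] m = refl
nth-++-skip d (x ∷ xs) m = nth-++-skip d xs m

𝟙-any≤ : ∀ {A : Set} (l : List A) q → 𝟙 (any l q) ≤ ∑ l (𝟙 ∘ q)
𝟙-any≤ [] q = z≤n
𝟙-any≤ (x ∷ l) q with q x
... | true = s≤s z≤n
... | false = 𝟙-any≤ l q

-- Bonferroni's inequality. Adding one set to `L` others costs at most `L * W`, and `L * L + L` is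
-- at most the square of `suc L`.
union-bound : ∀ {P A : Set} (Cs : List (List A)) (ps : List P) (f : P → List A → Bool) W → AllPairs (λ p q → count (λ x → f p x ∧ f q x) Cs ≤ W) ps →
  ∑ ps (λ p → count (f p) Cs) ≤ ⟪ Cs ⟫ + length ps * length ps * W
union-bound {P} {A} Cs ps f W h = ≤-trans (go ps h) (+-monoˡ-≤ (length ps * length ps * W) (count≤vol (λ x → any ps (λ p → f p x)) Cs))
  where
  X = tuples Cs
  go : ∀ ps → AllPairs (λ p q → count (λ x → f p x ∧ f q x) Cs ≤ W) ps →
    ∑ ps (λ p → count (f p) Cs) ≤ count (λ x → any ps (λ p → f p x)) Cs + length ps * length ps * W
  go [] [] = z≤n
  go (p ∷ ps) (a ∷ h) = begin
    count (f p) Cs + ∑ ps (λ q → count (f q) Cs) ≤⟨ +-monoʳ-≤ (count (f p) Cs) (go ps h) ⟩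
    count (f p) Cs + (count (λ x → any ps (λ q → f q x)) Cs + L * L * W) ≡⟨ sym (+-assoc (count (f p) Cs) _ _) ⟩
    count (f p) Cs + count (λ x → any ps (λ q → f q x)) Cs + L * L * W ≡⟨ cong (_+ L * L * W) (sym (∑-+ X _ _)) ⟩
    ∑ X (λ x → 𝟙 (f p x) + 𝟙 (any ps (λ q → f q x))) + L * L * W ≤⟨ +-monoˡ-≤ (L * L * W) (∑-mono X λ x → meets x (f p x)) ⟩
    ∑ X (λ x → 𝟙 (f p x ∨ any ps (λ q → f q x)) + ∑ ps (λ q → 𝟙 (f p x ∧ f q x))) + L * L * W
      ≡⟨ cong (_+ L * L * W) (trans (∑-+ X _ _) (cong (U +_) (∑-swap X ps _))) ⟩
    U + ∑ ps (λ q → count (λ x → f p x ∧ f q x) Cs) + L * L * W ≤⟨ +-monoˡ-≤ (L * L * W) (+-monoʳ-≤ U (overlaps a)) ⟩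
    U + L * W + L * L * W ≤⟨ m≤m+n _ (L * W + W) ⟩
    U + L * W + L * L * W + (L * W + W) ≡⟨ lem U L W ⟩
    U + suc L * suc L * W ∎
    where
    open ≤-Reasoning
    L = length ps
    U = count (λ x → f p x ∨ any ps (λ q → f q x)) Cs
    lem : ∀ U L W → U + L * W + L * L * W + (L * W + W) ≡ U + (1 + L) * (1 + L) * W
    lem = solve-∀
    meets : ∀ x b → 𝟙 b + 𝟙 (any ps (λ q → f q x)) ≤ 𝟙 (b ∨ any ps (λ q → f q x)) + ∑ ps (λ q → 𝟙 (b ∧ f q x))
    meets x true = s≤s (𝟙-any≤ ps (λ q → f q x))
    meets x false = m≤m+n _ _
    overlaps : ∀ {qs} → All (λ q → count (λ x → f p x ∧ f q x) Cs ≤ W) qs → ∑ qs (λ q → count (λ x → f p x ∧ f q x) Cs) ≤ length qs * W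
    overlaps [] = z≤n
    overlaps (a ∷ as) = +-mono-≤ a (overlaps as)

Within : ℕ → ℕ → List ℕ → Set
Within lo hi L = Increasing L × All (λ m → lo ≤ m × m < hi) L

within-++ : ∀ {lo mid hi L L′} → lo ≤ mid → mid ≤ hi → Within lo mid L → Within mid hi L′ → Within lo hi (L ++ L′)
within-++ lo≤ ≤hi (inc , bd) (inc′ , bd′) = AllPairsₚ.++⁺ inc inc′ (All.map (λ (_ , a) → All.map (λ (b , _) → <-≤-trans a b) bd′) bd) ,
  Allₚ.++⁺ (All.map (λ (a , b) → a , <-≤-trans b ≤hi) bd) (All.map (λ (a , b) → ≤-trans lo≤ a , b) bd′)

within-∷ : ∀ {lo hi m L} → lo ≤ m → suc m ≤ hi → Within (suc m) hi L → Within lo hi (m ∷ L)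
within-∷ {m = m} lo≤ m<hi (inc , bd) = (All.map proj₁ bd ∷ inc) , (lo≤ , m<hi) ∷ All.map (λ (a , b) → ≤-trans lo≤ (≤-trans (n≤1+n m) a) , b) bd

within-weaken : ∀ {lo hi lo′ hi′ L} → lo′ ≤ lo → hi ≤ hi′ → Within lo hi L → Within lo′ hi′ L
within-weaken l h (inc , bd) = inc , All.map (λ (a , b) → ≤-trans l a , <-≤-trans b h) bd

block : ℕ → ℕ → List ℕ
block lo x = applyUpTo (lo +_) x

block-within : ∀ lo x {hi} → lo + x ≤ hi → Within lo hi (block lo x)
block-within lo x h = AllPairsₚ.applyUpTo⁺₁ (lo +_) x (λ i<j _ → +-monoʳ-< lo i<j) ,
  Allₚ.applyUpTo⁺₁ (lo +_) x (λ {i} i<x → m≤m+n lo i , <-≤-trans (+-monoʳ-< lo i<x) h)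

-- The number gives every role its own slots in a common layout and thus disjoint edges. It also
-- orders the edges, so that the one with the smaller number is the first edge in `arrange²`.
tag : ∀ {P : Set} → ℕ → List P → List (ℕ × P)
tag t [] = []
tag t (p ∷ ps) = (t , p) ∷ tag (suc t) ps

∑-tag : ∀ {P : Set} t (ps : List P) f → ∑ (tag t ps) (f ∘ proj₂) ≡ ∑ ps f
∑-tag t [] f = refl
∑-tag t (p ∷ ps) f = cong (f p +_) (∑-tag (suc t) ps f)

length-tag : ∀ {P : Set} t (ps : List P) → length (tag t ps) ≡ length ps
length-tag t [] = refl
length-tag t (p ∷ ps) = cong suc (length-tag (suc t) ps)

tag-bounds : ∀ {P : Set} t (ps : List P) → All (λ q → t ≤ proj₁ q × proj₁ q < t + length ps × proj₂ q ∈ ps) (tag t ps)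
tag-bounds t [] = []
tag-bounds t (p ∷ ps) = (≤-refl , m<m+n t (s≤s z≤n) , here refl) ∷
  All.map (λ (a , b , c) → <⇒≤ a , ≤-trans b (≤-reflexive (sym (+-suc t (length ps)))) , there c) (tag-bounds (suc t) ps)

tag-pairs : ∀ {P : Set} t {ps : List P} → Unique ps → AllPairs (λ a b → proj₁ a < proj₁ b × proj₂ a ≢ proj₂ b) (tag t ps)
tag-pairs t [] = []
tag-pairs t {p ∷ ps} (h ∷ hs) = All.map (λ (a , _ , c) → a , All.lookup h c) (tag-bounds (suc t) ps) ∷ tag-pairs (suc t) hs

pair-meet : ∀ {A : Set} (d : A) T {i j i′ j′} → i < j → i′ < j′ → i < T → j < T → ¬ (i ≡ i′ × j ≡ j′) →
  Telescoping.Meet d T (mask (i ∷ j ∷ [])) (mask (i′ ∷ j′ ∷ []))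
pair-meet d T {i} {j} {i′} {j′} i<j i′<j′ i<T j<T differ = decide (Any.any? (i ≟_) (i′ ∷ j′ ∷ []))
  where
  decide : Dec (i ∈ i′ ∷ j′ ∷ []) → Telescoping.Meet d T (mask (i ∷ j ∷ [])) (mask (i′ ∷ j′ ∷ []))
  decide (yes common) = i , i<T , ∈-mask {i ∷ j ∷ []} (here refl) , λ l Jl Kl → only l (mask-∈ {i ∷ j ∷ []} Jl) (mask-∈ {i′ ∷ j′ ∷ []} Kl) common
    where
    only : ∀ l → l ∈ i ∷ j ∷ [] → l ∈ i′ ∷ j′ ∷ [] → i ∈ i′ ∷ j′ ∷ [] → l ≡ i
    only l (here e) _ _ = e
    only l (there (here refl)) (here e) (here e′) = contradiction i<j (<-irrefl (trans e′ (sym e)))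
    only l (there (here refl)) (here e) (there (here e′)) = contradiction (<-trans (subst₂ _<_ e′ e i<j) i′<j′) (<-irrefl refl)
    only l (there (here refl)) (there (here e)) (here e′) = contradiction (e′ , e) differ
    only l (there (here refl)) (there (here e)) (there (here e′)) = contradiction i<j (<-irrefl (trans e′ (sym e)))
  decide (no none) = j , j<T , ∈-mask {i ∷ j ∷ []} (there (here refl)) , λ l Jl Kl → only l (mask-∈ {i ∷ j ∷ []} Jl) (mask-∈ {i′ ∷ j′ ∷ []} Kl)
    where
    only : ∀ l → l ∈ i ∷ j ∷ [] → l ∈ i′ ∷ j′ ∷ [] → l ≡ j
    only l (here refl) m = contradiction m none
    only l (there (here e)) _ = e

module Arrangement (k : ℕ) where

  rs : List Role
  rs = roles (2 + k)

  -- Each of the three regions around the common pair has a slot of `k` indices for each of the `c`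
  -- edges; the one extra index in `w` is the place of a vertex of the pair.
  c w : ℕ
  c = length rs
  w = suc (c * k)

  piece : ℕ → ℕ → ℕ → List ℕ
  piece b t x = block (b * w + t * k) x

  piece-within : ∀ b t x → x ≤ k → Within (b * w + t * k) (b * w + suc t * k) (piece b t x)
  piece-within b t x h = block-within (b * w + t * k) x (≤-trans (+-monoʳ-≤ (b * w + t * k) h)
      (≤-reflexive (trans (+-assoc (b * w) (t * k) k) (cong (b * w +_) (+-comm (t * k) k)))))

  pos₁ pos₂ : ℕ
  pos₁ = c * k
  pos₂ = w + c * k

  -- the t-th edge uses the t-th piece of each of the three regions around the common pair
  places : ℕ → Role → List ℕ
  places t (x , y) = piece 0 t x ++ pos₁ ∷ (piece 1 t y ++ pos₂ ∷ piece 2 t (k ∸ (x + y)))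

  places² : ℕ → Role → ℕ → Role → List ℕ
  places² t (x , y) t′ (x′ , y′) = interleave (piece 0 t x) (piece 0 t′ x′) pos₁ (piece 1 t y) (piece 1 t′ y′) pos₂ (piece 2 t (k ∸ (x + y))) (piece 2 t′ (k ∸ (x′ + y′)))

  M : ℕ
  M = w + (w + w)

  private
    region : ∀ b {t t′ x x′} → t < t′ → t′ < c → x ≤ k → x′ ≤ k → Within (b * w) (b * w + c * k) (piece b t x ++ piece b t′ x′)
    region b {t} {t′} {x} {x′} lt t′< h h′ = within-weaken (m≤m+n (b * w) (t * k)) (+-monoʳ-≤ (b * w) (*-monoˡ-≤ k t′<))
      (within-++ {mid = b * w + t′ * k} (+-monoʳ-≤ (b * w) (*-monoˡ-≤ k (<⇒≤ lt))) (+-monoʳ-≤ (b * w) (*-monoˡ-≤ k (n≤1+n t′)))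
        (within-weaken ≤-refl (+-monoʳ-≤ (b * w) (*-monoˡ-≤ k lt)) (piece-within b t x h)) (piece-within b t′ x′ h′))

  places²-within : ∀ {t t′ x y x′ y′} → t < t′ → t′ < c → x + y ≤ k → x′ + y′ ≤ k → Within 0 M (places² t (x , y) t′ (x′ , y′))
  places²-within {t} {t′} {x} {y} {x′} {y′} lt t′< h h′ = subst (Within 0 M) (++-assoc (piece 0 t x) _ _)
    (within-++ {mid = c * k} z≤n (≤-trans (n≤1+n (c * k)) (m≤m+n w (w + w)))
      (region 0 lt t′< (≤-trans (m≤m+n x y) h) (≤-trans (m≤m+n x′ y′) h′))
      (within-∷ ≤-refl (m≤m+n w (w + w)) (subst (Within w M) (++-assoc (piece 1 t y) _ _)
        (within-++ {mid = w + c * k} (m≤m+n w (c * k)) (+-monoʳ-≤ w (≤-trans (n≤1+n (c * k)) (m≤m+n w w)))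
          (subst (λ z → Within z (z + c * k) (piece 1 t y ++ piece 1 t′ y′)) (*-identityˡ w) (region 1 lt t′< (≤-trans (m≤n+m y x) h) (≤-trans (m≤n+m y′ x′) h′)))
          (within-∷ ≤-refl (≤-trans (≤-reflexive (sym (+-suc w (c * k)))) (+-monoʳ-≤ w (m≤m+n w w)))
            (within-weaken (≤-reflexive (trans (sym (+-suc w (c * k))) (cong (w +_) (sym (+-identityʳ w))))) (≤-trans (+-mono-≤ (≤-reflexive (cong (w +_) (+-identityʳ w))) (n≤1+n (c * k))) (≤-reflexive (+-assoc w w w)))
              (region 2 lt t′< (m∸n≤m k (x + y)) (m∸n≤m k (x′ + y′)))))))))

  length-piece : ∀ b t x → length (piece b t x) ≡ x
  length-piece b t x = length-applyUpTo (b * w + t * k +_) x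

  places-length : ∀ t {x y} → x + y ≤ k → length (places t (x , y)) ≡ 2 + k
  places-length t {x} {y} h = begin
    length (places t (x , y)) ≡⟨ length-++ (piece 0 t x) ⟩
    length (piece 0 t x) + suc (length (piece 1 t y ++ pos₂ ∷ piece 2 t z)) ≡⟨ cong₂ (λ a b → a + suc b) (length-piece 0 t x) (trans (length-++ (piece 1 t y)) (cong₂ (λ a b → a + suc b) (length-piece 1 t y) (length-piece 2 t z))) ⟩
    x + suc (y + suc z) ≡⟨ lem x y z ⟩
    2 + (x + y + z) ≡⟨ cong (2 +_) (m+[n∸m]≡n h) ⟩
    2 + k ∎
    where
    open ≡-Reasoning
    z = k ∸ (x + y)
    lem : ∀ x y z → x + suc (y + suc z) ≡ 2 + (x + y + z)
    lem = solve-∀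

  places-within : ∀ {t x y} → t < c → x + y ≤ k → Within 0 M (places t (x , y))
  places-within {t} {x} {y} t< h = within-++ {mid = c * k} z≤n (≤-trans (n≤1+n (c * k)) (m≤m+n w (w + w)))
    (within-weaken z≤n (*-monoˡ-≤ k t<) (piece-within 0 t x (≤-trans (m≤m+n x y) h)))
    (within-∷ ≤-refl (m≤m+n w (w + w)) (within-++ {mid = w + c * k} (m≤m+n w (c * k)) (+-monoʳ-≤ w (≤-trans (n≤1+n (c * k)) (m≤m+n w w)))
      (within-weaken (≤-trans (≤-reflexive (sym (*-identityˡ w))) (m≤m+n (1 * w) (t * k))) (+-mono-≤ (≤-reflexive (*-identityˡ w)) (*-monoˡ-≤ k t<)) (piece-within 1 t y (≤-trans (m≤n+m y x) h)))
      (within-∷ ≤-refl (≤-trans (≤-reflexive (sym (+-suc w (c * k)))) (+-monoʳ-≤ w (m≤m+n w w)))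
        (within-weaken (≤-trans (≤-reflexive (trans (sym (+-suc w (c * k))) (cong (w +_) (sym (+-identityʳ w))))) (m≤m+n (2 * w) (t * k)))
          (≤-trans (+-mono-≤ (≤-reflexive (cong (w +_) (+-identityʳ w))) (≤-trans (*-monoˡ-≤ k t<) (n≤1+n (c * k)))) (≤-reflexive (+-assoc w w w)))
          (piece-within 2 t (k ∸ (x + y)) (m∸n≤m k (x + y)))))))

module Finale {k : ℕ} (H : Hypergraph (2 + k)) (v₀ : Fin (n H)) (Bs : List (List (Fin (n H)))) (s : ℕ)
  (sides : All (λ B → length B ≡ s) Bs) (s>0 : 0 < s)
  (Cs : List (List (Fin (n H)))) (Cs≼Bs : Cs ≼ Bs) (Cs>0 : 0 < ⟪ Cs ⟫) (N : ℕ) where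

  private
    r = 2 + k
    V = Fin (n H)
    T = length Bs

  open Links H v₀ T
  open Telescoping {V} v₀ T
  open BoxCounts H v₀ Bs s sides s>0
  open Arrangement k

  first second : List ℕ → Role → ℕ
  first I (x , y) = nth 0 I x
  second I (x , y) = nth 0 I (x + suc y)

  popularAs : List ℕ → Role → List V → Bool
  popularAs I p = popular N I (first I p) (second I p)

  module _ (I : List ℕ) (I-increasing : Increasing I) (I-length : length I ≡ r) (I< : All (_< T) I) (ℓ : ℕ) (m : Role → ℕ)
    (m≤ℓ : ∀ {p} → p ∈ rs → m p ≤ ℓ)
    (up : ∀ {p} → p ∈ rs → ∀ Ds → Ds ≼ Cs → ℓ * count (popularAs I p) Ds ≤ m p * ⟪ Ds ⟫ + 2 * ⟪ Cs ⟫) where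

    private
      first<second : ∀ {p} → p ∈ rs → first I p < second I p
      first<second {x , y} p∈ = nth-mono I-increasing (m<m+n x (s≤s z≤n)) (subst (x + suc y <_) (sym I-length) (∈-roles p∈))

      second< : ∀ {p} → p ∈ rs → proj₁ p + suc (proj₂ p) < length I
      second< {x , y} p∈ = subst (x + suc y <_) (sym I-length) (∈-roles p∈)

      first< : ∀ {p} → p ∈ rs → proj₁ p < length I
      first< {x , y} p∈ = <-trans (m<m+n x (s≤s z≤n)) (second< p∈)

      same-role : ∀ {p q} → p ∈ rs → q ∈ rs → first I p ≡ first I q → second I p ≡ second I q → p ≡ q
      same-role {x , y} {x′ , y′} p∈ q∈ e e′ with nth-injective 0 (increasing-unique I-increasing) (first< p∈) (first< q∈) e
      ... | refl = cong (x ,_) (suc-injective (+-cancelˡ-≡ x _ _ (nth-injective 0 (increasing-unique I-increasing) (second< p∈) (second< q∈) e′)))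

      pm : Role → ℕ → Bool
      pm p = pairMask (first I p) (second I p)

      meet : ∀ {p q} → p ∈ rs → q ∈ rs → p ≢ q → Meet (pm p) (pm q)
      meet {p} {q} p∈ q∈ p≢q = pair-meet v₀ T (first<second p∈) (first<second q∈) (All.lookup I< (nth-∈ 0 I (first< p∈))) (All.lookup I< (nth-∈ 0 I (second< p∈)))
        (λ (e , e′) → p≢q (same-role p∈ q∈ e e′))

      Cs-length : length Cs ≡ T
      Cs-length = Pw.Pointwise-length Cs≼Bs

      E = 2 * ⟪ Cs ⟫
      It = Item Cs Cs-length Cs>0 E
      open Item

      item : ∀ {p} → p ∈ rs → It
      item {p} p∈ = record
        { coords = pm p ; f = λ _ → true ; o = popularAs I p ; a = ℓ ; b = m p
        ; f-dep = λ _ _ _ → refl ; o-dep = popular-depends N I (first I p) (second I p)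
        ; dom = λ Ds s → subst (λ v → ℓ * count (popularAs I p) Ds ≤ m p * v + E) (length-∑ (tuples Ds)) (up p∈ Ds s) }

      items : ∀ {ps} → All (_∈ rs) ps → List It
      items [] = []
      items (p∈ ∷ h) = item p∈ ∷ items h

      items-bounds : ∀ {ps} (h : All (_∈ rs) ps) → All (λ it → a it ≤ ℓ × b it ≤ ℓ) (items h)
      items-bounds [] = []
      items-bounds (p∈ ∷ h) = (≤-refl , m≤ℓ p∈) ∷ items-bounds h

      items-meet : ∀ {ps} (h : All (_∈ rs) ps) → Unique ps → AllPairs (λ it jt → Meet² Cs Cs-length Cs>0 E (coords it) (coords jt)) (items h)
      items-meet [] [] = []
      items-meet {p ∷ ps} (p∈ ∷ h) (u ∷ us) = go h u ∷ items-meet h us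
        where
        go : ∀ {ps} (h : All (_∈ rs) ps) → All (p ≢_) ps → All (λ jt → Meet² Cs Cs-length Cs>0 E (coords (item p∈)) (coords jt)) (items h)
        go [] [] = []
        go (q∈ ∷ h) (ne ∷ nes) = (meet p∈ q∈ ne , meet q∈ p∈ (ne ∘ sym)) ∷ go h nes

      items-length : ∀ {ps} (h : All (_∈ rs) ps) → length (items h) ≡ length ps
      items-length [] = refl
      items-length (_ ∷ h) = cong suc (items-length h)

      items-a : ∀ {ps} (h : All (_∈ rs) ps) → ∏ (items h) a ≡ ℓ ^ length ps
      items-a [] = refl
      items-a (_ ∷ h) = cong (ℓ *_) (items-a h)

      items-b : ∀ {ps} (h : All (_∈ rs) ps) → ∏ (items h) b ≡ ∏ ps m
      items-b [] = refl
      items-b {p ∷ _} (_ ∷ h) = cong (m p *_) (items-b h)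

      items-o : ∀ {ps} (h : All (_∈ rs) ps) x → all (items h) (λ it → o it x) ≡ all ps (λ p → popularAs I p x)
      items-o [] x = refl
      items-o {p ∷ _} (_ ∷ h) x = cong (popularAs I p x ∧_) (items-o h x)

      items-f : ∀ {ps} (h : All (_∈ rs) ps) x → all (items h) (λ it → f it x) ≡ true
      items-f [] x = refl
      items-f (_ ∷ h) x = items-f h x

      members : All (_∈ rs) rs
      members = All.tabulate id

    allPopular : List V → Bool
    allPopular x = all rs (λ p → popularAs I p x)

    -- The position pairs of distinct roles in `I` meet in at most one coordinate. Telescoping with
    -- `f` constantly true therefore treats the popular sets as independent and bounds their common
    -- part by the product of the densities `m p / ℓ`.
    popular-product : ℓ * (ℓ ^ c * count allPopular Cs) ≤ ℓ * (∏ rs m * ⟪ Cs ⟫) + c * (ℓ ^ c * (2 * ⟪ Cs ⟫))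
    popular-product = begin
      ℓ * (ℓ ^ c * count allPopular Cs) ≡⟨ cong (ℓ *_) (sym (cong₂ _*_ (items-a members) (∑-cong (tuples Cs) λ x → cong 𝟙 (items-o members x)))) ⟩
      ℓ * (∏ its a * count (λ x → all its (λ it → o it x)) Cs) ≤⟨ *-monoʳ-≤ ℓ (telescope Cs Cs-length Cs>0 E ℓ its (items-bounds members) (items-meet members (roles-unique r))) ⟩
      ℓ * (∏ its b * count (λ x → all its (λ it → f it x)) Cs + loss Cs Cs-length Cs>0 E ℓ (length its)) ≡⟨ *-distribˡ-+ ℓ _ _ ⟩
      ℓ * (∏ its b * count (λ x → all its (λ it → f it x)) Cs) + ℓ * loss Cs Cs-length Cs>0 E ℓ (length its)
        ≡⟨ cong₂ (λ a b → ℓ * a + b) (cong₂ _*_ (items-b members) (trans (∑-cong (tuples Cs) λ x → cong 𝟙 (items-f members x)) (sym (length-∑ (tuples Cs)))))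
             (trans (loss-closed Cs Cs-length Cs>0 E ℓ (length its)) (cong (λ z → z * (ℓ ^ z * E)) (items-length members))) ⟩
      ℓ * (∏ rs m * ⟪ Cs ⟫) + c * (ℓ ^ c * (2 * ⟪ Cs ⟫)) ∎
      where
      open ≤-Reasoning
      its = items members

    -- An edge that fails to be popular in some role is counted by `unpopular-few` for that role.
    -- That bound lives on the larger box `Bs`, in which popularity is defined, hence the error in
    -- terms of its volume.
    edges-mostly-popular : N * count (joined I) Cs ≤ N * count allPopular Cs + c * ⟪ Bs ⟫
    edges-mostly-popular = begin
      N * count (joined I) Cs ≤⟨ *-monoʳ-≤ N (∑-mono (tuples Cs) λ x → covered (joined I x) rs (λ p → popularAs I p x)) ⟩
      N * ∑ (tuples Cs) (λ x → 𝟙 (allPopular x) + ∑ rs (λ p → 𝟙 (joined I x ∧ not (popularAs I p x)))) ≡⟨ cong (N *_) (trans (∑-+ (tuples Cs) _ _) (cong (count allPopular Cs +_) (∑-swap (tuples Cs) rs _))) ⟩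
      N * (count allPopular Cs + ∑ rs (λ p → count (λ x → joined I x ∧ not (popularAs I p x)) Cs)) ≡⟨ trans (*-distribˡ-+ N _ _) (cong (N * count allPopular Cs +_) (sym (∑-* rs N _))) ⟩
      N * count allPopular Cs + ∑ rs (λ p → N * count (λ x → joined I x ∧ not (popularAs I p x)) Cs)
        ≤⟨ +-monoʳ-≤ (N * count allPopular Cs) (∑-mono rs λ p → ≤-trans (*-monoʳ-≤ N (count-≼ (λ x → joined I x ∧ not (popularAs I p x)) Cs≼Bs)) (unpopular-few N I (first I p) (second I p))) ⟩
      N * count allPopular Cs + ∑ rs (λ p → ⟪ Bs ⟫) ≡⟨ cong (N * count allPopular Cs +_) (∑-const rs ⟪ Bs ⟫) ⟩
      N * count allPopular Cs + c * ⟪ Bs ⟫ ∎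
      where
      open ≤-Reasoning
      covered : ∀ b (ps : List Role) f → 𝟙 b ≤ 𝟙 (all ps f) + ∑ ps (λ p → 𝟙 (b ∧ not (f p)))
      covered false ps f = z≤n
      covered true [] f = s≤s z≤n
      covered true (p ∷ ps) f with f p
      ... | true = covered true ps f
      ... | false = s≤s z≤n

  module _ (Y : List ℕ) (Y-increasing : Increasing Y) (Y-length : length Y ≡ M) (W : ℕ)
    (rare : ∀ {π} → ValidPattern r π → ∀ J → J ⊆ Y → length J ≡ 2 + (k + k) → count (linked π J) Bs ≤ W) where

    edgeAt : ℕ × Role → List ℕ
    edgeAt (t , p) = map (nth 0 Y) (places t p)

    tagged : List (ℕ × Role)
    tagged = tag 0 rs

    private
      role≤ : ∀ {x y} → (x , y) ∈ rs → x + y ≤ k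
      role≤ = role-bound

      pick : ∀ {L} → Within 0 M L → map (nth 0 Y) L ⊆ Y
      pick (inc , bd) = nth-⊆ 0 Y inc (All.map (λ (_ , b) → subst (_ <_) (sym Y-length) b) bd)

    edgeAt-⊆ : ∀ {t p} → t < c → p ∈ rs → edgeAt (t , p) ⊆ Y
    edgeAt-⊆ {p = x , y} t< p∈ = pick (places-within t< (role≤ p∈))

    edgeAt-length : ∀ {t p} → p ∈ rs → length (edgeAt (t , p)) ≡ r
    edgeAt-length {t} {x , y} p∈ = trans (length-map (nth 0 Y) (places t (x , y))) (places-length t {x} {y} (role≤ p∈))

    private
      i j : ℕ
      i = nth 0 Y pos₁
      j = nth 0 Y pos₂

      e-pieces : ∀ t x y → edgeAt (t , (x , y)) ≡ map (nth 0 Y) (piece 0 t x) ++ i ∷ (map (nth 0 Y) (piece 1 t y) ++ j ∷ map (nth 0 Y) (piece 2 t (k ∸ (x + y))))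
      e-pieces t x y = trans (map-++ (nth 0 Y) (piece 0 t x) _) (cong (λ l → map (nth 0 Y) (piece 0 t x) ++ i ∷ l) (map-++ (nth 0 Y) (piece 1 t y) _))

      len : ∀ b t x → length (map (nth 0 Y) (piece b t x)) ≡ x
      len b t x = trans (length-map (nth 0 Y) (piece b t x)) (length-piece b t x)

      first-edgeAt : ∀ t p → first (edgeAt (t , p)) p ≡ i
      first-edgeAt t (x , y) = trans (cong (λ l → nth 0 l x) (e-pieces t x y))
        (trans (cong (nth 0 (map (nth 0 Y) (piece 0 t x) ++ i ∷ (map (nth 0 Y) (piece 1 t y) ++ j ∷ map (nth 0 Y) (piece 2 t (k ∸ (x + y)))))) (sym (len 0 t x))) (nth-++-length 0 (map (nth 0 Y) (piece 0 t x))))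

      second-edgeAt : ∀ t p → second (edgeAt (t , p)) p ≡ j
      second-edgeAt t (x , y) = trans (cong (λ l → nth 0 l (x + suc y)) (e-pieces t x y))
        (trans (cong₂ (λ a b → nth 0 (P ++ i ∷ (Q ++ j ∷ R)) (a + suc b)) (sym (len 0 t x)) (sym (len 1 t y)))
          (trans (nth-++-skip 0 P (suc (length Q))) (nth-++-length 0 Q)))
        where
        P = map (nth 0 Y) (piece 0 t x)
        Q = map (nth 0 Y) (piece 1 t y)
        R = map (nth 0 Y) (piece 2 t (k ∸ (x + y)))

      overlapping : ∀ {a b : ℕ × Role} → proj₁ a < proj₁ b → proj₁ b < c → proj₂ a ∈ rs → proj₂ b ∈ rs → proj₂ a ≢ proj₂ b →
        count (λ z → popularAs (edgeAt a) (proj₂ a) z ∧ popularAs (edgeAt b) (proj₂ b) z) Cs ≤ N * N * W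
      overlapping {t , p@(x , y)} {t′ , q@(x′ , y′)} t<t′ t′< p∈ q∈ p≢q = begin
        count (λ z → popularAs I p z ∧ popularAs I′ q z) Cs ≤⟨ count-≼ (λ z → popularAs I p z ∧ popularAs I′ q z) Cs≼Bs ⟩
        count (λ z → popularAs I p z ∧ popularAs I′ q z) Bs ≡⟨ ∑-cong (tuples Bs) (λ z → cong₂ (λ a b → 𝟙 (a z ∧ b z))
            (cong₂ (popular N I) (first-edgeAt t p) (second-edgeAt t p)) (cong₂ (popular N I′) (first-edgeAt t′ q) (second-edgeAt t′ q))) ⟩
        count (λ z → popular N I i j z ∧ popular N I′ i j z) Bs ≤⟨ popular-overlap N I I′ i j share ⟩
        N * N * count (λ z → joined I z ∧ joined I′ z) Bs ≡⟨ cong (N * N *_) (∑-cong (tuples Bs) λ z → cong (λ s → 𝟙 (joined (proj₁ s) z ∧ joined (proj₂ s) z)) (sym split-J)) ⟩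
        N * N * count (linked (p , q) J) Bs ≤⟨ *-monoʳ-≤ (N * N) (rare (p∈ , q∈ , p≢q) J (pick within) J-length) ⟩
        N * N * W ∎
        where
        open ≤-Reasoning
        I = edgeAt (t , p)
        I′ = edgeAt (t′ , q)
        J = map (nth 0 Y) (places² t p t′ q)
        within = places²-within {t} {t′} {x} {y} {x′} {y′} t<t′ t′< (role≤ p∈) (role≤ q∈)
        P = map (nth 0 Y) (piece 0 t x)
        P′ = map (nth 0 Y) (piece 0 t′ x′)
        Q = map (nth 0 Y) (piece 1 t y)
        Q′ = map (nth 0 Y) (piece 1 t′ y′)
        R = map (nth 0 Y) (piece 2 t (k ∸ (x + y)))
        R′ = map (nth 0 Y) (piece 2 t′ (k ∸ (x′ + y′)))
        J≡ : J ≡ interleave P P′ i Q Q′ j R R′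
        J≡ = map-interleave (nth 0 Y) (piece 0 t x) (piece 0 t′ x′) pos₁ (piece 1 t y) (piece 1 t′ y′) pos₂ (piece 2 t (k ∸ (x + y))) (piece 2 t′ (k ∸ (x′ + y′)))
        split-J : split p q k J ≡ (I , I′)
        split-J = trans (cong (split p q k) J≡) (trans (split-interleave {x = x} {y} {x′} {y′} {k} P P′ i Q Q′ j R R′ (len 0 t x) (len 0 t′ x′) (len 1 t y) (len 1 t′ y′) (len 2 t (k ∸ (x + y))))
          (cong₂ _,_ (sym (e-pieces t x y)) (sym (e-pieces t′ x′ y′))))
        J↭ : J ↭ I ++ (P′ ++ Q′ ++ R′)
        J↭ = ↭-trans (↭-reflexive J≡) (↭-trans (interleave-↭ P P′ i Q Q′ j R R′) (↭-reflexive (cong (_++ (P′ ++ Q′ ++ R′)) (sym (e-pieces t x y)))))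
        J-length : length J ≡ 2 + (k + k)
        J-length = trans (↭ₚ.↭-length J↭) (trans (length-++ I) (trans (cong₂ _+_ (edgeAt-length {t} p∈)
          (trans (length-++ P′) (trans (cong₂ _+_ (len 0 t′ x′) (trans (length-++ Q′) (cong₂ _+_ (len 1 t′ y′) (len 2 t′ (k ∸ (x′ + y′))))))
            (trans (sym (+-assoc x′ y′ _)) (m+[n∸m]≡n (role≤ q∈)))))) refl))
        J-unique : Unique (I ++ (P′ ++ Q′ ++ R′))
        J-unique = unique-↭ J↭ (increasing-unique (AllPairs-⊆ (pick within) Y-increasing))
        disjoint : ∀ (xs : List ℕ) {ys l} → Unique (xs ++ ys) → l ∈ xs → l ∈ ys → ⊥
        disjoint (x ∷ xs) (h ∷ _) (here refl) l∈ = All.lookup (Allₚ.++⁻ʳ xs h) l∈ refl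
        disjoint (x ∷ xs) (_ ∷ hs) (there l∈) l∈′ = disjoint xs hs l∈ l∈′
        share : ∀ {l} → l ∈ I → l ∈ I′ → pairMask i j l ≡ true
        share {l} l∈ l∈′ = by (∈ₚ.∈-++⁻ P′ (subst (l ∈_) (e-pieces t′ x′ y′) l∈′))
          where
          by₂ : l ∈ Q′ ⊎ l ∈ j ∷ R′ → pairMask i j l ≡ true
          by₂ (inj₁ m) = ⊥-elim (disjoint I J-unique l∈ (∈ₚ.∈-++⁺ʳ P′ (∈ₚ.∈-++⁺ˡ m)))
          by₂ (inj₂ (here e)) = ∈-mask {i ∷ j ∷ []} (there (here e))
          by₂ (inj₂ (there m)) = ⊥-elim (disjoint I J-unique l∈ (∈ₚ.∈-++⁺ʳ P′ (∈ₚ.∈-++⁺ʳ Q′ m)))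
          by : l ∈ P′ ⊎ l ∈ i ∷ (Q′ ++ j ∷ R′) → pairMask i j l ≡ true
          by (inj₁ m) = ⊥-elim (disjoint I J-unique l∈ (∈ₚ.∈-++⁺ˡ m))
          by (inj₂ (here e)) = ∈-mask {i ∷ j ∷ []} (here e)
          by (inj₂ (there m)) = by₂ (∈ₚ.∈-++⁻ Q′ m)

    -- The densities `m p` do not depend on the index set, so for each role it may be evaluated on
    -- the edge of the layout that uses `i` and `j` in that role. Then all popular sets concern the
    -- same two coordinates, and any two of them overlap little because gadgets are rare.
    popular-sum : ∀ ℓ (m : Role → ℕ) → (∀ I p → I ⊆ Y → length I ≡ r → p ∈ rs → m p * ⟪ Cs ⟫ ≤ ℓ * count (popularAs I p) Cs + 2 * ⟪ Cs ⟫) →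
      ∑ rs m * ⟪ Cs ⟫ ≤ ℓ * (⟪ Cs ⟫ + c * c * (N * N * W)) + c * (2 * ⟪ Cs ⟫)
    popular-sum ℓ m low = begin
      ∑ rs m * ⟪ Cs ⟫ ≡⟨ cong (_* ⟪ Cs ⟫) (sym (∑-tag 0 rs m)) ⟩
      ∑ tagged (m ∘ proj₂) * ⟪ Cs ⟫ ≡⟨ sym (∑-*ʳ tagged ⟪ Cs ⟫ (m ∘ proj₂)) ⟩
      ∑ tagged (λ a → m (proj₂ a) * ⟪ Cs ⟫) ≤⟨ ∑-mono∈ tagged (λ a a∈ → let _ , t< , p∈ = All.lookup (tag-bounds 0 rs) a∈ in
          low (edgeAt a) (proj₂ a) (edgeAt-⊆ t< p∈) (edgeAt-length {proj₁ a} p∈) p∈) ⟩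
      ∑ tagged (λ a → ℓ * count (popularAs (edgeAt a) (proj₂ a)) Cs + 2 * ⟪ Cs ⟫)
        ≡⟨ trans (∑-+ tagged (λ a → ℓ * count (popularAs (edgeAt a) (proj₂ a)) Cs) _) (cong₂ _+_ (∑-* tagged ℓ _) (trans (∑-const tagged (2 * ⟪ Cs ⟫)) (cong (_* (2 * ⟪ Cs ⟫)) (length-tag 0 rs)))) ⟩
      ℓ * ∑ tagged (λ a → count (popularAs (edgeAt a) (proj₂ a)) Cs) + c * (2 * ⟪ Cs ⟫)
        ≤⟨ +-monoˡ-≤ (c * (2 * ⟪ Cs ⟫)) (*-monoʳ-≤ ℓ (≤-trans (union-bound Cs tagged (λ a → popularAs (edgeAt a) (proj₂ a)) (N * N * W)
             (pairs (tag-bounds 0 rs) (tag-pairs 0 (roles-unique r)))) (≤-reflexive (cong (λ z → ⟪ Cs ⟫ + z * z * (N * N * W)) (length-tag 0 rs))))) ⟩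
      ℓ * (⟪ Cs ⟫ + c * c * (N * N * W)) + c * (2 * ⟪ Cs ⟫) ∎
      where
      open ≤-Reasoning
      pairs : ∀ {l} → All (λ a → 0 ≤ proj₁ a × proj₁ a < c × proj₂ a ∈ rs) l → AllPairs (λ a b → proj₁ a < proj₁ b × proj₂ a ≢ proj₂ b) l →
        AllPairs (λ a b → count (λ z → popularAs (edgeAt a) (proj₂ a) z ∧ popularAs (edgeAt b) (proj₂ b) z) Cs ≤ N * N * W) l
      pairs [] [] = []
      pairs {a ∷ l} ((_ , t< , p∈) ∷ bs) (h ∷ hs) = go bs h ∷ pairs bs hs
        where
        go : ∀ {l} → All (λ a → 0 ≤ proj₁ a × proj₁ a < c × proj₂ a ∈ rs) l → All (λ b → proj₁ a < proj₁ b × proj₂ a ≢ proj₂ b) l →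
          All (λ b → count (λ z → popularAs (edgeAt a) (proj₂ a) z ∧ popularAs (edgeAt b) (proj₂ b) z) Cs ≤ N * N * W) l
        go [] [] = []
        go {b ∷ _} ((_ , t′< , q∈) ∷ bs) ((lt , ne) ∷ hs) = overlapping {a} {b} lt t′< p∈ q∈ ne ∷ go bs hs

-- The upper bound

private
  pos-factor : ∀ a b → 0 < a * b → 0 < a
  pos-factor (suc a) b _ = s≤s z≤n

-- By the inequality of the means `Q * P` is at most `(ℓ + x) ^ c`, that is `ℓ ^ c` up to the
-- relative error `Kp / ℓ`; telescoping adds `2 * c * Q / ℓ`. As `ℓ = 8 * A * G`, the two errors
-- together are `1 / (8 * A)`.
popular-density : ∀ A Q c x Kp G ℓ P Σm vol cS → 0 < A → 0 < G → 0 < vol → ℓ ≡ 8 * A * G → G ≡ Kp + 2 * c * Q → Kp ≡ (1 + 2 * x) ^ c →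
  Q * P ≤ Σm ^ c → Σm ≤ ℓ + x → ℓ * (ℓ ^ c * cS) ≤ ℓ * (P * vol) + c * (ℓ ^ c * (2 * vol)) →
  8 * A * Q * cS ≤ (8 * A + 1) * vol
popular-density A Q c x Kp G ℓ P Σm vol cS A>0 G>0 vol>0 refl refl refl am sum β = *-cancelˡ-≤ G {{ℕ.>-nonZero G>0}} (*-cancelˡ-≤ (ℓ ^ c) {{ℕ.>-nonZero (m^n>0 ℓ {{ℕ.>-nonZero ℓ>0}} c)}} (begin
  ℓ ^ c * (G * (8 * A * Q * cS)) ≡⟨ lem₁ (ℓ ^ c) G A Q cS ⟩
  Q * (ℓ * (ℓ ^ c * cS)) ≤⟨ *-monoʳ-≤ Q β ⟩
  Q * (ℓ * (P * vol) + c * (ℓ ^ c * (2 * vol))) ≡⟨ lem₂ Q ℓ P vol c (ℓ ^ c) ⟩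
  ℓ * (Q * P) * vol + 2 * c * Q * (ℓ ^ c * vol) ≤⟨ +-monoˡ-≤ (2 * c * Q * (ℓ ^ c * vol)) (*-monoˡ-≤ vol (≤-trans (*-monoʳ-≤ ℓ (≤-trans am (^-monoˡ-≤ c sum))) (pow-bound ℓ x c ℓ>0))) ⟩
  (ℓ + Kp) * ℓ ^ c * vol + 2 * c * Q * (ℓ ^ c * vol) ≡⟨ lem₃ (8 * A) Kp (2 * c * Q) (ℓ ^ c) vol ⟩
  ℓ ^ c * (G * ((8 * A + 1) * vol)) ∎))
  where
  open ≤-Reasoning
  ℓ>0 : 0 < ℓ
  ℓ>0 = *-mono-≤ {1} {8 * A} (≤-trans A>0 (m≤m+n A _)) G>0
  lem₁ : ∀ p G A Q s → p * (G * (8 * A * Q * s)) ≡ Q * (8 * A * G * (p * s))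
  lem₁ = solve-∀
  lem₂ : ∀ Q l P v c p → Q * (l * (P * v) + c * (p * (2 * v))) ≡ l * (Q * P) * v + 2 * c * Q * (p * v)
  lem₂ = solve-∀
  lem₃ : ∀ a K b p v → (a * (K + b) + K) * p * v + b * (p * v) ≡ p * ((K + b) * ((a + 1) * v))
  lem₃ = solve-∀

-- On the smaller box the edge density is at most `(8 * A + 1) / (8 * A * Q)`, plus
-- `c * R / N = 1 / (8 * A * Q)` for edges with an unpopular pair. It is at least
-- `1 / Q + 1 / (2 * A)`, minus the regularity error `2 * R / ℓA`. Since `Q ≥ 1`, both bounds can
-- hold only if `ℓA ≤ 8 * A * Q * R`.
final-contradiction : ∀ A Q c R N ℓA kI cnt cS vol₁ vol₂ → 0 < Q → 0 < vol₂ → 0 < c * R → N ≡ 8 * A * Q * (c * R) → vol₁ ≤ R * vol₂ →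
  (2 * A + Q) * ℓA ≤ 2 * A * Q * kI → kI * vol₂ ≤ ℓA * cnt + 2 * vol₁ → N * cnt ≤ N * cS + c * vol₁ →
  8 * A * Q * cS ≤ (8 * A + 1) * vol₂ → 8 * A * Q * R < ℓA → ⊥
final-contradiction A Q c R N ℓA kI cnt cS vol₁ vol₂ Q>0 vol₂>0 cR>0 refl vol good low α δ big = <⇒≱ big (+-cancelˡ-≤ ℓA _ _ (begin
  ℓA + ℓA ≡⟨ lem₀ ℓA ⟩
  2 * 1 * ℓA ≤⟨ *-monoˡ-≤ ℓA (*-monoʳ-≤ 2 Q>0) ⟩
  2 * Q * ℓA ≤⟨ +-cancelˡ-≤ (4 * A * ℓA) _ _ (*-cancelʳ-≤ _ _ vol₂ {{ℕ.>-nonZero vol₂>0}} doubled) ⟩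
  ℓA + 8 * A * Q * R ∎))
  where
  open ≤-Reasoning
  lem₀ : ∀ l → l + l ≡ 2 * 1 * l
  lem₀ = solve-∀
  cnt≤ : 8 * A * Q * cnt ≤ (8 * A + 2) * vol₂
  cnt≤ = *-cancelʳ-≤ _ _ (c * R) {{ℕ.>-nonZero cR>0}} (begin
    8 * A * Q * cnt * (c * R) ≡⟨ lem₁ (8 * A * Q) cnt (c * R) ⟩
    8 * A * Q * (c * R) * cnt ≤⟨ α ⟩
    8 * A * Q * (c * R) * cS + c * vol₁ ≤⟨ +-monoʳ-≤ (8 * A * Q * (c * R) * cS) (*-monoʳ-≤ c vol) ⟩
    8 * A * Q * (c * R) * cS + c * (R * vol₂) ≡⟨ lem₂ (8 * A * Q) c R cS vol₂ ⟩
    (8 * A * Q * cS + vol₂) * (c * R) ≤⟨ *-monoˡ-≤ (c * R) (+-monoˡ-≤ vol₂ δ) ⟩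
    ((8 * A + 1) * vol₂ + vol₂) * (c * R) ≡⟨ cong (_* (c * R)) (lem₃ (8 * A) vol₂) ⟩
    (8 * A + 2) * vol₂ * (c * R) ∎)
    where
    lem₁ : ∀ a b c → a * b * c ≡ a * c * b
    lem₁ = solve-∀
    lem₂ : ∀ a c R s v → a * (c * R) * s + c * (R * v) ≡ (a * s + v) * (c * R)
    lem₂ = solve-∀
    lem₃ : ∀ a v → (a + 1) * v + v ≡ (a + 2) * v
    lem₃ = solve-∀
  doubled : (4 * A * ℓA + 2 * Q * ℓA) * vol₂ ≤ (4 * A * ℓA + (ℓA + 8 * A * Q * R)) * vol₂
  doubled = *-cancelˡ-≤ 2 (begin
    2 * ((4 * A * ℓA + 2 * Q * ℓA) * vol₂) ≡⟨ lem₁ A Q ℓA vol₂ ⟩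
    4 * ((2 * A + Q) * ℓA * vol₂) ≤⟨ *-monoʳ-≤ 4 (*-monoˡ-≤ vol₂ good) ⟩
    4 * (2 * A * Q * kI * vol₂) ≡⟨ lem₂ A Q kI vol₂ ⟩
    8 * A * Q * (kI * vol₂) ≤⟨ *-monoʳ-≤ (8 * A * Q) (≤-trans low (+-monoʳ-≤ (ℓA * cnt) (*-monoʳ-≤ 2 vol))) ⟩
    8 * A * Q * (ℓA * cnt + 2 * (R * vol₂)) ≡⟨ lem₃ A Q ℓA cnt R vol₂ ⟩
    ℓA * (8 * A * Q * cnt) + 16 * A * Q * R * vol₂ ≤⟨ +-monoˡ-≤ (16 * A * Q * R * vol₂) (*-monoʳ-≤ ℓA cnt≤) ⟩
    ℓA * ((8 * A + 2) * vol₂) + 16 * A * Q * R * vol₂ ≡⟨ lem₄ A Q ℓA R vol₂ ⟩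
    2 * ((4 * A * ℓA + (ℓA + 8 * A * Q * R)) * vol₂) ∎)
    where
    lem₁ : ∀ A Q l v → 2 * ((4 * A * l + 2 * Q * l) * v) ≡ 4 * ((2 * A + Q) * l * v)
    lem₁ = solve-∀
    lem₂ : ∀ A Q k v → 4 * (2 * A * Q * k * v) ≡ 8 * A * Q * (k * v)
    lem₂ = solve-∀
    lem₃ : ∀ A Q l c R v → 8 * A * Q * (l * c + 2 * (R * v)) ≡ l * (8 * A * Q * c) + 16 * A * Q * R * v
    lem₃ = solve-∀
    lem₄ : ∀ A Q l R v → l * ((8 * A + 2) * v) + 16 * A * Q * R * v ≡ 2 * ((4 * A * l + (l + 8 * A * Q * R)) * v)
    lem₄ = solve-∀

-- A numerator below the threshold `1 / Q + 1 / (2 * A)` and a regularity error of at most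
-- `1 / (4 * A)` give the constant `1 / Q + 3 / (4 * A)` of `sparse-contradiction`.
bad-sparse : ∀ A Q ℓ k vol cnt → 0 < ℓ → 8 * A ≤ ℓ → 2 * A * Q * k ≤ (2 * A + Q) * ℓ → ℓ * cnt ≤ k * vol + 2 * vol →
  4 * A * Q * cnt ≤ (4 * A + 3 * Q) * vol
bad-sparse A Q ℓ k vol cnt ℓ>0 8A≤ bad up = *-cancelˡ-≤ ℓ {{ℕ.>-nonZero ℓ>0}} (begin
  ℓ * (4 * A * Q * cnt) ≡⟨ lem₁ ℓ A Q cnt ⟩
  4 * A * Q * (ℓ * cnt) ≤⟨ *-monoʳ-≤ (4 * A * Q) up ⟩
  4 * A * Q * (k * vol + 2 * vol) ≡⟨ lem₂ A Q k vol ⟩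
  2 * (2 * A * Q * k) * vol + 8 * A * Q * vol ≤⟨ +-mono-≤ (*-monoˡ-≤ vol (*-monoʳ-≤ 2 bad)) (*-monoˡ-≤ vol (*-monoˡ-≤ Q 8A≤)) ⟩
  2 * ((2 * A + Q) * ℓ) * vol + ℓ * Q * vol ≡⟨ lem₃ A Q ℓ vol ⟩
  ℓ * ((4 * A + 3 * Q) * vol) ∎)
  where
  open ≤-Reasoning
  lem₁ : ∀ l A Q c → l * (4 * A * Q * c) ≡ 4 * A * Q * (l * c)
  lem₁ = solve-∀
  lem₂ : ∀ A Q k v → 4 * A * Q * (k * v + 2 * v) ≡ 2 * (2 * A * Q * k) * v + 8 * A * Q * v
  lem₂ = solve-∀
  lem₃ : ∀ A Q l v → 2 * ((2 * A + Q) * l) * v + l * Q * v ≡ l * ((4 * A + 3 * Q) * v)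
  lem₃ = solve-∀

poor-count : ∀ κ ℓ k vol cnt → 0 < ℓ → 2 * κ ≤ ℓ → κ * k ≤ ℓ → ℓ * cnt ≤ k * vol + 2 * vol → κ * cnt ≤ 2 * vol
poor-count κ ℓ k vol cnt ℓ>0 2κ≤ poor up = *-cancelˡ-≤ ℓ {{ℕ.>-nonZero ℓ>0}} (begin
  ℓ * (κ * cnt) ≡⟨ lem₁ ℓ κ cnt ⟩
  κ * (ℓ * cnt) ≤⟨ *-monoʳ-≤ κ up ⟩
  κ * (k * vol + 2 * vol) ≡⟨ lem₂ κ k vol ⟩
  (κ * k + 2 * κ) * vol ≤⟨ *-monoˡ-≤ vol (+-mono-≤ poor 2κ≤) ⟩
  (ℓ + ℓ) * vol ≡⟨ lem₃ ℓ vol ⟩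
  ℓ * (2 * vol) ∎)
  where
  open ≤-Reasoning
  lem₁ : ∀ a b c → a * (b * c) ≡ b * (a * c)
  lem₁ = solve-∀
  lem₂ : ∀ a k v → a * (k * v + 2 * v) ≡ (a * k + 2 * a) * v
  lem₂ = solve-∀
  lem₃ : ∀ l v → (l + l) * v ≡ l * (2 * v)
  lem₃ = solve-∀

-- Almost all `r`-sets in a union of many equal sides are transversal: the ratio of the two counts
-- is at most `(M / (M - r)) ^ r`, which `pow-bound` brings below `1 + 1 / (4 * A)`.
choose-close : ∀ A r M s → 0 < s → 4 * A * (1 + 2 * r) ^ r + 1 + r ≤ M → 4 * A * ((M * s) choose r) < (4 * A + 1) * (s ^ r * (M choose r))
choose-close A r M s s>0 h = *-cancelʳ-< (d * (r !)) _ _ (begin-strict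
  4 * A * ((M * s) choose r) * (d * (r !)) ≡⟨ lem₁ (4 * A) ((M * s) choose r) d (r !) ⟩
  4 * A * d * (((M * s) choose r) * (r !)) ≤⟨ *-monoʳ-≤ (4 * A * d) (≤-trans (choose-upper (M * s) r) (≤-reflexive (^-* r M s))) ⟩
  4 * A * d * (M ^ r * s ^ r) ≡⟨ cong (λ z → 4 * A * d * (z ^ r * s ^ r)) (sym d+r) ⟩
  4 * A * d * ((d + r) ^ r * s ^ r) ≡⟨ lem₂ (4 * A) d ((d + r) ^ r) (s ^ r) ⟩
  4 * A * (d * (d + r) ^ r) * s ^ r ≤⟨ *-monoˡ-≤ (s ^ r) (*-monoʳ-≤ (4 * A) (pow-bound d r r d>0)) ⟩
  4 * A * ((d + K) * d ^ r) * s ^ r ≡⟨ lem₃ (4 * A) d K (d ^ r) (s ^ r) ⟩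
  (4 * A * d + 4 * A * K) * (d ^ r * s ^ r) <⟨ *-monoˡ-< (d ^ r * s ^ r) {{ℕ.>-nonZero (*-mono-≤ (m^n>0 d {{ℕ.>-nonZero d>0}} r) (m^n>0 s {{ℕ.>-nonZero s>0}} r))}} (+-monoʳ-< (4 * A * d) 4AK<d) ⟩
  (4 * A * d + d) * (d ^ r * s ^ r) ≤⟨ *-monoʳ-≤ (4 * A * d + d) (*-monoˡ-≤ (s ^ r) (≤-trans (choose-lower d r) (≤-reflexive (cong (λ z → (z choose r) * (r !)) d+r)))) ⟩
  (4 * A * d + d) * ((M choose r) * (r !) * s ^ r) ≡⟨ lem₄ (4 * A) d (M choose r) (r !) (s ^ r) ⟩
  (4 * A + 1) * (s ^ r * (M choose r)) * (d * (r !)) ∎)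
  where
  open ≤-Reasoning
  K = (1 + 2 * r) ^ r
  d = M ∸ r
  d+r : d + r ≡ M
  d+r = m∸n+n≡m (≤-trans (m≤n+m r _) h)
  4AK<d : 4 * A * K < d
  4AK<d = ≤-trans (≤-reflexive (+-comm 1 (4 * A * K))) (m+n≤o⇒m≤o∸n (4 * A * K + 1) h)
  d>0 : 0 < d
  d>0 = ≤-trans (s≤s z≤n) 4AK<d
  lem₁ : ∀ a b d f → a * b * (d * f) ≡ a * d * (b * f)
  lem₁ = solve-∀
  lem₂ : ∀ a d p s → a * d * (p * s) ≡ a * (d * p) * s
  lem₂ = solve-∀
  lem₃ : ∀ a d K p s → a * ((d + K) * p) * s ≡ (a * d + a * K) * (p * s)
  lem₃ = solve-∀
  lem₄ : ∀ a d m f s → (a * d + d) * (m * f * s) ≡ (a + 1) * (s * m) * (d * f)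
  lem₄ = solve-∀

abstract
  -- Turns regularity of each listed function into one function of density numerators, which the
  -- Ramsey colourings need. Off the list it takes the default 0.
  choiceOn : ∀ {X : Set} → (∀ (x y : X) → Dec (x ≡ y)) → ∀ (xs : List X) (P : X → ℕ → Set) → (∀ {x} → x ∈ xs → ∃[ m ] P x m) →
    Σ (X → ℕ) λ f → ∀ {x} → x ∈ xs → P x (f x)
  choiceOn {X} _≟ˣ_ xs P h = (λ x → pick {x} (x ∈? xs)) , λ {x} x∈ → by x∈ (x ∈? xs)
    where
    _∈?_ : ∀ (x : X) (xs : List X) → Dec (x ∈ xs)
    x ∈? xs = Any.any? (x ≟ˣ_) xs
    pick : ∀ {x : X} → Dec (x ∈ xs) → ℕ
    pick (yes x∈) = proj₁ (h x∈)
    pick (no _) = 0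
    by : ∀ {x : X} → x ∈ xs → (d : Dec (x ∈ xs)) → P x (pick {x} d)
    by x∈ (yes x∈′) = proj₂ (h x∈′)
    by x∈ (no x∉) = contradiction x∈ x∉

private
  _≟ᴸ_ : ∀ (I J : List ℕ) → Dec (I ≡ J)
  _≟ᴸ_ = Data.List.Properties.≡-dec _≟_

  _≟ᴾ_ : ∀ (π ρ : Pattern × List ℕ) → Dec (π ≡ ρ)
  _≟ᴾ_ = Data.Product.Properties.≡-dec (Data.Product.Properties.≡-dec role≟′ role≟′) _≟ᴸ_
    where role≟′ : ∀ (p q : Role) → Dec (p ≡ q)
          role≟′ = Data.Product.Properties.≡-dec _≟_ _≟_

  _≟ᴿ_ : ∀ (π ρ : Role × List ℕ) → Dec (π ≡ ρ)
  _≟ᴿ_ = Data.Product.Properties.≡-dec (Data.Product.Properties.≡-dec _≟_ _≟_) _≟ᴸ_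

labelled : ∀ {X : Set} → List X → List (List ℕ) → List (X × List ℕ)
labelled xs Is = concatMap (λ x → map (x ,_) Is) xs

∈-labelled : ∀ {X : Set} {xs : List X} {Is x I} → x ∈ xs → I ∈ Is → (x , I) ∈ labelled xs Is
∈-labelled {Is = Is} {x} x∈ I∈ = ∈ₚ.∈-concatMap⁺ (λ x → map (x ,_) Is) (lose x∈ (∈ₚ.∈-map⁺ (x ,_) I∈))

boolBit : Bool → Fin 2
boolBit true = fsuc fzero
boolBit false = fzero

boolBit-injective : ∀ {a b} → boolBit a ≡ boolBit b → a ≡ b
boolBit-injective {true} {true} _ = refl
boolBit-injective {false} {false} _ = refl

capped : ∀ ℓ → ℕ → Fin (suc ℓ)
capped ℓ m with m <? suc ℓ
... | yes h = fromℕ< h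
... | no _ = fzero

toℕ-capped : ∀ {ℓ m} → m ≤ ℓ → toℕ (capped ℓ m) ≡ m
toℕ-capped {ℓ} {m} h with m <? suc ℓ
... | yes h′ = Finₚ.toℕ-fromℕ< h′
... | no ¬h = contradiction (s≤s h) ¬h

module Core {k′ : ℕ} (𝒢 : GadgetSystem (suc k′)) (A : ℕ) (A>0 : 0 < A) where

  open Arrangement (suc k′)

  private
    k = suc k′
    r = 2 + k
    Q = c ^ c
    pats = patterns r

  -- The values are settled in the order `ℓB`, the Ramsey sizes from `M` back to `T`, the shrinkage
  -- `RB` with the volume ratio `R`, then `N`, `κ` and finally `ℓA`. Edges with an unpopular pair
  -- take up `c / N` of the first volume, so `N` contains `c * R`; `κ` makes all overlaps of popular
  -- sets together, multiplied by `ℓB`, fit into the second volume.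
  record Constants : Set₁ where
    no-eta-equality
    field
      A+Q≤ : A + Q ≤ A * Q
      x Kp G ℓB : ℕ
      x≡ : x ≡ 1 + 2 * c
      Kp≡ : Kp ≡ (1 + 2 * x) ^ c
      G≡ : G ≡ Kp + 2 * c * Q
      ℓB≡ : ℓB ≡ 8 * A * G
      G>0 : 0 < G
      ℓB>0 : 0 < ℓB
      N₃ M₂ N₂ M₁ T : ℕ
      ramsey₃ : Ramsey r (suc ℓB ^ c) M N₃
      ramsey₂ : Ramsey (2 + (k + k)) (2 ^ length pats) M₂ N₂
      ramsey₁ : Ramsey r 2 M₁ T
      N₃≤ : N₃ ≤ M₂
      bound≤ : GadgetSystem.bound 𝒢 ≤ M₂
      N₂≤ : N₂ ≤ M₁
      close : ∀ s → 0 < s → 4 * A * ((M₁ * s) choose r) < (4 * A + 1) * (s ^ r * (M₁ choose r))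
      RB : ℕ
      RB≡ : RB ≡ Regularity.shrinkage ℓB T ℓB>0 (length (labelled rs (combos r (upTo T))))
      RB>0 : 0 < RB
      R N κ ℓA : ℕ
      R≡ : R ≡ RB ^ T
      N≡ : N ≡ 8 * A * Q * (c * R)
      κ≡ : κ ≡ 2 * R * (c * c * (N * N) * ℓB)
      κ>0 : 0 < κ
      ℓA>0 : 0 < ℓA
      8A≤ : 8 * A ≤ ℓA
      2κ≤ : 2 * κ ≤ ℓA
      gadgets< : 2 * length (GadgetSystem.gadgets 𝒢) * κ ^ length (GadgetSystem.gadgets 𝒢) < ℓA
      8AQR< : 8 * A * Q * R < ℓA

    Is Js : List (List ℕ)
    Is = combos r (upTo T)
    Js = combos (2 + (k + k)) (upTo T)

  record RegularBox (constants : Constants) (H : Hypergraph r) (v₀ : Fin (n H)) : Set where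
    no-eta-equality
    open Constants constants
    field
      Bs : List (List (Fin (n H)))
      T≡ : length Bs ≡ T
      σ : ℕ
      σ>0 : 0 < σ
      sides : All (λ B → length B ≡ σ * RB) Bs
      Bs⊆ : concat Bs ⊆ allFin (n H)
      dense : ∀ S → ∣ S ∣ ≡ M₁ * (σ * RB) → (A + Q) * (∣ S ∣ choose r) ≤ A * Q * eCount H S
      regular-joined : ∀ {I} → I ∈ Is → Regular ℓA (Links.joined H v₀ (length Bs) I) Bs
      regular-linked : ∀ {z} → z ∈ labelled pats Js → Regular ℓA (Links.linked H v₀ (length Bs) (proj₁ z) (proj₂ z)) Bs
      free : ¬ (systemGraph 𝒢 ⊑ H)

  module Stage (constants : Constants) (H : Hypergraph r) (v₀ : Fin (n H)) (box : RegularBox constants H v₀) where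

    open Constants constants
    open RegularBox box

    private
      V = Fin (n H)
      X = upTo T

    private
      s = σ * RB
      s>0 : 0 < s
      s>0 = *-mono-≤ σ>0 RB>0
    open Links H v₀ (length Bs)
    open BoxCounts H v₀ Bs s sides s>0

    private
      vol₁ = ⟪ Bs ⟫

      chosenH = choiceOn _≟ᴸ_ Is (λ I m → m ≤ ℓA × (∀ Cs → Cs ≼ Bs → m * ⟪ Cs ⟫ ≤ ℓA * count (joined I) Cs + 2 * vol₁) × (∀ Cs → Cs ≼ Bs → ℓA * count (joined I) Cs ≤ m * ⟪ Cs ⟫ + 2 * vol₁)) regular-joined
      kH = proj₁ chosenH
      chosenG = choiceOn _≟ᴾ_ (labelled pats Js) (λ z m → m ≤ ℓA × (∀ Cs → Cs ≼ Bs → m * ⟪ Cs ⟫ ≤ ℓA * count (linked (proj₁ z) (proj₂ z)) Cs + 2 * vol₁) × (∀ Cs → Cs ≼ Bs → ℓA * count (linked (proj₁ z) (proj₂ z)) Cs ≤ m * ⟪ Cs ⟫ + 2 * vol₁)) regular-linked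
      kG = proj₁ chosenG
      kG-spec : ∀ {π J} → (π , J) ∈ labelled pats Js → kG (π , J) ≤ ℓA × (∀ Cs → Cs ≼ Bs → kG (π , J) * ⟪ Cs ⟫ ≤ ℓA * count (linked π J) Cs + 2 * vol₁) × (∀ Cs → Cs ≼ Bs → ℓA * count (linked π J) Cs ≤ kG (π , J) * ⟪ Cs ⟫ + 2 * vol₁)
      kG-spec = proj₂ chosenG

      good : List ℕ → Bool
      good I = (2 * A + Q) * ℓA ℕ.≤ᵇ 2 * A * Q * kH I

      hom₁ = ramsey₁ (λ I → boolBit (good I)) X (≤-reflexive (sym (length-upTo T)))
      Y₁ = proj₁ hom₁
      Y₁⊆ : Y₁ ⊆ X
      Y₁⊆ = proj₁ (proj₂ hom₁)
      Y₁-length : length Y₁ ≡ M₁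
      Y₁-length = proj₁ (proj₂ (proj₂ hom₁))
      col₁ = proj₁ (proj₂ (proj₂ (proj₂ hom₁)))
      hom₁-eq = proj₂ (proj₂ (proj₂ (proj₂ hom₁)))

      X-increasing : Increasing X
      X-increasing = AllPairsₚ.applyUpTo⁺₁ id T λ i<j _ → i<j

      X-bound : ∀ {Y} → Y ⊆ X → All (_< length Bs) Y
      X-bound Y⊆ = All.tabulate λ i∈ → subst (_ <_) (sym T≡) (∈ₚ.∈-upTo⁻ (Sub.lookup Y⊆ i∈))

      -- On `Y₁` all `r`-sets of indices are good or all are bad. In the second case the union of
      -- the sides in `Y₁` would be too sparse, contrary to the local density.
      all-good : ∀ I → I ⊆ Y₁ → length I ≡ r → good I ≡ true
      all-good I I⊆ l = by col₁ refl
        where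
        by : ∀ b → col₁ ≡ b → good I ≡ true
        by (fsuc fzero) e = boolBit-injective (trans (hom₁-eq I I⊆ l) e)
        by fzero e = ⊥-elim (sparse-contradiction A Q A>0 A+Q≤ Bs⊆ Y₁ (AllPairs-⊆ Y₁⊆ X-increasing) (X-bound Y₁⊆)
          (λ S size → dense S (trans size (cong (_* s) Y₁-length)))
          (λ Z Z∈ → let Z⊆ , lZ = ∈-combos r Y₁ Z∈ in
            bad-sparse A Q ℓA (kH Z) vol₁ (count (joined Z) Bs) ℓA>0 8A≤ (≤ᵇ-false {(2 * A + Q) * ℓA} (boolBit-injective (trans (hom₁-eq Z Z⊆ lZ) e)))
              (proj₂ (proj₂ (proj₂ chosenH (combos-∈ (⊆-trans Z⊆ Y₁⊆) lZ))) Bs ≼-refl))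
          (subst (λ m → 4 * A * ((m * s) choose r) < (4 * A + 1) * (s ^ r * (m choose r))) (sym Y₁-length) (close s s>0)))

      rich : Pattern → List ℕ → Bool
      rich π J = ℓA ℕ.≤ᵇ κ * kG (π , J)

      colour₂ : List ℕ → Fin (length pats) → Fin 2
      colour₂ J i = boolBit (rich (Data.List.lookup pats i) J)

      hom₂ = ramsey₂ (λ J → funToFin (colour₂ J)) Y₁ (≤-trans N₂≤ (≤-reflexive (sym Y₁-length)))
      Y₂ = proj₁ hom₂
      Y₂⊆ : Y₂ ⊆ Y₁
      Y₂⊆ = proj₁ (proj₂ hom₂)
      Y₂-length : length Y₂ ≡ M₂
      Y₂-length = proj₁ (proj₂ (proj₂ hom₂))

      rich-constant : ∀ {π J J′} → π ∈ pats → J ⊆ Y₂ → length J ≡ 2 + (k + k) → J′ ⊆ Y₂ → length J′ ≡ 2 + (k + k) → rich π J ≡ rich π J′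
      rich-constant {π} {J} {J′} π∈ s l s′ l′ = boolBit-injective (subst (λ π → boolBit (rich π J) ≡ boolBit (rich π J′)) (sym (Anyₚ.lookup-index π∈))
        (funToFin-injective {f = colour₂ J} {colour₂ J′} (trans (hom₂-eq J s l) (sym (hom₂-eq J′ s′ l′))) (Any.index π∈)))
        where hom₂-eq = proj₂ (proj₂ (proj₂ (proj₂ hom₂)))

      linked-∈ : ∀ {π J} → π ∈ pats → J ⊆ Y₂ → length J ≡ 2 + (k + k) → (π , J) ∈ labelled pats Js
      linked-∈ π∈ J⊆ l = ∈-labelled π∈ (combos-∈ (⊆-trans J⊆ (⊆-trans Y₂⊆ Y₁⊆)) l)

      -- Richness of a pattern does not depend on the index set inside `Y₂`. One rich set therefore
      -- makes the pattern rich everywhere, and F embeds.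
      never-rich : ∀ {π J} → ValidPattern r π → J ⊆ Y₂ → length J ≡ 2 + (k + k) → rich π J ≡ false
      never-rich {π@(p , q)} {J} valid J⊆ l = by (rich π J) refl
        where
        by : ∀ b → rich π J ≡ b → rich π J ≡ false
        by false e = e
        by true e = contradiction (Embedding.embedding 𝒢 H v₀ Bs (Unique-⊆ Bs⊆ (Uniqueₚ.allFin⁺ (n H))) vol>0 p q valid Y₂
          (AllPairs-⊆ (⊆-trans Y₂⊆ Y₁⊆) X-increasing) (X-bound (⊆-trans Y₂⊆ Y₁⊆)) (≤-trans bound≤ (≤-reflexive (sym Y₂-length))) ℓA κ
          (λ J′ J′⊆ l′ → let m≤ , low , _ = kG-spec (linked-∈ (∈-patterns {r} valid) J′⊆ l′) in
            kG (π , J′) , m≤ , ≤ᵇ-true (trans (rich-constant (∈-patterns {r} valid) J′⊆ l′ J⊆ l) e) , low) gadgets<) free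

      instance κ-nonZero = ℕ.>-nonZero κ>0

      -- The bound of `poor-count` on the number of gadgets, rounded down to an integer.
      W = (2 * vol₁) ℕ./ κ

      rare : ∀ {π} → ValidPattern r π → ∀ J → J ⊆ Y₂ → length J ≡ 2 + (k + k) → count (linked π J) Bs ≤ W
      rare {π} valid J J⊆ l = ≤-trans (≤-reflexive (sym (m*n/n≡m (count (linked π J) Bs) κ))) (/-monoˡ-≤ κ (≤-trans (≤-reflexive (*-comm (count (linked π J) Bs) κ))
        (poor-count κ ℓA (kG (π , J)) vol₁ (count (linked π J) Bs) ℓA>0 2κ≤ (≤ᵇ-false {ℓA} {κ * kG (π , J)} (never-rich valid J⊆ l))
          (proj₂ (proj₂ (kG-spec (linked-∈ (∈-patterns {r} valid) J⊆ l))) Bs ≼-refl))))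

    position₁ position₂ : List ℕ → Role → ℕ
    position₁ I (x , y) = nth 0 I x
    position₂ I (x , y) = nth 0 I (x + suc y)

    popularIn : Role × List ℕ → List V → Bool
    popularIn (p , I) = popular N I (position₁ I p) (position₂ I p)

    module _ (Cs : List (List V)) (Cs≼ : Cs ≼ Bs) (τ : ℕ) (τ>0 : 0 < τ) (sides₂ : All (λ C → length C ≡ σ * τ) Cs)
      (regular-popular : ∀ {z} → z ∈ labelled rs Is → Regular ℓB (popularIn z) Cs) where

      private
        vol₂ = ⟪ Cs ⟫

        Cs-length : length Cs ≡ T
        Cs-length = trans (Pw.Pointwise-length Cs≼) T≡

        vol₂>0 : 0 < vol₂
        vol₂>0 = ≤-trans (m^n>0 (σ * τ) {{ℕ.>-nonZero (*-mono-≤ σ>0 τ>0)}} (length Cs)) (≤-reflexive (sym (vol-^ Cs sides₂)))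

        vol-ratio : vol₁ ≤ R * vol₂
        vol-ratio = begin
          vol₁ ≡⟨ trans (vol-^ Bs sides) (cong ((σ * RB) ^_) T≡) ⟩
          (σ * RB) ^ T ≤⟨ ^-monoˡ-≤ T (≤-trans (≤-reflexive (lem σ RB)) (*-monoʳ-≤ RB (*-monoʳ-≤ σ τ>0))) ⟩
          (RB * (σ * τ)) ^ T ≡⟨ ^-* T RB (σ * τ) ⟩
          RB ^ T * (σ * τ) ^ T ≡⟨ cong₂ _*_ (sym R≡) (sym (trans (vol-^ Cs sides₂) (cong ((σ * τ) ^_) Cs-length))) ⟩
          R * vol₂ ∎
          where
          open ≤-Reasoning
          lem : ∀ a b → a * b ≡ b * (a * 1)
          lem = solve-∀

        open Finale H v₀ Bs s sides s>0 Cs Cs≼ vol₂>0 N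

        popularIn≡ : ∀ p I → popularIn (p , I) ≡ popularAs I p
        popularIn≡ (x , y) I = refl

        chosenP = choiceOn _≟ᴿ_ (labelled rs Is) (λ z m → m ≤ ℓB × (∀ Ds → Ds ≼ Cs → m * ⟪ Ds ⟫ ≤ ℓB * count (popularIn z) Ds + 2 * vol₂) × (∀ Ds → Ds ≼ Cs → ℓB * count (popularIn z) Ds ≤ m * ⟪ Ds ⟫ + 2 * vol₂)) regular-popular
        kP = proj₁ chosenP

        colour₃ : List ℕ → Fin c → Fin (suc ℓB)
        colour₃ I i = capped ℓB (kP (Data.List.lookup rs i , I))

        hom₃ = ramsey₃ (λ I → funToFin (colour₃ I)) Y₂ (≤-trans N₃≤ (≤-reflexive (sym Y₂-length)))
        Y₃ = proj₁ hom₃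
        Y₃⊆ : Y₃ ⊆ Y₂
        Y₃⊆ = proj₁ (proj₂ hom₃)
        Y₃-length : length Y₃ ≡ M
        Y₃-length = proj₁ (proj₂ (proj₂ hom₃))

        Y₃⊆X : Y₃ ⊆ X
        Y₃⊆X = ⊆-trans Y₃⊆ (⊆-trans Y₂⊆ Y₁⊆)

        Y₃-increasing : Increasing Y₃
        Y₃-increasing = AllPairs-⊆ Y₃⊆X X-increasing

        label-∈ : ∀ {p I} → p ∈ rs → I ⊆ Y₃ → length I ≡ r → (p , I) ∈ labelled rs Is
        label-∈ p∈ I⊆ l = ∈-labelled p∈ (combos-∈ (⊆-trans I⊆ Y₃⊆X) l)

        rare₃ : ∀ {π} → ValidPattern r π → ∀ J → J ⊆ Y₃ → length J ≡ 2 + (k + k) → count (linked π J) Bs ≤ W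
        rare₃ valid J J⊆ l = rare valid J (⊆-trans J⊆ Y₃⊆) l

        p₀∈ : (0 , 0) ∈ rs
        p₀∈ = roles-∈ {r} 0 0 (s≤s (s≤s z≤n))

        c>0 : 0 < c
        c>0 = ∈ₚ.∈-length p₀∈

        -- A representative index set. All `r`-sets inside `Y₃` are good and have the same
        -- numerators, so one of the layout's edges stands for all.
        I₀ : List ℕ
        I₀ = edgeAt Y₃ Y₃-increasing Y₃-length W rare₃ (0 , (0 , 0))

        I₀⊆ : I₀ ⊆ Y₃
        I₀⊆ = edgeAt-⊆ Y₃ Y₃-increasing Y₃-length W rare₃ {0} {0 , 0} c>0 p₀∈

        I₀-length : length I₀ ≡ r
        I₀-length = edgeAt-length Y₃ Y₃-increasing Y₃-length W rare₃ {0} {0 , 0} p₀∈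

        m : Role → ℕ
        m p = kP (p , I₀)

        m-constant : ∀ {p I} → p ∈ rs → I ⊆ Y₃ → length I ≡ r → kP (p , I) ≡ m p
        m-constant {p} {I} p∈ I⊆ l = trans (sym (toℕ-capped (proj₁ (proj₂ chosenP (label-∈ p∈ I⊆ l)))))
          (trans (cong toℕ (subst (λ p → capped ℓB (kP (p , I)) ≡ capped ℓB (kP (p , I₀))) (sym (Anyₚ.lookup-index p∈))
            (funToFin-injective {f = colour₃ I} {colour₃ I₀} (trans (hom₃-eq I I⊆ l) (sym (hom₃-eq I₀ I₀⊆ I₀-length))) (Any.index p∈))))
          (toℕ-capped (proj₁ (proj₂ chosenP (label-∈ p∈ I₀⊆ I₀-length)))))
          where hom₃-eq = proj₂ (proj₂ (proj₂ (proj₂ hom₃)))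

        low : ∀ I p → I ⊆ Y₃ → length I ≡ r → p ∈ rs → m p * vol₂ ≤ ℓB * count (popularAs I p) Cs + 2 * vol₂
        low I p I⊆ l p∈ = subst₂ (λ a f → a * vol₂ ≤ ℓB * count f Cs + 2 * vol₂) (m-constant p∈ I⊆ l) (popularIn≡ p I)
          (proj₁ (proj₂ (proj₂ chosenP (label-∈ p∈ I⊆ l))) Cs ≼-refl)

        up : ∀ {p} → p ∈ rs → ∀ Ds → Ds ≼ Cs → ℓB * count (popularAs I₀ p) Ds ≤ m p * ⟪ Ds ⟫ + 2 * vol₂
        up {p} p∈ Ds s = subst (λ f → ℓB * count f Ds ≤ m p * ⟪ Ds ⟫ + 2 * vol₂) (popularIn≡ p I₀)
          (proj₂ (proj₂ (proj₂ chosenP (label-∈ p∈ I₀⊆ I₀-length))) Ds s)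

        Σm≤ : ∑ rs m ≤ ℓB + x
        Σm≤ = *-cancelʳ-≤ _ _ vol₂ {{ℕ.>-nonZero vol₂>0}} (begin
          ∑ rs m * vol₂ ≤⟨ popular-sum Y₃ Y₃-increasing Y₃-length W rare₃ ℓB m low ⟩
          ℓB * (vol₂ + c * c * (N * N * W)) + c * (2 * vol₂) ≡⟨ lem₁ ℓB vol₂ c N W ⟩
          ℓB * vol₂ + c * c * (N * N) * ℓB * W + 2 * c * vol₂ ≤⟨ +-monoˡ-≤ (2 * c * vol₂) (+-monoʳ-≤ (ℓB * vol₂) overlaps) ⟩
          ℓB * vol₂ + vol₂ + 2 * c * vol₂ ≡⟨ lem₂ ℓB vol₂ c ⟩
          (ℓB + (1 + 2 * c)) * vol₂ ≡⟨ cong (λ z → (ℓB + z) * vol₂) (sym x≡) ⟩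
          (ℓB + x) * vol₂ ∎)
          where
          open ≤-Reasoning
          lem₁ : ∀ l v c N W → l * (v + c * c * (N * N * W)) + c * (2 * v) ≡ l * v + c * c * (N * N) * l * W + 2 * c * v
          lem₁ = solve-∀
          lem₂ : ∀ l v c → l * v + v + 2 * c * v ≡ (l + (1 + 2 * c)) * v
          lem₂ = solve-∀
          2R>0 : 0 < 2 * R
          2R>0 = pos-factor (2 * R) (c * c * (N * N) * ℓB) (subst (0 <_) κ≡ κ>0)
          overlaps : c * c * (N * N) * ℓB * W ≤ vol₂
          overlaps = *-cancelˡ-≤ (2 * R) {{ℕ.>-nonZero 2R>0}} (begin
            2 * R * (c * c * (N * N) * ℓB * W) ≡⟨ sym (*-assoc (2 * R) (c * c * (N * N) * ℓB) W) ⟩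
            2 * R * (c * c * (N * N) * ℓB) * W ≡⟨ trans (cong (_* W) (sym κ≡)) (*-comm κ W) ⟩
            W * κ ≤⟨ m/n*n≤m (2 * vol₁) κ ⟩
            2 * vol₁ ≤⟨ *-monoʳ-≤ 2 vol-ratio ⟩
            2 * (R * vol₂) ≡⟨ sym (*-assoc 2 R vol₂) ⟩
            2 * R * vol₂ ∎)

        I₀-increasing : Increasing I₀
        I₀-increasing = AllPairs-⊆ I₀⊆ Y₃-increasing

        I₀< : All (_< length Bs) I₀
        I₀< = X-bound (⊆-trans I₀⊆ Y₃⊆X)

        m≤ℓB : ∀ {p} → p ∈ rs → m p ≤ ℓB
        m≤ℓB p∈ = proj₁ (proj₂ chosenP (label-∈ p∈ I₀⊆ I₀-length))

        cS = count (allPopular I₀ I₀-increasing I₀-length I₀< ℓB m m≤ℓB up) Cs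

        density : 8 * A * Q * cS ≤ (8 * A + 1) * vol₂
        density = popular-density A Q c x Kp G ℓB (∏ rs m) (∑ rs m) vol₂ cS A>0 G>0 vol₂>0 ℓB≡ G≡ Kp≡ (am-gm rs m) Σm≤
          (popular-product I₀ I₀-increasing I₀-length I₀< ℓB m m≤ℓB up)

      contradictory : ⊥
      contradictory = final-contradiction A Q c R N ℓA (kH I₀) (count (joined I₀) Cs) cS vol₁ vol₂ (m^n>0 c {{ℕ.>-nonZero c>0}} c) vol₂>0
        (*-mono-≤ c>0 (≤-trans (m^n>0 RB {{ℕ.>-nonZero RB>0}} T) (≤-reflexive (sym R≡)))) N≡ vol-ratio
        (≤ᵇ-true (all-good I₀ (⊆-trans I₀⊆ (⊆-trans Y₃⊆ Y₂⊆)) I₀-length))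
        (proj₁ (proj₂ (proj₂ chosenH (combos-∈ (⊆-trans I₀⊆ Y₃⊆X) I₀-length))) Cs Cs≼)
        (edges-mostly-popular I₀ I₀-increasing I₀-length I₀< ℓB m m≤ℓB up) density 8AQR<

private
  two-members : ∀ {A : Set} {a b : A} {xs} → a ∈ xs → b ∈ xs → a ≢ b → 2 ≤ length xs
  two-members (here refl) (here refl) ne = contradiction refl ne
  two-members {xs = _ ∷ _ ∷ _} (here _) (there _) ne = s≤s (s≤s z≤n)
  two-members {xs = _ ∷ _ ∷ _} (there _) _ ne = s≤s (s≤s z≤n)

  sum≤product : ∀ {a q} → 2 ≤ a → 2 ≤ q → a + q ≤ a * q
  sum≤product {suc (suc a)} {suc (suc q)} _ _ = ≤-trans (m≤m+n _ (a + q + a * q)) (≤-reflexive (lem a q))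
    where lem : ∀ a q → (2 + a) + (2 + q) + (a + q + a * q) ≡ (2 + a) * (2 + q)
          lem = solve-∀
  sum≤product {suc zero} (s≤s ()) _
  sum≤product {suc (suc a)} {suc zero} _ (s≤s ())

  n≤n^n : ∀ {c} → 0 < c → c ≤ c ^ c
  n≤n^n {suc c} _ = ≤-trans (≤-reflexive (sym (^-identityʳ (suc c)))) (^-monoʳ-≤ (suc c) {1} {suc c} (s≤s z≤n))

rolePower : ℕ → ℕ
rolePower r = length (roles r) ^ length (roles r)

roles≥2 : ∀ k → 1 ≤ k → 2 ≤ length (roles (2 + k))
roles≥2 (suc k) _ = two-members (roles-∈ {3 + k} 0 0 (s≤s (s≤s z≤n))) (roles-∈ {3 + k} 0 1 (s≤s (s≤s (s≤s z≤n)))) λ ()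

module UpperBound {k′ : ℕ} (𝒢 : GadgetSystem (suc k′)) (A : ℕ) (2≤A : 2 ≤ A) where

  private
    k = suc k′
    r = 2 + k
  open Arrangement k using (rs; c; M)

  private
    pats = patterns r
    Q = c ^ c
    A>0 : 0 < A
    A>0 = ≤-trans (s≤s z≤n) 2≤A
    c≥2 : 2 ≤ c
    c≥2 = roles≥2 k (s≤s z≤n)
    c>0 : 0 < c
    c>0 = ≤-trans (s≤s z≤n) c≥2
    Q≥2 : 2 ≤ Q
    Q≥2 = ≤-trans c≥2 (n≤n^n c>0)
    Q>0 : 0 < Q
    Q>0 = ≤-trans (s≤s z≤n) Q≥2

    x Kp G ℓB : ℕ
    x = 1 + 2 * c
    Kp = (1 + 2 * x) ^ c
    G = Kp + 2 * c * Q
    ℓB = 8 * A * G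
    G>0 : 0 < G
    G>0 = ≤-trans (m^n>0 (1 + 2 * x) c) (m≤m+n Kp _)
    ℓB>0 : 0 < ℓB
    ℓB>0 = *-mono-≤ {1} {8 * A} (≤-trans A>0 (m≤m+n A _)) G>0

    gs = length (GadgetSystem.gadgets 𝒢)
    R₃ = ramsey r (suc ℓB ^ c) M
    M₂ = proj₁ R₃ ⊔ GadgetSystem.bound 𝒢
    R₂ = ramsey (2 + (k + k)) (2 ^ length pats) M₂
    M₀ = 4 * A * (1 + 2 * r) ^ r + 1 + r
    M₁ = proj₁ R₂ ⊔ M₀
    R₁ = ramsey r 2 M₁
    T = proj₁ R₁
    X = upTo T
    Is = combos r X
    Js = combos (2 + (k + k)) X

    RB = Regularity.shrinkage ℓB T ℓB>0 (length (labelled rs Is))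
    RB>0 : 0 < RB
    RB>0 = Regularity.shrinkage-positive ℓB T ℓB>0 (length (labelled rs Is))
    R = RB ^ T
    R>0 : 0 < R
    R>0 = m^n>0 RB {{ℕ.>-nonZero RB>0}} T
    N = 8 * A * Q * (c * R)
    N>0 : 0 < N
    N>0 = *-mono-≤ {1} {8 * A * Q} (*-mono-≤ {1} {8 * A} (≤-trans A>0 (m≤m+n A _)) Q>0) (*-mono-≤ c>0 R>0)
    κ = 2 * R * (c * c * (N * N) * ℓB)
    κ>0 : 0 < κ
    κ>0 = *-mono-≤ {1} {2 * R} (≤-trans R>0 (m≤m+n R _)) (*-mono-≤ (*-mono-≤ (*-mono-≤ c>0 c>0) (*-mono-≤ N>0 N>0)) ℓB>0)
    -- One summand for each demand: the final contradiction, `bad-sparse`, `poor-count`, and the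
    -- embedding.
    ℓA = 1 + (8 * A * Q * R + (8 * A + (2 * κ + 2 * gs * κ ^ gs)))
    8AQR< : 8 * A * Q * R < ℓA
    8AQR< = s≤s (m≤m+n _ _)
    8A≤ : 8 * A ≤ ℓA
    8A≤ = ≤-trans (≤-trans (m≤m+n _ _) (m≤n+m _ (8 * A * Q * R))) (n≤1+n _)
    2κ≤ : 2 * κ ≤ ℓA
    2κ≤ = ≤-trans (≤-trans (≤-trans (m≤m+n (2 * κ) (2 * gs * κ ^ gs)) (m≤n+m _ (8 * A))) (m≤n+m _ (8 * A * Q * R))) (n≤1+n _)
    gadgets< : 2 * gs * κ ^ gs < ℓA
    gadgets< = s≤s (≤-trans (≤-trans (m≤n+m (2 * gs * κ ^ gs) (2 * κ)) (m≤n+m _ (8 * A))) (m≤n+m _ (8 * A * Q * R)))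
    ℓA>0 : 0 < ℓA
    ℓA>0 = s≤s z≤n

    lengthA = length Is + length (labelled pats Js)
    RA = Regularity.shrinkage ℓA T ℓA>0 lengthA
    RA>0 : 0 < RA
    RA>0 = Regularity.shrinkage-positive ℓA T ℓA>0 lengthA
    -- `T` parts of `σ * RB * RA` vertices fit into the host when `σ * g ≤ n H`; they survive both
    -- shrinkages with exact divisions. Taking `suc T` keeps `g` positive.
    g = suc T * (RB * RA)
    g>0 : 0 < g
    g>0 = *-mono-≤ {1} {suc T} (s≤s z≤n) (*-mono-≤ RB>0 RA>0)

    constants : Core.Constants 𝒢 A A>0
    constants = record
      { A+Q≤ = sum≤product 2≤A Q≥2 ; x = x ; Kp = Kp ; G = G ; ℓB = ℓB ; x≡ = refl ; Kp≡ = refl ; G≡ = refl ; ℓB≡ = refl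
      ; G>0 = G>0 ; ℓB>0 = ℓB>0 ; N₃ = proj₁ R₃ ; M₂ = M₂ ; N₂ = proj₁ R₂ ; M₁ = M₁ ; T = T
      ; ramsey₃ = proj₂ R₃ ; ramsey₂ = proj₂ R₂ ; ramsey₁ = proj₂ R₁
      ; N₃≤ = m≤m⊔n (proj₁ R₃) _ ; bound≤ = m≤n⊔m (proj₁ R₃) _ ; N₂≤ = m≤m⊔n (proj₁ R₂) M₀
      ; close = λ s s>0 → choose-close A r M₁ s s>0 (m≤n⊔m (proj₁ R₂) M₀)
      ; RB = RB ; RB≡ = refl ; RB>0 = RB>0 ; R = R ; N = N ; κ = κ ; ℓA = ℓA ; R≡ = refl ; N≡ = refl ; κ≡ = refl
      ; κ>0 = κ>0 ; ℓA>0 = ℓA>0 ; 8A≤ = 8A≤ ; 2κ≤ = 2κ≤ ; gadgets< = gadgets< ; 8AQR< = 8AQR< }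

  -- More than `g` vertices force `σ ≥ 1`, and then `n H ≤ 2 * g * σ`. A union of sides has at least
  -- `σ` vertices even after shrinking, so the density hypothesis applies to it.
  threshold scale : ℕ
  threshold = suc g
  scale = 2 * g

  module _ (H : Hypergraph r) (large : threshold ≤ n H)
    (dense : ∀ S → n H ≤ scale * ∣ S ∣ → (A + Q) * (∣ S ∣ choose r) ≤ A * Q * eCount H S)
    (free : ¬ (systemGraph 𝒢 ⊑ H)) where

    private
      V = Fin (n H)
      v₀ : V
      v₀ = fromℕ< (≤-trans (s≤s z≤n) large)

      floored = div-floor (n H) g g>0
      σ = proj₁ floored
      σ>0 : 0 < σ
      σ>0 = pos σ (proj₂ (proj₂ floored))
        where pos : ∀ σ → n H ≤ σ * g + g → 0 < σ
              pos zero h = contradiction (≤-trans large h) (<-irrefl refl)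
              pos (suc σ) _ = s≤s z≤n

      B₀ = chunks T (σ * RB * RA) (allFin (n H))

      fits : T * (σ * RB * RA) ≤ length (allFin (n H))
      fits = ≤-trans (≤-trans (*-monoˡ-≤ (σ * RB * RA) (n≤1+n T)) (≤-reflexive (lem (suc T) σ RB RA)))
        (≤-trans (proj₁ (proj₂ floored)) (≤-reflexive (sym (length-tabulate {n = n H} id))))
        where lem : ∀ T s a b → T * (s * a * b) ≡ s * (T * (a * b))
              lem = solve-∀

      linkedA : Pattern × List ℕ → List V → Bool
      linkedA z = Links.linked H v₀ T (proj₁ z) (proj₂ z)

      fsA : List (List V → Bool)
      fsA = map (Links.joined H v₀ T) Is ++ map linkedA (labelled pats Js)

      fsA-length : length fsA ≡ lengthA
      fsA-length = trans (length-++ (map (Links.joined H v₀ T) Is)) (cong₂ _+_ (length-map (Links.joined H v₀ T) Is) (length-map linkedA (labelled pats Js)))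

    -- Two nested regularisations. The second one treats functions that are defined by the box found
    -- in the first, so it cannot be merged with it, and the factor `RB` for its shrinkage is
    -- reserved in the sides from the start.
    contradiction-free : ⊥
    contradiction-free = Regularity.regularise ℓA T ℓA>0 fsA (σ * RB) B₀ (length-chunks T (σ * RB * RA) (allFin (n H)))
      (subst (λ l → All (λ B → length B ≡ σ * RB * Regularity.shrinkage ℓA T ℓA>0 l) B₀) (sym fsA-length) (chunks-sides T (σ * RB * RA) (allFin (n H)) fits)) stageA
      where
      stageA : ∀ Bs w → Bs ≼ B₀ → 0 < w → All (λ B → length B ≡ σ * RB * w) Bs → All (λ f → Regular ℓA f Bs) fsA → ⊥
      stageA Bs w Bs≼ w>0 sides regs = Regularity.regularise ℓB T ℓB>0 (map popularIn (labelled rs Is)) (σ * w) Bs Bs-length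
          (subst (λ l → All (λ B → length B ≡ σ * w * Regularity.shrinkage ℓB T ℓB>0 l) Bs) (sym (length-map popularIn (labelled rs Is))) sides′) stageB
        where
        Bs-length : length Bs ≡ T
        Bs-length = trans (Pw.Pointwise-length Bs≼) (length-chunks T (σ * RB * RA) (allFin (n H)))
        sides′ : All (λ B → length B ≡ σ * w * RB) Bs
        sides′ = All.map (λ e → trans e (lem σ RB w)) sides
          where lem : ∀ a b c → a * b * c ≡ a * c * b
                lem = solve-∀
        σw>0 : 0 < σ * w
        σw>0 = *-mono-≤ σ>0 w>0
        dense′ : ∀ S → ∣ S ∣ ≡ M₁ * (σ * w * RB) → (A + Q) * (∣ S ∣ choose r) ≤ A * Q * eCount H S
        dense′ S size = dense S (begin
          n H ≤⟨ proj₂ (proj₂ floored) ⟩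
          σ * g + g ≤⟨ +-monoʳ-≤ (σ * g) (≤-trans (≤-reflexive (sym (*-identityˡ g))) (*-monoˡ-≤ g σ>0)) ⟩
          σ * g + σ * g ≡⟨ lem σ g ⟩
          scale * (1 * (σ * 1 * 1)) ≤⟨ *-monoʳ-≤ scale (*-mono-≤ {1} {M₁} (≤-trans (m≤n+m 1 (4 * A * (1 + 2 * r) ^ r)) (≤-trans (m≤m+n _ r) (m≤n⊔m (proj₁ R₂) M₀))) (*-mono-≤ (*-monoʳ-≤ σ w>0) RB>0)) ⟩
          scale * (M₁ * (σ * w * RB)) ≡⟨ cong (scale *_) (sym size) ⟩
          scale * ∣ S ∣ ∎)
          where
          open ≤-Reasoning
          lem : ∀ s g → s * g + s * g ≡ 2 * g * (1 * (s * 1 * 1))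
          lem = solve-∀
        Bs⊆ : concat Bs ⊆ allFin (n H)
        Bs⊆ = ⊆-trans (concat-≼ Bs≼) (concat-chunks T (σ * RB * RA) (allFin (n H)))
        regular-joined : ∀ {I} → I ∈ Is → Regular ℓA (Links.joined H v₀ (length Bs) I) Bs
        regular-joined I∈ = All.lookup (Allₚ.map⁻ (Allₚ.++⁻ˡ (map (Links.joined H v₀ T) Is) regs)) I∈
        regular-linked : ∀ {z} → z ∈ labelled pats Js → Regular ℓA (Links.linked H v₀ (length Bs) (proj₁ z) (proj₂ z)) Bs
        regular-linked z∈ = All.lookup (Allₚ.map⁻ {f = linkedA} (Allₚ.++⁻ʳ (map (Links.joined H v₀ T) Is) regs)) z∈
        box : Core.RegularBox 𝒢 A A>0 constants H v₀
        box = record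
          { Bs = Bs ; T≡ = Bs-length ; σ = σ * w ; σ>0 = σw>0 ; sides = sides′ ; Bs⊆ = Bs⊆ ; dense = dense′
          ; regular-joined = regular-joined ; regular-linked = regular-linked ; free = free }
        popularIn : Role × List ℕ → List V → Bool
        popularIn = Core.Stage.popularIn 𝒢 A A>0 constants H v₀ box
        stageB : ∀ Cs τ → Cs ≼ Bs → 0 < τ → All (λ C → length C ≡ σ * w * τ) Cs → All (λ f → Regular ℓB f Cs) (map popularIn (labelled rs Is)) → ⊥
        stageB Cs τ Cs≼ τ>0 sides₂ regs₂ = Core.Stage.contradictory 𝒢 A A>0 constants H v₀ box Cs Cs≼ τ τ>0 sides₂ (λ z∈ → All.lookup (Allₚ.map⁻ {f = popularIn} regs₂) z∈)

-- A quasirandom colouring of the pairs by roles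

∑ᶻ : List A → (A → ℤ) → ℤ
∑ᶻ [] f = 0ℤ
∑ᶻ (x ∷ xs) f = f x ℤ.+ ∑ᶻ xs f

∑ᶻ-cong : ∀ (xs : List A) {f g : A → ℤ} → (∀ x → f x ≡ g x) → ∑ᶻ xs f ≡ ∑ᶻ xs g
∑ᶻ-cong [] h = refl
∑ᶻ-cong (x ∷ xs) h = cong₂ ℤ._+_ (h x) (∑ᶻ-cong xs h)

∑ᶻ-+ : ∀ (xs : List A) (f g : A → ℤ) → ∑ᶻ xs (λ x → f x ℤ.+ g x) ≡ ∑ᶻ xs f ℤ.+ ∑ᶻ xs g
∑ᶻ-+ [] f g = refl
∑ᶻ-+ (x ∷ xs) f g rewrite ∑ᶻ-+ xs f g = lem (f x) (g x) (∑ᶻ xs f) (∑ᶻ xs g)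
  where lem : ∀ a b c d → a ℤ.+ b ℤ.+ (c ℤ.+ d) ≡ a ℤ.+ c ℤ.+ (b ℤ.+ d)
        lem = ℤ-Solver.solve-∀

∑ᶻ-* : ∀ (xs : List A) c (f : A → ℤ) → ∑ᶻ xs (λ x → c ℤ.* f x) ≡ c ℤ.* ∑ᶻ xs f
∑ᶻ-* [] c f = sym (ℤₚ.*-zeroʳ c)
∑ᶻ-* (x ∷ xs) c f rewrite ∑ᶻ-* xs c f = sym (ℤₚ.*-distribˡ-+ c (f x) (∑ᶻ xs f))

∑ᶻ-0 : ∀ (xs : List A) → ∑ᶻ xs (λ _ → 0ℤ) ≡ 0ℤ
∑ᶻ-0 [] = refl
∑ᶻ-0 (x ∷ xs) = trans (ℤₚ.+-identityˡ _) (∑ᶻ-0 xs)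

∑ᶻ-swap : ∀ (xs : List A) (ys : List A′) (f : A → A′ → ℤ) → ∑ᶻ xs (λ x → ∑ᶻ ys (f x)) ≡ ∑ᶻ ys (λ y → ∑ᶻ xs (λ x → f x y))
∑ᶻ-swap [] ys f = sym (∑ᶻ-0 ys)
∑ᶻ-swap (x ∷ xs) ys f rewrite ∑ᶻ-swap xs ys f = sym (∑ᶻ-+ ys (f x) (λ y → ∑ᶻ xs (λ x → f x y)))

∑ᶻ-pos : ∀ (xs : List A) (f : A → ℕ) → ∑ᶻ xs (λ x → ⁺ f x) ≡ ⁺ ∑ xs f
∑ᶻ-pos [] f = refl
∑ᶻ-pos (x ∷ xs) f rewrite ∑ᶻ-pos xs f = refl

∑ᶻ-map : ∀ (g : A → A′) (xs : List A) (f : A′ → ℤ) → ∑ᶻ (map g xs) f ≡ ∑ᶻ xs (f ∘ g)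
∑ᶻ-map g [] f = refl
∑ᶻ-map g (x ∷ xs) f = cong (λ t → f (g x) ℤ.+ t) (∑ᶻ-map g xs f)

sq : ℤ → ℕ
sq z = ℤ.∣ z ∣ * ℤ.∣ z ∣

sq-+ : ∀ z → ⁺ sq z ≡ z ℤ.* z
sq-+ (⁺ n) = ℤₚ.pos-* n n
sq-+ (ℤ.-[1+ n ]) = refl

sq-mono : ∀ a {b} → ℤ.∣ a ∣ ≤ b → sq a ≤ b * b
sq-mono a h = *-mono-≤ h h

-- In the induction the mixed term `2 * (α * β)` is bounded by `m * (α * α) + S` through
-- `two-squares`, after multiplication by `m`; for `m = 0` the hypothesis makes `β` vanish.
cauchy-schwarz : ∀ (xs : List A) (f : A → ℤ) → sq (∑ᶻ xs f) ≤ length xs * ∑ xs (sq ∘ f)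
cauchy-schwarz [] f = z≤n
cauchy-schwarz (x ∷ xs) f = ≤-trans (sq-mono (f x ℤ.+ ∑ᶻ xs f) (ℤₚ.∣i+j∣≤∣i∣+∣j∣ (f x) (∑ᶻ xs f))) (step (length xs) (cauchy-schwarz xs f))
  where
  open ≤-Reasoning
  α = ℤ.∣ f x ∣
  β = ℤ.∣ ∑ᶻ xs f ∣
  S = ∑ xs (sq ∘ f)
  mixed-term : ∀ m → β * β ≤ m * S → 2 * (α * β) ≤ m * (α * α) + S
  mixed-term zero h = ≤-trans (≤-reflexive (cong (λ z → 2 * (α * z)) (square-zero β h))) (≤-trans (≤-reflexive (cong (2 *_) (*-zeroʳ α))) z≤n)
    where square-zero : ∀ b → b * b ≤ 0 → b ≡ 0
          square-zero zero _ = refl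
  mixed-term m@(suc _) h = *-cancelˡ-≤ m (begin
    m * (2 * (α * β)) ≡⟨ lem₁ m α β ⟩
    2 * (m * α * β) ≤⟨ two-squares (m * α) β ⟩
    m * α * (m * α) + β * β ≤⟨ +-monoʳ-≤ (m * α * (m * α)) h ⟩
    m * α * (m * α) + m * S ≡⟨ lem₂ m α S ⟩
    m * (m * (α * α) + S) ∎)
    where
    lem₁ : ∀ m a b → m * (2 * (a * b)) ≡ 2 * (m * a * b)
    lem₁ = solve-∀
    lem₂ : ∀ m a S → m * a * (m * a) + m * S ≡ m * (m * (a * a) + S)
    lem₂ = solve-∀
  step : ∀ m → β * β ≤ m * S → (α + β) * (α + β) ≤ suc m * (α * α + S)
  step m h = begin
    (α + β) * (α + β) ≡⟨ lem₁ α β ⟩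
    α * α + 2 * (α * β) + β * β ≤⟨ +-mono-≤ (+-monoʳ-≤ (α * α) (mixed-term m h)) h ⟩
    α * α + (m * (α * α) + S) + m * S ≡⟨ lem₂ α m S ⟩
    suc m * (α * α + S) ∎
    where
    lem₁ : ∀ a b → (a + b) * (a + b) ≡ a * a + 2 * (a * b) + b * b
    lem₁ = solve-∀
    lem₂ : ∀ a m S → a * a + (m * (a * a) + S) + m * S ≡ (1 + m) * (a * a + S)
    lem₂ = solve-∀

dot : List ℤ → List ℤ → ℤ
dot (a ∷ as) (b ∷ bs) = a ℤ.* b ℤ.+ dot as bs
dot _ _ = 0ℤ

dot-comm : ∀ as bs → dot as bs ≡ dot bs as
dot-comm [] [] = refl
dot-comm [] (b ∷ bs) = refl
dot-comm (a ∷ as) [] = refl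
dot-comm (a ∷ as) (b ∷ bs) = cong₂ ℤ._+_ (ℤₚ.*-comm a b) (dot-comm as bs)

norm : List ℤ → ℕ
norm as = ∑ as sq

∑ᶻ-nth : ∀ m as bs → length as ≤ m → ∑ᶻ (upTo m) (λ i → nth 0ℤ as i ℤ.* nth 0ℤ bs i) ≡ dot as bs
∑ᶻ-nth m [] bs h = trans (∑ᶻ-cong (upTo m) λ i → ℤₚ.*-zeroˡ (nth 0ℤ bs i)) (∑ᶻ-0 (upTo m))
∑ᶻ-nth m (a ∷ as) [] h = trans (∑ᶻ-cong (upTo m) λ i → ℤₚ.*-zeroʳ (nth 0ℤ (a ∷ as) i)) (∑ᶻ-0 (upTo m))
∑ᶻ-nth (suc m) (a ∷ as) (b ∷ bs) (s≤s h) = cong (λ t → a ℤ.* b ℤ.+ t)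
  (trans (cong (λ l → ∑ᶻ l (λ i → nth 0ℤ (a ∷ as) i ℤ.* nth 0ℤ (b ∷ bs) i)) (sym (Data.List.Properties.map-upTo suc m)))
    (trans (∑ᶻ-map suc (upTo m) _) (∑ᶻ-nth m as bs h)))

module Signs (cs : List Role) (cs-unique : Unique cs) where

  c : ℕ
  c = length cs

  -- The indicator of `p`, centred and scaled to integers: it sums to 0 over all roles, so rectangle
  -- sums of signs measure the deviation of the colour `p` from density `1 / c`.
  sign : Role → Role → ℤ
  sign p q = ⁺ (c * 𝟙 (p ≡ʳ q)) ℤ.- 1ℤ

  signs : Role → List Role → List ℤ
  signs p w = map (sign p) w

  private
    ∑-equal : ∀ {p qs} → Unique qs → p ∈ qs → ∑ qs (λ q → 𝟙 (p ≡ʳ q)) ≡ 1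
    ∑-equal {p} {q ∷ qs} (h ∷ hs) (here refl) = cong₂ _+_ (cong 𝟙 (≡ʳ-refl p)) (trans (∑-cong∈ qs (λ q q∈ → cong 𝟙 (differ (p ≡ʳ q) refl (All.lookup h q∈)))) (∑-0 qs))
      where differ : ∀ {q} b → (p ≡ʳ q) ≡ b → p ≢ q → (p ≡ʳ q) ≡ false
            differ true e ne = contradiction (≡ʳ-true e) ne
            differ false e ne = e
    ∑-equal {p} {q ∷ qs} (h ∷ hs) (there p∈) = cong₂ _+_ (cong 𝟙 (differ (p ≡ʳ q) refl)) (∑-equal hs p∈)
      where differ : ∀ b → (p ≡ʳ q) ≡ b → (p ≡ʳ q) ≡ false
            differ true e = contradiction (sym (≡ʳ-true e)) (All.lookup h p∈)
            differ false e = e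

  sign-mean : ∀ {p} → p ∈ cs → ∑ᶻ cs (sign p) ≡ 0ℤ
  sign-mean {p} p∈ = begin
    ∑ᶻ cs (sign p) ≡⟨ ∑ᶻ-+ cs (λ q → ⁺ (c * 𝟙 (p ≡ʳ q))) (λ _ → ℤ.- 1ℤ) ⟩
    ∑ᶻ cs (λ q → ⁺ (c * 𝟙 (p ≡ʳ q))) ℤ.+ ∑ᶻ cs (λ _ → ℤ.- 1ℤ) ≡⟨ cong₂ ℤ._+_ (trans (∑ᶻ-pos cs (λ q → c * 𝟙 (p ≡ʳ q))) (cong ⁺_ (trans (∑-* cs c _) (trans (cong (c *_) (∑-equal cs-unique p∈)) (*-identityʳ c))))) (minus cs) ⟩
    ⁺ c ℤ.+ ℤ.- (⁺ c) ≡⟨ ℤₚ.+-inverseʳ (⁺ c) ⟩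
    0ℤ ∎
    where
    open ≡-Reasoning
    minus : ∀ (qs : List Role) → ∑ᶻ qs (λ _ → ℤ.- 1ℤ) ≡ ℤ.- (⁺ length qs)
    minus [] = refl
    minus (q ∷ qs) = trans (cong (λ t → ℤ.- 1ℤ ℤ.+ t) (minus qs)) (sym (ℤₚ.neg-distrib-+ 1ℤ (⁺ length qs)))

  sign-bound : ∀ p q → 0 < c → ℤ.∣ sign p q ∣ ≤ c
  sign-bound p q c>0 = by (p ≡ʳ q) c c>0
    where
    by : ∀ b c → 0 < c → ℤ.∣ ⁺ (c * 𝟙 b) ℤ.- 1ℤ ∣ ≤ c
    by true (suc c) _ = ≤-trans (≤-reflexive (cong ℤ.∣_∣ (trans (cong (λ t → ⁺ t ℤ.- 1ℤ) (*-identityʳ (suc c))) (ℤₚ.+-comm (⁺ suc c) (ℤ.- 1ℤ))))) (n≤1+n c)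
    by false c h = ≤-trans (≤-reflexive (cong (λ t → ℤ.∣ ⁺ t ℤ.- 1ℤ ∣) (*-zeroʳ c))) h

  norm-signs : ∀ p w → 0 < c → norm (signs p w) ≤ length w * (c * c)
  norm-signs p w c>0 = ≤-trans (≤-reflexive (∑-map (sign p) w sq)) (≤-trans (∑-mono w λ q → sq-mono (sign p q) (sign-bound p q c>0)) (≤-reflexive (∑-const w (c * c))))

  -- signs of independent uniform roles are uncorrelated
  second-moment : ∀ p → p ∈ cs → ∀ m as → ∑ (tuples (replicate m cs)) (λ w → sq (dot as (signs p w))) ≤ c ^ m * (c * c) * norm as
  second-moment p p∈ zero [] = z≤n
  second-moment p p∈ zero (a ∷ as) = z≤n
  second-moment p p∈ (suc m) [] = ≤-trans (≤-reflexive (trans (∑-cong (tuples (replicate (suc m) cs)) λ w → refl) (∑-0 (tuples (replicate (suc m) cs))))) z≤n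
  second-moment p p∈ (suc m) (a ∷ as) = begin
    ∑ (tuples (cs ∷ Bs)) (λ w → sq (dot (a ∷ as) (signs p w))) ≡⟨ ∑-tuples cs Bs _ ⟩
    ∑ cs (λ q → ∑ W (λ w → sq (a ℤ.* sign p q ℤ.+ dot as (signs p w)))) ≡⟨ ℤₚ.+-injective expand ⟩
    ∑ cs (λ q → sq (a ℤ.* sign p q)) * length W + c * ∑ W (λ w → sq (dot as (signs p w)))
      ≤⟨ +-mono-≤ (*-mono-≤ (≤-trans (∑-mono cs (λ q → square-bound q)) (≤-reflexive (∑-const cs (sq a * (c * c))))) (≤-reflexive W-length)) (*-monoʳ-≤ c (second-moment p p∈ m as)) ⟩
    c * (sq a * (c * c)) * c ^ m + c * (c ^ m * (c * c) * norm as) ≡⟨ lem c (sq a) (c ^ m) (norm as) ⟩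
    c ^ suc m * (c * c) * norm (a ∷ as) ∎
    where
    Bs = replicate m cs
    W = tuples Bs
    c>0 : 0 < c
    c>0 = ∈ₚ.∈-length p∈
    W-length : length W ≡ c ^ m
    W-length = trans (vol-^ Bs (length-replicate-box cs m)) (cong (c ^_) (length-replicate m))
    lem : ∀ c s p n → c * (s * (c * c)) * p + c * (p * (c * c) * n) ≡ c * p * (c * c) * (s + n)
    lem = solve-∀
    square-bound : ∀ q → sq (a ℤ.* sign p q) ≤ sq a * (c * c)
    square-bound q = ≤-trans (≤-reflexive (trans (cong (λ t → t * t) (ℤₚ.∣i*j∣≡∣i∣*∣j∣ a (sign p q))) (lem′ ℤ.∣ a ∣ ℤ.∣ sign p q ∣))) (*-monoʳ-≤ (sq a) (sq-mono (sign p q) (sign-bound p q c>0)))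
      where lem′ : ∀ a b → a * b * (a * b) ≡ a * a * (b * b)
            lem′ = solve-∀
    D : List Role → ℤ
    D w = dot as (signs p w)
    expand : ⁺ ∑ cs (λ q → ∑ W (λ w → sq (a ℤ.* sign p q ℤ.+ D w))) ≡ ⁺ (∑ cs (λ q → sq (a ℤ.* sign p q)) * length W + c * ∑ W (λ w → sq (D w)))
    expand = eq
      where
      open ≡-Reasoning
      S = λ q → a ℤ.* sign p q
      square : ∀ s d → (s ℤ.+ d) ℤ.* (s ℤ.+ d) ≡ s ℤ.* s ℤ.+ (⁺ 2 ℤ.* s ℤ.* d ℤ.+ d ℤ.* d)
      square = ℤ-Solver.solve-∀
      constant : ∀ {A : Set} (xs : List A) z → ∑ᶻ xs (λ _ → z) ≡ ⁺ length xs ℤ.* z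
      constant [] z = sym (ℤₚ.*-zeroˡ z)
      constant (x ∷ xs) z = trans (cong (λ t → z ℤ.+ t) (constant xs z)) (lem″ z (⁺ length xs))
        where lem″ : ∀ z l → z ℤ.+ l ℤ.* z ≡ (1ℤ ℤ.+ l) ℤ.* z
              lem″ = ℤ-Solver.solve-∀
      inner : ∀ q → ∑ᶻ W (λ w → (S q ℤ.+ D w) ℤ.* (S q ℤ.+ D w)) ≡ ⁺ length W ℤ.* (S q ℤ.* S q) ℤ.+ (⁺ 2 ℤ.* ∑ᶻ W D ℤ.* S q ℤ.+ ∑ᶻ W (λ w → D w ℤ.* D w))
      inner q = trans (∑ᶻ-cong W λ w → square (S q) (D w)) (trans (∑ᶻ-+ W _ _) (cong₂ ℤ._+_ (constant W (S q ℤ.* S q))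
        (trans (∑ᶻ-+ W _ _) (cong (λ t → t ℤ.+ ∑ᶻ W (λ w → D w ℤ.* D w)) (trans (∑ᶻ-* W (⁺ 2 ℤ.* S q) D) (lem″ (S q) (∑ᶻ W D)))))))
        where lem″ : ∀ s t → ⁺ 2 ℤ.* s ℤ.* t ≡ ⁺ 2 ℤ.* t ℤ.* s
              lem″ = ℤ-Solver.solve-∀
      mean : ∑ᶻ cs S ≡ 0ℤ
      mean = trans (∑ᶻ-* cs a (sign p)) (trans (cong (a ℤ.*_) (sign-mean p∈)) (ℤₚ.*-zeroʳ a))
      eq : ⁺ ∑ cs (λ q → ∑ W (λ w → sq (S q ℤ.+ D w))) ≡ ⁺ (∑ cs (λ q → sq (S q)) * length W + c * ∑ W (λ w → sq (D w)))
      eq = begin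
        ⁺ ∑ cs (λ q → ∑ W (λ w → sq (S q ℤ.+ D w))) ≡⟨ sym (trans (∑ᶻ-cong cs λ q → ∑ᶻ-pos W (λ w → sq (S q ℤ.+ D w))) (∑ᶻ-pos cs _)) ⟩
        ∑ᶻ cs (λ q → ∑ᶻ W (λ w → ⁺ sq (S q ℤ.+ D w))) ≡⟨ ∑ᶻ-cong cs (λ q → trans (∑ᶻ-cong W λ w → sq-+ (S q ℤ.+ D w)) (inner q)) ⟩
        ∑ᶻ cs (λ q → ⁺ length W ℤ.* (S q ℤ.* S q) ℤ.+ (⁺ 2 ℤ.* ∑ᶻ W D ℤ.* S q ℤ.+ ∑ᶻ W (λ w → D w ℤ.* D w)))
          ≡⟨ trans (∑ᶻ-+ cs _ _) (cong₂ ℤ._+_ (∑ᶻ-* cs (⁺ length W) _) (trans (∑ᶻ-+ cs _ _) (cong₂ ℤ._+_ (∑ᶻ-* cs (⁺ 2 ℤ.* ∑ᶻ W D) S) (constant cs _)))) ⟩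
        ⁺ length W ℤ.* ∑ᶻ cs (λ q → S q ℤ.* S q) ℤ.+ (⁺ 2 ℤ.* ∑ᶻ W D ℤ.* ∑ᶻ cs S ℤ.+ ⁺ c ℤ.* ∑ᶻ W (λ w → D w ℤ.* D w))
          ≡⟨ cong₂ (λ s d → ⁺ length W ℤ.* s ℤ.+ (⁺ 2 ℤ.* ∑ᶻ W D ℤ.* ∑ᶻ cs S ℤ.+ ⁺ c ℤ.* d)) (squares cs S) (squares W D) ⟩
        ⁺ length W ℤ.* ⁺ ∑ cs (sq ∘ S) ℤ.+ (⁺ 2 ℤ.* ∑ᶻ W D ℤ.* ∑ᶻ cs S ℤ.+ ⁺ c ℤ.* ⁺ ∑ W (sq ∘ D))
          ≡⟨ cong (λ t → ⁺ length W ℤ.* ⁺ ∑ cs (sq ∘ S) ℤ.+ (t ℤ.+ ⁺ c ℤ.* ⁺ ∑ W (sq ∘ D))) (trans (cong (λ t → ⁺ 2 ℤ.* ∑ᶻ W D ℤ.* t) mean) (ℤₚ.*-zeroʳ (⁺ 2 ℤ.* ∑ᶻ W D))) ⟩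
        ⁺ length W ℤ.* ⁺ ∑ cs (sq ∘ S) ℤ.+ (0ℤ ℤ.+ ⁺ c ℤ.* ⁺ ∑ W (sq ∘ D))
          ≡⟨ cong₂ ℤ._+_ (trans (sym (ℤₚ.pos-* (length W) _)) (cong ⁺_ (*-comm (length W) _))) (trans (ℤₚ.+-identityˡ _) (sym (ℤₚ.pos-* c _))) ⟩
        ⁺ (∑ cs (sq ∘ S) * length W) ℤ.+ ⁺ (c * ∑ W (sq ∘ D)) ≡⟨ sym (ℤₚ.pos-+ (∑ cs (sq ∘ S) * length W) (c * ∑ W (sq ∘ D))) ⟩
        ⁺ (∑ cs (sq ∘ S) * length W + c * ∑ W (sq ∘ D)) ∎
        where
        squares : ∀ {A : Set} (xs : List A) (f : A → ℤ) → ∑ᶻ xs (λ x → f x ℤ.* f x) ≡ ⁺ ∑ xs (sq ∘ f)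
        squares xs f = trans (∑ᶻ-cong xs λ x → sym (sq-+ (f x))) (∑ᶻ-pos xs (sq ∘ f))
    open ≤-Reasoning

  -- For independent random columns the squared inner products are linear in the length, which makes
  -- this sum cubic in the number of columns; the trivial bound is of fourth order. Cubic growth is
  -- the quasirandomness that the discrepancy estimate uses.
  correlation : Role → List (List Role) → ℕ
  correlation p ws = ∑ ws (λ w → ∑ ws (λ w′ → sq (dot (signs p w) (signs p w′))))

  κ₅ : ℕ
  κ₅ = c * (c * (c * (c * c)))

  Columns : ℕ → List (List Role) → Set
  Columns v ws = (∀ {p} → p ∈ cs → correlation p ws ≤ 3 * κ₅ * (v * v * v)) × length ws ≡ v × (∀ i → i < v → length (nth [] ws i) ≡ i) × All (λ w → length w ≤ v) ws

  private
    snoc-lengths : ∀ {v} ws {w : List Role} → length ws ≡ v → length w ≡ v → (∀ i → i < v → length (nth [] ws i) ≡ i) →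
      ∀ i → i < suc v → length (nth [] (ws ++ w ∷ []) i) ≡ i
    snoc-lengths {v} ws {w} len w-length lens i (s≤s h) = by (m≤n⇒m<n∨m≡n h)
      where
      nth-++ : ∀ (ws : List (List Role)) {ys i} → i < length ws → nth [] (ws ++ ys) i ≡ nth [] ws i
      nth-++ (w ∷ ws) {i = zero} _ = refl
      nth-++ (w ∷ ws) {i = suc i} (s≤s h) = nth-++ ws h
      by : i < v ⊎ i ≡ v → length (nth [] (ws ++ w ∷ []) i) ≡ i
      by (inj₁ lt) = trans (cong length (nth-++ ws (subst (i <_) (sym len) lt))) (lens i lt)
      by (inj₂ refl) = trans (cong length (trans (cong (nth [] (ws ++ w ∷ [])) (sym len)) (nth-++-length [] ws))) w-length

  -- The method of conditional expectations, one vertex at a time: the new column has at most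
  -- average `cost`. The cost is summed over all roles, so that one choice serves them all. The old
  -- columns contribute twice and the diagonal once, each at most `κ₅ * (v * v)`, and `3 * v * v` is
  -- less than the increment of the cube. In `κ₅` four factors `c` bound the signs and the fifth
  -- comes from the sum over roles.
  columns : 0 < c → ∀ v → ∃[ ws ] Columns v ws
  columns c>0 zero = [] , (λ _ → z≤n) , refl , (λ i ()) , []
  columns c>0 (suc v) with columns c>0 v
  ... | ws , corr , len , lens , short = ws ++ w ∷ [] , corr′ , trans (length-++ ws) (trans (cong (_+ 1) len) (+-comm v 1)) , snoc-lengths ws len w-length lens , Allₚ.++⁺ (All.map m≤n⇒m≤1+n short) (≤-trans (≤-reflexive w-length) (n≤1+n v) ∷ [])
    where
    open ≤-Reasoning
    W = tuples (replicate v cs)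
    cost : List Role → ℕ
    cost w = ∑ cs (λ p → ∑ ws (λ w′ → sq (dot (signs p w′) (signs p w))))
    W-length : length W ≡ c ^ v
    W-length = trans (vol-^ (replicate v cs) (length-replicate-box cs v)) (cong (c ^_) (length-replicate v))
    total : ∑ W cost ≤ length W * (κ₅ * (v * v))
    total = begin
      ∑ W cost ≡⟨ trans (∑-swap W cs _) (∑-cong cs λ p → ∑-swap W ws _) ⟩
      ∑ cs (λ p → ∑ ws (λ w′ → ∑ W (λ w → sq (dot (signs p w′) (signs p w)))))
        ≤⟨ ∑-mono∈ cs (λ p p∈ → ∑-mono∈ ws λ w′ w′∈ → ≤-trans (second-moment p p∈ v (signs p w′)) (*-monoʳ-≤ (c ^ v * (c * c)) (≤-trans (norm-signs p w′ c>0) (*-monoˡ-≤ (c * c) (All.lookup short w′∈))))) ⟩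
      ∑ cs (λ p → ∑ ws (λ w′ → c ^ v * (c * c) * (v * (c * c)))) ≡⟨ trans (∑-cong cs λ p → ∑-const ws B) (∑-const cs (length ws * B)) ⟩
      c * (length ws * B) ≡⟨ cong (λ l → c * (l * B)) len ⟩
      c * (v * (c ^ v * (c * c) * (v * (c * c)))) ≡⟨ lem c v (c ^ v) ⟩
      c ^ v * (κ₅ * (v * v)) ≡⟨ cong (_* (κ₅ * (v * v))) (sym W-length) ⟩
      length W * (κ₅ * (v * v)) ∎
      where
      B = c ^ v * (c * c) * (v * (c * c))
      lem : ∀ c v p → c * (v * (p * (c * c) * (v * (c * c)))) ≡ p * (c * (c * (c * (c * c))) * (v * v))
      lem = solve-∀
    chosen = ∑-avg-≤ W cost (κ₅ * (v * v)) (≤-trans (m^n>0 c {{ℕ.>-nonZero c>0}} v) (≤-reflexive (sym W-length))) total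
    w = proj₁ chosen
    w-length : length w ≡ v
    w-length = trans (length-∈-tuples (replicate v cs) (proj₁ (proj₂ chosen))) (length-replicate v)
    corr′ : ∀ {p} → p ∈ cs → correlation p (ws ++ w ∷ []) ≤ 3 * κ₅ * (suc v * suc v * suc v)
    corr′ {p} p∈ = begin
      correlation p (ws ++ w ∷ []) ≡⟨ trans (∑-++ ws (w ∷ []) _) (cong₂ _+_ (trans (∑-cong ws λ w₁ → trans (∑-++ ws (w ∷ []) _) (cong (∑ ws (f w₁) +_) (+-identityʳ _))) (∑-+ ws _ _)) (trans (+-identityʳ _) (trans (∑-++ ws (w ∷ []) _) (cong (∑ ws (f w) +_) (+-identityʳ _))))) ⟩
      correlation p ws + ∑ ws (λ w₁ → f w₁ w) + (∑ ws (f w) + f w w)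
        ≡⟨ cong (λ t → correlation p ws + ∑ ws (λ w₁ → f w₁ w) + (t + f w w)) (∑-cong ws λ w₁ → cong sq (dot-comm (signs p w) (signs p w₁))) ⟩
      correlation p ws + X + (X + f w w) ≤⟨ +-mono-≤ (+-mono-≤ (corr p∈) X≤) (+-mono-≤ X≤ diagonal) ⟩
      3 * κ₅ * (v * v * v) + κ₅ * (v * v) + (κ₅ * (v * v) + κ₅ * (v * v)) ≤⟨ m≤m+n _ (3 * κ₅ * (2 * (v * v) + 3 * v + 1)) ⟩
      3 * κ₅ * (v * v * v) + κ₅ * (v * v) + (κ₅ * (v * v) + κ₅ * (v * v)) + 3 * κ₅ * (2 * (v * v) + 3 * v + 1) ≡⟨ lem κ₅ v ⟩
      3 * κ₅ * (suc v * suc v * suc v) ∎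
      where
      f : List Role → List Role → ℕ
      f w₁ w₂ = sq (dot (signs p w₁) (signs p w₂))
      X = ∑ ws (λ w₁ → f w₁ w)
      X≤ : X ≤ κ₅ * (v * v)
      X≤ = ≤-trans (∑-∈ (λ p → ∑ ws (λ w′ → sq (dot (signs p w′) (signs p w)))) p∈) (proj₂ (proj₂ chosen))
      lem : ∀ κ v → 3 * κ * (v * v * v) + κ * (v * v) + (κ * (v * v) + κ * (v * v)) + 3 * κ * (2 * (v * v) + 3 * v + 1) ≡ 3 * κ * ((1 + v) * (1 + v) * (1 + v))
      lem = solve-∀
      dot-self : ∀ as → dot as as ≡ ⁺ norm as
      dot-self [] = refl
      dot-self (a ∷ as) = cong₂ ℤ._+_ (sym (sq-+ a)) (dot-self as)
      diagonal : f w w ≤ κ₅ * (v * v)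
      diagonal = begin
        f w w ≡⟨ cong sq (dot-self (signs p w)) ⟩
        norm (signs p w) * norm (signs p w) ≤⟨ *-mono-≤ small small ⟩
        v * (c * c) * (v * (c * c)) ≤⟨ m≤m*n _ c {{ℕ.>-nonZero c>0}} ⟩
        v * (c * c) * (v * (c * c)) * c ≡⟨ lem′ c v ⟩
        κ₅ * (v * v) ∎
        where
        small : norm (signs p w) ≤ v * (c * c)
        small = ≤-trans (norm-signs p w c>0) (≤-reflexive (cong (_* (c * c)) w-length))
        lem′ : ∀ c v → v * (c * c) * (v * (c * c)) * c ≡ c * (c * (c * (c * c))) * (v * v)
        lem′ = solve-∀

-- The lower bound

∑-upTo-nth : ∀ {A : Set} (d : A) ws (f : A → ℕ) → ∑ (upTo (length ws)) (λ i → f (nth d ws i)) ≡ ∑ ws f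
∑-upTo-nth d [] f = refl
∑-upTo-nth d (w ∷ ws) f = cong (λ t → f w + t) (trans (cong (λ l → ∑ l (λ i → f (nth d (w ∷ ws) i))) (sym (Data.List.Properties.map-upTo suc (length ws))))
  (trans (∑-map suc (upTo (length ws)) _) (∑-upTo-nth d ws f)))

map-toℕ-allFin : ∀ n → map toℕ (allFin n) ≡ upTo n
map-toℕ-allFin zero = refl
map-toℕ-allFin (suc n) = cong (0 ∷_) (trans (cong (map toℕ) (sym (map-tabulate id fsuc))) (trans (sym (map-∘ (allFin n)))
  (trans (map-∘ (allFin n)) (trans (cong (map suc) (map-toℕ-allFin n)) (Data.List.Properties.map-upTo suc n)))))

restrict-tuples : ∀ {A : Set} k w (L : List A) (G : List A → ℕ) → (∀ x → w ∈ x → G x ≡ 0) →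
  ∑ (tuples (replicate k (w ∷ L))) G ≡ ∑ (tuples (replicate k L)) G
restrict-tuples zero w L G h = refl
restrict-tuples (suc k) w L G h = trans (∑-tuples (w ∷ L) (replicate k (w ∷ L)) G) (trans (cong₂ _+_
    (trans (∑-cong (tuples (replicate k (w ∷ L))) λ x → h (w ∷ x) (here refl)) (∑-0 (tuples (replicate k (w ∷ L)))))
    (∑-cong L λ v → restrict-tuples k w L (G ∘ (v ∷_)) λ x w∈ → h (v ∷ x) (there w∈)))
  (sym (∑-tuples L (replicate k L) G)))

-- Sets become tuples of a box by listing them increasingly. This moves the count of edges in a
-- vertex set to a power of that set, where telescoping applies.
sorted-tuples : ∀ {A : Set} (ψ : A → ℕ) k (L : List A) → AllPairs (λ a b → ψ a < ψ b) L → ∀ (g : List A → ℕ) →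
  ∑ (combos k L) g ≡ ∑ (tuples (replicate k L)) (λ x → 𝟙 (isIncreasing (map ψ x)) * g x)
sorted-tuples ψ zero L h g = cong (_+ 0) (sym (+-identityʳ (g [])))
sorted-tuples {A} ψ (suc k) [] [] g = refl
sorted-tuples {A} ψ (suc k) (w ∷ L) (a ∷ h) g = sym (begin
  ∑ (tuples (replicate (suc k) (w ∷ L))) F ≡⟨ ∑-tuples (w ∷ L) (replicate k (w ∷ L)) F ⟩
  ∑ (w ∷ L) (λ v → ∑ (tuples (replicate k (w ∷ L))) (λ x → F (v ∷ x))) ≡⟨ ∑-cong∈ (w ∷ L) (λ v v∈ → restrict-tuples k w L (λ x → F (v ∷ x)) (avoid v (above v∈))) ⟩
  ∑ (tuples (replicate k L)) (λ x → F (w ∷ x)) + ∑ L (λ v → ∑ (tuples (replicate k L)) (λ x → F (v ∷ x)))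
    ≡⟨ cong₂ _+_ (trans (∑-cong∈ (tuples (replicate k L)) head) (sym (sorted-tuples ψ k L h (g ∘ (w ∷_)))))
         (trans (sym (∑-tuples L (replicate k L) F)) (sym (sorted-tuples ψ (suc k) L h g))) ⟩
  ∑ (combos k L) (g ∘ (w ∷_)) + ∑ (combos (suc k) L) g ≡⟨ sym (∑-combos-∷ k w L g) ⟩
  ∑ (combos (suc k) (w ∷ L)) g ∎)
  where
  open ≡-Reasoning
  F : List A → ℕ
  F x = 𝟙 (isIncreasing (map ψ x)) * g x
  above : ∀ {v} → v ∈ w ∷ L → ψ w ≤ ψ v
  above (here refl) = ≤-refl
  above (there v∈) = <⇒≤ (All.lookup a v∈)
  avoid : ∀ v → ψ w ≤ ψ v → ∀ x → w ∈ x → F (v ∷ x) ≡ 0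
  avoid v le x w∈ = by (isIncreasing (map ψ (v ∷ x))) refl
    where by : ∀ b → isIncreasing (map ψ (v ∷ x)) ≡ b → 𝟙 b * g (v ∷ x) ≡ 0
          by false _ = refl
          by true e = contradiction (<ᵇ-true⁻¹ (all-∈ {xs = map ψ x} (∧-trueˡ e) (∈ₚ.∈-map⁺ ψ w∈))) (≤⇒≯ le)
  head : ∀ x → x ∈ tuples (replicate k L) → F (w ∷ x) ≡ 𝟙 (isIncreasing (map ψ x)) * g (w ∷ x)
  head x x∈ = cong (λ b → 𝟙 (b ∧ isIncreasing (map ψ x)) * g (w ∷ x)) (∈-all (map ψ x) λ i∈ →
    let v , v∈ , e = ∈ₚ.∈-map⁻ ψ i∈ in <ᵇ-true (subst (ψ w <_) (sym e) (All.lookup a (members k (∈-tuples (replicate k L) x∈) v∈))))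
    where members : ∀ k {x} → Pointwise _∈_ x (replicate k L) → ∀ {v} → v ∈ x → v ∈ L
          members (suc k) (p ∷ q) (here refl) = p
          members (suc k) (p ∷ q) (there v∈) = members k q v∈

vol≤ : ∀ {A : Set} {s} (Cs : List (List A)) → All (λ C → length C ≤ s) Cs → ⟪ Cs ⟫ ≤ s ^ length Cs
vol≤ [] [] = ≤-refl
vol≤ (C ∷ Cs) (h ∷ hs) = ≤-trans (≤-reflexive (vol-∷ C Cs)) (*-mono-≤ h (vol≤ Cs hs))

marginal₁ : ∀ {A : Set} (d : A) s m (Cs : List (List A)) → All (λ C → length C ≤ s) Cs → length Cs ≡ suc m → ∀ i → i < length Cs →
  ∃[ P ] (P ≤ s ^ m × ∀ (g : A → ℕ) → ∑ (tuples Cs) (λ z → g (nth d z i)) ≡ P * ∑ (nth [] Cs i) g)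
marginal₁ d s m (C ∷ Cs) (h ∷ hs) refl zero _ = ⟪ Cs ⟫ , vol≤ Cs hs , λ g →
  trans (∑-tuples C Cs _) (trans (∑-cong C λ v → ∑-const (tuples Cs) (g v)) (∑-* C ⟪ Cs ⟫ g))
marginal₁ d s m (C ∷ Cs@(_ ∷ Cs′)) (h ∷ hs) refl (suc i) (s≤s i<) with marginal₁ d s (length Cs′) Cs hs refl i i<
... | P , P≤ , eq = length C * P , *-mono-≤ h P≤ , λ g →
  trans (∑-tuples C Cs _) (trans (∑-const C _) (trans (cong (length C *_) (eq g)) (sym (*-assoc (length C) P _))))

-- Sub-boxes have sides of different lengths, so the weight `P` of the remaining coordinates is only
-- known to be at most `s ^ m`. The same `P` serves every `g`, which lets two counts be compared.
marginal₂ : ∀ {A : Set} (d : A) s m (Cs : List (List A)) → All (λ C → length C ≤ s) Cs → length Cs ≡ 2 + m → ∀ i j → i < j → j < length Cs →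
  ∃[ P ] (P ≤ s ^ m × ∀ (g : A → A → ℕ) → ∑ (tuples Cs) (λ z → g (nth d z i) (nth d z j)) ≡ P * ∑ (nth [] Cs i) (λ u → ∑ (nth [] Cs j) (g u)))
marginal₂ d s m (C ∷ Cs) (h ∷ hs) e zero (suc j) _ (s≤s j<) with marginal₁ d s m Cs hs (suc-injective e) j j<
... | P , P≤ , eq = P , P≤ , λ g → trans (∑-tuples C Cs _) (trans (∑-cong C λ v → eq (g v)) (∑-* C P _))
marginal₂ d s zero (C ∷ (_ ∷ [])) (h ∷ hs) e (suc i) (suc (suc j)) (s≤s i<j) (s≤s (s≤s ()))
marginal₂ d s zero (C ∷ (_ ∷ [])) (h ∷ hs) e (suc i) (suc zero) (s≤s ()) _
marginal₂ d s (suc m) (C ∷ Cs) (h ∷ hs) e (suc i) (suc j) (s≤s i<j) (s≤s j<) with marginal₂ d s m Cs hs (suc-injective e) i j i<j j<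
... | P , P≤ , eq = length C * P , *-mono-≤ h P≤ , λ g →
  trans (∑-tuples C Cs _) (trans (∑-const C _) (trans (cong (length C *_) (eq g)) (sym (*-assoc (length C) P _))))

module LowerGraph (k : ℕ) (n′ : ℕ) (v₀ : Fin n′) where

  private
    r = 2 + k
    rs = roles r
    V = Fin n′

  open Signs rs (roles-unique r)

  c>0 : 0 < c
  c>0 = ∈ₚ.∈-length (roles-∈ {r} 0 0 (s≤s (s≤s z≤n)))

  private abstract
    chosen : ∃[ ws ] Columns n′ ws
    chosen = columns c>0 n′

  private
    ws = proj₁ chosen
    ws-correlation = proj₁ (proj₂ chosen)
    ws-length = proj₁ (proj₂ (proj₂ chosen))
    word-length = proj₁ (proj₂ (proj₂ (proj₂ chosen)))

  word : ℕ → List Role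
  word v = nth [] ws v

  colour : ℕ → ℕ → Role
  colour u v = nth (0 , 0) (word v) u

  hits : Role → ℕ → ℕ → Bool
  hits p u v = (u ℕ.<ᵇ v) ∧ (p ≡ʳ colour u v)

  private
    entry : Role → ℕ → ℕ → ℤ
    entry p u v = nth 0ℤ (signs p (word v)) u

    nth-signs : ∀ p w u → u < length w → nth 0ℤ (signs p w) u ≡ sign p (nth (0 , 0) w u)
    nth-signs p (q ∷ w) zero _ = refl
    nth-signs p (q ∷ w) (suc u) (s≤s h) = nth-signs p w u h

    nth-beyond : ∀ {A : Set} (d : A) w u → length w ≤ u → nth d w u ≡ d
    nth-beyond d [] u _ = refl
    nth-beyond d (x ∷ w) (suc u) (s≤s h) = nth-beyond d w u h

    entry-hits : ∀ p u v → v < n′ → entry p u v ≡ ⁺ (c * 𝟙 (hits p u v)) ℤ.- ⁺ 𝟙 (u ℕ.<ᵇ v)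
    entry-hits p u v v< = by (u ℕ.<ᵇ v) refl
      where
      by : ∀ b → (u ℕ.<ᵇ v) ≡ b → entry p u v ≡ ⁺ (c * 𝟙 (b ∧ (p ≡ʳ colour u v))) ℤ.- ⁺ 𝟙 b
      by true e = nth-signs p (word v) u (subst (u <_) (sym (word-length v v<)) (<ᵇ-true⁻¹ e))
      by false e = trans (nth-beyond 0ℤ (signs p (word v)) u (≤-trans (≤-reflexive (trans (length-map (sign p) (word v)) (word-length v v<))) (≮⇒≥ λ q → true≢false (<ᵇ-true q) e)))
        (cong (λ t → ⁺ t ℤ.- 0ℤ) (sym (*-zeroʳ c)))

    sublist-≤ : ∀ {A : List ℕ} → A ⊆ upTo n′ → length A ≤ n′
    sublist-≤ s = ≤-trans (⊆-length s) (≤-reflexive (length-upTo n′))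

    -- Cauchy-Schwarz is applied over the rows and then, after the square is expanded, over the
    -- pairs of columns; extending the sums to all vertices leaves the correlation. The fourth power
    -- of `D` is thus of order `n′ ^ 7`, so `D` is small against the square of `n′`.
    discrepancy : ∀ {p} → p ∈ rs → ∀ A B → A ⊆ upTo n′ → B ⊆ upTo n′ →
      let D = ∑ᶻ A (λ u → ∑ᶻ B (entry p u)) in sq D * sq D ≤ n′ * n′ * (n′ * n′ * (3 * κ₅ * (n′ * n′ * n′)))
    discrepancy {p} p∈ A B A⊆ B⊆ = begin
      sq D * sq D ≤⟨ *-mono-≤ D≤ D≤ ⟩
      n′ * Y * (n′ * Y) ≡⟨ lem n′ Y ⟩
      n′ * n′ * (Y * Y) ≤⟨ *-monoʳ-≤ (n′ * n′) Y≤ ⟩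
      n′ * n′ * (n′ * n′ * (3 * κ₅ * (n′ * n′ * n′))) ∎
      where
      open ≤-Reasoning
      D = ∑ᶻ A (λ u → ∑ᶻ B (entry p u))
      Y = ∑ (upTo n′) (λ u → sq (∑ᶻ B (entry p u)))
      lem : ∀ n y → n * y * (n * y) ≡ n * n * (y * y)
      lem = solve-∀
      D≤ : sq D ≤ n′ * Y
      D≤ = ≤-trans (cauchy-schwarz A (λ u → ∑ᶻ B (entry p u))) (*-mono-≤ (sublist-≤ A⊆) (∑-⊆ (λ u → sq (∑ᶻ B (entry p u))) A⊆))
      C : ℕ → ℕ → ℤ
      C v v′ = dot (signs p (word v)) (signs p (word v′))
      Z = ∑ᶻ B (λ v → ∑ᶻ B (C v))
      ∑ᶻ-*ʳ : ∀ {X : Set} (xs : List X) z (f : X → ℤ) → ∑ᶻ xs (λ x → f x ℤ.* z) ≡ ∑ᶻ xs f ℤ.* z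
      ∑ᶻ-*ʳ xs z f = trans (∑ᶻ-cong xs λ x → ℤₚ.*-comm (f x) z) (trans (∑ᶻ-* xs z f) (ℤₚ.*-comm z _))
      word-short : ∀ {v} → v ∈ B → length (signs p (word v)) ≤ n′
      word-short {v} v∈ = let v< = ∈ₚ.∈-upTo⁻ (Sub.lookup B⊆ v∈) in
        ≤-trans (≤-reflexive (trans (length-map (sign p) (word v)) (word-length v v<))) (<⇒≤ v<)
      ∑ᶻ-cong∈ : ∀ (xs : List ℕ) {f g : ℕ → ℤ} → (∀ x → x ∈ xs → f x ≡ g x) → ∑ᶻ xs f ≡ ∑ᶻ xs g
      ∑ᶻ-cong∈ [] h = refl
      ∑ᶻ-cong∈ (x ∷ xs) h = cong₂ ℤ._+_ (h x (here refl)) (∑ᶻ-cong∈ xs λ y y∈ → h y (there y∈))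
      Y≡Z : ⁺ Y ≡ Z
      Y≡Z = trans (sym (∑ᶻ-pos (upTo n′) _)) (trans (∑ᶻ-cong (upTo n′) λ u → trans (sq-+ (∑ᶻ B (entry p u)))
        (trans (sym (∑ᶻ-*ʳ B (∑ᶻ B (entry p u)) (entry p u))) (∑ᶻ-cong B λ v → sym (∑ᶻ-* B (entry p u v) (entry p u)))))
        (trans (∑ᶻ-swap (upTo n′) B _) (∑ᶻ-cong∈ B λ v v∈ → trans (∑ᶻ-swap (upTo n′) B _) (∑ᶻ-cong B λ v′ → ∑ᶻ-nth n′ (signs p (word v)) (signs p (word v′)) (word-short v∈)))))
      Y≤ : Y * Y ≤ n′ * n′ * (3 * κ₅ * (n′ * n′ * n′))
      Y≤ = begin
        Y * Y ≡⟨ cong sq Y≡Z ⟩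
        sq Z ≤⟨ cauchy-schwarz B (λ v → ∑ᶻ B (C v)) ⟩
        length B * ∑ B (λ v → sq (∑ᶻ B (C v))) ≤⟨ *-mono-≤ (sublist-≤ B⊆) (∑-mono B λ v → ≤-trans (cauchy-schwarz B (C v)) (*-mono-≤ (sublist-≤ B⊆) (∑-⊆ (sq ∘ C v) B⊆))) ⟩
        n′ * ∑ B (λ v → n′ * ∑ (upTo n′) (sq ∘ C v)) ≡⟨ trans (cong (n′ *_) (∑-* B n′ _)) (sym (*-assoc n′ n′ _)) ⟩
        n′ * n′ * ∑ B (λ v → ∑ (upTo n′) (sq ∘ C v)) ≤⟨ *-monoʳ-≤ (n′ * n′) (∑-⊆ (λ v → ∑ (upTo n′) (sq ∘ C v)) B⊆) ⟩
        n′ * n′ * ∑ (upTo n′) (λ v → ∑ (upTo n′) (sq ∘ C v)) ≡⟨ cong (n′ * n′ *_) all-words ⟩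
        n′ * n′ * correlation p ws ≤⟨ *-monoʳ-≤ (n′ * n′) (ws-correlation p∈) ⟩
        n′ * n′ * (3 * κ₅ * (n′ * n′ * n′)) ∎
        where
        all-words : ∑ (upTo n′) (λ v → ∑ (upTo n′) (sq ∘ C v)) ≡ correlation p ws
        all-words = trans (cong (λ m → ∑ (upTo m) (λ v → ∑ (upTo m) (sq ∘ C v))) (sym ws-length))
          (trans (∑-cong (upTo (length ws)) λ v → ∑-upTo-nth [] ws (λ w′ → sq (dot (signs p (word v)) (signs p w′))))
            (∑-upTo-nth [] ws (λ w → ∑ ws (λ w′ → sq (dot (signs p w) (signs p w′))))))

  -- An entry is `c` times the indicator of the colour minus that of `u < v`, and 0 for `u ≥ v`. A
  -- shortage of more than `E` would make the modulus of the rectangle sum exceed `E`, against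
  -- `discrepancy`.
  balanced : ∀ E → n′ * n′ * (n′ * n′ * (3 * κ₅ * (n′ * n′ * n′))) ≤ E * E * (E * E) → ∀ {p} → p ∈ rs → ∀ A B → A ⊆ upTo n′ → B ⊆ upTo n′ →
    ∑ A (λ u → ∑ B (λ v → 𝟙 (u ℕ.<ᵇ v))) ≤ c * ∑ A (λ u → ∑ B (λ v → 𝟙 (hits p u v))) + E
  balanced E large {p} p∈ A B A⊆ B⊆ = ≮⇒≥ λ lt → impossible (m≤n⇒∃[o]m+o≡n lt)
    where
    o = ∑ A (λ u → ∑ B (λ v → 𝟙 (u ℕ.<ᵇ v)))
    e = ∑ A (λ u → ∑ B (λ v → 𝟙 (hits p u v)))
    D = ∑ᶻ A (λ u → ∑ᶻ B (entry p u))
    difference : ∀ (xs : List ℕ) (f g : ℕ → ℕ) → ∑ᶻ xs (λ x → ⁺ f x ℤ.- ⁺ g x) ≡ ⁺ ∑ xs f ℤ.- ⁺ ∑ xs g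
    difference [] f g = refl
    difference (x ∷ xs) f g = trans (cong (λ t → ⁺ f x ℤ.- ⁺ g x ℤ.+ t) (difference xs f g))
      (trans (lem (⁺ f x) (⁺ g x) (⁺ ∑ xs f) (⁺ ∑ xs g)) (cong₂ ℤ._-_ (sym (ℤₚ.pos-+ (f x) (∑ xs f))) (sym (ℤₚ.pos-+ (g x) (∑ xs g)))))
      where lem : ∀ a b c d → a ℤ.- b ℤ.+ (c ℤ.- d) ≡ a ℤ.+ c ℤ.- (b ℤ.+ d)
            lem = ℤ-Solver.solve-∀
    cong∈ : ∀ (xs : List ℕ) {f g : ℕ → ℤ} → (∀ x → x ∈ xs → f x ≡ g x) → ∑ᶻ xs f ≡ ∑ᶻ xs g
    cong∈ [] h = refl
    cong∈ (x ∷ xs) h = cong₂ ℤ._+_ (h x (here refl)) (cong∈ xs λ y y∈ → h y (there y∈))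
    D≡ : D ≡ ⁺ (c * e) ℤ.- ⁺ o
    D≡ = trans (∑ᶻ-cong A λ u → trans (cong∈ B λ v v∈ → entry-hits p u v (∈ₚ.∈-upTo⁻ (Sub.lookup B⊆ v∈))) (difference B (λ v → c * 𝟙 (hits p u v)) (λ v → 𝟙 (u ℕ.<ᵇ v))))
      (trans (difference A (λ u → ∑ B (λ v → c * 𝟙 (hits p u v))) (λ u → ∑ B (λ v → 𝟙 (u ℕ.<ᵇ v))))
        (cong (λ t → ⁺ t ℤ.- ⁺ o) (trans (∑-cong A λ u → ∑-* B c _) (∑-* A c _))))
    impossible : ∃[ d ] (suc (c * e + E) + d ≡ o) → ⊥
    impossible (d , eq) = <⇒≱ (*-mono-< bigger bigger) (≤-trans (discrepancy p∈ A B A⊆ B⊆) large)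
      where
      x = suc (E + d)
      ∣D∣ : ℤ.∣ D ∣ ≡ x
      ∣D∣ = trans (cong ℤ.∣_∣ (trans D≡ (trans (cong (λ t → ⁺ (c * e) ℤ.- ⁺ t) (trans (sym eq) (lem (c * e) E d)))
          (trans (cong (λ t → ⁺ (c * e) ℤ.- t) (ℤₚ.pos-+ (c * e) x)) (lem′ (⁺ (c * e)) (⁺ x)))))) (ℤₚ.∣-i∣≡∣i∣ (⁺ x))
        where
        lem : ∀ a E d → suc (a + E) + d ≡ a + suc (E + d)
        lem = solve-∀
        lem′ : ∀ a b → a ℤ.- (a ℤ.+ b) ≡ ℤ.- b
        lem′ = ℤ-Solver.solve-∀
      bigger : E * E < sq D
      bigger = subst (λ t → E * E < t * t) (sym ∣D∣) (*-mono-< E<x E<x)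
        where E<x : E < x
              E<x = s≤s (m≤m+n E d)

  matches : List V → Bool
  matches l = all rs (λ p → p ≡ʳ colour (toℕ (nth v₀ l (proj₁ p))) (toℕ (nth v₀ l (proj₁ p + suc (proj₂ p)))))

  graph : Hypergraph r
  graph = record { n = n′ ; edge = λ s → (length (elems s) == r) ∧ matches (elems s)
    ; uniform = λ s h → trans (sym (length-elems s)) (==-true (∧-trueˡ h)) }

  private
    allFin-sorted : AllPairs (λ a b → toℕ a < toℕ b) (allFin n′)
    allFin-sorted = AllPairsₚ.map⁻ (subst Increasing (sym (map-toℕ-allFin n′)) (AllPairsₚ.applyUpTo⁺₁ id n′ λ i<j _ → i<j))

    increasing-from-nth : ∀ (is : List ℕ) → (∀ i j → i < j → j < length is → nth 0 is i < nth 0 is j) → Increasing is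
    increasing-from-nth [] h = []
    increasing-from-nth (i ∷ is) h = All.tabulate (λ {j} j∈ → let m , m< , e = position j∈ in subst (i <_) e (h 0 (suc m) (s≤s z≤n) (s≤s m<)))
        ∷ increasing-from-nth is (λ a b a<b b< → h (suc a) (suc b) (s≤s a<b) (s≤s b<))
      where
      position : ∀ {j is} → j ∈ is → ∃[ m ] (m < length is × nth 0 is m ≡ j)
      position (here refl) = 0 , s≤s z≤n , refl
      position (there j∈) = let m , m< , e = position j∈ in suc m , s≤s m< , e

    nth-toℕ : ∀ (z : List V) i → i < length z → nth 0 (map toℕ z) i ≡ toℕ (nth v₀ z i)
    nth-toℕ (v ∷ z) zero _ = refl
    nth-toℕ (v ∷ z) (suc i) (s≤s h) = nth-toℕ z i h

  module Count (S : Subset n′) (E : ℕ) (large : n′ * n′ * (n′ * n′ * (3 * κ₅ * (n′ * n′ * n′))) ≤ E * E * (E * E)) (S>0 : 0 < ∣ S ∣) where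

    private
      L = elems S
      s = ∣ S ∣
      Bs = replicate r L
      E′ = s ^ k * E

    open Telescoping {V} v₀ r

    private
      L-sorted : AllPairs (λ a b → toℕ a < toℕ b) L
      L-sorted = AllPairs-⊆ (elems-⊆ S) allFin-sorted

      Bs-sides : All (λ B → length B ≡ s) Bs
      Bs-sides = All.map (λ e → trans e (length-elems S)) (length-replicate-box L r)

      Bs-pos : 0 < ⟪ Bs ⟫
      Bs-pos = ≤-trans (m^n>0 s {{ℕ.>-nonZero S>0}} (length Bs)) (≤-reflexive (sym (vol-^ Bs Bs-sides)))

      Bs-length : length Bs ≡ r
      Bs-length = length-replicate r

      -- The order is treated as a condition on pairs, too. Telescoping replaces `lt p` by `hit p`
      -- role by role, so the restriction to increasing tuples, which is not a box, requires no
      -- separate count.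
      lt : Role → List V → Bool
      lt (x , y) z = toℕ (nth v₀ z x) ℕ.<ᵇ toℕ (nth v₀ z (x + suc y))

      hit : Role → List V → Bool
      hit p@(x , y) z = hits p (toℕ (nth v₀ z x)) (toℕ (nth v₀ z (x + suc y)))

      coordinates : Role → ℕ → Bool
      coordinates (x , y) = mask (x ∷ (x + suc y) ∷ [])

      Cs-facts : ∀ {Cs n} → Cs ≼ replicate n L → All (λ C → length C ≤ s) Cs
      Cs-facts {n = zero} [] = []
      Cs-facts {n = suc n} (h ∷ hs) = ≤-trans (⊆-length h) (≤-reflexive (length-elems S)) ∷ Cs-facts {n = n} hs

      side-⊆ : ∀ n {Cs} → Cs ≼ replicate n L → ∀ i → i < n → nth [] Cs i ⊆ L
      side-⊆ (suc n) (h ∷ hs) zero _ = h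
      side-⊆ (suc n) (h ∷ hs) (suc i) (s≤s q) = side-⊆ n hs i q

      to-upTo : ∀ {C} → C ⊆ L → map toℕ C ⊆ upTo n′
      to-upTo {C} h = subst (map toℕ C ⊆_) (map-toℕ-allFin n′) (Subₚ.map⁺ toℕ (⊆-trans h (elems-⊆ S)))

      -- Only two coordinates matter, so the count factors through `marginal₂`. The remaining `k`
      -- coordinates multiply the error `E` by at most `s ^ k`.
      dominated : ∀ {p} → p ∈ rs → ∀ Cs → Cs ≼ Bs → 1 * count (lt p) Cs ≤ c * count (hit p) Cs + E′
      dominated {p@(x , y)} p∈ Cs Cs≼ with marginal₂ v₀ s k Cs (Cs-facts {n = r} Cs≼) (trans (Pw.Pointwise-length Cs≼) Bs-length) x (x + suc y) (m<m+n x (s≤s z≤n))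
                (subst (x + suc y <_) (sym (trans (Pw.Pointwise-length Cs≼) Bs-length)) (∈-roles p∈))
      ... | P , P≤ , eq = begin
        1 * count (lt p) Cs ≡⟨ trans (*-identityˡ _) (eq (λ a b → 𝟙 (toℕ a ℕ.<ᵇ toℕ b))) ⟩
        P * ∑ C (λ a → ∑ C′ (λ b → 𝟙 (toℕ a ℕ.<ᵇ toℕ b))) ≡⟨ cong (P *_) (pull (λ a b → 𝟙 (a ℕ.<ᵇ b))) ⟩
        P * ∑ (map toℕ C) (λ a → ∑ (map toℕ C′) (λ b → 𝟙 (a ℕ.<ᵇ b)))
          ≤⟨ *-monoʳ-≤ P (balanced E large p∈ (map toℕ C) (map toℕ C′) (to-upTo (side-⊆ r Cs≼ x x<)) (to-upTo (side-⊆ r Cs≼ (x + suc y) (∈-roles p∈)))) ⟩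
        P * (c * ∑ (map toℕ C) (λ a → ∑ (map toℕ C′) (λ b → 𝟙 (hits p a b))) + E) ≡⟨ cong (λ t → P * (c * t + E)) (sym (pull (λ a b → 𝟙 (hits p a b)))) ⟩
        P * (c * X + E) ≡⟨ lem P c X E ⟩
        c * (P * X) + P * E ≤⟨ +-mono-≤ (≤-reflexive (cong (c *_) (sym (eq (λ a b → 𝟙 (hits p (toℕ a) (toℕ b))))))) (*-monoˡ-≤ E P≤) ⟩
        c * count (hit p) Cs + E′ ∎
        where
        open ≤-Reasoning
        C = nth [] Cs x
        C′ = nth [] Cs (x + suc y)
        X = ∑ C (λ a → ∑ C′ (λ b → 𝟙 (hits p (toℕ a) (toℕ b))))
        x< : x < r
        x< = <-trans (m<m+n x (s≤s z≤n)) (∈-roles p∈)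
        pull : ∀ (f : ℕ → ℕ → ℕ) → ∑ C (λ a → ∑ C′ (λ b → f (toℕ a) (toℕ b))) ≡ ∑ (map toℕ C) (λ a → ∑ (map toℕ C′) (f a))
        pull f = sym (trans (∑-map toℕ C _) (∑-cong C λ a → ∑-map toℕ C′ (f (toℕ a))))
        lem : ∀ P c X E → P * (c * X + E) ≡ c * (P * X) + P * E
        lem = solve-∀

      It = Item Bs Bs-length Bs-pos E′
      open Item

      item : ∀ {p} → p ∈ rs → It
      item {p@(x , y)} p∈ = record { coords = coordinates p ; f = hit p ; o = lt p ; a = 1 ; b = c
        ; f-dep = λ z z′ h → cong₂ (λ u v → hits p (toℕ u) (toℕ v)) (h x (at-x)) (h (x + suc y) at-y)
        ; o-dep = λ z z′ h → cong₂ (λ u v → toℕ u ℕ.<ᵇ toℕ v) (h x at-x) (h (x + suc y) at-y)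
        ; dom = dominated p∈ }
        where
        at-x : coordinates (x , y) x ≡ true
        at-x = ∈-mask {x ∷ (x + suc y) ∷ []} (here refl)
        at-y : coordinates (x , y) (x + suc y) ≡ true
        at-y = ∈-mask {x ∷ (x + suc y) ∷ []} (there (here refl))

      meet : ∀ {p q} → p ∈ rs → q ∈ rs → p ≢ q → Meet (coordinates p) (coordinates q)
      meet {x , y} {x′ , y′} p∈ q∈ p≢q = pair-meet v₀ r (m<m+n x (s≤s z≤n)) (m<m+n x′ (s≤s z≤n)) (<-trans (m<m+n x (s≤s z≤n)) (∈-roles p∈)) (∈-roles p∈)
        λ { (refl , e) → p≢q (cong (x ,_) (suc-injective (+-cancelˡ-≡ x _ _ e))) }

      items : ∀ {ps} → All (_∈ rs) ps → List It
      items [] = []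
      items (p∈ ∷ h) = item p∈ ∷ items h

      items-bounds : ∀ {ps} (h : All (_∈ rs) ps) → All (λ it → a it ≤ c × b it ≤ c) (items h)
      items-bounds [] = []
      items-bounds (p∈ ∷ h) = (c>0 , ≤-refl) ∷ items-bounds h

      items-meet : ∀ {ps} (h : All (_∈ rs) ps) → Unique ps → AllPairs (λ it jt → Meet² Bs Bs-length Bs-pos E′ (coords it) (coords jt)) (items h)
      items-meet [] [] = []
      items-meet {p ∷ ps} (p∈ ∷ h) (u ∷ us) = go h u ∷ items-meet h us
        where
        go : ∀ {ps} (h : All (_∈ rs) ps) → All (p ≢_) ps → All (λ jt → Meet² Bs Bs-length Bs-pos E′ (coords (item p∈)) (coords jt)) (items h)
        go [] [] = []
        go (q∈ ∷ h) (ne ∷ nes) = (meet p∈ q∈ ne , meet q∈ p∈ (ne ∘ sym)) ∷ go h nes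

      items-length : ∀ {ps} (h : All (_∈ rs) ps) → length (items h) ≡ length ps
      items-length [] = refl
      items-length (_ ∷ h) = cong suc (items-length h)

      items-a : ∀ {ps} (h : All (_∈ rs) ps) → ∏ (items h) a ≡ 1
      items-a [] = refl
      items-a (_ ∷ h) = cong (1 *_) (items-a h)

      items-b : ∀ {ps} (h : All (_∈ rs) ps) → ∏ (items h) b ≡ c ^ length ps
      items-b [] = refl
      items-b (_ ∷ h) = cong (c *_) (items-b h)

      items-o : ∀ {ps} (h : All (_∈ rs) ps) z → all (items h) (λ it → o it z) ≡ all ps (λ p → lt p z)
      items-o [] z = refl
      items-o {p ∷ _} (_ ∷ h) z = cong (lt p z ∧_) (items-o h z)

      items-f : ∀ {ps} (h : All (_∈ rs) ps) z → all (items h) (λ it → f it z) ≡ all ps (λ p → hit p z)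
      items-f [] z = refl
      items-f {p ∷ _} (_ ∷ h) z = cong (hit p z ∧_) (items-f h z)

      members : All (_∈ rs) rs
      members = All.tabulate id

      loss≡ : loss Bs Bs-length Bs-pos E′ c (length (items members)) ≡ c ^ c * E′
      loss≡ = *-cancelˡ-≡ _ _ c {{ℕ.>-nonZero c>0}} (trans (loss-closed Bs Bs-length Bs-pos E′ c (length (items members)))
        (cong (λ m → m * (c ^ m * E′)) (items-length members)))

      telescoped : count (λ z → all rs (λ p → lt p z)) Bs ≤ c ^ c * count (λ z → all rs (λ p → hit p z)) Bs + c ^ c * E′
      telescoped = subst₂ _≤_
        (trans (cong₂ _*_ (items-a members) (∑-cong (tuples Bs) λ z → cong 𝟙 (items-o members z))) (*-identityˡ _))
        (cong₂ _+_ (cong₂ _*_ (items-b members) (∑-cong (tuples Bs) λ z → cong 𝟙 (items-f members z))) loss≡)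
        (telescope Bs Bs-length Bs-pos E′ c (items members) (items-bounds members) (items-meet members (roles-unique r)))

      tuple-length : ∀ {z} → z ∈ tuples Bs → length z ≡ r
      tuple-length z∈ = trans (length-∈-tuples Bs z∈) Bs-length

      all-sets : s choose r ≤ count (λ z → all rs (λ p → lt p z)) Bs
      all-sets = ≤-trans (≤-reflexive (trans (cong (_choose r) (sym (length-elems S))) (trans (sym (length-combos r L)) (trans (length-∑ (combos r L)) (sorted-tuples toℕ r L L-sorted (λ _ → 1))))))
        (∑-mono∈ (tuples Bs) λ z z∈ → ≤-trans (≤-reflexive (*-identityʳ _)) (𝟙-mono λ inc → ∈-all rs λ {p} p∈ → ordered z (tuple-length z∈) (isIncreasing-sound (map toℕ z) inc) p p∈))
        where
        ordered : ∀ z → length z ≡ r → Increasing (map toℕ z) → ∀ p → p ∈ rs → lt p z ≡ true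
        ordered z l inc (x , y) p∈ = <ᵇ-true (subst₂ _<_ (nth-toℕ z x (<-trans (m<m+n x (s≤s z≤n)) bd)) (nth-toℕ z (x + suc y) bd)
            (nth-mono inc (m<m+n x (s≤s z≤n)) (subst (x + suc y <_) (sym (length-map toℕ z)) bd)))
          where bd = subst (x + suc y <_) (sym l) (∈-roles p∈)

      edge-sets : count (λ z → all rs (λ p → hit p z)) Bs ≤ eCount graph S
      edge-sets = ≤-trans (∑-mono∈ (tuples Bs) λ z z∈ → ≤-trans (𝟙-mono (λ h → ∧-true (isIncreasing-complete (sorted z (tuple-length z∈) h)) (matched z h))) (≤-reflexive (𝟙-∧ (isIncreasing (map toℕ z)) (matches z))))
        (≤-reflexive (trans (sym (sorted-tuples toℕ r L L-sorted (𝟙 ∘ matches))) (trans (∑-cong∈ (combos r L) same) (sym (eCount-combos graph S)))))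
        where
        sorted : ∀ z → length z ≡ r → all rs (λ p → hit p z) ≡ true → Increasing (map toℕ z)
        sorted z l h = increasing-from-nth (map toℕ z) λ i j i<j j< → by i j (m≤n⇒∃[o]m+o≡n i<j) (subst (j <_) (length-map toℕ z) j<)
          where
          by : ∀ i j → ∃[ d ] (suc i + d ≡ j) → j < length z → nth 0 (map toℕ z) i < nth 0 (map toℕ z) j
          by i j (d , e) j< = subst₂ _<_ (sym (nth-toℕ z i (<-trans (subst (i <_) e′ (m<m+n i (s≤s z≤n))) j<))) (sym (nth-toℕ z j j<))
              (subst (λ j → toℕ (nth v₀ z i) < toℕ (nth v₀ z j)) e′ (<ᵇ-true⁻¹ (∧-trueˡ (all-∈ h (roles-∈ {r} i d (subst₂ _<_ (sym e′) l j<))))))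
            where e′ : i + suc d ≡ j
                  e′ = trans (+-suc i d) e
        matched : ∀ z → all rs (λ p → hit p z) ≡ true → matches z ≡ true
        matched z h = ∈-all rs λ {p} p∈ → ∧-trueʳ {lt p z} (all-∈ h p∈)
        same : ∀ Z → Z ∈ combos r L → 𝟙 (matches Z) ≡ 𝟙 (edge graph (fromList Z))
        same Z Z∈ = let Z⊆ , l = ∈-combos r L Z∈ in
          trans (cong (λ b → 𝟙 (b ∧ matches Z)) (sym (trans (cong (_== r) l) (==-refl r))))
            (cong (λ Z → 𝟙 ((length Z == r) ∧ matches Z)) (sym (elems-fromList (⊆-trans Z⊆ (elems-⊆ S)))))

    counted : s choose r ≤ c ^ c * eCount graph S + c ^ c * E′
    counted = ≤-trans all-sets (≤-trans telescoped (+-monoˡ-≤ (c ^ c * E′) (*-monoʳ-≤ (c ^ c) edge-sets)))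

  roleUnder-swap : ∀ {A : Set} (ψ : A → ℕ) u v E → roleUnder ψ u v E ≡ roleUnder ψ v u E
  roleUnder-swap ψ u v E = cong₂ _,_ (∑-cong E λ e → *-comm (𝟙 (ψ e ℕ.<ᵇ ψ u)) _)
    (∑-cong E λ e → trans (+-comm (𝟙 (ψ e ℕ.<ᵇ ψ u) * 𝟙 (not (ψ e ℕ.<ᵇ ψ v))) _) (cong₂ _+_ (*-comm (𝟙 (not (ψ e ℕ.<ᵇ ψ u))) _) (*-comm (𝟙 (ψ e ℕ.<ᵇ ψ u)) _)))

  -- The increasing list of the edge has the form `X ++ a ∷ Y ++ b ∷ W`, so the pair stands at the
  -- positions of the role `(length X , length Y)`, and `matches` says that this role is its colour.
  -- `roleUnder` sums over the other vertices, so their order in `E` is immaterial.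
  edge-colour : ∀ a b E → Unique (a ∷ b ∷ E) → toℕ a < toℕ b → edge graph (fromList (a ∷ b ∷ E)) ≡ true →
    roleUnder toℕ a b E ≡ colour (toℕ a) (toℕ b)
  edge-colour a b E uniq a<b h = found (∈ₚ.∈-∃++ (member (here refl)))
    where
    l = a ∷ b ∷ E
    Z = elems (fromList l)
    Z-sorted : AllPairs (λ a b → toℕ a < toℕ b) Z
    Z-sorted = AllPairs-⊆ (elems-⊆ (fromList l)) allFin-sorted
    Z-length : length Z ≡ r
    Z-length = ==-true (∧-trueˡ h)
    Z-sum : ∀ f → ∑ Z f ≡ ∑ l f
    Z-sum f = ∑-elems-fromList l uniq f
    member : ∀ {w} → w ∈ l → w ∈ Z
    member {w} w∈ with ∑-pos Z (λ z → 𝟙 (w ≡ᶠ z)) (subst (0 <_) (sym (Z-sum _)) (≤-trans (≤-reflexive (cong 𝟙 (sym (≡ᶠ-refl w)))) (∑-∈ (λ z → 𝟙 (w ≡ᶠ z)) w∈)))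
    ... | z , z∈ , p = subst (_∈ Z) (sym (≡ᶠ-true (𝟙-pos p))) z∈
    found : ∃[ X ] ∃[ R ] (Z ≡ X ++ a ∷ R) → roleUnder toℕ a b E ≡ colour (toℕ a) (toℕ b)
    found (X , R , Z≡) = locate (∈ₚ.∈-++⁻ X (subst (b ∈_) Z≡ (member (there (here refl)))))
      where
      sortedXR : AllPairs (λ a b → toℕ a < toℕ b) (X ++ a ∷ R)
      sortedXR = subst (AllPairs _) Z≡ Z-sorted
      before : b ∈ X → ⊥
      before b∈ with All.lookup (proj₁ (AllPairs-++⁻ X sortedXR)) b∈
      ... | b<a ∷ _ = <-asym a<b b<a
      finish : ∃[ Y ] ∃[ W ] (R ≡ Y ++ b ∷ W) → roleUnder toℕ a b E ≡ colour (toℕ a) (toℕ b)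
      finish (Y , W , R≡) = trans (cong₂ _,_ (rest-sum _) (rest-sum _)) (trans placed (≡ʳ-true matched))
        where
        x = length X
        y = length Y
        E* = X ++ (Y ++ W)
        Z≡′ : Z ≡ X ++ a ∷ (Y ++ b ∷ W)
        Z≡′ = trans Z≡ (cong (λ R → X ++ a ∷ R) R≡)
        Z↭ : Z ↭ a ∷ b ∷ E*
        Z↭ = ↭-trans (↭-reflexive Z≡′) (↭-trans (↭ₚ.shift a X (Y ++ b ∷ W)) (prep a (↭-trans (↭ₚ.++⁺ˡ X (↭ₚ.shift b Y W)) (↭ₚ.shift b X (Y ++ W)))))
        ∑-↭ : ∀ {xs ys : List V} (f : V → ℕ) → xs ↭ ys → ∑ xs f ≡ ∑ ys f
        ∑-↭ f _↭_.refl = refl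
        ∑-↭ f (prep x p) = cong (λ t → f x + t) (∑-↭ f p)
        ∑-↭ f (_↭_.swap x y p) = trans (cong (λ t → f x + (f y + t)) (∑-↭ f p)) (lem (f x) (f y) _)
          where lem : ∀ a b c → a + (b + c) ≡ b + (a + c)
                lem = solve-∀
        ∑-↭ f (_↭_.trans p q) = trans (∑-↭ f p) (∑-↭ f q)
        rest-sum : ∀ f → ∑ E f ≡ ∑ E* f
        rest-sum f = +-cancelˡ-≡ (f b) _ _ (+-cancelˡ-≡ (f a) _ _ (trans (sym (Z-sum f)) (∑-↭ f Z↭)))
        E*-length : length E* ≡ k
        E*-length = suc-injective (suc-injective (trans (sym (↭ₚ.↭-length Z↭)) Z-length))
        xy≤ : x + y ≤ k
        xy≤ = ≤-trans (+-monoʳ-≤ x (≤-trans (m≤m+n y (length W)) (≤-reflexive (sym (length-++ Y))))) (≤-reflexive (trans (sym (length-++ X)) E*-length))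
        arranged : arrange (x , y) a b E* ≡ Z
        arranged = trans (cong₂ (λ P Q → P ++ a ∷ (take y Q ++ b ∷ drop y Q)) (take-++-exact X refl) (drop-++-exact X refl))
          (trans (cong₂ (λ P Q → X ++ a ∷ (P ++ b ∷ Q)) (take-++-exact Y refl) (drop-++-exact Y refl)) (sym Z≡′))
        placed : roleUnder toℕ a b E* ≡ (x , y)
        placed = roleUnder-increasing toℕ xy≤ a b E* E*-length (subst (AllPairs _) (sym arranged) Z-sorted)
        nth-a : nth v₀ Z x ≡ a
        nth-a = trans (cong (λ Z → nth v₀ Z x) Z≡′) (nth-++-length v₀ X)
        nth-b : nth v₀ Z (x + suc y) ≡ b
        nth-b = trans (cong (λ Z → nth v₀ Z (x + suc y)) Z≡′) (trans (nth-++-skip v₀ X (suc y)) (nth-++-length v₀ Y))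
        matched : ((x , y) ≡ʳ colour (toℕ a) (toℕ b)) ≡ true
        matched = subst₂ (λ u v → ((x , y) ≡ʳ colour (toℕ u) (toℕ v)) ≡ true) nth-a nth-b
          (all-∈ (∧-trueʳ {length Z == r} h) (roles-∈ {r} x y (≤-trans (≤-reflexive (cong suc (+-suc x y))) (s≤s (s≤s xy≤)))))
      locate : b ∈ X ⊎ b ∈ a ∷ R → roleUnder toℕ a b E ≡ colour (toℕ a) (toℕ b)
      locate (inj₁ b∈) = ⊥-elim (before b∈)
      locate (inj₂ (here e)) = contradiction a<b (<-irrefl (cong toℕ (sym e)))
      locate (inj₂ (there b∈)) = finish (∈ₚ.∈-∃++ b∈)

  -- In a copy of a gadget both roles of the common pair equal the one colour of its image, so the
  -- order pulled back along `φ` would be consistent with all gadgets. Colours are read from the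
  -- smaller vertex, hence the swap when `φ` reverses the pair.
  graph-free : ∀ {k′} (k≡ : k ≡ suc k′) (𝒢 : GadgetSystem (suc k′)) → ¬ (systemGraph 𝒢 ⊑ subst (λ k → Hypergraph (2 + k)) k≡ graph)
  graph-free refl 𝒢 (φ , φ-injective , preserves) = let g , g∈ , bad = unavoidable (toℕ ∘ φ) (λ e → φ-injective (Finₚ.toℕ-injective e)) in bad (consistent g g∈)
    where
    open GadgetSystem 𝒢
    role-of : ∀ a b E → Unique (a ∷ b ∷ E) → edge (systemGraph 𝒢) (fromList (a ∷ b ∷ E)) ≡ true → toℕ (φ a) < toℕ (φ b) → roleUnder (toℕ ∘ φ) a b E ≡ colour (toℕ (φ a)) (toℕ (φ b))
    role-of a b E uniq e lt = trans (sym (roleUnder-map φ toℕ a b E)) (edge-colour (φ a) (φ b) (map φ E)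
      (Uniqueₚ.map⁺ φ-injective uniq) lt (trans (cong (edge graph) (sym (image-fromList φ (a ∷ b ∷ E)))) (preserves (fromList (a ∷ b ∷ E)) e)))
    unique-swap : ∀ {a b : Fin size} {E} → Unique (a ∷ b ∷ E) → Unique (b ∷ a ∷ E)
    unique-swap ((ne ∷ h) ∷ h′ ∷ hs) = ((ne ∘ sym) ∷ h′) ∷ h ∷ hs
    role-of-swapped : ∀ a b E → Unique (a ∷ b ∷ E) → edge (systemGraph 𝒢) (fromList (a ∷ b ∷ E)) ≡ true → toℕ (φ b) < toℕ (φ a) → roleUnder (toℕ ∘ φ) a b E ≡ colour (toℕ (φ b)) (toℕ (φ a))
    role-of-swapped a b E uniq e lt = trans (roleUnder-swap (toℕ ∘ φ) a b E) (role-of b a E (unique-swap uniq)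
      (subst (λ s → edge (systemGraph 𝒢) s ≡ true) (fromList-↭ {l = a ∷ b ∷ E} {b ∷ a ∷ E} (_↭_.swap a b ↭-refl)) e) lt)
    consistent : ∀ g → g ∈ gadgets → Consistent (toℕ ∘ φ) g
    consistent g g∈ = by (<-cmp (toℕ (φ (u g))) (toℕ (φ (v g))))
      where
      e₁ : edge (systemGraph 𝒢) (fromList (u g ∷ v g ∷ rest g)) ≡ true
      e₁ = ∈-any g∈ (isEdge-rest 𝒢 g)
      e₂ : edge (systemGraph 𝒢) (fromList (u g ∷ v g ∷ rest′ g)) ≡ true
      e₂ = ∈-any g∈ (isEdge-rest′ 𝒢 g)
      by : Tri (toℕ (φ (u g)) < toℕ (φ (v g))) (toℕ (φ (u g)) ≡ toℕ (φ (v g))) (toℕ (φ (v g)) < toℕ (φ (u g))) → Consistent (toℕ ∘ φ) g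
      by (tri< lt _ _) = trans (role-of (u g) (v g) (rest g) (edge₁-unique 𝒢 g∈) e₁ lt) (sym (role-of (u g) (v g) (rest′ g) (edge₂-unique 𝒢 g∈) e₂ lt))
      by (tri> _ _ gt) = trans (role-of-swapped (u g) (v g) (rest g) (edge₁-unique 𝒢 g∈) e₁ gt) (sym (role-of-swapped (u g) (v g) (rest′ g) (edge₂-unique 𝒢 g∈) e₂ gt))
      by (tri≈ _ eq _) with edge₁-unique 𝒢 g∈
      ... | (ne ∷ _) ∷ _ = contradiction (φ-injective (Finₚ.toℕ-injective eq)) ne

module _ (k K : ℕ) (K>0 : 0 < K) where

  private
    r = 2 + k
    Q = rolePower r
    open Signs (roles r) (roles-unique r) using (κ₅)

    K′ t n′ E : ℕ
    -- With `n′ = K′ * t`, `E = n′ * t` and `n′ ≤ K * s`, the quantity `K′ * (K * (s ^ k * E))` is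
    -- at most `K ^ 3 * s ^ r`, so this `K′` brings the error below `s choose r`. The first summand
    -- of `t` yields `3 * κ₅ * n′ ^ 7 ≤ E ^ 4`, the second `2 * r ≤ s`, the third `K ≤ n′`.
    K′ = K * K * K * ((r !) * 2 ^ r)
    t = 3 * κ₅ * (K′ * K′ * K′) + 2 * r * K + K
    n′ = K′ * t
    E = n′ * t

    K′>0 : 0 < K′
    K′>0 = *-mono-≤ {1} {K * K * K} (*-mono-≤ {1} {K * K} (*-mono-≤ K>0 K>0) K>0) (*-mono-≤ (1≤n! r) (m^n>0 2 r))
    K≤n′ : K ≤ n′
    K≤n′ = ≤-trans (m≤n+m K (3 * κ₅ * (K′ * K′ * K′) + 2 * r * K)) (≤-trans (≤-reflexive (sym (*-identityˡ t))) (*-monoˡ-≤ t K′>0))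
    2rK≤n′ : 2 * r * K ≤ n′
    2rK≤n′ = ≤-trans (≤-trans (m≤n+m (2 * r * K) (3 * κ₅ * (K′ * K′ * K′))) (m≤m+n _ K)) (≤-trans (≤-reflexive (sym (*-identityˡ t))) (*-monoˡ-≤ t K′>0))
    n′>0 : 0 < n′
    n′>0 = ≤-trans K>0 K≤n′

    large : n′ * n′ * (n′ * n′ * (3 * κ₅ * (n′ * n′ * n′))) ≤ E * E * (E * E)
    large = begin
      n′ * n′ * (n′ * n′ * (3 * κ₅ * (n′ * n′ * n′))) ≡⟨ left n′ κ₅ K′ t ⟩
      n′ * n′ * (n′ * n′) * (t * t * t) * (3 * κ₅ * (K′ * K′ * K′)) ≤⟨ *-monoʳ-≤ (n′ * n′ * (n′ * n′) * (t * t * t)) (≤-trans (m≤m+n _ (2 * r * K)) (m≤m+n _ K)) ⟩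
      n′ * n′ * (n′ * n′) * (t * t * t) * t ≡⟨ right n′ t ⟩
      E * E * (E * E) ∎
      where
      open ≤-Reasoning
      left : ∀ n κ a t → n * n * (n * n * (3 * κ * (a * t * (a * t) * (a * t)))) ≡ n * n * (n * n) * (t * t * t) * (3 * κ * (a * a * a))
      left = solve-∀
      right : ∀ n t → n * n * (n * n) * (t * t * t) * t ≡ n * t * (n * t) * (n * t * (n * t))
      right = solve-∀

    open LowerGraph k n′ (fromℕ< n′>0) using (graph; graph-free; module Count)

    power≤choose : ∀ s → 2 * r ≤ s → s ^ r ≤ (r !) * 2 ^ r * (s choose r)
    power≤choose s 2r≤s with m≤n⇒∃[o]m+o≡n (≤-trans (m≤m+n r (r + 0)) 2r≤s)
    ... | d , refl = begin
      (r + d) ^ r ≤⟨ ^-monoˡ-≤ r r+d≤2d ⟩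
      (2 * d) ^ r ≡⟨ ^-* r 2 d ⟩
      2 ^ r * d ^ r ≤⟨ *-monoʳ-≤ (2 ^ r) (choose-lower d r) ⟩
      2 ^ r * (((d + r) choose r) * (r !)) ≡⟨ cong (λ s → 2 ^ r * ((s choose r) * (r !))) (+-comm d r) ⟩
      2 ^ r * (((r + d) choose r) * (r !)) ≡⟨ lem (2 ^ r) ((r + d) choose r) (r !) ⟩
      (r !) * 2 ^ r * ((r + d) choose r) ∎
      where
      open ≤-Reasoning
      lem : ∀ a b c → a * (b * c) ≡ c * a * b
      lem = solve-∀
      r+d≤2d : r + d ≤ 2 * d
      r+d≤2d = ≤-trans (+-monoˡ-≤ d (≤-trans (≤-reflexive (sym (+-identityʳ r))) (+-cancelˡ-≤ r (r + 0) d 2r≤s))) (≤-reflexive (cong (λ x → d + x) (sym (+-identityʳ d))))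

    counted : ∀ S → n′ ≤ K * ∣ S ∣ → K * (∣ S ∣ choose r) ≤ Q * (K * eCount graph S + (∣ S ∣ choose r))
    counted S n′≤ = begin
      K * C′ ≤⟨ *-monoʳ-≤ K (Count.counted S E large s>0) ⟩
      K * (Q * e + Q * (s ^ k * E)) ≡⟨ lem K Q e (s ^ k * E) ⟩
      Q * (K * e + K * (s ^ k * E)) ≤⟨ *-monoʳ-≤ Q (+-monoʳ-≤ (K * e) error) ⟩
      Q * (K * e + C′) ∎
      where
      open ≤-Reasoning
      s = ∣ S ∣
      e = eCount graph S
      C′ = s choose r
      lem : ∀ K Q e x → K * (Q * e + Q * x) ≡ Q * (K * e + K * x)
      lem = solve-∀
      2r≤s : 2 * r ≤ s
      2r≤s = *-cancelˡ-≤ K {{ℕ.>-nonZero K>0}} (≤-trans (≤-reflexive (*-comm K (2 * r))) (≤-trans 2rK≤n′ n′≤))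
      s>0 : 0 < s
      s>0 = ≤-trans (s≤s z≤n) 2r≤s
      error : K * (s ^ k * E) ≤ C′
      error = *-cancelˡ-≤ K′ {{ℕ.>-nonZero K′>0}} (begin
        K′ * (K * (s ^ k * E)) ≡⟨ lem₁ K′ K (s ^ k) n′ t ⟩
        K * s ^ k * (n′ * n′) ≤⟨ *-monoʳ-≤ (K * s ^ k) (*-mono-≤ n′≤ n′≤) ⟩
        K * s ^ k * (K * s * (K * s)) ≡⟨ lem₂ K s (s ^ k) ⟩
        K * K * K * s ^ r ≤⟨ *-monoʳ-≤ (K * K * K) (power≤choose s 2r≤s) ⟩
        K * K * K * ((r !) * 2 ^ r * C′) ≡⟨ sym (*-assoc (K * K * K) ((r !) * 2 ^ r) C′) ⟩
        K′ * C′ ∎)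
        where
        lem₁ : ∀ a K p n t → a * (K * (p * (n * t))) ≡ K * p * (n * (a * t))
        lem₁ = solve-∀
        lem₂ : ∀ K s p → K * p * (K * s * (K * s)) ≡ K * K * K * (s * (s * p))
        lem₂ = solve-∀

  dense-graph : Σ (Hypergraph r) λ H → K ≤ n H
    × (∀ S → n H ≤ K * ∣ S ∣ → K * (∣ S ∣ choose r) ≤ Q * (K * eCount H S + (∣ S ∣ choose r)))
    × (∀ {k′} (k≡ : k ≡ suc k′) (𝒢 : GadgetSystem (suc k′)) → ¬ (systemGraph 𝒢 ⊑ subst (λ k → Hypergraph (2 + k)) k≡ H))
  dense-graph = graph , K≤n′ , counted , graph-free

-- From natural numbers to rational densities

private
  ι-≃ : ∀ m → ℚ.toℚᵘ (ℕ→ℚ m) ℚᵘ.≃ ℚᵘ.mkℚᵘ (⁺ m) 0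
  ι-≃ m = ℚₚ.toℚᵘ-fromℚᵘ (ℚᵘ.mkℚᵘ (⁺ m) 0)

ℕ→ℚ-+ : ∀ a b → ℕ→ℚ (a + b) ≡ ℕ→ℚ a ℚ.+ ℕ→ℚ b
ℕ→ℚ-+ a b = ℚₚ.toℚᵘ-injective (ℚᵘₚ.≃-trans (ι-≃ (a + b)) (ℚᵘₚ.≃-trans (ℚᵘ.*≡* same)
  (ℚᵘₚ.≃-sym (ℚᵘₚ.≃-trans (ℚₚ.toℚᵘ-homo-+ (ℕ→ℚ a) (ℕ→ℚ b)) (ℚᵘₚ.+-cong (ι-≃ a) (ι-≃ b))))))
  where same : ⁺ (a + b) ℤ.* 1ℤ ≡ (⁺ a ℤ.* 1ℤ ℤ.+ ⁺ b ℤ.* 1ℤ) ℤ.* 1ℤ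
        same = cong (ℤ._* 1ℤ) (trans (ℤₚ.pos-+ a b) (cong₂ ℤ._+_ (sym (ℤₚ.*-identityʳ (⁺ a))) (sym (ℤₚ.*-identityʳ (⁺ b)))))

ℕ→ℚ-* : ∀ a b → ℕ→ℚ (a * b) ≡ ℕ→ℚ a ℚ.* ℕ→ℚ b
ℕ→ℚ-* a b = ℚₚ.toℚᵘ-injective (ℚᵘₚ.≃-trans (ι-≃ (a * b)) (ℚᵘₚ.≃-trans (ℚᵘ.*≡* (cong (ℤ._* 1ℤ) (ℤₚ.pos-* a b)))
  (ℚᵘₚ.≃-sym (ℚᵘₚ.≃-trans (ℚₚ.toℚᵘ-homo-* (ℕ→ℚ a) (ℕ→ℚ b)) (ℚᵘₚ.*-cong (ι-≃ a) (ι-≃ b))))))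

ℕ→ℚ-mono : ∀ {a b} → a ≤ b → ℕ→ℚ a ℚ.≤ ℕ→ℚ b
ℕ→ℚ-mono {a} {b} le = ℚₚ.toℚᵘ-cancel-≤ (ℚᵘₚ.≤-respˡ-≃ (ℚᵘₚ.≃-sym (ι-≃ a)) (ℚᵘₚ.≤-respʳ-≃ (ℚᵘₚ.≃-sym (ι-≃ b))
  (ℚᵘ.*≤* (ℤₚ.*-monoʳ-≤-nonNeg 1ℤ (ℤ.+≤+ le)))))

ℕ→ℚ-cancel : ∀ {a b} → ℕ→ℚ a ℚ.≤ ℕ→ℚ b → a ≤ b
ℕ→ℚ-cancel {a} {b} le = by (ℚᵘₚ.≤-respˡ-≃ (ι-≃ a) (ℚᵘₚ.≤-respʳ-≃ (ι-≃ b) (ℚₚ.toℚᵘ-mono-≤ le)))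
  where by : ℚᵘ.mkℚᵘ (⁺ a) 0 ℚᵘ.≤ ℚᵘ.mkℚᵘ (⁺ b) 0 → a ≤ b
        by (ℚᵘ.*≤* le) = ℤₚ.drop‿+≤+ (subst₂ ℤ._≤_ (ℤₚ.*-identityʳ (⁺ a)) (ℤₚ.*-identityʳ (⁺ b)) le)

ℕ→ℚ-mono-< : ∀ {a b} → a < b → ℕ→ℚ a ℚ.< ℕ→ℚ b
ℕ→ℚ-mono-< {a} {b} lt = ℚₚ.toℚᵘ-cancel-< (ℚᵘₚ.<-respˡ-≃ (ℚᵘₚ.≃-sym (ι-≃ a)) (ℚᵘₚ.<-respʳ-≃ (ℚᵘₚ.≃-sym (ι-≃ b))
  (ℚᵘ.*<* (ℤₚ.*-monoʳ-<-pos 1ℤ (ℤ.+<+ lt)))))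

ℕ→ℚ-nonNeg : ∀ a → ℚ.NonNegative (ℕ→ℚ a)
ℕ→ℚ-nonNeg a = ℚ.nonNegative (ℕ→ℚ-mono {0} {a} z≤n)

ℕ→ℚ-pos : ∀ {a} → 0 < a → ℚ.Positive (ℕ→ℚ a)
ℕ→ℚ-pos {a} a>0 = ℚ.positive (ℕ→ℚ-mono-< {0} {a} a>0)

scale-≤ : ∀ a {x y} → x ℚ.≤ y → ℕ→ℚ a ℚ.* x ℚ.≤ ℕ→ℚ a ℚ.* y
scale-≤ a = ℚₚ.*-monoˡ-≤-nonNeg (ℕ→ℚ a) {{ℕ→ℚ-nonNeg a}}

unscale-≤ : ∀ {a} → 0 < a → ∀ {x y} → ℕ→ℚ a ℚ.* x ℚ.≤ ℕ→ℚ a ℚ.* y → x ℚ.≤ y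
unscale-≤ {a} a>0 = ℚₚ.*-cancelˡ-≤-pos (ℕ→ℚ a) {{ℕ→ℚ-pos a>0}}

reciprocal : ∀ n .{{_ : NonZero n}} → ℕ→ℚ n ℚ.* (1ℤ ℚ./ n) ≡ ℚ.1ℚ
reciprocal (suc m) = ℚₚ.toℚᵘ-injective (ℚᵘₚ.≃-trans (ℚₚ.toℚᵘ-homo-* (ℕ→ℚ (suc m)) (1ℤ ℚ./ suc m))
  (ℚᵘₚ.≃-trans (ℚᵘₚ.*-cong (ι-≃ (suc m)) (ℚₚ.toℚᵘ-fromℚᵘ (ℚᵘ.mkℚᵘ 1ℤ m))) (ℚᵘ.*≡* same)))
  where same : ⁺ suc m ℤ.* 1ℤ ℤ.* 1ℤ ≡ 1ℤ ℤ.* (⁺ (1 * suc m))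
        same = trans (ℤₚ.*-identityʳ _) (trans (ℤₚ.*-identityʳ _) (trans (cong ⁺_ (sym (*-identityˡ (suc m)))) (sym (ℤₚ.*-identityˡ _))))

-- The denominator of a positive fraction is large enough, since its numerator is at least 1.
archimedean : ∀ {δ} → ℚ.0ℚ ℚ.< δ → ∃[ M ] (0 < M × ℚ.1ℚ ℚ.≤ ℕ→ℚ M ℚ.* δ)
archimedean {ℚ.mkℚ (⁺ zero) d _} (ℚ.*<* (ℤ.+<+ ()))
archimedean {ℚ.mkℚ (ℤ.-[1+ a ]) d _} (ℚ.*<* ())
archimedean {δ@(ℚ.mkℚ (⁺ suc a) d _)} _ = suc d , s≤s z≤n , ℚₚ.toℚᵘ-cancel-≤ (ℚᵘₚ.≤-respʳ-≃
  (ℚᵘₚ.≃-sym (ℚᵘₚ.≃-trans (ℚₚ.toℚᵘ-homo-* (ℕ→ℚ (suc d)) δ) (ℚᵘₚ.*-congʳ {ℚ.toℚᵘ δ} (ι-≃ (suc d)))))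
  (ℚᵘ.*≤* (ℤ.+≤+ (≤-trans (≤-reflexive (lem₁ d)) (≤-trans (*-monoʳ-≤ (suc d) (s≤s (z≤n {a}))) (≤-reflexive (lem₂ (suc d) (suc a))))))))
  where lem₁ : ∀ d → 1 * (1 * suc d) ≡ suc d * 1
        lem₁ = solve-∀
        lem₂ : ∀ d a → d * a ≡ d * a * 1
        lem₂ = solve-∀

module _ {r : ℕ} {q : ℚ} {Q : ℕ} (Q>0 : 0 < Q) (q-def : ℕ→ℚ Q ℚ.* q ≡ ℚ.1ℚ) where

  -- The hypothesis is `e ≥ (1 / Q - 1 / K) * C` without denominators, so `1 / K` serves both as the
  -- error of the density and as the bound on the relative size of `S`.
  dense-from-counts : ∀ K .{{_ : NonZero K}} (H : Hypergraph r) →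
    (∀ S → n H ≤ K * ∣ S ∣ → K * (∣ S ∣ choose r) ≤ Q * (K * eCount H S + (∣ S ∣ choose r))) → Dense q (1ℤ ℚ./ K) H
  dense-from-counts K H counted S large = unscale-≤ Q>0 (unscale-≤ K>0 (ℚₚ.≤-trans (ℚₚ.≤-reflexive left) (ℚₚ.≤-trans bound (ℚₚ.≤-reflexive right))))
    where
    K>0 : 0 < K
    K>0 = ℕ.>-nonZero⁻¹ K
    ε = 1ℤ ℚ./ K
    C′ = ∣ S ∣ choose r
    e = eCount H S
    n≤ : n H ≤ K * ∣ S ∣
    n≤ = ℕ→ℚ-cancel (begin
      ℕ→ℚ (n H) ≡⟨ sym (ℚₚ.*-identityˡ _) ⟩
      ℚ.1ℚ ℚ.* ℕ→ℚ (n H) ≡⟨ cong (ℚ._* ℕ→ℚ (n H)) (sym (reciprocal K)) ⟩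
      ℕ→ℚ K ℚ.* ε ℚ.* ℕ→ℚ (n H) ≡⟨ ℚₚ.*-assoc (ℕ→ℚ K) ε _ ⟩
      ℕ→ℚ K ℚ.* (ε ℚ.* ℕ→ℚ (n H)) ≤⟨ scale-≤ K large ⟩
      ℕ→ℚ K ℚ.* ℕ→ℚ ∣ S ∣ ≡⟨ sym (ℕ→ℚ-* K ∣ S ∣) ⟩
      ℕ→ℚ (K * ∣ S ∣) ∎)
      where open ℚₚ.≤-Reasoning
    c₁ = ℕ→ℚ C′
    bound : ℕ→ℚ K ℚ.* c₁ ℚ.- ℕ→ℚ Q ℚ.* c₁ ℚ.≤ ℕ→ℚ Q ℚ.* (ℕ→ℚ K ℚ.* ℕ→ℚ e)
    bound = ℚₚ.≤-trans (ℚₚ.+-monoˡ-≤ (ℚ.- (ℕ→ℚ Q ℚ.* c₁)) counted′) (ℚₚ.≤-reflexive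
      (solve 4 (λ Q K e c → Q :* (K :* e :+ c) :- Q :* c := Q :* (K :* e)) refl (ℕ→ℚ Q) (ℕ→ℚ K) (ℕ→ℚ e) c₁))
      where
      open +-*-Solver
      counted′ : ℕ→ℚ K ℚ.* c₁ ℚ.≤ ℕ→ℚ Q ℚ.* (ℕ→ℚ K ℚ.* ℕ→ℚ e ℚ.+ c₁)
      counted′ = subst₂ ℚ._≤_ (ℕ→ℚ-* K C′) (trans (ℕ→ℚ-* Q (K * e + C′)) (cong (ℕ→ℚ Q ℚ.*_) (trans (ℕ→ℚ-+ (K * e) C′) (cong (ℚ._+ c₁) (ℕ→ℚ-* K e))))) (ℕ→ℚ-mono (counted S n≤))
    left : ℕ→ℚ K ℚ.* (ℕ→ℚ Q ℚ.* ((q ℚ.- ε) ℚ.* c₁)) ≡ ℕ→ℚ K ℚ.* c₁ ℚ.- ℕ→ℚ Q ℚ.* c₁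
    left = trans (solve 5 (λ K Q q ε c → K :* (Q :* ((q :- ε) :* c)) := K :* ((Q :* q) :* c) :- (K :* ε) :* (Q :* c)) refl (ℕ→ℚ K) (ℕ→ℚ Q) q ε c₁)
      (cong₂ ℚ._-_ (cong (ℕ→ℚ K ℚ.*_) (trans (cong (ℚ._* c₁) q-def) (ℚₚ.*-identityˡ c₁))) (trans (cong (ℚ._* (ℕ→ℚ Q ℚ.* c₁)) (reciprocal K)) (ℚₚ.*-identityˡ _)))
      where open +-*-Solver
    right : ℕ→ℚ Q ℚ.* (ℕ→ℚ K ℚ.* ℕ→ℚ e) ≡ ℕ→ℚ K ℚ.* (ℕ→ℚ Q ℚ.* ℕ→ℚ e)
    right = solve 3 (λ K Q e → Q :* (K :* e) := K :* (Q :* e)) refl (ℕ→ℚ K) (ℕ→ℚ Q) (ℕ→ℚ e)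
      where open +-*-Solver

  -- `(A + Q) / (A * Q)` is `q + 1 / A`. Of the two units in the gap `A * (d - q)`, one pays for `ε`
  -- and the other is the excess `1 / A`. The factor `B` translates the bound on the size of `S`.
  counts-from-dense : ∀ {d ε} A B → (H : Hypergraph r) → 0 < B → ℚ.1ℚ ℚ.+ ℚ.1ℚ ℚ.≤ ℕ→ℚ A ℚ.* (d ℚ.- q) → ℕ→ℚ A ℚ.* ε ℚ.≤ ℚ.1ℚ → ℕ→ℚ B ℚ.* ε ℚ.≤ ℚ.1ℚ →
    Dense d ε H → ∀ S → n H ≤ B * ∣ S ∣ → (A + Q) * (∣ S ∣ choose r) ≤ A * Q * eCount H S
  counts-from-dense {d} {ε} A B H B>0 gap εA εB dense S n≤ = ℕ→ℚ-cancel (begin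
    ℕ→ℚ ((A + Q) * C′) ≡⟨ trans (ℕ→ℚ-* (A + Q) C′) (cong (ℚ._* c₁) (ℕ→ℚ-+ A Q)) ⟩
    (a ℚ.+ Q₁) ℚ.* c₁ ≤⟨ ℚₚ.*-monoʳ-≤-nonNeg c₁ {{ℕ→ℚ-nonNeg C′}} coefficient ⟩
    a ℚ.* Q₁ ℚ.* (d ℚ.- ε) ℚ.* c₁ ≡⟨ ℚₚ.*-assoc (a ℚ.* Q₁) _ c₁ ⟩
    a ℚ.* Q₁ ℚ.* ((d ℚ.- ε) ℚ.* c₁) ≡⟨ cong (ℚ._* ((d ℚ.- ε) ℚ.* c₁)) (sym (ℕ→ℚ-* A Q)) ⟩
    ℕ→ℚ (A * Q) ℚ.* ((d ℚ.- ε) ℚ.* c₁) ≤⟨ scale-≤ (A * Q) (dense S large) ⟩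
    ℕ→ℚ (A * Q) ℚ.* ℕ→ℚ e ≡⟨ sym (ℕ→ℚ-* (A * Q) e) ⟩
    ℕ→ℚ (A * Q * e) ∎)
    where
    open ℚₚ.≤-Reasoning
    open +-*-Solver
    C′ = ∣ S ∣ choose r
    c₁ = ℕ→ℚ C′
    e = eCount H S
    a = ℕ→ℚ A
    Q₁ = ℕ→ℚ Q
    large : ε ℚ.* ℕ→ℚ (n H) ℚ.≤ ℕ→ℚ ∣ S ∣
    large = unscale-≤ B>0 (begin
      ℕ→ℚ B ℚ.* (ε ℚ.* ℕ→ℚ (n H)) ≡⟨ sym (ℚₚ.*-assoc (ℕ→ℚ B) ε _) ⟩
      ℕ→ℚ B ℚ.* ε ℚ.* ℕ→ℚ (n H) ≤⟨ ℚₚ.*-monoʳ-≤-nonNeg (ℕ→ℚ (n H)) {{ℕ→ℚ-nonNeg (n H)}} εB ⟩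
      ℚ.1ℚ ℚ.* ℕ→ℚ (n H) ≡⟨ ℚₚ.*-identityˡ _ ⟩
      ℕ→ℚ (n H) ≤⟨ ℕ→ℚ-mono n≤ ⟩
      ℕ→ℚ (B * ∣ S ∣) ≡⟨ ℕ→ℚ-* B ∣ S ∣ ⟩
      ℕ→ℚ B ℚ.* ℕ→ℚ ∣ S ∣ ∎)
    coefficient : a ℚ.+ Q₁ ℚ.≤ a ℚ.* Q₁ ℚ.* (d ℚ.- ε)
    coefficient = begin
      a ℚ.+ Q₁ ≡⟨ cong₂ ℚ._+_ (sym (trans (cong (a ℚ.*_) q-def) (ℚₚ.*-identityʳ a))) (sym (ℚₚ.*-identityʳ Q₁)) ⟩
      a ℚ.* (Q₁ ℚ.* q) ℚ.+ Q₁ ℚ.* ℚ.1ℚ ≡⟨ solve 4 (λ a Q q i → a :* (Q :* q) :+ Q :* i := Q :* (a :* q :+ ((i :+ i) :- i))) refl a Q₁ q ℚ.1ℚ ⟩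
      Q₁ ℚ.* (a ℚ.* q ℚ.+ ((ℚ.1ℚ ℚ.+ ℚ.1ℚ) ℚ.- ℚ.1ℚ)) ≤⟨ scale-≤ Q (ℚₚ.+-monoʳ-≤ (a ℚ.* q) (ℚₚ.+-mono-≤ gap (ℚₚ.neg-antimono-≤ εA))) ⟩
      Q₁ ℚ.* (a ℚ.* q ℚ.+ (a ℚ.* (d ℚ.- q) ℚ.- a ℚ.* ε)) ≡⟨ solve 5 (λ a Q q d ε → Q :* (a :* q :+ (a :* (d :- q) :- a :* ε)) := a :* Q :* (d :- ε)) refl a Q₁ q d ε ⟩
      a ℚ.* Q₁ ℚ.* (d ℚ.- ε) ∎

eventually-small : ∀ {δ} → ℚ.0ℚ ℚ.< δ → ∃[ N ] ∀ k → N ≤ k → 1ℤ ℚ./ suc k ℚ.< δ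
eventually-small {δ} δ>0 with archimedean δ>0
... | M , M>0 , 1≤ = M , λ k M≤k → ℚₚ.*-cancelˡ-<-nonNeg (ℕ→ℚ (suc k)) {{ℕ→ℚ-nonNeg (suc k)}} (begin-strict
    ℕ→ℚ (suc k) ℚ.* (1ℤ ℚ./ suc k) ≡⟨ reciprocal (suc k) ⟩
    ℚ.1ℚ ≤⟨ 1≤ ⟩
    ℕ→ℚ M ℚ.* δ <⟨ ℚₚ.*-monoˡ-<-pos δ {{ℚ.positive δ>0}} (ℕ→ℚ-mono-< (s≤s M≤k)) ⟩
    ℕ→ℚ (suc k) ℚ.* δ ∎)
  where open ℚₚ.≤-Reasoning

private
  1/>0 : ∀ n → ℚ.0ℚ ℚ.< 1ℤ ℚ./ suc n
  1/>0 n = ℚₚ.positive⁻¹ _ {{ℚₚ.normalize-pos 1 (suc n)}}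

  below-reciprocal : ∀ n {ε} → ε ℚ.< 1ℤ ℚ./ suc n → ℕ→ℚ (suc n) ℚ.* ε ℚ.≤ ℚ.1ℚ
  below-reciprocal n lt = ℚₚ.≤-trans (scale-≤ (suc n) (ℚₚ.<⇒≤ lt)) (ℚₚ.≤-reflexive (reciprocal (suc n)))

  target-reciprocal : ∀ r → ℕ→ℚ (rolePower r) ℚ.* targetDensity r ≡ ℚ.1ℚ
  target-reciprocal r = trans (cong (λ c → ℕ→ℚ (c ^ c) ℚ.* targetDensity r) (length-roles r)) (reciprocal (c ^ c) {{powSelf-nonZero c}})
    where c = r choose 2

-- The two halves of the density statement

module _ (k′ : ℕ) where

  private
    r = 3 + k′
    𝒢 : GadgetSystem (suc k′)
    𝒢 = gadgetSystem (suc k′) (s≤s z≤n)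
    F = systemGraph 𝒢
    Q>0 : 0 < rolePower r
    Q>0 = subst (λ c → 0 < c ^ c) (sym (length-roles r)) (ℕ.>-nonZero⁻¹ _ {{powSelf-nonZero (r choose 2)}})

    sequence : ∀ k → Σ (Hypergraph r) λ H → suc k ≤ n H
      × (∀ S → n H ≤ suc k * ∣ S ∣ → suc k * (∣ S ∣ choose r) ≤ rolePower r * (suc k * eCount H S + (∣ S ∣ choose r)))
      × ¬ (F ⊑ H)
    sequence k = let H , K≤ , counted , free = dense-graph (suc k′) (suc k) (s≤s z≤n) in H , K≤ , counted , free refl 𝒢

  lower-bound : HasFreeLocallyDense F (targetDensity r)
  lower-bound = proj₁ ∘ sequence
    , ((λ k → 1ℤ ℚ./ suc k)
      , (λ k → dense-from-counts Q>0 (target-reciprocal r) (suc k) (proj₁ (sequence k)) (proj₁ (proj₂ (proj₂ (sequence k)))))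
      , (λ δ → eventually-small)
      , λ M → M , λ k M≤k → ≤-trans M≤k (≤-trans (n≤1+n k) (proj₁ (proj₂ (sequence k)))))
    , λ k → proj₂ (proj₂ (proj₂ (sequence k)))

  upper-bound : ∀ d → targetDensity r ℚ.< d → ¬ HasFreeLocallyDense F d
  upper-bound d q<d (Hs , (ε , dense , small , growing) , free) = by (archimedean δ>0)
    where
    q = targetDensity r
    δ>0 : ℚ.0ℚ ℚ.< d ℚ.- q
    δ>0 = subst (ℚ._< d ℚ.- q) (ℚₚ.+-inverseʳ q) (ℚₚ.+-monoˡ-< (ℚ.- q) q<d)
    by : ∃[ M ] (0 < M × ℚ.1ℚ ℚ.≤ ℕ→ℚ M ℚ.* (d ℚ.- q)) → ⊥
    by (M@(suc M′) , _ , 1≤) = contradiction-free (Hs j)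
        (proj₂ (growing threshold) j (m≤n+m _ (N₁ + N₂)))
        (λ S n≤ → counts-from-dense Q>0 (target-reciprocal r) {d} {ε j} (M + M) (suc scale) (Hs j) (s≤s z≤n) gap
          (below-reciprocal (M′ + M) (proj₂ (small _ (1/>0 (M′ + M))) j (≤-trans (m≤m+n N₁ N₂) (m≤m+n (N₁ + N₂) N₃))))
          (below-reciprocal scale (proj₂ (small _ (1/>0 scale)) j (≤-trans (m≤n+m N₂ N₁) (m≤m+n (N₁ + N₂) N₃))))
          (dense j) S (≤-trans n≤ (*-monoˡ-≤ ∣ S ∣ (n≤1+n scale))))
        (free j)
      where
      -- `M` makes `M * (d - q)` at least 1. Doubling it gives the gap of 2 that `counts-from-dense`
      -- demands, and also the bound `2 ≤ A`.
      open UpperBound 𝒢 (M + M) (s≤s (≤-trans (s≤s z≤n) (m≤n+m M M′)))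
      N₁ = proj₁ (small (1ℤ ℚ./ (M + M)) (1/>0 (M′ + M)))
      N₂ = proj₁ (small (1ℤ ℚ./ suc scale) (1/>0 scale))
      N₃ = proj₁ (growing threshold)
      -- A sum of the three thresholds exceeds each of them, so at this index `ε` is small against
      -- both `M + M` and `scale`, and the host is large enough.
      j = N₁ + N₂ + N₃
      gap : ℚ.1ℚ ℚ.+ ℚ.1ℚ ℚ.≤ ℕ→ℚ (M + M) ℚ.* (d ℚ.- q)
      gap = ℚₚ.≤-trans (ℚₚ.+-mono-≤ 1≤ 1≤) (ℚₚ.≤-reflexive (trans (sym (ℚₚ.*-distribʳ-+ (d ℚ.- q) (ℕ→ℚ M) (ℕ→ℚ M))) (cong (ℚ._* (d ℚ.- q)) (sym (ℕ→ℚ-+ M M)))))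

theorem1p3 : ∀ (r : ℕ) → 3 ≤ r → ∃[ F ] UniformTuranDensityIs {r} F (targetDensity r)
theorem1p3 (suc (suc (suc k′))) _ = systemGraph (gadgetSystem (suc k′) (s≤s z≤n)) , lower-bound k′ , upper-bound k′
theorem1p3 zero ()
theorem1p3 (suc zero) (s≤s ())
theorem1p3 (suc (suc zero)) (s≤s (s≤s ()))
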